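{- Let $\alpha([3]^n)$ be the number of antichains of the poset $[3]^n$, and let $\alpha(L_{[n-1,n+1]})$ be the number of antichains of $[3]^n$ contained in $L_{[n-1,n+1]}=L_{n-1}\cup L_n\cup L_{n+1}$. Then $$\alpha([3]^n)=\left(1+e^{ -\Omega(n^2)}\right)\alpha(L_{[n-1,n+1]}).$$
   Context: $[3]^n=\{0,1,2\}^n$ with the coordinatewise order. For an integer $k$, the $k$-th layer is $L_k=\{v\in[3]^n:\sum_{i=1}^n v_i=k\}$. An antichain is a set of pairwise incomparable elements (the empty set included). The notation $1+e^{ -\Omega(n^2)}$ denotes a quantity $1+\varepsilon_n$ with $|\varepsilon_n|\le e^{ -cn^2}$ for some constant $c>0$ and all sufficiently large $n$. -}

module Defs where

open import Data.Nat using (ℕ; zero; suc; _+_; _≤_; _≤?_)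
open import Data.Fin using (Fin; toℕ)
import Data.Fin as F
import Data.Fin.Properties as FP
open import Data.Vec using (Vec; []; _∷_)
import Data.Vec as V
open import Data.List using (List; []; _∷_; map; concatMap; filter; length; allFin)
open import Data.List.Relation.Unary.AllPairs using (AllPairs; allPairs?)
open import Data.Vec.Relation.Binary.Pointwise.Inductive using (Pointwise)
import Data.Vec.Relation.Binary.Pointwise.Inductive as PW
open import Data.Product using (_×_)
open import Data.Nat.ListAction using (sum)
open import Relation.Nullary using (¬_; Dec; _×-dec_; ¬?)

Elem : ℕ → Set
Elem n = Vec (Fin 3) n

_≼_ : ∀ {n} → Elem n → Elem n → Set
_≼_ = Pointwise F._≤_

_≼?_ : ∀ {n} (v w : Elem n) → Dec (v ≼ w)
_≼?_ = PW.decidable F._≤?_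

Incomparable : ∀ {n} → Elem n → Elem n → Set
Incomparable v w = ¬ (v ≼ w) × ¬ (w ≼ v)

incomparable? : ∀ {n} (v w : Elem n) → Dec (Incomparable v w)
incomparable? v w = ¬? (v ≼? w) ×-dec ¬? (w ≼? v)

allElems : (n : ℕ) → List (Elem n)
allElems zero = [] ∷ []
allElems (suc n) = concatMap (λ a → map (a ∷_) (allElems n)) (allFin 3)

-- all sublists (= all subsets, for a duplicate-free list)
sublists : ∀ {A : Set} → List A → List (List A)
sublists [] = [] ∷ []
sublists (x ∷ xs) = sublists xs Data.List.++ map (x ∷_) (sublists xs)

-- a subset (given as a duplicate-free list) is an antichain iff
-- its elements are pairwise incomparable
IsAntichain : ∀ {n} → List (Elem n) → Set
IsAntichain = AllPairs Incomparable

isAntichain? : ∀ {n} (S : List (Elem n)) → Dec (IsAntichain S)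
isAntichain? = allPairs? incomparable?

countAntichains : ∀ {n} → List (Elem n) → ℕ
countAntichains X = length (filter isAntichain? (sublists X))

rank : ∀ {n} → Elem n → ℕ
rank v = sum (map toℕ (V.toList v))

-- v ∈ L_{n-1} ∪ L_n ∪ L_{n+1}  ⇔  n ≤ rank v + 1  and  rank v ≤ n + 1
InMiddle : ∀ {n} → Elem n → Set
InMiddle {n} v = (n ≤ suc (rank v)) × (rank v ≤ suc n)

inMiddle? : ∀ {n} (v : Elem n) → Dec (InMiddle v)
inMiddle? {n} v = (n ≤? suc (rank v)) ×-dec (rank v ≤? suc n)

α : ℕ → ℕ
α n = countAntichains (allElems n)

αMid : ℕ → ℕ
αMid n = countAntichains (filter inMiddle? (allElems n))

-- Antichains correspond to downsets of [3]ⁿ. Let I be a downset, v ∈ I of rank k > n, and C the component of v in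
-- I ∩ L_k, where two points are linked when they share a lower cover; let ∂C be the shadow of C. Split I into the part
-- of rank ≥ k above C (filled up with all of L_{<k}) and the remaining part, which no longer contains v and from which
-- any subset of ∂C can still be removed. The map from pairs (I, subset of ∂C) to such pairs of downsets is injective. So if
-- C ⊆ S for a fixed container S, then these I number at most 2^-|∂C| · N(S) times all downsets avoiding v, where N(S)
-- counts the possible parts above L_{<k} whose rank k layer lies in S. By downward induction on k, N(S) ≤ 2^(|S| + j)
-- for a small error j.
--
-- It remains to cover all C by few containers S with |S| + j well below |∂C|. If |∂C| is at most n³ times a power of
-- log n, counting paths of length four gives |∂C| ≥ 4 r |C| with r of order log n, and C itself, encoded by a short
-- walk from v, serves as its container. If |∂C| is larger, Sapozhenko's graph container method applies: weights on
-- the edges between L_k and L_{k-1} show that ∂C exceeds the closure {x ∈ L_k : ∂{x} ⊆ ∂C} by a proportion 1/(40n),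
-- and the containers cost much less than this gap.
--
-- If I contains a point u of rank n + 2, then for any v covered by u the component C contains all lower covers of u,
-- so |∂C| ≥ n²/8. A union bound over u, and the duality x ↦ 2 - x for the layers below n - 1, finish the proof.
module Submission where

open import Defs
open import Data.Nat using (ℕ; suc; _*_; _^_; _≤_; ∣_-_∣)
open import Data.Product using (Σ)
open import Data.Nat.Divisibility using (_∣_; divides; quotient; _∣?_; ∣-trans; m∣m*n; m≤n⇒m!∣n!)
open import Data.Nat using (zero; _+_; _∸_; _<_; _/_; _!; z≤n; s≤s; >-nonZero; >-nonZero⁻¹; _≤?_; _<?_)
open import Data.Nat.Properties
open import Data.Nat.DivMod using (m/n*n≤m; m≡m%n+[m/n]*n; m%n<n)
open import Data.Nat.Tactic.RingSolver using (solve-∀)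
open import Data.Bool using (Bool; true; false; _∧_; _∨_; not; if_then_else_)
open import Data.Bool.Properties using (¬-not; ∨-zeroʳ; ∧-zeroʳ)
open import Data.Fin using (Fin; zero; suc; toℕ)
open import Data.Vec using (Vec; []; _∷_)
import Data.Vec
import Data.Bool
import Data.Bool.Properties
import Data.Fin.Properties
import Data.Vec.Relation.Binary.Pointwise.Inductive as Pointwise
open import Data.List using (List; []; _∷_; _++_; map; concatMap; filter; length; allFin; cartesianProduct; upTo)
open import Data.List.Properties using (length-map; length-++; length-upTo)
open import Data.List.Membership.Propositional using (_∈_)
open import Data.List.Membership.Propositional.Properties using (∈-map⁺; ∈-map⁻; ∈-++⁺ˡ; ∈-++⁺ʳ; ∈-++⁻; ∈-filter⁺; ∈-filter⁻; ∈-cartesianProduct⁺; ∈-cartesianProduct⁻; ∈-allFin; ∈-upTo⁺)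
open import Data.List.Relation.Unary.Any using (here; there)
open import Data.List.Relation.Unary.All using (All; []; _∷_)
import Data.List.Relation.Unary.All as All
open import Data.List.Relation.Unary.AllPairs using (AllPairs; []; _∷_)
open import Data.List.Relation.Unary.Unique.Propositional using (Unique)
import Data.List.Relation.Unary.Unique.Propositional.Properties as Uniq
open import Data.Product using (_×_; _,_; proj₁; proj₂)
open import Data.Sum using (_⊎_; inj₁; inj₂)
open import Data.Empty using (⊥; ⊥-elim)
open import Function using (_∘_)
open import Relation.Binary.Definitions using (Tri; tri<; tri≈; tri>)
open import Relation.Nullary using (¬_; Dec; yes; no; does)
open import Relation.Nullary.Decidable using (⌊_⌋; dec-true)
open import Relation.Binary.PropositionalEquality using (_≡_; _≢_; refl; sym; trans; cong; cong₂; subst; subst₂; module ≡-Reasoning)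

-- Encoding C outright costs of order log n bits for each of its points, so |∂C| must exceed |C| by
-- a logarithmic factor, which the path count yields only for small shadows. For large shadows the
-- only surplus is t = |∂C| - |closure of C|, possibly just a 1/(40n) part of |∂C|, and the error j,
-- the code and the union bound all have to fit below it. Even this surplus does not come from
-- uniform weights, where a point of rank k splits M evenly among its lower covers: the all-ones
-- point, of rank n, has n upper covers with n lower covers each and would receive exactly M. Hence,
-- where the 1s are more than twice as many as the 0s, edges lowering a 2 get less and edges
-- lowering a 1 get more; elsewhere uniform weights already leave slack. The container is the
-- approximating set S if many points of ∂C escape the approximation `F₂`; otherwise these points
-- are cheap to list and the closure itself is the container. The number r, of order log n, is the
-- common unit: two tokens of a walk cost at most r bits, and r¹⁰ is still at most n.

⟦_⟧ : Bool → ℕ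
⟦ true ⟧ = 1
⟦ false ⟧ = 0

∑ : {A : Set} → List A → (A → ℕ) → ℕ
∑ [] f = 0
∑ (x ∷ xs) f = f x + ∑ xs f

∑-mono∈ : {A : Set} (xs : List A) {f g : A → ℕ} → (∀ x → x ∈ xs → f x ≤ g x) → ∑ xs f ≤ ∑ xs g
∑-mono∈ [] h = z≤n
∑-mono∈ (x ∷ xs) h = +-mono-≤ (h x (here refl)) (∑-mono∈ xs (λ y m → h y (there m)))

∑-mono : {A : Set} (xs : List A) {f g : A → ℕ} → (∀ x → f x ≤ g x) → ∑ xs f ≤ ∑ xs g
∑-mono xs h = ∑-mono∈ xs (λ x _ → h x)

∑-cong : {A : Set} (xs : List A) {f g : A → ℕ} → (∀ x → f x ≡ g x) → ∑ xs f ≡ ∑ xs g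
∑-cong [] h = refl
∑-cong (x ∷ xs) h = cong₂ _+_ (h x) (∑-cong xs h)

+-interchange : ∀ a b c d → (a + b) + (c + d) ≡ (a + c) + (b + d)
+-interchange = solve-∀

∑-+ : {A : Set} (xs : List A) (f g : A → ℕ) → ∑ xs (λ x → f x + g x) ≡ ∑ xs f + ∑ xs g
∑-+ [] f g = refl
∑-+ (x ∷ xs) f g rewrite ∑-+ xs f g = +-interchange (f x) (g x) (∑ xs f) (∑ xs g)

∑-*ˡ : {A : Set} (xs : List A) (c : ℕ) (f : A → ℕ) → ∑ xs (λ x → c * f x) ≡ c * ∑ xs f
∑-*ˡ [] c f = sym (*-zeroʳ c)
∑-*ˡ (x ∷ xs) c f rewrite ∑-*ˡ xs c f = sym (*-distribˡ-+ c (f x) (∑ xs f))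

∑-*ʳ : {A : Set} (xs : List A) (c : ℕ) (f : A → ℕ) → ∑ xs (λ x → f x * c) ≡ ∑ xs f * c
∑-*ʳ xs c f = trans (∑-cong xs (λ x → *-comm (f x) c)) (trans (∑-*ˡ xs c f) (*-comm c (∑ xs f)))

∑-zero : {A : Set} (xs : List A) → ∑ xs (λ _ → 0) ≡ 0
∑-zero [] = refl
∑-zero (x ∷ xs) = ∑-zero xs

∑-const : {A : Set} (xs : List A) (c : ℕ) → ∑ xs (λ _ → c) ≡ length xs * c
∑-const [] c = refl
∑-const (x ∷ xs) c = cong (c +_) (∑-const xs c)

∑-swap : {A B : Set} (xs : List A) (ys : List B) (f : A → B → ℕ) →
         ∑ xs (λ x → ∑ ys (f x)) ≡ ∑ ys (λ y → ∑ xs (λ x → f x y))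
∑-swap [] ys f = sym (∑-zero ys)
∑-swap (x ∷ xs) ys f rewrite ∑-swap xs ys f = sym (∑-+ ys (f x) (λ y → ∑ xs (λ z → f z y)))

∑-++ : {A : Set} (xs ys : List A) (f : A → ℕ) → ∑ (xs ++ ys) f ≡ ∑ xs f + ∑ ys f
∑-++ [] ys f = refl
∑-++ (x ∷ xs) ys f rewrite ∑-++ xs ys f = sym (+-assoc (f x) (∑ xs f) (∑ ys f))

∑-map : {A B : Set} (h : A → B) (xs : List A) (f : B → ℕ) → ∑ (map h xs) f ≡ ∑ xs (f ∘ h)
∑-map h [] f = refl
∑-map h (x ∷ xs) f = cong (f (h x) +_) (∑-map h xs f)

length-concatMap : {A B : Set} (h : A → List B) (xs : List A) → length (concatMap h xs) ≡ ∑ xs (length ∘ h)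
length-concatMap h [] = refl
length-concatMap h (x ∷ xs) = trans (length-++ (h x)) (cong (length (h x) +_) (length-concatMap h xs))

∈⇒≤∑ : {A : Set} {xs : List A} {x : A} (f : A → ℕ) → x ∈ xs → f x ≤ ∑ xs f
∈⇒≤∑ f (here refl) = m≤m+n _ _
∈⇒≤∑ f (there m) = ≤-trans (∈⇒≤∑ f m) (m≤n+m _ _)

∑-pos : {A : Set} (xs : List A) (f : A → ℕ) → 0 < ∑ xs f → Σ A λ x → x ∈ xs × 0 < f x
∑-pos (x ∷ xs) f h with f x in eq
... | suc k = x , here refl , subst (0 <_) (sym eq) (s≤s z≤n)
... | zero with ∑-pos xs f h
... | y , m , p = y , there m , p

∑-empty : {A : Set} (xs : List A) (f : A → ℕ) → (∀ x → x ∈ xs → f x ≡ 0) → ∑ xs f ≡ 0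
∑-empty [] f h = refl
∑-empty (x ∷ xs) f h rewrite h x (here refl) = ∑-empty xs f (λ y m → h y (there m))

length-filter≡∑ : {A : Set} {P : A → Set} (P? : ∀ x → Dec (P x)) (xs : List A) →
                  length (filter P? xs) ≡ ∑ xs (λ x → ⟦ does (P? x) ⟧)
length-filter≡∑ P? [] = refl
length-filter≡∑ P? (x ∷ xs) with P? x
... | yes _ = cong suc (length-filter≡∑ P? xs)
... | no _ = length-filter≡∑ P? xs

⟦⟧≤1 : ∀ b → ⟦ b ⟧ ≤ 1
⟦⟧≤1 true = ≤-refl
⟦⟧≤1 false = z≤n

⟦⟧-mono : ∀ {a b} → (a ≡ true → b ≡ true) → ⟦ a ⟧ ≤ ⟦ b ⟧
⟦⟧-mono {false} h = z≤n
⟦⟧-mono {true} {b} h rewrite h refl = ≤-refl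

⟦∧⟧ : ∀ a b → ⟦ a ∧ b ⟧ ≡ ⟦ a ⟧ * ⟦ b ⟧
⟦∧⟧ true b = sym (+-identityʳ ⟦ b ⟧)
⟦∧⟧ false b = refl

⟦⟧-*-mono : ∀ a {m n} → (a ≡ true → m ≤ n) → ⟦ a ⟧ * m ≤ ⟦ a ⟧ * n
⟦⟧-*-mono false h = z≤n
⟦⟧-*-mono true {m} {n} h = *-monoʳ-≤ 1 (h refl)

⟦⟧-*-cong : ∀ a {m n} → (a ≡ true → m ≡ n) → ⟦ a ⟧ * m ≡ ⟦ a ⟧ * n
⟦⟧-*-cong false h = refl
⟦⟧-*-cong true h = cong (1 *_) (h refl)

⟦⟧*≤ : ∀ a m → ⟦ a ⟧ * m ≤ m
⟦⟧*≤ false m = z≤n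
⟦⟧*≤ true m = ≤-reflexive (+-identityʳ m)

∧-split : ∀ {a b} → a ∧ b ≡ true → a ≡ true × b ≡ true
∧-split {true} {true} _ = refl , refl

∧-join : ∀ {a b} → a ≡ true → b ≡ true → a ∧ b ≡ true
∧-join refl refl = refl

∨-split : ∀ {a b} → a ∨ b ≡ true → a ≡ true ⊎ b ≡ true
∨-split {true} _ = inj₁ refl
∨-split {false} h = inj₂ h

∨-left : ∀ {a b} → a ≡ true → a ∨ b ≡ true
∨-left refl = refl

∨-right : ∀ {a b} → b ≡ true → a ∨ b ≡ true
∨-right {a} refl = ∨-zeroʳ a

not-split : ∀ {a} → not a ≡ true → a ≡ false
not-split {false} _ = refl

not-join : ∀ {a} → (a ≡ true → ⊥) → not a ≡ true
not-join {false} _ = refl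
not-join {true} h = ⊥-elim (h refl)

true≢false : ∀ {a} → a ≡ true → a ≡ false → ⊥
true≢false refl ()

bool-case : ∀ a → a ≡ true ⊎ a ≡ false
bool-case true = inj₁ refl
bool-case false = inj₂ refl

bool-ext : ∀ {a b} → (a ≡ true → b ≡ true) → (b ≡ true → a ≡ true) → a ≡ b
bool-ext {true} h k = sym (h refl)
bool-ext {false} {true} h k = k refl
bool-ext {false} {false} h k = refl

⌊⌋⁺ : {P : Set} (d : Dec P) → P → ⌊ d ⌋ ≡ true
⌊⌋⁺ (yes _) p = refl
⌊⌋⁺ (no ¬p) p = ⊥-elim (¬p p)

⌊⌋⁻ : {P : Set} (d : Dec P) → ⌊ d ⌋ ≡ true → P
⌊⌋⁻ (yes p) _ = p

⌊⌋-no : {P : Set} (d : Dec P) → not ⌊ d ⌋ ≡ true → ¬ P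
⌊⌋-no (no ¬p) _ = ¬p

removeAt : {A : Set} {x : A} {ys : List A} → x ∈ ys → List A
removeAt {ys = y ∷ ys} (here _) = ys
removeAt {ys = y ∷ ys} (there m) = y ∷ removeAt m

length-removeAt : {A : Set} {x : A} {ys : List A} (m : x ∈ ys) → length ys ≡ suc (length (removeAt m))
length-removeAt (here _) = refl
length-removeAt (there m) = cong suc (length-removeAt m)

∈-removeAt : {A : Set} {x y : A} {ys : List A} (m : x ∈ ys) → y ∈ ys → y ≢ x → y ∈ removeAt m
∈-removeAt (here refl) (here refl) ne = ⊥-elim (ne refl)
∈-removeAt (here refl) (there k) ne = k
∈-removeAt (there m) (here refl) ne = here refl
∈-removeAt (there m) (there k) ne = there (∈-removeAt m k ne)

injection-length : {A B : Set} {xs : List A} → Unique xs → (ys : List B) (f : A → B) →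
  (∀ x → x ∈ xs → f x ∈ ys) →
  (∀ x x′ → x ∈ xs → x′ ∈ xs → f x ≡ f x′ → x ≡ x′) →
  length xs ≤ length ys
injection-length [] ys f h inj = z≤n
injection-length {xs = x ∷ xs} (px ∷ u) ys f h inj =
  subst (suc (length xs) ≤_) (sym (length-removeAt m))
    (s≤s (injection-length u (removeAt m) f
      (λ y k → ∈-removeAt m (h y (there k))
        (λ e → All.lookup px k (sym (inj y x (there k) (here refl) e))))
      (λ y y′ k k′ → inj y y′ (there k) (there k′))))
  where m = h x (here refl)

∑-atMostOne : {A : Set} {xs : List A} → Unique xs → (p : A → Bool) →
  (∀ x y → p x ≡ true → p y ≡ true → x ≡ y) → ∑ xs (λ x → ⟦ p x ⟧) ≤ 1
∑-atMostOne [] p h = z≤n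
∑-atMostOne {xs = x ∷ xs} (px ∷ u) p h with p x in eq
... | false = ∑-atMostOne u p h
... | true = s≤s (≤-reflexive (∑-empty xs _ λ y m → cong ⟦_⟧
               (¬-not λ py → All.lookup px m (h x y eq py))))

pow-mono : ∀ b {m n} → m ≤ n → (suc b) ^ m ≤ (suc b) ^ n
pow-mono b = ^-monoʳ-≤ (suc b)

≤-by : ∀ {m n} k → n ≡ m + k → m ≤ n
≤-by {m} k refl = m≤m+n m k

*-cancelˡ-≤′ : ∀ k {m n} → 0 < k → k * m ≤ k * n → m ≤ n
*-cancelˡ-≤′ (suc k) _ = *-cancelˡ-≤ (suc k)

*-cancelʳ-≤′ : ∀ k {m n} → 0 < k → m * k ≤ n * k → m ≤ n
*-cancelʳ-≤′ (suc k) {m} {n} _ = *-cancelʳ-≤ m n (suc k)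

pow-pos : ∀ b n → 0 < b → 0 < b ^ n
pow-pos (suc b) n _ = m^n>0 (suc b) n

-- Subsets of [3]ⁿ

pattern 0F = zero
pattern 1F = suc zero
pattern 2F = suc (suc zero)

∑V : ∀ {n} → (Elem n → ℕ) → ℕ
∑V {n} = ∑ (allElems n)

card : ∀ {n} → (Elem n → Bool) → ℕ
card p = ∑V (λ x → ⟦ p x ⟧)

∑V-suc : ∀ {n} (f : Elem (suc n) → ℕ) →
  ∑V f ≡ ∑V (λ v → f (0F ∷ v)) + (∑V (λ v → f (1F ∷ v)) + ∑V (λ v → f (2F ∷ v)))
∑V-suc {n} f =
  trans (∑-++ (map (0F ∷_) E) _ f) (cong₂ _+_ (∑-map (0F ∷_) E f)
  (trans (∑-++ (map (1F ∷_) E) _ f) (cong₂ _+_ (∑-map (1F ∷_) E f)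
  (trans (∑-++ (map (2F ∷_) E) [] f) (trans (+-identityʳ _) (∑-map (2F ∷_) E f))))))
  where E = allElems n

allElems-complete : ∀ {n} (v : Elem n) → v ∈ allElems n
allElems-complete [] = here refl
allElems-complete {suc n} (0F ∷ v) = ∈-++⁺ˡ (∈-map⁺ (0F ∷_) (allElems-complete v))
allElems-complete {suc n} (1F ∷ v) =
  ∈-++⁺ʳ (map (0F ∷_) (allElems n)) (∈-++⁺ˡ (∈-map⁺ (1F ∷_) (allElems-complete v)))
allElems-complete {suc n} (2F ∷ v) =
  ∈-++⁺ʳ (map (0F ∷_) (allElems n)) (∈-++⁺ʳ (map (1F ∷_) (allElems n))
    (∈-++⁺ˡ (∈-map⁺ (2F ∷_) (allElems-complete v))))

allElems-unique : ∀ n → Unique (allElems n)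
allElems-unique zero = [] ∷ []
allElems-unique (suc n) =
  Uniq.++⁺ (piece 0F) (Uniq.++⁺ (piece 1F) (Uniq.++⁺ (piece 2F) [] λ ()) d₁) d₀
  where
  E = allElems n
  piece : ∀ a → Unique (map (a ∷_) E)
  piece a = Uniq.map⁺ (λ { refl → refl }) (allElems-unique n)
  heads : ∀ {a v} → v ∈ map (a ∷_) E → Data.Vec.head v ≡ a
  heads m with ∈-map⁻ _ m
  ... | _ , _ , refl = refl
  d₁ : ∀ {v} → ¬ (v ∈ map (1F ∷_) E × v ∈ (map (2F ∷_) E ++ []))
  d₁ (p , q) with ∈-++⁻ (map (2F ∷_) E) q
  ... | inj₁ r with trans (sym (heads p)) (heads r)
  ...   | ()
  d₀ : ∀ {v} → ¬ (v ∈ map (0F ∷_) E × v ∈ (map (1F ∷_) E ++ (map (2F ∷_) E ++ [])))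
  d₀ (p , q) with ∈-++⁻ (map (1F ∷_) E) q
  ... | inj₁ r with trans (sym (heads p)) (heads r)
  ...   | ()
  d₀ (p , q) | inj₂ q′ with ∈-++⁻ (map (2F ∷_) E) q′
  ... | inj₁ r with trans (sym (heads p)) (heads r)
  ...   | ()

length-allElems : ∀ n → length (allElems n) ≡ 3 ^ n
length-allElems zero = refl
length-allElems (suc n)
  rewrite length-++ (map {B = Elem (suc n)} (0F ∷_) (allElems n)) {map (1F ∷_) (allElems n) ++ (map (2F ∷_) (allElems n) ++ [])}
        | length-++ (map {B = Elem (suc n)} (1F ∷_) (allElems n)) {map (2F ∷_) (allElems n) ++ []}
        | length-++ (map {B = Elem (suc n)} (2F ∷_) (allElems n)) {[]}
        | length-map {B = Elem (suc n)} (0F ∷_) (allElems n) | length-map {B = Elem (suc n)} (1F ∷_) (allElems n)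
        | length-map {B = Elem (suc n)} (2F ∷_) (allElems n)
        | length-allElems n = refl

≤∑V : ∀ {n} (f : Elem n → ℕ) (x : Elem n) → f x ≤ ∑V f
≤∑V f x = ∈⇒≤∑ f (allElems-complete x)

∑V-pos : ∀ {n} (f : Elem n → ℕ) → 0 < ∑V f → Σ (Elem n) λ x → 0 < f x
∑V-pos f h with ∑-pos (allElems _) f h
... | x , _ , p = x , p

card-mono : ∀ {n} {p q : Elem n → Bool} → (∀ x → p x ≡ true → q x ≡ true) → card p ≤ card q
card-mono h = ∑-mono (allElems _) (λ x → ⟦⟧-mono (h x))

card≤3^ : ∀ {n} (p : Elem n → Bool) → card p ≤ 3 ^ n
card≤3^ {n} p = ≤-trans (∑-mono (allElems n) (λ x → ⟦⟧≤1 (p x)))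
  (≤-reflexive (trans (∑-const (allElems n) 1) (trans (*-identityʳ _) (length-allElems n))))

card-≤1 : ∀ {n} (p : Elem n → Bool) → (∀ x y → p x ≡ true → p y ≡ true → x ≡ y) → card p ≤ 1
card-≤1 {n} = ∑-atMostOne (allElems-unique n)

anyV : ∀ {n} → (Elem n → Bool) → Bool
anyV {zero} p = p []
anyV {suc n} p = anyV (λ v → p (0F ∷ v)) ∨ (anyV (λ v → p (1F ∷ v)) ∨ anyV (λ v → p (2F ∷ v)))

anyV⁺ : ∀ {n} (p : Elem n → Bool) x → p x ≡ true → anyV p ≡ true
anyV⁺ p [] h = h
anyV⁺ p (0F ∷ v) h = ∨-left (anyV⁺ _ v h)
anyV⁺ {suc n} p (1F ∷ v) h = ∨-right {anyV {n} _} (∨-left (anyV⁺ _ v h))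
anyV⁺ {suc n} p (2F ∷ v) h = ∨-right {anyV {n} _} (∨-right {anyV {n} _} (anyV⁺ _ v h))

anyV⁻ : ∀ {n} (p : Elem n → Bool) → anyV p ≡ true → Σ (Elem n) λ x → p x ≡ true
anyV⁻ {zero} p h = [] , h
anyV⁻ {suc n} p h with ∨-split {anyV {n} _} h
... | inj₁ h₀ = let (v , q) = anyV⁻ _ h₀ in 0F ∷ v , q
... | inj₂ h′ with ∨-split {anyV {n} _} h′
...   | inj₁ h₁ = let (v , q) = anyV⁻ _ h₁ in 1F ∷ v , q
...   | inj₂ h₂ = let (v , q) = anyV⁻ _ h₂ in 2F ∷ v , q

allV : ∀ {n} → (Elem n → Bool) → Bool
allV p = not (anyV (λ x → not (p x)))

allV⁺ : ∀ {n} (p : Elem n → Bool) → (∀ x → p x ≡ true) → allV p ≡ true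
allV⁺ p h = not-join λ e → let (x , q) = anyV⁻ _ e in true≢false (h x) (not-split q)

allV⁻ : ∀ {n} (p : Elem n → Bool) → allV p ≡ true → ∀ x → p x ≡ true
allV⁻ p h x with bool-case (p x)
... | inj₁ e = e
... | inj₂ e = ⊥-elim (true≢false (anyV⁺ (λ y → not (p y)) x (cong not e)) (not-split h))

_⇒ᵇ_ : Bool → Bool → Bool
a ⇒ᵇ b = not a ∨ b

⇒ᵇ⁺ : ∀ {a b} → (a ≡ true → b ≡ true) → a ⇒ᵇ b ≡ true
⇒ᵇ⁺ {true} h = h refl
⇒ᵇ⁺ {false} h = refl

⇒ᵇ⁻ : ∀ {a b} → a ⇒ᵇ b ≡ true → a ≡ true → b ≡ true
⇒ᵇ⁻ h refl = h

-- A set of points of [3]ⁿ as a ternary tree of Booleans, so that extensionally equal sets are equal.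
Sub : ℕ → Set
Sub zero = Bool
Sub (suc n) = Sub n × (Sub n × Sub n)

infix 5 _∋_
_∋_ : ∀ {n} → Sub n → Elem n → Bool
_∋_ {zero} S [] = S
_∋_ {suc n} (S , _) (0F ∷ v) = S ∋ v
_∋_ {suc n} (_ , S , _) (1F ∷ v) = S ∋ v
_∋_ {suc n} (_ , _ , S) (2F ∷ v) = S ∋ v

tab : ∀ {n} → (Elem n → Bool) → Sub n
tab {zero} p = p []
tab {suc n} p = tab (λ v → p (0F ∷ v)) , tab (λ v → p (1F ∷ v)) , tab (λ v → p (2F ∷ v))

∋-tab : ∀ {n} (p : Elem n → Bool) x → (tab p ∋ x) ≡ p x
∋-tab p [] = refl
∋-tab p (0F ∷ v) = ∋-tab _ v
∋-tab p (1F ∷ v) = ∋-tab _ v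
∋-tab p (2F ∷ v) = ∋-tab _ v

Sub-ext : ∀ {n} {S T : Sub n} → (∀ x → (S ∋ x) ≡ (T ∋ x)) → S ≡ T
Sub-ext {zero} h = h []
Sub-ext {suc n} h = cong₂ _,_ (Sub-ext λ v → h (0F ∷ v))
  (cong₂ _,_ (Sub-ext λ v → h (1F ∷ v)) (Sub-ext λ v → h (2F ∷ v)))

subsets : ∀ {n} → (Elem n → Bool) → List (Sub n)
subsets {zero} p = if p [] then true ∷ false ∷ [] else false ∷ []
subsets {suc n} p = cartesianProduct (subsets (λ v → p (0F ∷ v)))
  (cartesianProduct (subsets (λ v → p (1F ∷ v))) (subsets (λ v → p (2F ∷ v))))

length-cartesianProduct : {A B : Set} (xs : List A) (ys : List B) →
  length (cartesianProduct xs ys) ≡ length xs * length ys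
length-cartesianProduct [] ys = refl
length-cartesianProduct (x ∷ xs) ys = trans (length-++ (map (x ,_) ys))
  (cong₂ _+_ (length-map (x ,_) ys) (length-cartesianProduct xs ys))

length-subsets : ∀ {n} (p : Elem n → Bool) → length (subsets p) ≡ 2 ^ card p
length-subsets {zero} p with p []
... | true = refl
... | false = refl
length-subsets {suc n} p = begin
  length (subsets p)
    ≡⟨ trans (length-cartesianProduct (subsets p₀) _) (cong (length (subsets p₀) *_) (length-cartesianProduct (subsets p₁) _)) ⟩
  length (subsets p₀) * (length (subsets p₁) * length (subsets p₂))
    ≡⟨ cong₂ _*_ (length-subsets p₀) (cong₂ _*_ (length-subsets p₁) (length-subsets p₂)) ⟩
  2 ^ card p₀ * (2 ^ card p₁ * 2 ^ card p₂)
    ≡⟨ sym (trans (^-distribˡ-+-* 2 (card p₀) _) (cong (2 ^ card p₀ *_) (^-distribˡ-+-* 2 (card p₁) _))) ⟩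
  2 ^ (card p₀ + (card p₁ + card p₂))
    ≡⟨ cong (2 ^_) (sym (∑V-suc {n} (λ x → ⟦ p x ⟧))) ⟩
  2 ^ card p ∎
  where
  open ≡-Reasoning
  p₀ p₁ p₂ : Elem n → Bool
  p₀ v = p (0F ∷ v)
  p₁ v = p (1F ∷ v)
  p₂ v = p (2F ∷ v)

subsets-unique : ∀ {n} (p : Elem n → Bool) → Unique (subsets p)
subsets-unique {zero} p with p []
... | true = ((λ ()) ∷ []) ∷ [] ∷ []
... | false = [] ∷ []
subsets-unique {suc n} p = Uniq.cartesianProduct⁺ (subsets-unique _)
  (Uniq.cartesianProduct⁺ (subsets-unique _) (subsets-unique _))

∈-subsets⁺ : ∀ {n} (p : Elem n → Bool) (S : Sub n) → (∀ x → (S ∋ x) ≡ true → p x ≡ true) → S ∈ subsets p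
∈-subsets⁺ {zero} p false h with p []
... | true = there (here refl)
... | false = here refl
∈-subsets⁺ {zero} p true h rewrite h [] refl = here refl
∈-subsets⁺ {suc n} p (S₀ , S₁ , S₂) h = ∈-cartesianProduct⁺ (∈-subsets⁺ _ S₀ λ v → h (0F ∷ v))
  (∈-cartesianProduct⁺ (∈-subsets⁺ _ S₁ λ v → h (1F ∷ v)) (∈-subsets⁺ _ S₂ λ v → h (2F ∷ v)))

∈-subsets⁻ : ∀ {n} (p : Elem n → Bool) (S : Sub n) → S ∈ subsets p → ∀ x → (S ∋ x) ≡ true → p x ≡ true
∈-subsets⁻ {zero} p S m [] h with p []
∈-subsets⁻ {zero} p S m [] h | true = refl
∈-subsets⁻ {zero} p .false (here refl) [] () | false
∈-subsets⁻ {suc n} p (S₀ , S₁ , S₂) m x h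
  with ∈-cartesianProduct⁻ (subsets (λ v → p (0F ∷ v))) _ m
... | m₀ , m′ with ∈-cartesianProduct⁻ (subsets (λ v → p (1F ∷ v))) _ m′
∈-subsets⁻ p (S₀ , S₁ , S₂) m (0F ∷ v) h | m₀ , m′ | m₁ , m₂ = ∈-subsets⁻ _ S₀ m₀ v h
∈-subsets⁻ p (S₀ , S₁ , S₂) m (1F ∷ v) h | m₀ , m′ | m₁ , m₂ = ∈-subsets⁻ _ S₁ m₁ v h
∈-subsets⁻ p (S₀ , S₁ , S₂) m (2F ∷ v) h | m₀ , m′ | m₁ , m₂ = ∈-subsets⁻ _ S₂ m₂ v h

full : ∀ {n} → Elem n → Bool
full _ = true

allSubs : ∀ n → List (Sub n)
allSubs n = subsets {n} full

allSubs-complete : ∀ {n} (S : Sub n) → S ∈ allSubs n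
allSubs-complete S = ∈-subsets⁺ full S (λ _ _ → refl)

allS : ∀ {n} → (Sub n → Bool) → Bool
allS {n} P = does (All.all? (λ S → P S Data.Bool.≟ true) (allSubs n))

allS⁺ : ∀ {n} (P : Sub n → Bool) → (∀ S → P S ≡ true) → allS P ≡ true
allS⁺ {n} P h = dec-true (All.all? (λ S → P S Data.Bool.≟ true) (allSubs n)) (All.tabulate (λ {S} _ → h S))

allS⁻ : ∀ {n} (P : Sub n → Bool) → allS P ≡ true → ∀ S → P S ≡ true
allS⁻ {n} P h S with All.all? (λ S → P S Data.Bool.≟ true) (allSubs n)
... | yes a = All.lookup a (allSubs-complete S)

-- The cover relation of [3]ⁿ

data Rel : Set where
  same up other : Rel

-- The covers 0 < 1 and 1 < 2 are counted apart because the edge weights treat them differently.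
data Step : Set where
  low high : Step

relₛ : Step → Fin 3 → Fin 3 → Rel
relₛ s 0F 0F = same
relₛ s 1F 1F = same
relₛ s 2F 2F = same
relₛ low 0F 1F = up
relₛ high 1F 2F = up
relₛ s _ _ = other

rel : Fin 3 → Fin 3 → Rel
rel 0F 0F = same
rel 1F 1F = same
rel 2F 2F = same
rel 0F 1F = up
rel 1F 2F = up
rel _ _ = other

-- Comparing first coordinates decides what remains to be checked on the tails: the same relation
-- after `same`, equality after `up`. Sums over covers therefore unfold one coordinate at a time by
-- `∑V-suc`.
pick : Rel → Bool → Bool → Bool
pick same c e = c
pick up c e = e
pick other c e = false

eqV : ∀ {n} → Elem n → Elem n → Bool
eqV [] [] = true
eqV (0F ∷ v) (0F ∷ w) = eqV v w
eqV (1F ∷ v) (1F ∷ w) = eqV v w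
eqV (2F ∷ v) (2F ∷ w) = eqV v w
eqV _ _ = false

eqV⁻ : ∀ {n} (v w : Elem n) → eqV v w ≡ true → v ≡ w
eqV⁻ [] [] _ = refl
eqV⁻ (0F ∷ v) (0F ∷ w) h = cong (0F ∷_) (eqV⁻ v w h)
eqV⁻ (1F ∷ v) (1F ∷ w) h = cong (1F ∷_) (eqV⁻ v w h)
eqV⁻ (2F ∷ v) (2F ∷ w) h = cong (2F ∷_) (eqV⁻ v w h)
eqV⁻ (0F ∷ v) (1F ∷ w) ()
eqV⁻ (0F ∷ v) (2F ∷ w) ()
eqV⁻ (1F ∷ v) (0F ∷ w) ()
eqV⁻ (1F ∷ v) (2F ∷ w) ()
eqV⁻ (2F ∷ v) (0F ∷ w) ()
eqV⁻ (2F ∷ v) (1F ∷ w) ()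

eqV-refl : ∀ {n} (v : Elem n) → eqV v v ≡ true
eqV-refl [] = refl
eqV-refl (0F ∷ v) = eqV-refl v
eqV-refl (1F ∷ v) = eqV-refl v
eqV-refl (2F ∷ v) = eqV-refl v

_≟V_ : ∀ {n} (v w : Elem n) → Dec (v ≡ w)
v ≟V w with bool-case (eqV v w)
... | inj₁ e = yes (eqV⁻ v w e)
... | inj₂ e = no λ { refl → true≢false (eqV-refl v) e }

∑V-zero : ∀ {n} → ∑V {n} (λ _ → 0) ≡ 0
∑V-zero {n} = ∑-zero (allElems n)

∑-eqVˡ : ∀ {n} (x : Elem n) (f : Elem n → ℕ) → ∑V (λ y → ⟦ eqV x y ⟧ * f y) ≡ f x
∑-eqVˡ [] f = trans (+-identityʳ _) (+-identityʳ _)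
∑-eqVˡ {suc n} (0F ∷ x) f
  rewrite ∑V-suc (λ y → ⟦ eqV (0F ∷ x) y ⟧ * f y)
        | ∑-eqVˡ x (λ y → f (0F ∷ y)) | ∑V-zero {n} = +-identityʳ _
∑-eqVˡ {suc n} (1F ∷ x) f
  rewrite ∑V-suc (λ y → ⟦ eqV (1F ∷ x) y ⟧ * f y)
        | ∑-eqVˡ x (λ y → f (1F ∷ y)) | ∑V-zero {n} = +-identityʳ _
∑-eqVˡ {suc n} (2F ∷ x) f
  rewrite ∑V-suc (λ y → ⟦ eqV (2F ∷ x) y ⟧ * f y)
        | ∑-eqVˡ x (λ y → f (2F ∷ y)) | ∑V-zero {n} = refl

eqV-sym : ∀ {n} (x y : Elem n) → eqV x y ≡ eqV y x
eqV-sym x y = bool-ext (λ e → subst (λ z → eqV z x ≡ true) (eqV⁻ x y e) (eqV-refl x))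
                       (λ e → subst (λ z → eqV z y ≡ true) (eqV⁻ y x e) (eqV-refl y))

∑-eqVʳ : ∀ {n} (x : Elem n) (f : Elem n → ℕ) → ∑V (λ y → ⟦ eqV y x ⟧ * f y) ≡ f x
∑-eqVʳ {n} x f = trans (∑-cong (allElems n) (λ y → cong (λ b → ⟦ b ⟧ * f y) (eqV-sym y x))) (∑-eqVˡ x f)

∑-eqVˡ₁ : ∀ {n} (x : Elem n) → ∑V (λ y → ⟦ eqV x y ⟧) ≡ 1
∑-eqVˡ₁ {n} x = trans (∑-cong (allElems n) (λ y → sym (*-identityʳ ⟦ eqV x y ⟧))) (∑-eqVˡ x (λ _ → 1))

∑-eqVʳ₁ : ∀ {n} (x : Elem n) → ∑V (λ y → ⟦ eqV y x ⟧) ≡ 1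
∑-eqVʳ₁ {n} x = trans (∑-cong (allElems n) (λ y → sym (*-identityʳ ⟦ eqV y x ⟧))) (∑-eqVʳ x (λ _ → 1))

-- y is covered by x, with a coordinate raised from 0 to 1 (low) or from 1 to 2 (high).
covₛ : ∀ {n} → Step → Elem n → Elem n → Bool
covₛ s [] [] = false
covₛ s (a ∷ y) (b ∷ x) = pick (relₛ s a b) (covₛ s y x) (eqV y x)

cov : ∀ {n} → Elem n → Elem n → Bool
cov [] [] = false
cov (a ∷ y) (b ∷ x) = pick (rel a b) (cov y x) (eqV y x)

cnt₀ cnt₁ cnt₂ : ∀ {n} → Elem n → ℕ
cnt₀ [] = 0
cnt₀ (0F ∷ v) = suc (cnt₀ v)
cnt₀ (_ ∷ v) = cnt₀ v
cnt₁ [] = 0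
cnt₁ (1F ∷ v) = suc (cnt₁ v)
cnt₁ (_ ∷ v) = cnt₁ v
cnt₂ [] = 0
cnt₂ (2F ∷ v) = suc (cnt₂ v)
cnt₂ (_ ∷ v) = cnt₂ v

cnt-total : ∀ {n} (v : Elem n) → cnt₀ v + (cnt₁ v + cnt₂ v) ≡ n
cnt-total [] = refl
cnt-total (0F ∷ v) = cong suc (cnt-total v)
cnt-total (1F ∷ v) = trans (+-suc (cnt₀ v) _) (cong suc (cnt-total v))
cnt-total (2F ∷ v) = trans (cong (cnt₀ v +_) (+-suc (cnt₁ v) _)) (trans (+-suc (cnt₀ v) _) (cong suc (cnt-total v)))

cnt-rank : ∀ {n} (v : Elem n) → cnt₁ v + (cnt₂ v + cnt₂ v) ≡ rank v
cnt-rank [] = refl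
cnt-rank (0F ∷ v) = cnt-rank v
cnt-rank (1F ∷ v) = cong suc (cnt-rank v)
cnt-rank (2F ∷ v) rewrite +-suc (cnt₂ v) (cnt₂ v) | +-suc (cnt₁ v) (suc (cnt₂ v + cnt₂ v)) | +-suc (cnt₁ v) (cnt₂ v + cnt₂ v)
  = cong (λ k → suc (suc k)) (cnt-rank v)

low-down : ∀ {n} (x : Elem n) → ∑V (λ y → ⟦ covₛ low y x ⟧) ≡ cnt₁ x
low-down [] = refl
low-down {suc n} (0F ∷ x) rewrite ∑V-suc (λ y → ⟦ covₛ low y (0F ∷ x) ⟧) | ∑V-zero {n} = trans (+-identityʳ _) (low-down x)
low-down {suc n} (1F ∷ x) rewrite ∑V-suc (λ y → ⟦ covₛ low y (1F ∷ x) ⟧) | ∑V-zero {n} | ∑-eqVʳ₁ x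
  = cong suc (trans (+-identityʳ _) (low-down x))
low-down {suc n} (2F ∷ x) rewrite ∑V-suc (λ y → ⟦ covₛ low y (2F ∷ x) ⟧) | ∑V-zero {n} = low-down x

high-down : ∀ {n} (x : Elem n) → ∑V (λ y → ⟦ covₛ high y x ⟧) ≡ cnt₂ x
high-down [] = refl
high-down {suc n} (0F ∷ x) rewrite ∑V-suc (λ y → ⟦ covₛ high y (0F ∷ x) ⟧) | ∑V-zero {n} = trans (+-identityʳ _) (high-down x)
high-down {suc n} (1F ∷ x) rewrite ∑V-suc (λ y → ⟦ covₛ high y (1F ∷ x) ⟧) | ∑V-zero {n} = trans (+-identityʳ _) (high-down x)
high-down {suc n} (2F ∷ x) rewrite ∑V-suc (λ y → ⟦ covₛ high y (2F ∷ x) ⟧) | ∑V-zero {n} | ∑-eqVʳ₁ x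
  = cong suc (high-down x)

low-up : ∀ {n} (y : Elem n) → ∑V (λ x → ⟦ covₛ low y x ⟧) ≡ cnt₀ y
low-up [] = refl
low-up {suc n} (0F ∷ y) rewrite ∑V-suc (λ x → ⟦ covₛ low (0F ∷ y) x ⟧) | ∑V-zero {n} | ∑-eqVˡ₁ y
  = trans (+-comm _ 1) (cong suc (low-up y))
low-up {suc n} (1F ∷ y) rewrite ∑V-suc (λ x → ⟦ covₛ low (1F ∷ y) x ⟧) | ∑V-zero {n} = trans (+-identityʳ _) (low-up y)
low-up {suc n} (2F ∷ y) rewrite ∑V-suc (λ x → ⟦ covₛ low (2F ∷ y) x ⟧) | ∑V-zero {n} = low-up y

high-up : ∀ {n} (y : Elem n) → ∑V (λ x → ⟦ covₛ high y x ⟧) ≡ cnt₁ y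
high-up [] = refl
high-up {suc n} (0F ∷ y) rewrite ∑V-suc (λ x → ⟦ covₛ high (0F ∷ y) x ⟧) | ∑V-zero {n} = trans (+-identityʳ _) (high-up y)
high-up {suc n} (1F ∷ y) rewrite ∑V-suc (λ x → ⟦ covₛ high (1F ∷ y) x ⟧) | ∑V-zero {n} | ∑-eqVˡ₁ y
  = trans (+-comm _ 1) (cong suc (high-up y))
high-up {suc n} (2F ∷ y) rewrite ∑V-suc (λ x → ⟦ covₛ high (2F ∷ y) x ⟧) | ∑V-zero {n} = high-up y

cov-split : ∀ {n} (y x : Elem n) → ⟦ cov y x ⟧ ≡ ⟦ covₛ low y x ⟧ + ⟦ covₛ high y x ⟧
cov-split [] [] = refl
cov-split (0F ∷ y) (0F ∷ x) = cov-split y x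
cov-split (1F ∷ y) (1F ∷ x) = cov-split y x
cov-split (2F ∷ y) (2F ∷ x) = cov-split y x
cov-split (0F ∷ y) (1F ∷ x) = sym (+-identityʳ _)
cov-split (1F ∷ y) (2F ∷ x) = refl
cov-split (0F ∷ y) (2F ∷ x) = refl
cov-split (1F ∷ y) (0F ∷ x) = refl
cov-split (2F ∷ y) (0F ∷ x) = refl
cov-split (2F ∷ y) (1F ∷ x) = refl

down-degree : ∀ {n} (x : Elem n) → ∑V (λ y → ⟦ cov y x ⟧) ≡ cnt₁ x + cnt₂ x
down-degree {n} x = trans (∑-cong (allElems n) (λ y → cov-split y x))
  (trans (∑-+ (allElems n) _ _) (cong₂ _+_ (low-down x) (high-down x)))

up-degree : ∀ {n} (y : Elem n) → ∑V (λ x → ⟦ cov y x ⟧) ≡ cnt₀ y + cnt₁ y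
up-degree {n} y = trans (∑-cong (allElems n) (λ x → cov-split y x))
  (trans (∑-+ (allElems n) _ _) (cong₂ _+_ (low-up y) (high-up y)))

data Cov : ∀ {n} → Elem n → Elem n → Set where
  stepC : ∀ {n a b} {x : Elem n} → rel a b ≡ up → Cov (a ∷ x) (b ∷ x)
  keepC : ∀ {n} a {y x : Elem n} → Cov y x → Cov (a ∷ y) (a ∷ x)

cov⁻ : ∀ {n} (y x : Elem n) → cov y x ≡ true → Cov y x
cov⁻ [] [] ()
cov⁻ (0F ∷ y) (0F ∷ x) h = keepC 0F (cov⁻ y x h)
cov⁻ (1F ∷ y) (1F ∷ x) h = keepC 1F (cov⁻ y x h)
cov⁻ (2F ∷ y) (2F ∷ x) h = keepC 2F (cov⁻ y x h)
cov⁻ (0F ∷ y) (1F ∷ x) h with refl ← eqV⁻ y x h = stepC refl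
cov⁻ (1F ∷ y) (2F ∷ x) h with refl ← eqV⁻ y x h = stepC refl

cov⁺ : ∀ {n} {y x : Elem n} → Cov y x → cov y x ≡ true
cov⁺ (stepC {x = x} e) rewrite e = eqV-refl x
cov⁺ (keepC 0F c) = cov⁺ c
cov⁺ (keepC 1F c) = cov⁺ c
cov⁺ (keepC 2F c) = cov⁺ c

rel-up : ∀ {a b} → rel a b ≡ up → toℕ b ≡ suc (toℕ a)
rel-up {0F} {1F} _ = refl
rel-up {1F} {2F} _ = refl
rel-up {1F} {0F} ()
rel-up {1F} {1F} ()
rel-up {2F} {0F} ()
rel-up {2F} {1F} ()
rel-up {2F} {2F} ()

Cov-rank : ∀ {n} {y x : Elem n} → Cov y x → rank x ≡ suc (rank y)
Cov-rank (stepC {x = x} e) = cong (_+ rank x) (rel-up e)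
Cov-rank (keepC a {y} c) = trans (cong (toℕ a +_) (Cov-rank c)) (+-suc (toℕ a) (rank y))

cov-rank : ∀ {n} (y x : Elem n) → cov y x ≡ true → rank x ≡ suc (rank y)
cov-rank y x h = Cov-rank (cov⁻ y x h)

≼-refl : ∀ {n} (x : Elem n) → x ≼ x
≼-refl [] = Pointwise.[]
≼-refl (a ∷ x) = ≤-refl Pointwise.∷ ≼-refl x

≼-trans : ∀ {n} {x y z : Elem n} → x ≼ y → y ≼ z → x ≼ z
≼-trans Pointwise.[] Pointwise.[] = Pointwise.[]
≼-trans (p Pointwise.∷ ps) (q Pointwise.∷ qs) = ≤-trans p q Pointwise.∷ ≼-trans ps qs

Cov⇒≼ : ∀ {n} {y x : Elem n} → Cov y x → y ≼ x
Cov⇒≼ (stepC {a = a} {x = x} e) = subst (toℕ a ≤_) (sym (rel-up e)) (n≤1+n _) Pointwise.∷ ≼-refl x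
Cov⇒≼ (keepC a c) = ≤-refl Pointwise.∷ Cov⇒≼ c

cov⇒≼ : ∀ {n} (y x : Elem n) → cov y x ≡ true → y ≼ x
cov⇒≼ y x h = Cov⇒≼ (cov⁻ y x h)

≼-rank : ∀ {n} {x y : Elem n} → x ≼ y → rank x ≤ rank y
≼-rank Pointwise.[] = z≤n
≼-rank (p Pointwise.∷ ps) = +-mono-≤ p (≼-rank ps)

toℕ-inj : ∀ {a b : Fin 3} → toℕ a ≡ toℕ b → a ≡ b
toℕ-inj = Data.Fin.Properties.toℕ-injective

≼-rank-≡ : ∀ {n} {x y : Elem n} → x ≼ y → rank y ≤ rank x → x ≡ y
≼-rank-≡ Pointwise.[] _ = refl
≼-rank-≡ {x = a ∷ x} {b ∷ y} (p Pointwise.∷ ps) h =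
  cong₂ _∷_ (toℕ-inj (≤-antisym p (+-cancelʳ-≤ (rank y) (toℕ b) (toℕ a)
              (≤-trans h (+-monoʳ-≤ (toℕ a) (≼-rank ps))))))
            (≼-rank-≡ ps (+-cancelˡ-≤ (toℕ b) (rank y) (rank x)
              (≤-trans h (+-monoˡ-≤ (rank x) p))))

lower : ∀ (a b : Fin 3) → toℕ a < toℕ b → Σ (Fin 3) λ c → toℕ a ≤ toℕ c × rel c b ≡ up
lower 0F 1F _ = 0F , z≤n , refl
lower 0F 2F _ = 1F , z≤n , refl
lower 1F 2F _ = 1F , ≤-refl , refl
lower 1F 1F (s≤s ())
lower 2F 1F (s≤s ())
lower 2F 2F (s≤s (s≤s ()))

≼-pred : ∀ {n} {x z : Elem n} → x ≼ z → rank x < rank z → Σ (Elem n) λ y → x ≼ y × cov y z ≡ true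
≼-pred {x = a ∷ x} {b ∷ z} (p Pointwise.∷ ps) h with toℕ a <? toℕ b
... | yes a<b = let (c , q , e) = lower a b a<b in c ∷ z , (q Pointwise.∷ ps) , cov⁺ {y = c ∷ z} {b ∷ z} (stepC e)
... | no a≮b with toℕ-inj {a} {b} (≤-antisym p (≮⇒≥ a≮b))
...   | refl = let (y , q , e) = ≼-pred ps (+-cancelˡ-< (toℕ a) _ _ h)
               in a ∷ y , (≤-refl Pointwise.∷ q) , cov⁺ {y = a ∷ y} {a ∷ z} (keepC a (cov⁻ y z e))

≼-between : ∀ {n} (m d : ℕ) {x z : Elem n} → x ≼ z → rank x ≤ m → m + d ≡ rank z →
            Σ (Elem n) λ y → x ≼ y × y ≼ z × rank y ≡ m
≼-between m zero {x} {z} xz h e = z , xz , ≼-refl z , trans (sym e) (+-identityʳ m)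
≼-between m (suc d) {x} {z} xz h e
  with ≼-pred xz (≤-<-trans h (subst (m <_) e (m<m+n m (s≤s z≤n))))
... | z₁ , xz₁ , c with ≼-between m d xz₁ h (suc-injective (trans (sym (+-suc m d)) (trans e (cov-rank z₁ z c))))
...   | y , p , q , r = y , p , ≼-trans q (cov⇒≼ z₁ z c) , r

≼-interpolate : ∀ {n} (m : ℕ) {x z : Elem n} → x ≼ z → rank x ≤ m → m ≤ rank z →
                Σ (Elem n) λ y → x ≼ y × y ≼ z × rank y ≡ m
≼-interpolate m {z = z} xz h k = ≼-between m (rank z ∸ m) xz h (m+[n∸m]≡n k)

bottom : ∀ n → Elem n
bottom zero = []
bottom (suc n) = 0F ∷ bottom n

bottom-≼ : ∀ {n} (x : Elem n) → bottom n ≼ x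
bottom-≼ [] = Pointwise.[]
bottom-≼ (a ∷ x) = z≤n Pointwise.∷ bottom-≼ x

rank-bottom : ∀ n → rank (bottom n) ≡ 0
rank-bottom zero = refl
rank-bottom (suc n) = rank-bottom n

≼-of-rank : ∀ {n} (m : ℕ) (z : Elem n) → m ≤ rank z → Σ (Elem n) λ y → y ≼ z × rank y ≡ m
≼-of-rank {n} m z h with ≼-interpolate m (bottom-≼ z) (≤-trans (≤-reflexive (rank-bottom n)) z≤n) h
... | y , _ , p , q = y , p , q

≼⇒cov : ∀ {n} {x z : Elem n} → x ≼ z → rank z ≡ suc (rank x) → cov x z ≡ true
≼⇒cov {x = x} {z} xz e with ≼-pred xz (≤-reflexive (sym e))
... | y , xy , c = subst (λ u → cov u z ≡ true)
  (sym (≼-rank-≡ xy (≤-reflexive (suc-injective (trans (sym (cov-rank y z c)) e))))) c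

meet : ∀ {n} → Elem n → Elem n → Elem n
meet [] [] = []
meet (a ∷ x) (b ∷ y) with toℕ a ≤? toℕ b
... | yes _ = a ∷ meet x y
... | no _ = b ∷ meet x y

meet-≼ˡ : ∀ {n} (x y : Elem n) → meet x y ≼ x
meet-≼ˡ [] [] = Pointwise.[]
meet-≼ˡ (a ∷ x) (b ∷ y) with toℕ a ≤? toℕ b
... | yes p = ≤-refl Pointwise.∷ meet-≼ˡ x y
... | no p = <⇒≤ (≰⇒> p) Pointwise.∷ meet-≼ˡ x y

meet-≼ʳ : ∀ {n} (x y : Elem n) → meet x y ≼ y
meet-≼ʳ [] [] = Pointwise.[]
meet-≼ʳ (a ∷ x) (b ∷ y) with toℕ a ≤? toℕ b
... | yes p = p Pointwise.∷ meet-≼ʳ x y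
... | no p = ≤-refl Pointwise.∷ meet-≼ʳ x y

meet-greatest : ∀ {n} {z x y : Elem n} → z ≼ x → z ≼ y → z ≼ meet x y
meet-greatest Pointwise.[] Pointwise.[] = Pointwise.[]
meet-greatest {x = a ∷ x} {b ∷ y} (p Pointwise.∷ ps) (q Pointwise.∷ qs) with toℕ a ≤? toℕ b
... | yes _ = p Pointwise.∷ meet-greatest ps qs
... | no _ = q Pointwise.∷ meet-greatest ps qs

meet-rank : ∀ {n} {x y : Elem n} → rank x ≡ rank y → x ≢ y → rank (meet x y) < rank x
meet-rank {x = x} {y} e ne with rank (meet x y) <? rank x
... | yes p = p
... | no p = ⊥-elim (ne (trans (sym (≼-rank-≡ (meet-≼ˡ x y) (≮⇒≥ p)))
               (≼-rank-≡ (meet-≼ʳ x y) (subst (_≤ rank (meet x y)) e (≮⇒≥ p)))))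

-- Both `w` and `w′` equal `meet x x′`, which lies above each of them and has rank below that of
-- `x`. So the graph between two consecutive layers has no 4-cycle; the later counts of paths rest
-- on this.
cov-unique : ∀ {n} {w w′ x x′ : Elem n} → x ≢ x′ → cov w x ≡ true → cov w x′ ≡ true →
             cov w′ x ≡ true → cov w′ x′ ≡ true → w ≡ w′
cov-unique {w = w} {w′} {x} {x′} ne a b c d =
  trans (go a b) (sym (go c d))
  where
  r : rank x ≡ rank x′
  r = trans (cov-rank w x a) (sym (cov-rank w x′ b))
  go : ∀ {u} → cov u x ≡ true → cov u x′ ≡ true → u ≡ meet x x′
  go {u} p q = ≼-rank-≡ (meet-greatest (cov⇒≼ u x p) (cov⇒≼ u x′ q))
    (≤-pred (≤-trans (meet-rank r ne) (≤-reflexive (cov-rank u x p))))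

-- Distinct lower covers of `x` lower different coordinates, since a chain has only one step below
-- each entry; lowering both coordinates gives `w`.
Cov-meet : ∀ {n} {y₁ y₂ x : Elem n} → Cov y₁ x → Cov y₂ x → y₁ ≢ y₂ →
           Σ (Elem n) λ w → Cov w y₁ × Cov w y₂
Cov-meet (stepC {x = x} e) (stepC e′) ne =
  ⊥-elim (ne (cong (_∷ x) (toℕ-inj (suc-injective (trans (sym (rel-up e)) (rel-up e′))))))
Cov-meet (stepC {a = a} e) (keepC _ c) ne = a ∷ _ , keepC a c , stepC e
Cov-meet (keepC _ c) (stepC {a = a} e) ne = a ∷ _ , stepC e , keepC a c
Cov-meet (keepC a c) (keepC _ c′) ne with Cov-meet c c′ (λ e → ne (cong (a ∷_) e))
... | w , p , q = a ∷ w , keepC a p , keepC a q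

cov-meet : ∀ {n} {y₁ y₂ x : Elem n} → cov y₁ x ≡ true → cov y₂ x ≡ true → y₁ ≢ y₂ →
           Σ (Elem n) λ w → cov w y₁ ≡ true × cov w y₂ ≡ true
cov-meet {y₁ = y₁} {y₂} {x} a b ne with Cov-meet (cov⁻ y₁ x a) (cov⁻ y₂ x b) ne
... | w , p , q = w , cov⁺ p , cov⁺ q

∑V-suc′ : ∀ {n} (f : Elem (suc n) → ℕ) {k₀ k₁ k₂} → ∑V (λ v → f (0F ∷ v)) ≡ k₀ → ∑V (λ v → f (1F ∷ v)) ≡ k₁ →
  ∑V (λ v → f (2F ∷ v)) ≡ k₂ → ∑V f ≡ k₀ + (k₁ + k₂)
∑V-suc′ f refl refl refl = ∑V-suc f

∑V-*0 : ∀ {n} (f : Elem n → ℕ) → ∑V (λ v → f v * 0) ≡ 0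
∑V-*0 {n} f = trans (∑-cong (allElems n) (λ v → *-zeroʳ (f v))) (∑V-zero {n})

∑-eqVʳ′ : ∀ {n} (x : Elem n) (f : Elem n → ℕ) → ∑V (λ y → f y * ⟦ eqV y x ⟧) ≡ f x
∑-eqVʳ′ {n} x f = trans (∑-cong (allElems n) (λ y → *-comm (f y) _)) (∑-eqVʳ x f)

-- An interval of length two is a chain (one coordinate raised twice) or a square (two coordinates
-- raised once). The cases run over the pairs of first coordinates.
interval-≤2 : ∀ {n} (z x : Elem n) → ∑V (λ y → ⟦ cov z y ⟧ * ⟦ cov y x ⟧) ≤ 2
interval-≤2 [] [] = z≤n
interval-≤2 {suc n} (0F ∷ z) (0F ∷ x) rewrite ∑V-suc′ (λ y → ⟦ cov (0F ∷ z) y ⟧ * ⟦ cov y (0F ∷ x) ⟧) refl (∑V-*0 (λ v → ⟦ eqV z v ⟧)) (∑V-zero {n})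
  = subst (_≤ 2) (sym (+-identityʳ _)) (interval-≤2 z x)
interval-≤2 {suc n} (1F ∷ z) (1F ∷ x) rewrite ∑V-suc′ (λ y → ⟦ cov (1F ∷ z) y ⟧ * ⟦ cov y (1F ∷ x) ⟧) (∑V-zero {n}) refl (∑V-*0 (λ v → ⟦ eqV z v ⟧))
  = subst (_≤ 2) (sym (+-identityʳ _)) (interval-≤2 z x)
interval-≤2 {suc n} (2F ∷ z) (2F ∷ x) rewrite ∑V-suc′ (λ y → ⟦ cov (2F ∷ z) y ⟧ * ⟦ cov y (2F ∷ x) ⟧) (∑V-zero {n}) (∑V-zero {n}) refl
  = interval-≤2 z x
interval-≤2 {suc n} (0F ∷ z) (1F ∷ x) rewrite ∑V-suc′ (λ y → ⟦ cov (0F ∷ z) y ⟧ * ⟦ cov y (1F ∷ x) ⟧) (∑-eqVʳ′ x (λ v → ⟦ cov z v ⟧)) (∑-eqVˡ z (λ v → ⟦ cov v x ⟧)) (∑V-zero {n})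
  = +-mono-≤ (⟦⟧≤1 (cov z x)) (subst (_≤ 1) (sym (+-identityʳ _)) (⟦⟧≤1 (cov z x)))
interval-≤2 {suc n} (1F ∷ z) (2F ∷ x) rewrite ∑V-suc′ (λ y → ⟦ cov (1F ∷ z) y ⟧ * ⟦ cov y (2F ∷ x) ⟧) (∑V-zero {n}) (∑-eqVʳ′ x (λ v → ⟦ cov z v ⟧)) (∑-eqVˡ z (λ v → ⟦ cov v x ⟧))
  = +-mono-≤ (⟦⟧≤1 (cov z x)) (⟦⟧≤1 (cov z x))
interval-≤2 {suc n} (0F ∷ z) (2F ∷ x) rewrite ∑V-suc′ (λ y → ⟦ cov (0F ∷ z) y ⟧ * ⟦ cov y (2F ∷ x) ⟧) (∑V-*0 (λ v → ⟦ cov z v ⟧)) (∑-eqVˡ z (λ v → ⟦ eqV v x ⟧)) (∑V-zero {n})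
  = ≤-trans (subst (_≤ 1) (sym (+-identityʳ _)) (⟦⟧≤1 (eqV z x))) (s≤s z≤n)
interval-≤2 {suc n} (1F ∷ z) (0F ∷ x) rewrite ∑V-suc′ (λ y → ⟦ cov (1F ∷ z) y ⟧ * ⟦ cov y (0F ∷ x) ⟧) (∑V-zero {n}) (∑V-*0 (λ v → ⟦ cov z v ⟧)) (∑V-*0 (λ v → ⟦ eqV z v ⟧)) = z≤n
interval-≤2 {suc n} (2F ∷ z) (0F ∷ x) rewrite ∑V-suc′ (λ y → ⟦ cov (2F ∷ z) y ⟧ * ⟦ cov y (0F ∷ x) ⟧) (∑V-zero {n}) (∑V-zero {n}) (∑V-*0 (λ v → ⟦ cov z v ⟧)) = z≤n
interval-≤2 {suc n} (2F ∷ z) (1F ∷ x) rewrite ∑V-suc′ (λ y → ⟦ cov (2F ∷ z) y ⟧ * ⟦ cov y (1F ∷ x) ⟧) (∑V-zero {n}) (∑V-zero {n}) (∑V-*0 (λ v → ⟦ cov z v ⟧)) = z≤n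

-- Components, downsets and the removal map

rk : ∀ {n} → ℕ → Elem n → Bool
rk k x = ⌊ rank x ≟ k ⌋

rk⁻ : ∀ {n} k (x : Elem n) → rk k x ≡ true → rank x ≡ k
rk⁻ k x = ⌊⌋⁻ (rank x ≟ k)

rk⁺ : ∀ {n} k (x : Elem n) → rank x ≡ k → rk k x ≡ true
rk⁺ k x = ⌊⌋⁺ (rank x ≟ k)

linked : ∀ {n} → Elem n → Elem n → Bool
linked x x′ = anyV (λ y → cov y x ∧ cov y x′)

linked⁺ : ∀ {n} (y x x′ : Elem n) → cov y x ≡ true → cov y x′ ≡ true → linked x x′ ≡ true
linked⁺ y x x′ a b = anyV⁺ (λ y → cov y x ∧ cov y x′) y (∧-join a b)

linked⁻ : ∀ {n} (x x′ : Elem n) → linked x x′ ≡ true → Σ (Elem n) λ y → cov y x ≡ true × cov y x′ ≡ true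
linked⁻ x x′ h = let (y , p) = anyV⁻ (λ y → cov y x ∧ cov y x′) h in y , ∧-split p

closedIn : ∀ {n} → (Elem n → Bool) → Sub n → Bool
closedIn U T = allV λ x → allV λ x′ → ((T ∋ x) ∧ (U x′ ∧ linked x x′)) ⇒ᵇ (T ∋ x′)

abstract
  -- The component of v in U is the intersection of all sets that contain v and are closed under links into U.
  comp : ∀ {n} → (Elem n → Bool) → Elem n → Elem n → Bool
  comp U v x = allS λ T → ((T ∋ v) ∧ closedIn U T) ⇒ᵇ (T ∋ x)

  comp-root : ∀ {n} (U : Elem n → Bool) v → comp U v v ≡ true
  comp-root U v = allS⁺ _ λ T → ⇒ᵇ⁺ {(T ∋ v) ∧ closedIn U T} λ h → proj₁ (∧-split h)

  comp-closed : ∀ {n} (U : Elem n → Bool) v x x′ → comp U v x ≡ true → U x′ ≡ true → linked x x′ ≡ true →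
                comp U v x′ ≡ true
  comp-closed U v x x′ c u l = allS⁺ _ λ T → ⇒ᵇ⁺ {(T ∋ v) ∧ closedIn U T} λ h →
    ⇒ᵇ⁻ (allV⁻ _ (allV⁻ _ (proj₂ (∧-split {T ∋ v} h)) x) x′)
      (∧-join (⇒ᵇ⁻ (allS⁻ _ c T) h) (∧-join u l))

  comp-ind : ∀ {n} (U : Elem n → Bool) v (P : Elem n → Bool) → P v ≡ true →
    (∀ x x′ → P x ≡ true → U x′ ≡ true → linked x x′ ≡ true → P x′ ≡ true) →
    ∀ x → comp U v x ≡ true → P x ≡ true
  comp-ind U v P base step x c = trans (sym (∋-tab P x))
    (⇒ᵇ⁻ (allS⁻ _ c (tab P)) (∧-join (trans (∋-tab P v) base)
      (allV⁺ _ λ y → allV⁺ _ λ y′ → ⇒ᵇ⁺ {(tab P ∋ y) ∧ (U y′ ∧ linked y y′)} λ h →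
        let (p , q) = ∧-split {tab P ∋ y} h
            (u , l) = ∧-split {U y′} q
        in trans (∋-tab P y′) (step y y′ (trans (sym (∋-tab P y)) p) u l))))

  comp-⊆ : ∀ {n} (U : Elem n → Bool) v → U v ≡ true → ∀ x → comp U v x ≡ true → U x ≡ true
  comp-⊆ U v h = comp-ind U v U h λ _ _ _ u _ → u

shadow : ∀ {n} → (Elem n → Bool) → Elem n → Bool
shadow C y = anyV λ x → C x ∧ cov y x

shadow⁺ : ∀ {n} (C : Elem n → Bool) y x → C x ≡ true → cov y x ≡ true → shadow C y ≡ true
shadow⁺ C y x c d = anyV⁺ (λ x → C x ∧ cov y x) x (∧-join c d)

shadow⁻ : ∀ {n} (C : Elem n → Bool) y → shadow C y ≡ true → Σ (Elem n) λ x → C x ≡ true × cov y x ≡ true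
shadow⁻ C y h = let (x , p) = anyV⁻ (λ x → C x ∧ cov y x) h in x , ∧-split p

-- With `b = 0` and `T` full these are all downsets. With `b = k` everything of rank below k is
-- filled in, so that only the layers from k upwards are free.
record Ens {n} (b : ℕ) (T : Elem n → Bool) (I : Sub n) : Set where
  constructor mkEns
  field
    down : ∀ x y → cov y x ≡ true → (I ∋ x) ≡ true → (I ∋ y) ≡ true
    base : ∀ x → rank x < b → (I ∋ x) ≡ true
    within : ∀ x → (I ∋ x) ≡ true → T x ≡ true

  down-≼′ : ∀ d x z → rank x + d ≡ rank z → x ≼ z → (I ∋ z) ≡ true → (I ∋ x) ≡ true
  down-≼′ zero x z e xz h = subst (λ u → (I ∋ u) ≡ true)
    (sym (≼-rank-≡ xz (≤-reflexive (trans (sym e) (+-identityʳ _))))) h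
  down-≼′ (suc d) x z e xz h with ≼-pred xz (subst (rank x <_) e (m<m+n (rank x) (s≤s z≤n)))
  ... | z₁ , xz₁ , c = down-≼′ d x z₁
    (suc-injective (trans (sym (+-suc (rank x) d)) (trans e (cov-rank z₁ z c)))) xz₁ (down z z₁ c h)

  down-≼ : ∀ x z → x ≼ z → (I ∋ z) ≡ true → (I ∋ x) ≡ true
  down-≼ x z xz = down-≼′ (rank z ∸ rank x) x z (m+[n∸m]≡n (≼-rank xz)) xz

abstract
  ens : ∀ {n} → ℕ → (Elem n → Bool) → Sub n → Bool
  ens b T I = (allV λ x → allV λ y → (cov y x ∧ (I ∋ x)) ⇒ᵇ (I ∋ y)) ∧
    ((allV λ x → ⌊ rank x <? b ⌋ ⇒ᵇ (I ∋ x)) ∧ (allV λ x → (I ∋ x) ⇒ᵇ T x))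

  ens⁺ : ∀ {n b T} {I : Sub n} → Ens b T I → ens b T I ≡ true
  ens⁺ {n} {b} {T} {I} (mkEns d e f) = ∧-join
    (allV⁺ _ λ x → allV⁺ _ λ y → ⇒ᵇ⁺ {cov y x ∧ (I ∋ x)} λ h → let (p , q) = ∧-split {cov y x} h in d x y p q)
    (∧-join (allV⁺ _ λ x → ⇒ᵇ⁺ {⌊ rank x <? b ⌋} λ h → e x (⌊⌋⁻ (rank x <? b) h)) (allV⁺ _ λ x → ⇒ᵇ⁺ {I ∋ x} (f x)))

  ens⁻ : ∀ {n b T} {I : Sub n} → ens b T I ≡ true → Ens b T I
  ens⁻ {n} {b} {T} {I} h with ∧-split {allV λ x → allV λ y → (cov y x ∧ (I ∋ x)) ⇒ᵇ (I ∋ y)} h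
  ... | h₁ , h′ with ∧-split {allV λ x → ⌊ rank x <? b ⌋ ⇒ᵇ (I ∋ x)} h′
  ... | h₂ , h₃ = mkEns
    (λ x y c i → ⇒ᵇ⁻ (allV⁻ _ (allV⁻ _ h₁ x) y) (∧-join c i))
    (λ x r → ⇒ᵇ⁻ (allV⁻ _ h₂ x) (⌊⌋⁺ (rank x <? b) r))
    (λ x → ⇒ᵇ⁻ (allV⁻ _ h₃ x))

countS : ∀ {n} → (Sub n → Bool) → ℕ
countS {n} Q = ∑ (allSubs n) (λ I → ⟦ Q I ⟧)

fam : ∀ {n} → (Sub n → Bool) → List (Sub n)
fam {n} Q = filter (λ I → Q I Data.Bool.≟ true) (allSubs n)

does-≟true : ∀ b → does (b Data.Bool.≟ true) ≡ b
does-≟true true = refl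
does-≟true false = refl

length-fam : ∀ {n} (Q : Sub n → Bool) → length (fam Q) ≡ countS Q
length-fam {n} Q = trans (length-filter≡∑ (λ I → Q I Data.Bool.≟ true) (allSubs n))
  (∑-cong (allSubs n) λ I → cong ⟦_⟧ (does-≟true (Q I)))

fam-unique : ∀ {n} (Q : Sub n → Bool) → Unique (fam Q)
fam-unique Q = Uniq.filter⁺ _ (subsets-unique full)

∈-fam⁺ : ∀ {n} (Q : Sub n → Bool) {I} → Q I ≡ true → I ∈ fam Q
∈-fam⁺ Q {I} h = ∈-filter⁺ (λ I → Q I Data.Bool.≟ true) (allSubs-complete I) h

∈-fam⁻ : ∀ {n} (Q : Sub n → Bool) {I} → I ∈ fam Q → Q I ≡ true
∈-fam⁻ {n} Q m = proj₂ (∈-filter⁻ (λ I → Q I Data.Bool.≟ true) {xs = allSubs n} m)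

countS-mono : ∀ {n} {P Q : Sub n → Bool} → (∀ I → P I ≡ true → Q I ≡ true) → countS P ≤ countS Q
countS-mono {n} h = ∑-mono (allSubs n) λ I → ⟦⟧-mono (h I)

lay : ∀ {n} → ℕ → Sub n → Elem n → Bool
lay k I x = (I ∋ x) ∧ rk k x

cmp : ∀ {n} → ℕ → Elem n → Sub n → Elem n → Bool
cmp k v I = comp (lay k I) v

atMost : ∀ {n} → ℕ → (Elem n → Bool) → Elem n → Bool
atMost k S x = rk k x ⇒ᵇ S x

_≼ᵇ_ : ∀ {n} → Elem n → Elem n → Bool
x ≼ᵇ y = ⌊ x ≼? y ⌋

-- Two elements of rank k below a common z are joined by links that stay below z.
below-connected : ∀ {n} k (P : Elem n → Bool) d z → rank z ≡ d + k →
  (∀ u u′ → u ≼ z → u′ ≼ z → rank u′ ≡ k → linked u u′ ≡ true → P u ≡ true → P u′ ≡ true) →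
  ∀ x x′ → x ≼ z → x′ ≼ z → rank x ≡ k → rank x′ ≡ k → P x ≡ true → P x′ ≡ true
below-connected k P zero z e cl x x′ xz xz′ r r′ p =
  subst (λ u → P u ≡ true)
    (trans (≼-rank-≡ xz (≤-reflexive (trans e (sym r)))) (sym (≼-rank-≡ xz′ (≤-reflexive (trans e (sym r′)))))) p
below-connected k P (suc d) z e cl x x′ xz xz′ r r′ p
  with ≼-pred xz (subst₂ _<_ (sym r) (sym e) (s≤s (m≤n+m k d)))
     | ≼-pred xz′ (subst₂ _<_ (sym r′) (sym e) (s≤s (m≤n+m k d)))
... | z₁ , xz₁ , c₁ | z₂ , xz₂ , c₂ with z₁ ≟V z₂
... | yes refl = below-connected k P d z₁ (suc-injective (trans (sym (cov-rank z₁ z c₁)) e))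
        (λ u u′ a b → cl u u′ (≼-trans a (cov⇒≼ z₁ z c₁)) (≼-trans b (cov⇒≼ z₁ z c₁))) x x′ xz₁ xz₂ r r′ p
... | no ne with cov-meet {x = z} c₁ c₂ ne
-- If `w` has rank below k, then `z₁` and `z₂` are `x` and `x′` themselves and `w` links them.
-- Otherwise a point `t` of rank k below `w` lies under both, and the path passes from `z₁` to `z₂`
-- through it.
...   | w , a₁ , a₂ with k ≤? rank w
...     | no q = cl x x′ xz xz′ r′ (linked⁺ w x x′
          (subst (λ u → cov w u ≡ true) (sym (≼-rank-≡ xz₁ (≤-trans (≤-reflexive (cov-rank w z₁ a₁)) (subst (rank w <_) (sym r) (≰⇒> q))))) a₁)
          (subst (λ u → cov w u ≡ true) (sym (≼-rank-≡ xz₂ (≤-trans (≤-reflexive (cov-rank w z₂ a₂)) (subst (rank w <_) (sym r′) (≰⇒> q))))) a₂)) p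
...     | yes q with ≼-of-rank k w q
...       | t , tw , rt = below-connected k P d z₂ (suc-injective (trans (sym (cov-rank z₂ z c₂)) e))
            (λ u u′ a b → cl u u′ (≼-trans a (cov⇒≼ z₂ z c₂)) (≼-trans b (cov⇒≼ z₂ z c₂)))
            t x′ (≼-trans tw (cov⇒≼ w z₂ a₂)) xz₂ rt r′
            (below-connected k P d z₁ (suc-injective (trans (sym (cov-rank z₁ z c₁)) e))
              (λ u u′ a b → cl u u′ (≼-trans a (cov⇒≼ z₁ z c₁)) (≼-trans b (cov⇒≼ z₁ z c₁)))
              x t xz₁ (≼-trans tw (cov⇒≼ w z₁ a₁)) r rt p)

module Lift {n : ℕ} (k b : ℕ) (v : Elem n) (b<k : b < k) (T : Elem n → Bool) (I : Sub n)
            (E : Ens b T I) (I∋v : (I ∋ v) ≡ true) (rv : rank v ≡ k) where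
  open Ens E

  C : Elem n → Bool
  C = cmp k v I

  C⊆lay : ∀ x → C x ≡ true → lay k I x ≡ true
  C⊆lay = comp-⊆ (lay k I) v (∧-join I∋v (rk⁺ k v rv))

  C-rank : ∀ x → C x ≡ true → rank x ≡ k
  C-rank x c = rk⁻ k x (proj₂ (∧-split {I ∋ x} (C⊆lay x c)))

  C⊆I : ∀ x → C x ≡ true → (I ∋ x) ≡ true
  C⊆I x c = proj₁ (∧-split (C⊆lay x c))

  over : Elem n → Bool
  over x = (I ∋ x) ∧ anyV (λ c → C c ∧ (c ≼ᵇ x))

  over⁺ : ∀ c x → (I ∋ x) ≡ true → C c ≡ true → c ≼ x → over x ≡ true
  over⁺ c x i h l = ∧-join i (anyV⁺ (λ c → C c ∧ (c ≼ᵇ x)) c (∧-join h (⌊⌋⁺ (c ≼? x) l)))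

  over⁻ : ∀ x → over x ≡ true → (I ∋ x) ≡ true × Σ (Elem n) λ c → C c ≡ true × c ≼ x
  over⁻ x h with ∧-split {I ∋ x} h
  ... | i , a with anyV⁻ (λ c → C c ∧ (c ≼ᵇ x)) a
  ... | c , p = i , c , proj₁ (∧-split p) , ⌊⌋⁻ (c ≼? x) (proj₂ (∧-split {C c} p))

  upper : Elem n → Bool
  upper x = ⌊ rank x <? k ⌋ ∨ over x

  upper⁻ : ∀ x → upper x ≡ true → k ≤ rank x → over x ≡ true
  upper⁻ x h r with ∨-split {⌊ rank x <? k ⌋} h
  ... | inj₁ q = ⊥-elim (<⇒≱ (⌊⌋⁻ (rank x <? k) q) r)
  ... | inj₂ q = q

  over-rank : ∀ x → over x ≡ true → k ≤ rank x
  over-rank x h with over⁻ x h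
  ... | _ , c , q , l = subst (_≤ rank x) (C-rank c q) (≼-rank l)

  over⇒C : ∀ x → over x ≡ true → rank x ≡ k → C x ≡ true
  over⇒C x h r with over⁻ x h
  ... | _ , c , q , l = subst (λ u → C u ≡ true) (≼-rank-≡ l (≤-reflexive (trans r (sym (C-rank c q))))) q

  C⇒over : ∀ x → C x ≡ true → over x ≡ true
  C⇒over x c = over⁺ x x (C⊆I x c) c (≼-refl x)

  shadow-rank : ∀ y → shadow C y ≡ true → suc (rank y) ≡ k
  shadow-rank y h with shadow⁻ C y h
  ... | x , c , d = trans (sym (cov-rank y x d)) (C-rank x c)

  shadow⊆I : ∀ y → shadow C y ≡ true → (I ∋ y) ≡ true
  shadow⊆I y h with shadow⁻ C y h
  ... | x , c , d = down x y d (C⊆I x c)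

  -- Only ranks from k on matter. If `x` lies above c in C and `u` of rank k lies below `y`, then
  -- `u` and c are both below `x`, hence joined by links inside I; so `u` belongs to C as well and
  -- `y` lies above it.
  upper-down : ∀ x y → cov y x ≡ true → upper x ≡ true → upper y ≡ true
  upper-down x y d h with rank y <? k
  ... | yes q = refl
  ... | no q with over⁻ x (upper⁻ x h (≤-trans (≮⇒≥ q) (≤-trans (n≤1+n _) (≤-reflexive (sym (cov-rank y x d))))))
  ...   | i , c , p , l with ≼-of-rank k y (≮⇒≥ q)
  ...     | u , uy , ru = over⁺ u y (down x y d i)
      (below-connected k C (rank x ∸ k) x (sym (m∸n+n≡m (≤-trans (≮⇒≥ q) (≼-rank (cov⇒≼ y x d)))))
        (λ s s′ a a′ r l q → comp-closed (lay k I) v s s′ q (∧-join (down-≼ s′ x a′ i) (rk⁺ k s′ r)) l)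
        c u l (≼-trans uy (cov⇒≼ y x d)) (C-rank c p) ru p) uy

  upper-Ens : (S : Elem n → Bool) → (∀ x → C x ≡ true → S x ≡ true) → Ens k (atMost k S) (tab upper)
  upper-Ens S h = mkEns
    (λ x y d p → trans (∋-tab upper y) (upper-down x y d (trans (sym (∋-tab upper x)) p)))
    (λ x r → trans (∋-tab upper x) (∨-left (⌊⌋⁺ (rank x <? k) r)))
    (λ x p → ⇒ᵇ⁺ {rk k x} λ r → let r′ = rk⁻ k x r in
       h x (over⇒C x (upper⁻ x (trans (sym (∋-tab upper x)) p) (≤-reflexive (sym r′))) r′))

  module _ (S′ : Sub n) (S′⊆ : ∀ x → (S′ ∋ x) ≡ true → shadow C x ≡ true) where
    rest : Elem n → Bool
    rest x = (I ∋ x) ∧ (not (over x) ∧ not (S′ ∋ x))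

    rest⁻ : ∀ x → rest x ≡ true → (I ∋ x) ≡ true × over x ≡ false × (S′ ∋ x) ≡ false
    rest⁻ x h with ∧-split {I ∋ x} h
    ... | i , q with ∧-split {not (over x)} q
    ... | o , s = i , not-split o , not-split s

    rest⁺ : ∀ x → (I ∋ x) ≡ true → (over x ≡ true → ⊥) → ((S′ ∋ x) ≡ true → ⊥) → rest x ≡ true
    rest⁺ x i o s = ∧-join i (∧-join (not-join o) (not-join s))

    -- If `y` were in `S′`, it would be a lower cover of some point of C; then `x` has rank k and is
    -- linked to that point through `y`, so it belongs to C and hence to `over`. This is where C
    -- must be a whole component.
    rest-down : ∀ x y → cov y x ≡ true → rest x ≡ true → rest y ≡ true
    rest-down x y d h with rest⁻ x h
    ... | i , o , s = rest⁺ y (down x y d i) no-over no-S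
      where
      no-over : over y ≡ true → ⊥
      no-over q with over⁻ y q
      ... | _ , c , p , l = true≢false (over⁺ c x i p (≼-trans l (cov⇒≼ y x d))) o
      no-S : (S′ ∋ y) ≡ true → ⊥
      no-S q with shadow⁻ C y (S′⊆ y q)
      ... | c , p , e = true≢false (C⇒over x (comp-closed (lay k I) v c x p
              (∧-join i (rk⁺ k x (trans (cov-rank y x d) (trans (sym (cov-rank y c e)) (C-rank c p)))))
              (linked⁺ y c x e d))) o

    rest-Ens : Ens b T (tab rest)
    rest-Ens = mkEns
      (λ x y d p → trans (∋-tab rest y) (rest-down x y d (trans (sym (∋-tab rest x)) p)))
      (λ x r → trans (∋-tab rest x) (rest⁺ x (base x r)
        (λ q → <⇒≱ (<-trans r b<k) (over-rank x q))
        (λ q → <⇒≱ b<k (subst (_≤ b) (shadow-rank x (S′⊆ x q)) r))))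
      (λ x p → within x (proj₁ (rest⁻ x (trans (sym (∋-tab rest x)) p))))

    rest-v : (tab rest ∋ v) ≡ false
    rest-v = trans (∋-tab rest v) (¬-not λ q → true≢false (C⇒over v (comp-root (lay k I) v)) (proj₁ (proj₂ (rest⁻ v q))))

    I-cases : ∀ x → (I ∋ x) ≡ true → over x ≡ true ⊎ (shadow C x ≡ true ⊎ rest x ≡ true)
    I-cases x i with bool-case (over x) | bool-case (S′ ∋ x)
    ... | inj₁ o | _ = inj₁ o
    ... | inj₂ o | inj₁ s = inj₂ (inj₁ (S′⊆ x s))
    ... | inj₂ o | inj₂ s = inj₂ (inj₂ (rest⁺ x i (λ q → true≢false q o) (λ q → true≢false q s)))

    -- ∂C lies in I and, having rank k - 1, never meets `over`. The points of ∂C absent from `rest`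
    -- are thus exactly those of `S′`, so `S′` can be read off.
    S′-char : ∀ x → shadow C x ≡ true → rest x ≡ false → (S′ ∋ x) ≡ true
    S′-char x s r with bool-case (S′ ∋ x)
    ... | inj₁ e = e
    ... | inj₂ e = ⊥-elim (true≢false (rest⁺ x (shadow⊆I x s)
            (λ o → <⇒≱ (≤-reflexive (shadow-rank x s)) (over-rank x o)) (λ q → true≢false q e)) r)

module Removal {n : ℕ} (k b : ℕ) (v : Elem n) (b<k : b < k) (rv : rank v ≡ k) (T S : Elem n → Bool)
  (Q : Sub n → Bool) (g : ℕ)
  (Q-ens : ∀ I → Q I ≡ true → Ens b T I) (Q-v : ∀ I → Q I ≡ true → (I ∋ v) ≡ true)
  (Q-g : ∀ I → Q I ≡ true → g ≤ card (shadow (cmp k v I)))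
  (Q-S : ∀ I → Q I ≡ true → ∀ x → cmp k v I x ≡ true → S x ≡ true) where

  module L {I} (q : Q I ≡ true) = Lift k b v b<k T I (Q-ens I q) (Q-v I q) rv

  pairs : List (Sub n × Sub n)
  pairs = concatMap (λ I → map (I ,_) (subsets (shadow (cmp k v I)))) (fam Q)

  pairs-unique : Unique pairs
  pairs-unique = go (fam Q) (fam-unique Q)
    where
    piece : Sub n → List (Sub n × Sub n)
    piece I = map (I ,_) (subsets (shadow (cmp k v I)))
    fst : ∀ (Is : List (Sub n)) {p} → p ∈ concatMap piece Is → proj₁ p ∈ Is
    fst (I ∷ Is) m with ∈-++⁻ (piece I) m
    ... | inj₁ m′ with ∈-map⁻ _ m′
    ...   | _ , _ , refl = here refl
    fst (I ∷ Is) m | inj₂ m′ = there (fst Is m′)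
    go : ∀ Is → Unique Is → Unique (concatMap piece Is)
    go [] u = []
    go (I ∷ Is) (pI ∷ u) = Uniq.++⁺ (Uniq.map⁺ (λ { refl → refl }) (subsets-unique _)) (go Is u) disj
      where
      disj : ∀ {p} → ¬ (p ∈ piece I × p ∈ concatMap piece Is)
      disj (a , c) with ∈-map⁻ _ a
      ... | _ , _ , refl = All.lookup pI (fst Is c) refl

  ∈-pairs⁻ : ∀ {I S′} → (I , S′) ∈ pairs → Q I ≡ true × (∀ x → (S′ ∋ x) ≡ true → shadow (cmp k v I) x ≡ true)
  ∈-pairs⁻ {I} {S′} m = go (fam Q) (λ J → ∈-fam⁻ Q) m
    where
    go : ∀ Is → (∀ J → J ∈ Is → Q J ≡ true) → (I , S′) ∈ concatMap (λ I → map (I ,_) (subsets (shadow (cmp k v I)))) Is →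
         Q I ≡ true × (∀ x → (S′ ∋ x) ≡ true → shadow (cmp k v I) x ≡ true)
    go (J ∷ Is) h m with ∈-++⁻ (map (J ,_) (subsets (shadow (cmp k v J)))) m
    ... | inj₂ m′ = go Is (λ K q → h K (there q)) m′
    ... | inj₁ m′ with ∈-map⁻ _ m′
    ...   | _ , s , refl = h J (here refl) , ∈-subsets⁻ _ S′ s

  pairs-length : countS Q * 2 ^ g ≤ length pairs
  pairs-length = subst (λ l → l * 2 ^ g ≤ length pairs) (length-fam Q)
    (subst₂ _≤_ (∑-const (fam Q) (2 ^ g)) (sym (length-concatMap _ (fam Q)))
      (∑-mono∈ (fam Q) λ I m → subst (2 ^ g ≤_)
        (sym (trans (length-map (I ,_) (subsets (shadow (cmp k v I)))) (length-subsets (shadow (cmp k v I)))))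
        (pow-mono 1 (Q-g I (∈-fam⁻ Q m)))))

  avoid : Sub n → Bool
  avoid I = ens b T I ∧ not (I ∋ v)

  -- `over′`, `upper′` and `rest′` repeat the definitions of `Lift` without its proof arguments. The
  -- map `f` is thereby defined on all pairs and agrees by definition with `Lift` wherever the
  -- latter applies.
  over′ : Sub n → Elem n → Bool
  over′ I x = (I ∋ x) ∧ anyV (λ c → cmp k v I c ∧ (c ≼ᵇ x))

  upper′ : Sub n → Sub n
  upper′ I = tab λ x → ⌊ rank x <? k ⌋ ∨ over′ I x

  rest′ : Sub n × Sub n → Sub n
  rest′ (I , S′) = tab λ x → (I ∋ x) ∧ (not (over′ I x) ∧ not (S′ ∋ x))

  f : Sub n × Sub n → Sub n × Sub n
  f p = upper′ (proj₁ p) , rest′ p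

  f-∈ : ∀ p → p ∈ pairs → f p ∈ cartesianProduct (fam (ens k (atMost k S))) (fam avoid)
  f-∈ (I , S′) m with ∈-pairs⁻ m
  ... | q , s = ∈-cartesianProduct⁺ (∈-fam⁺ _ (ens⁺ (L.upper-Ens q S (Q-S I q))))
    (∈-fam⁺ avoid (∧-join (ens⁺ (L.rest-Ens q S′ s)) (cong not (L.rest-v q S′ s))))

  -- upper determines the component C, and with rest it determines I = rest ∪ ∂C ∪ (the part of upper of rank ≥ k).
  C-transfer : ∀ {I J} → Q I ≡ true → Q J ≡ true → upper′ I ≡ upper′ J →
               ∀ x → cmp k v I x ≡ true → cmp k v J x ≡ true
  C-transfer {I} {J} qI qJ e x c = L.over⇒C qJ x
    (L.upper⁻ qJ x (trans (sym (∋-tab (L.upper qJ) x)) (trans (cong (_∋ x) (sym e)) (trans (∋-tab (L.upper qI) x)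
      (∨-right {⌊ rank x <? k ⌋} (L.C⇒over qI x c))))) (≤-reflexive (sym (L.C-rank qI x c))))
    (L.C-rank qI x c)

  I-transfer : ∀ {I J S′ S″} → (I , S′) ∈ pairs → (J , S″) ∈ pairs → upper′ I ≡ upper′ J → rest′ (I , S′) ≡ rest′ (J , S″) →
               ∀ x → (I ∋ x) ≡ true → (J ∋ x) ≡ true
  I-transfer {I} {J} {S′} {S″} m m′ e e′ x i with ∈-pairs⁻ m | ∈-pairs⁻ m′
  ... | qI , s | qJ , s″ with L.I-cases qI S′ s x i
  ... | inj₁ o = proj₁ (L.over⁻ qJ x (L.upper⁻ qJ x (trans (sym (∋-tab (L.upper qJ) x))
        (trans (cong (_∋ x) (sym e)) (trans (∋-tab (L.upper qI) x) (∨-right {⌊ rank x <? k ⌋} o)))) (L.over-rank qI x o)))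
  ... | inj₂ (inj₂ r) = proj₁ (L.rest⁻ qJ S″ s″ x (trans (sym (∋-tab (L.rest qJ S″ s″) x))
        (trans (cong (_∋ x) (sym e′)) (trans (∋-tab (L.rest qI S′ s) x) r))))
  ... | inj₂ (inj₁ h) with shadow⁻ (cmp k v I) x h
  ...   | c , p , d = L.shadow⊆I qJ x (shadow⁺ (cmp k v J) x c (C-transfer qI qJ e c p) d)

  S-transfer : ∀ {I S′ S″} → (I , S′) ∈ pairs → (I , S″) ∈ pairs → rest′ (I , S′) ≡ rest′ (I , S″) →
               ∀ x → (S′ ∋ x) ≡ true → (S″ ∋ x) ≡ true
  S-transfer {I} {S′} {S″} m m′ e x h with ∈-pairs⁻ m | ∈-pairs⁻ m′
  ... | q , s | _ , s″ = L.S′-char q S″ s″ x (s x h)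
        (trans (sym (∋-tab (L.rest q S″ s″) x)) (trans (cong (_∋ x) (sym e)) (trans (∋-tab (L.rest q S′ s) x)
          (¬-not λ r → true≢false h (proj₂ (proj₂ (L.rest⁻ q S′ s x r)))))))

  f-injective : ∀ p p′ → p ∈ pairs → p′ ∈ pairs → f p ≡ f p′ → p ≡ p′
  f-injective (I , S′) (J , S″) m m′ e
    with Sub-ext {S = I} {J} (λ x → bool-ext (I-transfer m m′ (cong proj₁ e) (cong proj₂ e) x)
                                   (I-transfer m′ m (sym (cong proj₁ e)) (sym (cong proj₂ e)) x))
  ... | refl = cong (I ,_) (Sub-ext λ x → bool-ext (S-transfer m m′ (cong proj₂ e) x) (S-transfer m′ m (sym (cong proj₂ e)) x))

  removal : countS Q * 2 ^ g ≤ countS (ens {n} k (atMost k S)) * countS avoid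
  removal = ≤-trans pairs-length (≤-trans
    (injection-length pairs-unique _ f f-∈ f-injective)
    (≤-reflexive (trans (length-cartesianProduct (fam (ens k (atMost k S))) (fam avoid))
      (cong₂ _*_ (length-fam (ens k (atMost k S))) (length-fam avoid)))))

-- Encoding components by walks

anyL : {A : Set} → (A → Bool) → List A → Bool
anyL p [] = false
anyL p (x ∷ xs) = p x ∨ anyL p xs

anyL⁺ : {A : Set} (p : A → Bool) {xs : List A} {x : A} → x ∈ xs → p x ≡ true → anyL p xs ≡ true
anyL⁺ p (here refl) h = ∨-left h
anyL⁺ p {y ∷ xs} (there m) h = ∨-right {p y} (anyL⁺ p m h)

anyL⁻ : {A : Set} (p : A → Bool) (xs : List A) → anyL p xs ≡ true → Σ A λ x → x ∈ xs × p x ≡ true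
anyL⁻ p (x ∷ xs) h with ∨-split {p x} h
... | inj₁ e = x , here refl , e
... | inj₂ e with anyL⁻ p xs e
...   | y , m , q = y , there m , q

-- Equality is included so that balls grow with the radius and a walk can be padded by standing
-- still.
touch : ∀ {n} → Elem n → Elem n → Bool
touch x y = eqV x y ∨ (cov x y ∨ cov y x)

touch-refl : ∀ {n} (x : Elem n) → touch x x ≡ true
touch-refl x = ∨-left (eqV-refl x)

touch-up : ∀ {n} (x y : Elem n) → cov x y ≡ true → touch x y ≡ true
touch-up x y h = ∨-right {eqV x y} (∨-left h)

touch-down : ∀ {n} (x y : Elem n) → cov y x ≡ true → touch x y ≡ true
touch-down x y h = ∨-right {eqV x y} (∨-right {cov x y} h)

touch-sym : ∀ {n} (x y : Elem n) → touch x y ≡ true → touch y x ≡ true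
touch-sym x y h with ∨-split {eqV x y} h
... | inj₁ e = ∨-left (trans (eqV-sym y x) e)
... | inj₂ e with ∨-split {cov x y} e
...   | inj₁ u = touch-down y x u
...   | inj₂ d = touch-up y x d

nbrs : ∀ {n} → Elem n → List (Elem n)
nbrs {n} x = filter (λ y → touch x y Data.Bool.≟ true) (allElems n)

⟦∨⟧≤ : ∀ a b → ⟦ a ∨ b ⟧ ≤ ⟦ a ⟧ + ⟦ b ⟧
⟦∨⟧≤ true b = s≤s z≤n
⟦∨⟧≤ false b = ≤-refl

up-degree≤n : ∀ {n} (y : Elem n) → ∑V (λ x → ⟦ cov y x ⟧) ≤ n
up-degree≤n {n} y = subst₂ _≤_ (sym (up-degree y)) (cnt-total y) (+-monoʳ-≤ (cnt₀ y) (m≤m+n (cnt₁ y) _))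

down-degree≤n : ∀ {n} (x : Elem n) → ∑V (λ y → ⟦ cov y x ⟧) ≤ n
down-degree≤n {n} x = subst₂ _≤_ (sym (down-degree x)) (cnt-total x) (m≤n+m _ (cnt₀ x))

length-nbrs : ∀ {n} (x : Elem n) → length (nbrs x) ≤ 1 + (n + n)
length-nbrs {n} x = begin
  length (nbrs x) ≡⟨ length-filter≡∑ (λ y → touch x y Data.Bool.≟ true) (allElems n) ⟩
  ∑V (λ y → ⟦ does (touch x y Data.Bool.≟ true) ⟧) ≡⟨ ∑-cong (allElems n) (λ y → cong ⟦_⟧ (does-≟true (touch x y))) ⟩
  ∑V (λ y → ⟦ touch x y ⟧)
    ≤⟨ ∑-mono (allElems n) (λ y → ≤-trans (⟦∨⟧≤ (eqV x y) _) (+-monoʳ-≤ ⟦ eqV x y ⟧ (⟦∨⟧≤ (cov x y) (cov y x)))) ⟩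
  ∑V (λ y → ⟦ eqV x y ⟧ + (⟦ cov x y ⟧ + ⟦ cov y x ⟧))
    ≡⟨ trans (∑-+ (allElems n) _ _) (cong₂ _+_ (∑-eqVˡ₁ x) (∑-+ (allElems n) _ _)) ⟩
  1 + (∑V (λ y → ⟦ cov x y ⟧) + ∑V (λ y → ⟦ cov y x ⟧))
    ≤⟨ +-monoʳ-≤ 1 (+-mono-≤ (up-degree≤n x) (down-degree≤n x)) ⟩
  1 + (n + n) ∎
  where open ≤-Reasoning

ball : ∀ {n} → ℕ → Elem n → List (Elem n)
ball zero x = x ∷ []
ball (suc r) x = concatMap (ball r) (nbrs x)

data Near {n} : ℕ → Elem n → Elem n → Set where
  nil : ∀ {x} → Near zero x x
  hop : ∀ {r x z} y → touch x y ≡ true → Near r y z → Near (suc r) x z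

near-trans : ∀ {n r s} {x y z : Elem n} → Near r x y → Near s y z → Near (r + s) x z
near-trans nil q = q
near-trans (hop u t p) q = hop u t (near-trans p q)

near-snoc : ∀ {n r} {x y : Elem n} z → Near r x y → touch y z ≡ true → Near (suc r) x z
near-snoc z nil t = hop z t nil
near-snoc z (hop u t′ p) t = hop u t′ (near-snoc z p t)

near-sym : ∀ {n r} {x y : Elem n} → Near r x y → Near r y x
near-sym nil = nil
near-sym {x = x} (hop u t p) = near-snoc x (near-sym p) (touch-sym x u t)

near-stay : ∀ {n} r (x : Elem n) → Near r x x
near-stay zero x = nil
near-stay (suc r) x = hop x (touch-refl x) (near-stay r x)

near-weaken : ∀ {n r s} {x y : Elem n} → r ≤ s → Near r x y → Near s x y
near-weaken {s = s} z≤n nil = near-stay s _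
near-weaken (s≤s h) (hop u t p) = hop u t (near-weaken h p)

concatMap-∈ : {A B : Set} (f : A → List B) {xs : List A} {x : A} {y : B} → x ∈ xs → y ∈ f x → y ∈ concatMap f xs
concatMap-∈ f (here refl) q = ∈-++⁺ˡ q
concatMap-∈ f {z ∷ xs} (there m) q = ∈-++⁺ʳ (f z) (concatMap-∈ f m q)

near⇒∈ball : ∀ {n r} {x y : Elem n} → Near r x y → y ∈ ball r x
near⇒∈ball nil = here refl
near⇒∈ball {r = suc r} {x} (hop u t p) = concatMap-∈ (ball r)
  (∈-filter⁺ (λ y → touch x y Data.Bool.≟ true) (allElems-complete u) t) (near⇒∈ball p)

concatMap-∈⁻ : {A B : Set} (f : A → List B) (xs : List A) {y : B} → y ∈ concatMap f xs → Σ A λ x → x ∈ xs × y ∈ f x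
concatMap-∈⁻ f (x ∷ xs) m with ∈-++⁻ (f x) m
... | inj₁ q = x , here refl , q
... | inj₂ q with concatMap-∈⁻ f xs q
...   | z , a , c = z , there a , c

∈ball⇒near : ∀ {n} r {x y : Elem n} → y ∈ ball r x → Near r x y
∈ball⇒near zero (here refl) = nil
∈ball⇒near {n} (suc r) {x} m with concatMap-∈⁻ (ball r) (nbrs x) m
... | u , a , c = hop u (proj₂ (∈-filter⁻ (λ y → touch x y Data.Bool.≟ true) {xs = allElems n} a)) (∈ball⇒near r c)

abstract
  nearᵇ : ∀ {n} → ℕ → Elem n → Elem n → Bool
  nearᵇ r x y = anyL (λ z → eqV z y) (ball r x)

  nearᵇ⁺ : ∀ {n r} {x y : Elem n} → Near r x y → nearᵇ r x y ≡ true
  nearᵇ⁺ {y = y} p = anyL⁺ _ (near⇒∈ball p) (eqV-refl y)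

  nearᵇ⁻ : ∀ {n} r (x y : Elem n) → nearᵇ r x y ≡ true → Near r x y
  nearᵇ⁻ r x y h with anyL⁻ (λ z → eqV z y) (ball r x) h
  ... | z , m , e = ∈ball⇒near r (subst (_∈ ball r x) (eqV⁻ z y e) m)

∑-≤-const : {A : Set} (xs : List A) (f : A → ℕ) (c m : ℕ) → length xs ≤ m → (∀ x → f x ≤ c) → ∑ xs f ≤ m * c
∑-≤-const xs f c m l h = ≤-trans (∑-mono xs h) (subst (_≤ m * c) (sym (∑-const xs c)) (*-monoˡ-≤ c l))

length-ball : ∀ {n} r (x : Elem n) → length (ball r x) ≤ (1 + (n + n)) ^ r
length-ball zero x = ≤-refl
length-ball {n} (suc r) x = subst (_≤ (1 + (n + n)) ^ suc r) (sym (length-concatMap (ball r) (nbrs x)))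
  (∑-≤-const (nbrs x) _ ((1 + (n + n)) ^ r) (1 + (n + n)) (length-nbrs x) (length-ball r))

-- Mark 0 is blank: it labels the returns and the padding of a walk, which carry no information.
Mark : Set
Mark = Fin 6

Token : ℕ → Set
Token n = Elem n × Mark

-- The step length is 8 = 3 + 2 + 3: from a token to a point of C, across one link, and on to a
-- token near the linked point.
data Walk {n} : Elem n → List (Token n) → Set where
  [] : ∀ {x} → Walk x []
  step : ∀ {x y m p} → Near 8 x y → Walk y p → Walk x ((y , m) ∷ p)

walks : ∀ {n} → ℕ → Elem n → List (List (Token n))
walks zero x = [] ∷ []
walks (suc ℓ) x = concatMap (λ y → concatMap (λ m → map ((y , m) ∷_) (walks ℓ y)) (allFin 6)) (ball 8 x)

length-walks : ∀ {n} ℓ (x : Elem n) → length (walks ℓ x) ≤ ((1 + (n + n)) ^ 8 * 6) ^ ℓ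
length-walks zero x = ≤-refl
length-walks {n} (suc ℓ) x = subst (_≤ D ^ suc ℓ)
  (sym (length-concatMap (λ y → concatMap (λ m → map ((y , m) ∷_) (walks ℓ y)) (allFin 6)) (ball 8 x)))
  (≤-trans (∑-≤-const (ball 8 x) _ (6 * D ^ ℓ) ((1 + (n + n)) ^ 8) (length-ball 8 x) λ y →
    subst (_≤ 6 * D ^ ℓ) (sym (length-concatMap (λ m → map ((y , m) ∷_) (walks ℓ y)) (allFin 6)))
      (∑-≤-const (allFin 6) _ (D ^ ℓ) 6 ≤-refl λ m →
        subst (_≤ D ^ ℓ) (sym (length-map ((y , m) ∷_) (walks ℓ y))) (length-walks ℓ y)))
    (≤-reflexive (sym (*-assoc ((1 + (n + n)) ^ 8) 6 (D ^ ℓ)))))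
  where
  D : ℕ
  D = (1 + (n + n)) ^ 8 * 6

walk-∈ : ∀ {n} {x : Elem n} {p} → Walk x p → p ∈ walks (length p) x
walk-∈ [] = here refl
walk-∈ {p = (y , m) ∷ p} (step h w) = concatMap-∈ _ (near⇒∈ball h)
  (concatMap-∈ (λ m → map ((y , m) ∷_) (walks (length p) y)) {x = m} (∈-allFin m) (∈-map⁺ ((y , m) ∷_) (walk-∈ w)))

pad : ∀ {n} → Elem n → ℕ → List (Token n) → List (Token n)
pad x zero p = p
pad x (suc d) p = (x , zero) ∷ pad x d p

pad-walk : ∀ {n} {x : Elem n} d {p} → Walk x p → Walk x (pad x d p)
pad-walk zero w = w
pad-walk {x = x} (suc d) w = step (near-stay 8 x) (pad-walk d w)

length-pad : ∀ {n} (x : Elem n) d p → length (pad x d p) ≡ d + length p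
length-pad x zero p = refl
length-pad x (suc d) p = cong suc (length-pad x d p)

walk-pad-∈ : ∀ {n} {x : Elem n} {p} ℓ → Walk x p → length p ≤ ℓ → pad x (ℓ ∸ length p) p ∈ walks ℓ x
walk-pad-∈ {x = x} {p} ℓ w h = subst (λ l → pad x (ℓ ∸ length p) p ∈ walks l x)
  (trans (length-pad x (ℓ ∸ length p) p) (m∸n+n≡m h)) (walk-∈ (pad-walk (ℓ ∸ length p) w))

pos : ∀ {n} → List (Token n) → List (Elem n)
pos = map proj₁

record Detour {n} (x : Elem n) (p : List (Token n)) (t : Token n) : Set where
  field
    path : List (Token n)
    isWalk : Walk x path
    len : length path ≡ 2 + length p
    reaches : t ∈ path
    keeps : ∀ u → u ∈ p → u ∈ path
    only : ∀ u → u ∈ path → u ∈ p ⊎ (u ≡ t ⊎ proj₂ u ≡ zero)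

-- At `z` the walk goes to the new token and straight back with a blank mark. This costs two tokens
-- and leaves the remainder of the walk as it was.
insert-detour : ∀ {n} {x z : Elem n} {p} (t : Token n) → Walk x p → z ∈ (x ∷ pos p) → Near 8 z (proj₁ t) → Detour x p t
insert-detour {x = x} {p = p} (y , m) w (here refl) h = record
  { path = (y , m) ∷ (x , zero) ∷ p
  ; isWalk = step h (step (near-sym h) w)
  ; len = refl
  ; reaches = here refl
  ; keeps = λ _ q → there (there q)
  ; only = λ { _ (here refl) → inj₂ (inj₁ refl) ; _ (there (here refl)) → inj₂ (inj₂ refl) ; _ (there (there q)) → inj₁ q }
  }
insert-detour t (step {y = y} {m} h w) (there q) k = record
  { path = (y , m) ∷ D.path
  ; isWalk = step h D.isWalk
  ; len = cong suc D.len
  ; reaches = there D.reaches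
  ; keeps = λ { _ (here refl) → here refl ; u (there s) → there (D.keeps u s) }
  ; only = λ { _ (here refl) → inj₁ (here refl) ; u (there s) → shift (D.only u s) }
  }
  where
  module D = Detour (insert-detour t w q k)
  shift : ∀ {u} → u ∈ _ ⊎ (u ≡ t ⊎ proj₂ u ≡ zero) → u ∈ ((y , m) ∷ _) ⊎ (u ≡ t ⊎ proj₂ u ≡ zero)
  shift (inj₁ a) = inj₁ (there a)
  shift (inj₂ a) = inj₂ a

∈-removeAt⁻ : {A : Set} {x y : A} {ys : List A} (m : x ∈ ys) → y ∈ ys → y ≡ x ⊎ y ∈ removeAt m
∈-removeAt⁻ (here refl) (here refl) = inj₁ refl
∈-removeAt⁻ (here refl) (there k) = inj₂ k
∈-removeAt⁻ (there m) (here refl) = inj₂ (here refl)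
∈-removeAt⁻ (there m) (there k) with ∈-removeAt⁻ m k
... | inj₁ e = inj₁ e
... | inj₂ e = inj₂ (there e)

linked⇒near : ∀ {n} (x x′ : Elem n) → linked x x′ ≡ true → Near 2 x x′
linked⇒near x x′ h with linked⁻ x x′ h
... | y , a , c = hop y (touch-down x y a) (hop x′ (touch-up y x′ c) nil)

module _ {n : ℕ} (v : Elem n) (C : Elem n → Bool)
  (ind : ∀ (P : Elem n → Bool) → P v ≡ true →
     (∀ x x′ → P x ≡ true → C x′ ≡ true → linked x x′ ≡ true → P x′ ≡ true) → ∀ x → C x ≡ true → P x ≡ true)
  (W : List (Token n))
  (W-near : ∀ t → t ∈ W → Σ (Elem n) λ c → C c ≡ true × Near 3 c (proj₁ t))
  (C-near : ∀ c → C c ≡ true → Σ (Token n) λ t → t ∈ W × Near 3 c (proj₁ t)) where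

  record Covered (d : ℕ) (p : List (Token n)) : Set where
    field
      path : List (Token n)
      isWalk : Walk v path
      len : length path ≡ 2 * d + length p
      covers : ∀ t → t ∈ W → t ∈ path
      only : ∀ t → t ∈ path → t ∈ p ⊎ (t ∈ W ⊎ proj₂ t ≡ zero)

  -- Suppose no remaining token lies within 8 of the walk. Then the points within 3 of the walk
  -- include `v` and are closed under links into C: a linked point of C has a token within 3, which
  -- must already be on the walk. By `ind` they contain C, and with it a point within 3 of a
  -- remaining token, a contradiction. So some token can always be attached by a detour.
  extend : ∀ d (todo : List (Token n)) p → length todo ≡ d → Walk v p →
    (∀ t → t ∈ W → t ∈ todo ⊎ t ∈ p) → (∀ t → t ∈ todo → t ∈ W) → Covered d p
  extend d [] p refl w cover sub = record
    { path = p ; isWalk = w ; len = refl ; covers = λ t m → go (cover t m) ; only = λ t m → inj₁ m }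
    where
    go : ∀ {t} → t ∈ [] ⊎ t ∈ p → t ∈ p
    go (inj₂ q) = q
  extend (suc d) todo@(t₀ ∷ _) p len w cover sub
    with bool-case (anyL (λ t → anyL (λ z → nearᵇ 8 z (proj₁ t)) (v ∷ pos p)) todo)
  ... | inj₂ none = ⊥-elim contra
    where
    absurd : ∀ t z → t ∈ todo → z ∈ (v ∷ pos p) → Near 8 z (proj₁ t) → ⊥
    absurd t z a c h = true≢false (anyL⁺ (λ t → anyL (λ z → nearᵇ 8 z (proj₁ t)) (v ∷ pos p)) a
      (anyL⁺ (λ z → nearᵇ 8 z (proj₁ t)) c (nearᵇ⁺ h))) none
    P : Elem n → Bool
    P c = anyL (λ z → nearᵇ 3 z c) (v ∷ pos p)
    P⁻ : ∀ c → P c ≡ true → Σ (Elem n) λ z → z ∈ (v ∷ pos p) × Near 3 z c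
    P⁻ c h with anyL⁻ (λ z → nearᵇ 3 z c) (v ∷ pos p) h
    ... | z , m , q = z , m , nearᵇ⁻ 3 z c q
    P-step : ∀ x x′ → P x ≡ true → C x′ ≡ true → linked x x′ ≡ true → P x′ ≡ true
    P-step x x′ px cx′ l with P⁻ x px | C-near x′ cx′
    ... | z , mz , nz | t , mt , nt with cover t mt
    ...   | inj₁ q = ⊥-elim (absurd t z q mz (near-trans nz (near-trans (linked⇒near x x′ l) nt)))
    ...   | inj₂ q = anyL⁺ (λ z → nearᵇ 3 z x′) (there (∈-map⁺ proj₁ q)) (nearᵇ⁺ (near-sym nt))
    contra : ⊥
    contra with W-near t₀ (sub t₀ (here refl))
    ... | c , cc , nc with P⁻ c (ind P (anyL⁺ (λ z → nearᵇ 3 z v) {v ∷ pos p} (here refl) (nearᵇ⁺ (near-stay 3 v))) P-step c cc)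
    ...   | z , mz , nz = absurd t₀ z (here refl) mz (near-weaken (≤-by 2 refl) (near-trans nz nc))
  ... | inj₁ found with anyL⁻ (λ t → anyL (λ z → nearᵇ 8 z (proj₁ t)) (v ∷ pos p)) todo found
  ...   | t , mt , q with anyL⁻ (λ z → nearᵇ 8 z (proj₁ t)) (v ∷ pos p) q
  ...     | z , mz , nz with insert-detour t w mz (nearᵇ⁻ 8 z (proj₁ t) nz)
  ...       | D = record
    { path = R.path
    ; isWalk = R.isWalk
    ; len = trans R.len (trans (cong (2 * d +_) D.len) (arith d (length p)))
    ; covers = R.covers
    ; only = λ u m → only′ u (R.only u m)
    }
    where
    module D = Detour D
    back : ∀ {u t} {xs : List (Token n)} (m : t ∈ xs) → u ∈ removeAt m → u ∈ xs
    back (here _) h = there h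
    back (there m) (here e) = here e
    back (there m) (there h) = there (back m h)
    cover′ : ∀ u → u ∈ W → u ∈ removeAt mt ⊎ u ∈ D.path
    cover′ u m with cover u m
    ... | inj₂ h = inj₂ (D.keeps u h)
    ... | inj₁ h with ∈-removeAt⁻ mt h
    ...   | inj₁ refl = inj₂ D.reaches
    ...   | inj₂ h′ = inj₁ h′
    module R = Covered (extend d (removeAt mt) D.path (suc-injective (trans (sym (length-removeAt mt)) len))
                 D.isWalk cover′ (λ u m → sub u (back mt m)))
    only′ : ∀ u → u ∈ D.path ⊎ (u ∈ W ⊎ proj₂ u ≡ zero) → u ∈ p ⊎ (u ∈ W ⊎ proj₂ u ≡ zero)
    only′ u (inj₂ h) = inj₂ h
    only′ u (inj₁ h) with D.only u h
    ... | inj₁ a = inj₁ a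
    ... | inj₂ (inj₁ refl) = inj₂ (inj₁ (sub t mt))
    ... | inj₂ (inj₂ e) = inj₂ (inj₂ e)
    arith : ∀ d l → 2 * d + (2 + l) ≡ 2 * suc d + l
    arith = solve-∀

  covering-walk : Covered (length W) []
  covering-walk = extend (length W) W [] refl [] (λ _ → inj₁) (λ _ m → m)

marked : ∀ {n} → Mark → List (Token n) → Elem n → Bool
marked m p y = anyL (λ t → eqV (proj₁ t) y ∧ ⌊ proj₂ t Data.Fin.≟ m ⌋) p

marked⁺ : ∀ {n} m (p : List (Token n)) y → (y , m) ∈ p → marked m p y ≡ true
marked⁺ m p y h = anyL⁺ (λ t → eqV (proj₁ t) y ∧ ⌊ proj₂ t Data.Fin.≟ m ⌋) h
  (∧-join (eqV-refl y) (⌊⌋⁺ (m Data.Fin.≟ m) refl))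

marked⁻ : ∀ {n} m (p : List (Token n)) y → marked m p y ≡ true → (y , m) ∈ p
marked⁻ m p y h with anyL⁻ (λ t → eqV (proj₁ t) y ∧ ⌊ proj₂ t Data.Fin.≟ m ⌋) p h
... | (z , m′) , i , q with ∧-split {eqV z y} q
... | e , f = subst₂ (λ a c → (a , c) ∈ p) (eqV⁻ z y e) (⌊⌋⁻ (m′ Data.Fin.≟ m) f) i

marked-pad : ∀ {n} m (x : Elem n) d p y → m ≢ zero → marked m (pad x d p) y ≡ marked m p y
marked-pad m x zero p y h = refl
marked-pad zero x (suc d) p y h = ⊥-elim (h refl)
marked-pad (suc m) x (suc d) p y h = trans
  (cong (_∨ marked (suc m) (pad x d p) y) (∧-zeroʳ (eqV x y))) (marked-pad (suc m) x d p y h)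

-- Padding brings all codes to one length ℓ, so that they come from a single list of walks; it adds
-- only blank tokens and leaves the other marks unchanged.
code-of : ∀ {n} (v : Elem n) (C : Elem n → Bool) →
  (∀ (P : Elem n → Bool) → P v ≡ true →
     (∀ x x′ → P x ≡ true → C x′ ≡ true → linked x x′ ≡ true → P x′ ≡ true) → ∀ x → C x ≡ true → P x ≡ true) →
  (W : List (Token n)) →
  (∀ t → t ∈ W → Σ (Elem n) λ c → C c ≡ true × Near 3 c (proj₁ t)) →
  (∀ c → C c ≡ true → Σ (Token n) λ t → t ∈ W × Near 3 c (proj₁ t)) →
  ∀ ℓ → 2 * length W ≤ ℓ →
  Σ (List (Token n)) λ p → p ∈ walks ℓ v × (∀ m → m ≢ zero → ∀ y → marked m p y ≡ marked m W y)
code-of v C ind W a b ℓ h = pad v (ℓ ∸ length R.path) R.path ,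
  walk-pad-∈ ℓ R.isWalk (≤-trans (≤-reflexive (trans R.len (+-identityʳ _))) h) ,
  λ m m≢0 y → trans (marked-pad m v (ℓ ∸ length R.path) R.path y m≢0)
    (bool-ext (λ q → marked⁺ m W y (only (R.only (y , m) (marked⁻ m R.path y q)) m≢0))
              (λ q → marked⁺ m R.path y (R.covers (y , m) (marked⁻ m W y q))))
  where
  module R = Covered (covering-walk v C ind W a b)
  only : ∀ {t} → t ∈ [] ⊎ (t ∈ W ⊎ proj₂ t ≡ zero) → proj₂ t ≢ zero → t ∈ W
  only (inj₂ (inj₁ q)) ne = q
  only (inj₂ (inj₂ e)) ne = ⊥-elim (ne e)

-- Union bound over families of containers

module Union {n : ℕ} (k b : ℕ) (v : Elem n) (b<k : b < k) (rv : rank v ≡ k) (T : Elem n → Bool) (Q : Sub n → Bool)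
  (Q-ens : ∀ I → Q I ≡ true → Ens b T I) (Q-v : ∀ I → Q I ≡ true → (I ∋ v) ≡ true) where

  others : ℕ
  others = countS (λ I → ens b T I ∧ not (I ∋ v))

  Q[_,_] : (Elem n → Bool) → ℕ → Sub n → Bool
  Q[ S , g ] I = Q I ∧ (⌊ g ≤? card (shadow (cmp k v I)) ⌋ ∧ allV (λ x → cmp k v I x ⇒ᵇ S x))

  single : ∀ S g → countS Q[ S , g ] * 2 ^ g ≤ countS (ens {n} k (atMost k S)) * others
  single S g = Removal.removal k b v b<k rv T S Q[ S , g ] g
    (λ I q → Q-ens I (proj₁ (∧-split q))) (λ I q → Q-v I (proj₁ (∧-split q)))
    (λ I q → ⌊⌋⁻ (g ≤? card (shadow (cmp k v I))) (proj₁ (∧-split (proj₂ (∧-split {Q I} q)))))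
    (λ I q x c → ⇒ᵇ⁻ (allV⁻ (λ x → cmp k v I x ⇒ᵇ S x)
        (proj₂ (∧-split {⌊ g ≤? card (shadow (cmp k v I)) ⌋} (proj₂ (∧-split {Q I} q)))) x) c)

  saving : ∀ S g j ℓ e → countS (ens {n} k (atMost k S)) ≤ 2 ^ (card S + j) → card S + j + (ℓ + e) ≤ g →
           countS Q[ S , g ] * 2 ^ (ℓ + e) ≤ others
  saving S g j ℓ e z h = *-cancelˡ-≤′ (2 ^ s) (pow-pos 2 s (s≤s z≤n)) (begin
    2 ^ s * (countS Q[ S , g ] * 2 ^ (ℓ + e)) ≡⟨ rearr (2 ^ s) (countS Q[ S , g ]) (2 ^ (ℓ + e)) ⟩
    countS Q[ S , g ] * (2 ^ s * 2 ^ (ℓ + e)) ≡⟨ cong (countS Q[ S , g ] *_) (sym (^-distribˡ-+-* 2 s (ℓ + e))) ⟩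
    countS Q[ S , g ] * 2 ^ (s + (ℓ + e)) ≤⟨ *-monoʳ-≤ (countS Q[ S , g ]) (pow-mono 1 h) ⟩
    countS Q[ S , g ] * 2 ^ g ≤⟨ single S g ⟩
    countS (ens {n} k (atMost k S)) * others ≤⟨ *-monoˡ-≤ others z ⟩
    2 ^ s * others ∎)
    where
    open ≤-Reasoning
    s : ℕ
    s = card S + j
    rearr : ∀ a b c → a * (b * c) ≡ b * (a * c)
    rearr = solve-∀

  -- The slack `ℓ a` in the exponent pays for the containers of class `a`, so each class contributes
  -- at most a 2^-e part of `others` and only the number of classes remains as a factor.
  union : {A : Set} (K : List A) (𝓕 : A → List (Elem n → Bool)) (g j ℓ : A → ℕ) (e : ℕ) →
    (∀ a → length (𝓕 a) ≤ 2 ^ ℓ a) →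
    (∀ a S → S ∈ 𝓕 a → countS (ens {n} k (atMost k S)) ≤ 2 ^ (card S + j a) × card S + j a + (ℓ a + e) ≤ g a) →
    (∀ I → Q I ≡ true → Σ A λ a → a ∈ K × Σ (Elem n → Bool) λ S → S ∈ 𝓕 a ×
       g a ≤ card (shadow (cmp k v I)) × (∀ x → cmp k v I x ≡ true → S x ≡ true)) →
    countS Q * 2 ^ e ≤ length K * others
  union {A} K 𝓕 g j ℓ e len ok cover = begin
    countS Q * 2 ^ e ≤⟨ *-monoˡ-≤ (2 ^ e) bound ⟩
    ∑ K (λ a → ∑ (𝓕 a) (λ S → countS Q[ S , g a ])) * 2 ^ e ≡⟨ sym (∑-*ʳ K (2 ^ e) _) ⟩
    ∑ K (λ a → ∑ (𝓕 a) (λ S → countS Q[ S , g a ]) * 2 ^ e) ≤⟨ ∑-mono K class ⟩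
    ∑ K (λ _ → others) ≡⟨ ∑-const K others ⟩
    length K * others ∎
    where
    open ≤-Reasoning
    rearr : ∀ a b c → a * b * c ≡ a * (c * b)
    rearr = solve-∀
    class : ∀ a → ∑ (𝓕 a) (λ S → countS Q[ S , g a ]) * 2 ^ e ≤ others
    class a = *-cancelˡ-≤′ (2 ^ ℓ a) (pow-pos 2 (ℓ a) (s≤s z≤n)) (begin
      2 ^ ℓ a * (∑ (𝓕 a) (λ S → countS Q[ S , g a ]) * 2 ^ e)
        ≡⟨ trans (*-comm (2 ^ ℓ a) _) (trans (rearr (∑ (𝓕 a) (λ S → countS Q[ S , g a ])) (2 ^ e) (2 ^ ℓ a))
             (cong (∑ (𝓕 a) (λ S → countS Q[ S , g a ]) *_) (sym (^-distribˡ-+-* 2 (ℓ a) e)))) ⟩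
      ∑ (𝓕 a) (λ S → countS Q[ S , g a ]) * 2 ^ (ℓ a + e) ≡⟨ sym (∑-*ʳ (𝓕 a) (2 ^ (ℓ a + e)) _) ⟩
      ∑ (𝓕 a) (λ S → countS Q[ S , g a ] * 2 ^ (ℓ a + e))
        ≤⟨ ∑-mono∈ (𝓕 a) (λ S m → saving S (g a) (j a) (ℓ a) e (proj₁ (ok a S m)) (proj₂ (ok a S m))) ⟩
      ∑ (𝓕 a) (λ _ → others) ≡⟨ ∑-const (𝓕 a) others ⟩
      length (𝓕 a) * others ≤⟨ *-monoˡ-≤ others (len a) ⟩
      2 ^ ℓ a * others ∎)
    bound : countS Q ≤ ∑ K (λ a → ∑ (𝓕 a) (λ S → countS Q[ S , g a ]))
    bound = begin
      countS Q ≤⟨ ∑-mono (allSubs n) pointwise ⟩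
      ∑ (allSubs n) (λ I → ∑ K (λ a → ∑ (𝓕 a) (λ S → ⟦ Q[ S , g a ] I ⟧))) ≡⟨ ∑-swap (allSubs n) K _ ⟩
      ∑ K (λ a → ∑ (allSubs n) (λ I → ∑ (𝓕 a) (λ S → ⟦ Q[ S , g a ] I ⟧)))
        ≡⟨ ∑-cong K (λ a → ∑-swap (allSubs n) (𝓕 a) _) ⟩
      ∑ K (λ a → ∑ (𝓕 a) (λ S → countS Q[ S , g a ])) ∎
      where
      pointwise : ∀ I → ⟦ Q I ⟧ ≤ ∑ K (λ a → ∑ (𝓕 a) (λ S → ⟦ Q[ S , g a ] I ⟧))
      pointwise I with bool-case (Q I)
      ... | inj₂ e = ≤-trans (≤-reflexive (cong ⟦_⟧ e)) z≤n
      ... | inj₁ e with cover I e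
      ...   | a , a∈K , S , S∈ , ga , sub = ≤-trans (subst (_≤ ⟦ Q[ S , g a ] I ⟧) (cong ⟦_⟧ (sym e))
                (≤-reflexive (cong ⟦_⟧ (sym {x = Q[ S , g a ] I} (∧-join e (∧-join (⌊⌋⁺ (g a ≤? _) ga)
                  (allV⁺ (λ x → cmp k v I x ⇒ᵇ S x) λ x → ⇒ᵇ⁺ {cmp k v I x} (sub x))))))))
              (≤-trans (∈⇒≤∑ (λ S → ⟦ Q[ S , g a ] I ⟧) S∈) (∈⇒≤∑ (λ a → ∑ (𝓕 a) (λ S → ⟦ Q[ S , g a ] I ⟧)) a∈K))

-- Greedy covers

mem : ∀ {n} → List (Elem n) → Elem n → Bool
mem L y = anyL (λ z → eqV z y) L

mem⁺ : ∀ {n} (L : List (Elem n)) y → y ∈ L → mem L y ≡ true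
mem⁺ L y m = anyL⁺ (λ z → eqV z y) m (eqV-refl y)

mem⁻ : ∀ {n} (L : List (Elem n)) y → mem L y ≡ true → y ∈ L
mem⁻ L y h with anyL⁻ (λ z → eqV z y) L h
... | z , m , e = subst (_∈ L) (eqV⁻ z y e) m

module Sums (n : ℕ) where
  ∑V-mono : {f g : Elem n → ℕ} → (∀ x → f x ≤ g x) → ∑V f ≤ ∑V g
  ∑V-mono = ∑-mono (allElems n)

  ∑V-cong : {f g : Elem n → ℕ} → (∀ x → f x ≡ g x) → ∑V f ≡ ∑V g
  ∑V-cong = ∑-cong (allElems n)

  ∑V-swap : (f : Elem n → Elem n → ℕ) → ∑V (λ x → ∑V (f x)) ≡ ∑V (λ y → ∑V (λ x → f x y))
  ∑V-swap = ∑-swap (allElems n) (allElems n)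

  ∑V-+ : (f g : Elem n → ℕ) → ∑V (λ x → f x + g x) ≡ ∑V f + ∑V g
  ∑V-+ = ∑-+ (allElems n)

  ∑V-*ˡ : ∀ c (f : Elem n → ℕ) → ∑V (λ x → c * f x) ≡ c * ∑V f
  ∑V-*ˡ = ∑-*ˡ (allElems n)

  ∑V-*ʳ : ∀ c (f : Elem n → ℕ) → ∑V (λ x → f x * c) ≡ ∑V f * c
  ∑V-*ʳ = ∑-*ʳ (allElems n)

  ∑V-pull : (a : Elem n → ℕ) (b : Elem n → Elem n → ℕ) →
    ∑V (λ y → a y * ∑V (b y)) ≡ ∑V (λ x → ∑V (λ y → a y * b y x))
  ∑V-pull a b = trans (∑V-cong λ y → sym (∑V-*ˡ (a y) (b y))) (∑V-swap (λ y x → a y * b y x))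

  card-cong : {p q : Elem n → Bool} → (∀ x → p x ≡ q x) → card p ≡ card q
  card-cong h = ∑V-cong λ x → cong ⟦_⟧ (h x)

-- Bernoulli's inequality (1 + d/b)^h ≥ 1 + hd/b with denominators cleared.
power-growth : ∀ b d h → b ^ h * (b + h * d) ≤ (b + d) ^ h * b
power-growth b d zero = ≤-reflexive (expand b)
  where
  expand : ∀ b → 1 * (b + 0) ≡ 1 * b
  expand b = cong (1 *_) (+-identityʳ b)
power-growth b d (suc h) = begin
  b ^ suc h * (b + suc h * d) ≤⟨ ≤-by (b ^ h * (h * d * d)) (expand b (b ^ h) h d) ⟩
  b ^ h * (b + h * d) * (b + d) ≤⟨ *-monoˡ-≤ (b + d) (power-growth b d h) ⟩
  (b + d) ^ h * b * (b + d) ≡⟨ rearr ((b + d) ^ h) b (b + d) ⟩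
  (b + d) ^ suc h * b ∎
  where
  open ≤-Reasoning
  expand : ∀ b c h d → c * (b + h * d) * (b + d) ≡ b * c * (b + suc h * d) + c * (h * d * d)
  expand = solve-∀
  rearr : ∀ a b c → a * b * c ≡ c * a * b
  rearr = solve-∀

halving : ∀ b d h → 0 < b → b ≤ h * d → 2 * b ^ h ≤ (b + d) ^ h
halving b d h b>0 hd = *-cancelʳ-≤′ b b>0 (begin
  2 * b ^ h * b ≡⟨ rearr (b ^ h) b ⟩
  b ^ h * (b + b) ≤⟨ *-monoʳ-≤ (b ^ h) (+-monoʳ-≤ b hd) ⟩
  b ^ h * (b + h * d) ≤⟨ power-growth b d h ⟩
  (b + d) ^ h * b ∎)
  where
  open ≤-Reasoning
  rearr : ∀ c b → 2 * c * b ≡ c * (b + b)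
  rearr = solve-∀

*-pow : ∀ a b m → (a * b) ^ m ≡ a ^ m * b ^ m
*-pow a b zero = refl
*-pow a b (suc m) = trans (cong (a * b *_) (*-pow a b m)) (rearr a b (a ^ m) (b ^ m))
  where
  rearr : ∀ a b c d → a * b * (c * d) ≡ a * c * (b * d)
  rearr = solve-∀

-- Greedy covering in the manner of Lovász and Stein. Every point of Z is related to at least d/s
-- points of K, and K has at most a/s points, so an average point of K covers a proportion d/a of
-- whatever is left; `s` only clears denominators.
module Cover {n : ℕ} (K Z : Elem n → Bool) (R : Elem n → Elem n → Bool) (s a d : ℕ)
  (dense : ∀ z → Z z ≡ true → d ≤ s * ∑V (λ y → ⟦ K y ⟧ * ⟦ R z y ⟧)) (small : s * card K ≤ a) where

  open Sums n

  left : List (Elem n) → Elem n → Bool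
  left L z = Z z ∧ not (anyL (R z) L)

  gain : List (Elem n) → Elem n → ℕ
  gain L y = ∑V (λ z → ⟦ left L z ⟧ * ⟦ R z y ⟧)

  left-gain : ∀ L y → card (left (y ∷ L)) + gain L y ≡ card (left L)
  left-gain L y = trans (sym (∑V-+ _ _)) (∑V-cong λ z → go (Z z) (R z y) (anyL (R z) L))
    where
    go : ∀ p q r → ⟦ p ∧ not (q ∨ r) ⟧ + ⟦ p ∧ not r ⟧ * ⟦ q ⟧ ≡ ⟦ p ∧ not r ⟧
    go false q r = refl
    go true true true = refl
    go true true false = refl
    go true false true = refl
    go true false false = refl

  total-gain : ∀ L → card (left L) * d ≤ s * ∑V (λ y → ⟦ K y ⟧ * gain L y)
  total-gain L = begin
    card (left L) * d ≡⟨ sym (∑V-*ʳ d _) ⟩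
    ∑V (λ z → ⟦ left L z ⟧ * d)
      ≤⟨ ∑V-mono (λ z → ⟦⟧-*-mono (left L z) λ h → dense z (proj₁ (∧-split h))) ⟩
    ∑V (λ z → ⟦ left L z ⟧ * (s * ∑V (λ y → ⟦ K y ⟧ * ⟦ R z y ⟧)))
      ≡⟨ ∑V-cong (λ z → rearr ⟦ left L z ⟧ s _) ⟩
    ∑V (λ z → s * (⟦ left L z ⟧ * ∑V (λ y → ⟦ K y ⟧ * ⟦ R z y ⟧))) ≡⟨ ∑V-*ˡ s _ ⟩
    s * ∑V (λ z → ⟦ left L z ⟧ * ∑V (λ y → ⟦ K y ⟧ * ⟦ R z y ⟧)) ≡⟨ cong (s *_) (∑V-pull (λ z → ⟦ left L z ⟧) (λ z y → ⟦ K y ⟧ * ⟦ R z y ⟧)) ⟩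
    s * ∑V (λ y → ∑V (λ z → ⟦ left L z ⟧ * (⟦ K y ⟧ * ⟦ R z y ⟧)))
      ≡⟨ cong (s *_) (∑V-cong λ y → trans (∑V-cong λ z → rearr ⟦ left L z ⟧ ⟦ K y ⟧ ⟦ R z y ⟧) (∑V-*ˡ ⟦ K y ⟧ _)) ⟩
    s * ∑V (λ y → ⟦ K y ⟧ * gain L y) ∎
    where
    open ≤-Reasoning
    rearr : ∀ a b c → a * (b * c) ≡ b * (a * c)
    rearr = solve-∀

  -- Averaging over K. If every y in K fell short, hence by at least 1, summation would force the
  -- spare term `s * card K` to vanish, and then nothing is gained or needed: `card (left L) * d` is
  -- 0.
  pickBest : ∀ L → card (left L) * d ≡ 0 ⊎ Σ (Elem n) λ y → K y ≡ true × card (left L) * d ≤ gain L y * a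
  pickBest L with bool-case (anyV λ y → K y ∧ ⌊ card (left L) * d ≤? gain L y * a ⌋)
  ... | inj₁ h with anyV⁻ (λ y → K y ∧ ⌊ card (left L) * d ≤? gain L y * a ⌋) h
  ...   | y , q = inj₂ (y , proj₁ (∧-split q) , ⌊⌋⁻ (card (left L) * d ≤? gain L y * a) (proj₂ (∧-split {K y} q)))
  pickBest L | inj₂ h = inj₁ zero-case
    where
    u : ℕ
    u = card (left L) * d
    Σg : ℕ
    Σg = ∑V (λ y → ⟦ K y ⟧ * gain L y)
    all-small : ∀ y → K y ≡ true → gain L y * a + 1 ≤ u
    all-small y ky with u ≤? gain L y * a
    ... | yes q = ⊥-elim (true≢false (anyV⁺ (λ y → K y ∧ ⌊ u ≤? gain L y * a ⌋) y (∧-join ky (⌊⌋⁺ (u ≤? _) q))) h)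
    ... | no q = subst (_≤ u) (+-comm 1 (gain L y * a)) (≰⇒> q)
    summed : Σg * a + card K ≤ card K * u
    summed = begin
      Σg * a + card K ≡⟨ cong (_+ card K) (sym (∑V-*ʳ a _)) ⟩
      ∑V (λ y → ⟦ K y ⟧ * gain L y * a) + card K ≡⟨ sym (∑V-+ _ _) ⟩
      ∑V (λ y → ⟦ K y ⟧ * gain L y * a + ⟦ K y ⟧) ≡⟨ ∑V-cong (λ y → rearr ⟦ K y ⟧ (gain L y) a) ⟩
      ∑V (λ y → ⟦ K y ⟧ * (gain L y * a + 1)) ≤⟨ ∑V-mono (λ y → ⟦⟧-*-mono (K y) (all-small y)) ⟩
      ∑V (λ y → ⟦ K y ⟧ * u) ≡⟨ ∑V-*ʳ u _ ⟩
      card K * u ∎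
      where
      open ≤-Reasoning
      rearr : ∀ k g a → k * g * a + k ≡ k * (g * a + 1)
      rearr = solve-∀
    empty : s * card K ≡ 0
    empty = n≤0⇒n≡0 (+-cancelˡ-≤ (u * a) (s * card K) 0 (begin
      u * a + s * card K ≤⟨ +-monoˡ-≤ (s * card K) (*-monoˡ-≤ a (total-gain L)) ⟩
      s * Σg * a + s * card K ≡⟨ rearr s Σg a (card K) ⟩
      s * (Σg * a + card K) ≤⟨ *-monoʳ-≤ s summed ⟩
      s * (card K * u) ≡⟨ sym (*-assoc s (card K) u) ⟩
      s * card K * u ≤⟨ *-monoˡ-≤ u small ⟩
      a * u ≡⟨ trans (*-comm a u) (sym (+-identityʳ _)) ⟩
      u * a + 0 ∎))
      where
      open ≤-Reasoning
      rearr : ∀ s g a k → s * g * a + s * k ≡ s * (g * a + k)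
      rearr = solve-∀
    sK-gain : s * Σg ≡ 0
    sK-gain with m*n≡0⇒m≡0∨n≡0 s empty
    ... | inj₁ e = cong (_* Σg) e
    ... | inj₂ e = trans (cong (s *_) (n≤0⇒n≡0 (begin
        Σg ≤⟨ ∑V-mono (λ y → *-monoʳ-≤ ⟦ K y ⟧ (≤∑V (gain L) y)) ⟩
        ∑V (λ y → ⟦ K y ⟧ * ∑V (gain L)) ≡⟨ ∑V-*ʳ (∑V (gain L)) _ ⟩
        card K * ∑V (gain L) ≡⟨ cong (_* ∑V (gain L)) e ⟩
        0 ∎))) (*-zeroʳ s)
      where open ≤-Reasoning
    zero-case : u ≡ 0
    zero-case = n≤0⇒n≡0 (≤-trans (total-gain L) (≤-reflexive sK-gain))

  cover : ∀ i → Σ (List (Elem n)) λ L → All (λ y → K y ≡ true) L × length L ≤ i ×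
                card (left L) * a ^ i ≤ card Z * (a ∸ d) ^ i
  cover zero = [] , [] , z≤n , *-monoˡ-≤ 1 (card-mono {p = left []} {q = Z} λ x h → proj₁ (∧-split h))
  cover (suc i) with cover i
  ... | L , ks , l , bd with pickBest L
  ... | inj₁ e = L , ks , m≤n⇒m≤1+n l , (begin
      card (left L) * (a * a ^ i) ≡⟨ rearr (card (left L)) a (a ^ i) ⟩
      card (left L) * a * a ^ i
        ≡⟨ cong (_* a ^ i) (sym (trans (*-distribˡ-∸ (card (left L)) a d) (cong (card (left L) * a ∸_) e))) ⟩
      card (left L) * (a ∸ d) * a ^ i ≡⟨ rearr′ (card (left L)) (a ∸ d) (a ^ i) ⟩
      card (left L) * a ^ i * (a ∸ d) ≤⟨ *-monoˡ-≤ (a ∸ d) bd ⟩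
      card Z * (a ∸ d) ^ i * (a ∸ d) ≡⟨ rearr″ (card Z) (a ∸ d) ((a ∸ d) ^ i) ⟩
      card Z * ((a ∸ d) * (a ∸ d) ^ i) ∎)
    where
    open ≤-Reasoning
    rearr : ∀ u a p → u * (a * p) ≡ u * a * p
    rearr = solve-∀
    rearr′ : ∀ u b p → u * b * p ≡ u * p * b
    rearr′ = solve-∀
    rearr″ : ∀ z b q → z * q * b ≡ z * (b * q)
    rearr″ = solve-∀
  ... | inj₂ (y , ky , gy) = y ∷ L , ky ∷ ks , s≤s l , (begin
      card (left (y ∷ L)) * (a * a ^ i) ≡⟨ rearr (card (left (y ∷ L))) a (a ^ i) ⟩
      card (left (y ∷ L)) * a * a ^ i ≤⟨ *-monoˡ-≤ (a ^ i) shrink ⟩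
      card (left L) * (a ∸ d) * a ^ i ≡⟨ rearr′ (card (left L)) (a ∸ d) (a ^ i) ⟩
      card (left L) * a ^ i * (a ∸ d) ≤⟨ *-monoˡ-≤ (a ∸ d) bd ⟩
      card Z * (a ∸ d) ^ i * (a ∸ d) ≡⟨ rearr″ (card Z) (a ∸ d) ((a ∸ d) ^ i) ⟩
      card Z * ((a ∸ d) * (a ∸ d) ^ i) ∎)
    where
    open ≤-Reasoning
    rearr : ∀ u a p → u * (a * p) ≡ u * a * p
    rearr = solve-∀
    rearr′ : ∀ u b p → u * b * p ≡ u * p * b
    rearr′ = solve-∀
    rearr″ : ∀ z b q → z * q * b ≡ z * (b * q)
    rearr″ = solve-∀
    shrink : card (left (y ∷ L)) * a ≤ card (left L) * (a ∸ d)
    shrink = subst (card (left (y ∷ L)) * a ≤_) (sym (*-distribˡ-∸ (card (left L)) a d))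
      (m+n≤o⇒m≤o∸n _ (begin
        card (left (y ∷ L)) * a + card (left L) * d ≤⟨ +-monoʳ-≤ _ gy ⟩
        card (left (y ∷ L)) * a + gain L y * a ≡⟨ sym (*-distribʳ-+ a (card (left (y ∷ L))) (gain L y)) ⟩
        (card (left (y ∷ L)) + gain L y) * a ≡⟨ cong (_* a) (left-gain L y) ⟩
        card (left L) * a ∎))

  -- Since a - d ≤ h d, Bernoulli gives (1 - d/a)^h ≤ 1/2: every h picks halve what is left, and
  -- there are ρ such rounds.
  cover-exp : ∀ h ρ → d < a → a ∸ d ≤ h * d →
    Σ (List (Elem n)) λ L → All (λ y → K y ≡ true) L × length L ≤ h * ρ × card (left L) * 2 ^ ρ ≤ card Z
  cover-exp h ρ d<a hd with cover (h * ρ)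
  ... | L , ks , l , bd = L , ks , l , *-cancelʳ-≤′ (B ^ ρ) (pow-pos B ρ (pow-pos b h b>0)) (begin
      card (left L) * 2 ^ ρ * B ^ ρ ≡⟨ *-assoc (card (left L)) (2 ^ ρ) (B ^ ρ) ⟩
      card (left L) * (2 ^ ρ * B ^ ρ) ≡⟨ cong (card (left L) *_) (sym (*-pow 2 B ρ)) ⟩
      card (left L) * (2 * B) ^ ρ ≤⟨ *-monoʳ-≤ (card (left L)) (^-monoˡ-≤ ρ (halving b d h b>0 hd)) ⟩
      card (left L) * ((b + d) ^ h) ^ ρ ≡⟨ cong (λ e → card (left L) * (e ^ h) ^ ρ) (m∸n+n≡m (<⇒≤ d<a)) ⟩
      card (left L) * (a ^ h) ^ ρ ≡⟨ cong (card (left L) *_) (^-*-assoc a h ρ) ⟩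
      card (left L) * a ^ (h * ρ) ≤⟨ bd ⟩
      card Z * b ^ (h * ρ) ≡⟨ cong (card Z *_) (sym (^-*-assoc b h ρ)) ⟩
      card Z * B ^ ρ ∎)
    where
    open ≤-Reasoning
    b : ℕ
    b = a ∸ d
    b>0 : 0 < b
    b>0 = m<n⇒0<n∸m d<a
    B : ℕ
    B = b ^ h

-- `Φ` is a potential that drops by `c` at each step. It bounds the number of steps and, through
-- `fuel`, the recursion.
greedy : {A : Set} (Φ : List A → ℕ) (Good : A → Set) (Done : List A → Set) (c : ℕ) → 0 < c →
  (∀ U → Done U ⊎ Σ A λ u → Good u × Φ (u ∷ U) + c ≤ Φ U) →
  Σ (List A) λ U → All Good U × Done U × length U * c ≤ Φ []
greedy Φ Good Done c c>0 next = go (Φ []) [] ≤-refl [] ≤-refl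
  where
  go : ∀ fuel U → Φ U ≤ fuel → All Good U → length U * c + Φ U ≤ Φ [] →
       Σ (List _) λ U → All Good U × Done U × length U * c ≤ Φ []
  go fuel U h gs bd with next U
  ... | inj₁ done = U , gs , done , ≤-trans (m≤m+n _ _) bd
  go zero U h gs bd | inj₂ (u , g , dec) =
    ⊥-elim (<⇒≱ c>0 (≤-trans (m≤n+m c _) (≤-trans dec h)))
  go (suc fuel) U h gs bd | inj₂ (u , g , dec) = go fuel (u ∷ U)
    (≤-pred (≤-trans (≤-trans (≤-reflexive (+-comm 1 _)) (+-monoʳ-≤ _ c>0)) (≤-trans dec h)))
    (g ∷ gs)
    (≤-trans (≤-reflexive (rearr c (length U * c) (Φ (u ∷ U)))) (≤-trans (+-monoʳ-≤ (length U * c) dec) bd))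
    where
    rearr : ∀ c l p → c + l + p ≡ l + (p + c)
    rearr = solve-∀

-- Containers for components with large shadow

-- Each element of rank k sends the amount M down its edges and each element of rank k - 1 receives
-- at most M - M / (c n): this makes the shadow of a set of rank k noticeably larger than its closure.
record Weights {n} (k c M : ℕ) (wt : Elem n → Elem n → ℕ) : Set where
  field
    M>0 : 0 < M
    w-off : ∀ y x → cov y x ≡ false → wt y x ≡ 0
    w-sum : ∀ x → rank x ≡ k → ∑V (λ y → wt y x) ≡ M
    w-up : ∀ y → suc (rank y) ≡ k → c * n * ∑V (λ x → wt y x) + M ≤ c * n * M
    w-lo : ∀ y x → cov y x ≡ true → rank x ≡ k → M ≤ 2 * n * wt y x
    w-hi : ∀ y x → rank x ≡ k → n * wt y x ≤ 3 * M
    deg : ∀ (x : Elem n) → rank x ≡ k → n ≤ 2 * ∑V (λ y → ⟦ cov y x ⟧)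

-- For C in layer k this is the closure of C: it contains C and has the same shadow, but membership
-- depends on ∂C alone.
hull : ∀ {n} → ℕ → (Elem n → Bool) → Elem n → Bool
hull k C x = rk k x ∧ allV (λ y → cov y x ⇒ᵇ shadow C y)

twin : ∀ {n} → (Elem n → Bool) → Elem n → Elem n → Bool
twin D z y = anyV (λ x → D x ∧ (cov z x ∧ cov y x))

twins : ∀ {n} → (Elem n → Bool) → List (Elem n) → Elem n → Bool
twins D L y = anyV (λ z → mem L z ∧ twin D z y)

-- T is a sparse subset of the shadow G of C and Ms the set of upper neighbours of T outside hull k C;
-- together they determine a subset of G that misses little of it.
record Approx {n} (k m₁ h ρ c : ℕ) (C : Elem n → Bool) (t : ℕ) : Set where
  field
    T Ms : List (Elem n)
    T⇒G : ∀ y → y ∈ T → shadow C y ≡ true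
    F₀⇒G : ∀ y → twins (hull k C) T y ≡ true → shadow C y ≡ true
    T-len : length T ≤ h * ρ
    Ms⁺ : ∀ z x → z ∈ T → cov z x ≡ true → hull k C x ≡ false → x ∈ Ms
    Ms⁻ : ∀ x → x ∈ Ms → Σ (Elem n) λ z → z ∈ T × cov z x ≡ true × hull k C x ≡ false
    Ms-len : length Ms ≤ length T * m₁
    po le : ℕ
    left≤ : card (λ y → shadow C y ∧ not (twins (hull k C) T y)) ≤ 2 * t + (32 * po + le)
    po≤ : po * m₁ ≤ t * (2 * n)
    le≤ : le * 2 ^ ρ ≤ t * (c * n)

module Closure {n : ℕ} (k c M : ℕ) (wt : Elem n → Elem n → ℕ) (Wt : Weights k c M wt) (n≥8 : 8 ≤ n)
  (C : Elem n → Bool) (C-rank : ∀ x → C x ≡ true → rank x ≡ k) where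

  open Weights Wt
  open Sums n

  n>0 : 0 < n
  n>0 = ≤-trans (s≤s z≤n) n≥8

  G : Elem n → Bool
  G = shadow C

  D : Elem n → Bool
  D = hull k C

  D⁺ : ∀ x → rank x ≡ k → (∀ y → cov y x ≡ true → G y ≡ true) → D x ≡ true
  D⁺ x r h = ∧-join (rk⁺ k x r) (allV⁺ _ λ y → ⇒ᵇ⁺ {cov y x} (h y))

  D-rank : ∀ x → D x ≡ true → rank x ≡ k
  D-rank x h = rk⁻ k x (proj₁ (∧-split h))

  D⇒G : ∀ x y → D x ≡ true → cov y x ≡ true → G y ≡ true
  D⇒G x y h = ⇒ᵇ⁻ (allV⁻ _ (proj₂ (∧-split {rk k x} h)) y)

  C⊆D : ∀ x → C x ≡ true → D x ≡ true
  C⊆D x h = D⁺ x (C-rank x h) λ y → shadow⁺ C y x h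

  G-rank : ∀ y → G y ≡ true → suc (rank y) ≡ k
  G-rank y h with shadow⁻ C y h
  ... | x , p , q = trans (sym (cov-rank y x q)) (C-rank x p)

  up-rank : ∀ (x y : Elem n) → cov y x ≡ true → suc (rank y) ≡ k → rank x ≡ k
  up-rank x y h r = trans (cov-rank y x h) r

  WD : Elem n → ℕ
  WD y = ∑V (λ x → ⟦ D x ⟧ * wt y x)

  WD-split : ∀ y → WD y + ∑V (λ x → ⟦ not (D x) ⟧ * wt y x) ≡ ∑V (λ x → wt y x)
  WD-split y = trans (sym (∑V-+ _ _)) (∑V-cong λ x → go (D x) (wt y x))
    where
    go : ∀ b m → ⟦ b ⟧ * m + ⟦ not b ⟧ * m ≡ m
    go true m = trans (+-identityʳ _) (+-identityʳ m)
    go false m = +-identityʳ m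

  up-sum≤M : ∀ y → G y ≡ true → ∑V (λ x → wt y x) ≤ M
  up-sum≤M y h = *-cancelˡ-≤′ (c * n) (positive (c * n) refl) (m+n≤o⇒m≤o _ (w-up y (G-rank y h)))
    where
    positive : ∀ m → m ≡ c * n → 0 < m
    positive (suc m) _ = s≤s z≤n
    positive zero e = ⊥-elim (<⇒≱ M>0 (subst (λ m → M ≤ m * M) (sym e) (≤-trans (m≤n+m M _) (w-up y (G-rank y h)))))

  WD≤M : ∀ y → G y ≡ true → WD y ≤ M
  WD≤M y h = ≤-trans (m≤m+n _ _) (≤-trans (≤-reflexive (WD-split y)) (up-sum≤M y h))

  D-weight : ∀ x → D x ≡ true → ∀ y → ⟦ G y ⟧ * wt y x ≡ wt y x
  D-weight x d y with bool-case (G y)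
  ... | inj₁ e = trans (cong (λ b → ⟦ b ⟧ * wt y x) e) (+-identityʳ _)
  ... | inj₂ e = trans (cong (λ b → ⟦ b ⟧ * wt y x) e) (sym (w-off y x (¬-not λ q → true≢false (D⇒G x y d q) e)))

  weight-count : ∑V (λ y → ⟦ G y ⟧ * WD y) ≡ card D * M
  weight-count = begin
    ∑V (λ y → ⟦ G y ⟧ * WD y) ≡⟨ ∑V-pull (λ y → ⟦ G y ⟧) (λ y x → ⟦ D x ⟧ * wt y x) ⟩
    ∑V (λ x → ∑V (λ y → ⟦ G y ⟧ * (⟦ D x ⟧ * wt y x)))
      ≡⟨ ∑V-cong (λ x → trans (∑V-cong λ y → rearr ⟦ G y ⟧ ⟦ D x ⟧ (wt y x)) (∑V-*ˡ ⟦ D x ⟧ (λ y → ⟦ G y ⟧ * wt y x))) ⟩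
    ∑V (λ x → ⟦ D x ⟧ * ∑V (λ y → ⟦ G y ⟧ * wt y x))
      ≡⟨ ∑V-cong (λ x → ⟦⟧-*-cong (D x) λ d → trans (∑V-cong (D-weight x d)) (w-sum x (D-rank x d))) ⟩
    ∑V (λ x → ⟦ D x ⟧ * M) ≡⟨ ∑V-*ʳ M _ ⟩
    card D * M ∎
    where
    open ≡-Reasoning
    rearr : ∀ a b c → a * (b * c) ≡ b * (a * c)
    rearr = solve-∀

  D≤G : card D ≤ card G
  D≤G = *-cancelʳ-≤′ M M>0 (begin
    card D * M ≡⟨ sym weight-count ⟩
    ∑V (λ y → ⟦ G y ⟧ * WD y) ≤⟨ ∑V-mono (λ y → ⟦⟧-*-mono (G y) (WD≤M y)) ⟩
    ∑V (λ y → ⟦ G y ⟧ * M) ≡⟨ ∑V-*ʳ M _ ⟩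
    card G * M ∎)
    where open ≤-Reasoning

  t : ℕ
  t = card G ∸ card D

  G≡D+t : card D + t ≡ card G
  G≡D+t = m+[n∸m]≡n D≤G

  df : Elem n → ℕ
  df y = M ∸ WD y

  df+WD : ∀ y → G y ≡ true → df y + WD y ≡ M
  df+WD y h = m∸n+n≡m (WD≤M y h)

  -- Each point of D sends its whole weight M into G, so the points of G together fall short of M by
  -- (|G| - |D|) M. Every later size estimate is Markov's inequality against this total.
  deficiency : ∑V (λ y → ⟦ G y ⟧ * df y) ≡ t * M
  deficiency = +-cancelʳ-≡ (card D * M) _ _ (begin
    ∑V (λ y → ⟦ G y ⟧ * df y) + card D * M ≡⟨ cong (∑V (λ y → ⟦ G y ⟧ * df y) +_) (sym weight-count) ⟩
    ∑V (λ y → ⟦ G y ⟧ * df y) + ∑V (λ y → ⟦ G y ⟧ * WD y) ≡⟨ sym (∑V-+ _ _) ⟩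
    ∑V (λ y → ⟦ G y ⟧ * df y + ⟦ G y ⟧ * WD y)
      ≡⟨ ∑V-cong (λ y → trans (sym (*-distribˡ-+ ⟦ G y ⟧ (df y) (WD y))) (⟦⟧-*-cong (G y) (df+WD y))) ⟩
    ∑V (λ y → ⟦ G y ⟧ * M) ≡⟨ ∑V-*ʳ M _ ⟩
    card G * M ≡⟨ cong (_* M) (sym G≡D+t) ⟩
    (card D + t) * M ≡⟨ trans (*-distribʳ-+ M (card D) t) (+-comm (card D * M) (t * M)) ⟩
    t * M + card D * M ∎)
    where open ≡-Reasoning

  markov : (q : Elem n → Bool) (a b : ℕ) → (∀ y → q y ≡ true → G y ≡ true) →
           (∀ y → q y ≡ true → M * a ≤ df y * b) → card q * a ≤ t * b
  markov q a b qG h = *-cancelʳ-≤′ M M>0 (begin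
    card q * a * M ≡⟨ rearr (card q) a M ⟩
    card q * (M * a) ≡⟨ sym (∑V-*ʳ (M * a) _) ⟩
    ∑V (λ y → ⟦ q y ⟧ * (M * a)) ≤⟨ ∑V-mono (λ y → ≤-trans (⟦⟧-*-mono (q y) (h y))
                                       (*-monoˡ-≤ (df y * b) (⟦⟧-mono (qG y)))) ⟩
    ∑V (λ y → ⟦ G y ⟧ * (df y * b)) ≡⟨ trans (∑V-cong λ y → sym (*-assoc ⟦ G y ⟧ (df y) b)) (∑V-*ʳ b _) ⟩
    ∑V (λ y → ⟦ G y ⟧ * df y) * b ≡⟨ cong (_* b) deficiency ⟩
    t * M * b ≡⟨ rearr′ t M b ⟩
    t * b * M ∎)
    where
    open ≤-Reasoning
    rearr : ∀ a b c → a * b * c ≡ a * (c * b)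
    rearr = solve-∀
    rearr′ : ∀ a b c → a * b * c ≡ a * c * b
    rearr′ = solve-∀

  -- By `w-up` no point of G receives more than M - M/(cn), so each has deficiency at least M/(cn).
  G-gap : card G ≤ t * (c * n)
  G-gap = subst (_≤ t * (c * n)) (*-identityʳ (card G)) (markov G 1 (c * n) (λ _ h → h) gap)
    where
    open ≤-Reasoning
    rearr : ∀ a b d → a * (b + d) ≡ a * d + b * a
    rearr = solve-∀
    gap : ∀ y → G y ≡ true → M * 1 ≤ df y * (c * n)
    gap y h = +-cancelˡ-≤ (c * n * WD y) _ _ (begin
      c * n * WD y + M * 1 ≡⟨ cong (c * n * WD y +_) (*-identityʳ M) ⟩
      c * n * WD y + M ≤⟨ +-monoˡ-≤ M (*-monoʳ-≤ (c * n) (m+n≤o⇒m≤o _ (≤-reflexive (WD-split y)))) ⟩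
      c * n * ∑V (λ x → wt y x) + M ≤⟨ w-up y (G-rank y h) ⟩
      c * n * M ≡⟨ cong (c * n *_) (sym (df+WD y h)) ⟩
      c * n * (df y + WD y) ≡⟨ rearr (c * n) (df y) (WD y) ⟩
      c * n * WD y + df y * (c * n) ∎)

  miss : Elem n → ℕ
  miss y = ∑V (λ x → ⟦ cov y x ⟧ * ⟦ not (D x) ⟧)

  -- An upper cover outside D withholds at least M/(2n) from `y`, by `w-lo`.
  miss-df : ∀ y → G y ≡ true → M * miss y ≤ df y * (2 * n)
  miss-df y h = begin
    M * miss y ≡⟨ sym (∑V-*ˡ M _) ⟩
    ∑V (λ x → M * (⟦ cov y x ⟧ * ⟦ not (D x) ⟧)) ≤⟨ ∑V-mono pointwise ⟩
    ∑V (λ x → ⟦ not (D x) ⟧ * wt y x * (2 * n)) ≡⟨ ∑V-*ʳ (2 * n) _ ⟩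
    ∑V (λ x → ⟦ not (D x) ⟧ * wt y x) * (2 * n) ≤⟨ *-monoˡ-≤ (2 * n) (+-cancelˡ-≤ (WD y) _ _ (begin
      WD y + ∑V (λ x → ⟦ not (D x) ⟧ * wt y x) ≡⟨ WD-split y ⟩
      ∑V (λ x → wt y x) ≤⟨ up-sum≤M y h ⟩
      M ≡⟨ trans (sym (df+WD y h)) (+-comm (df y) (WD y)) ⟩
      WD y + df y ∎)) ⟩
    df y * (2 * n) ∎
    where
    open ≤-Reasoning
    pointwise : ∀ x → M * (⟦ cov y x ⟧ * ⟦ not (D x) ⟧) ≤ ⟦ not (D x) ⟧ * wt y x * (2 * n)
    pointwise x with bool-case (cov y x)
    ... | inj₂ e rewrite e | *-zeroʳ M = z≤n
    ... | inj₁ e with D x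
    ...   | true rewrite e | *-zeroʳ M = z≤n
    ...   | false rewrite e = subst₂ _≤_ (sym (*-identityʳ M)) (rearr n (wt y x)) (w-lo y x e (up-rank x y e (G-rank y h)))
      where
      rearr : ∀ n w → 2 * n * w ≡ (w + 0) * (2 * n)
      rearr = solve-∀

  ND : Elem n → ℕ
  ND y = ∑V (λ x → ⟦ D x ⟧ * ⟦ cov y x ⟧)

  WD-ND : (S : Elem n → Bool) → (∀ x → S x ≡ true → rank x ≡ k) → ∀ y →
          n * ∑V (λ x → ⟦ S x ⟧ * wt y x) ≤ 3 * M * ∑V (λ x → ⟦ S x ⟧ * ⟦ cov y x ⟧)
  WD-ND S S-rank y = subst₂ _≤_ (∑V-*ˡ n _) (∑V-*ˡ (3 * M) _) (∑V-mono pointwise)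
    where
    pointwise : ∀ x → n * (⟦ S x ⟧ * wt y x) ≤ 3 * M * (⟦ S x ⟧ * ⟦ cov y x ⟧)
    pointwise x with bool-case (S x)
    ... | inj₂ e rewrite e | *-zeroʳ n = z≤n
    ... | inj₁ e with bool-case (cov y x)
    ...   | inj₂ q rewrite w-off y x q | *-zeroʳ ⟦ S x ⟧ | *-zeroʳ n = z≤n
    ...   | inj₁ q rewrite e | q | *-identityʳ (3 * M) | +-identityʳ (wt y x) = w-hi y x (S-rank x e)

  -- A point receiving at least M/2 from D must have at least n/6 upper covers in D, since an edge
  -- carries at most 3M/n. The others in G have deficiency above M/2, so there are at most 2t of
  -- them.
  heavy : Elem n → Bool
  heavy y = ⌊ M ≤? 2 * WD y ⌋

  heavy-ND : ∀ y → heavy y ≡ true → n ≤ 6 * ND y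
  heavy-ND y h = *-cancelʳ-≤′ M M>0 (begin
    n * M ≤⟨ *-monoʳ-≤ n (⌊⌋⁻ (M ≤? 2 * WD y) h) ⟩
    n * (2 * WD y) ≡⟨ rearr n (WD y) ⟩
    2 * (n * WD y) ≤⟨ *-monoʳ-≤ 2 (WD-ND D D-rank y) ⟩
    2 * (3 * M * ND y) ≡⟨ rearr′ M (ND y) ⟩
    6 * ND y * M ∎)
    where
    open ≤-Reasoning
    rearr : ∀ n w → n * (2 * w) ≡ 2 * (n * w)
    rearr = solve-∀
    rearr′ : ∀ m d → 2 * (3 * m * d) ≡ 6 * d * m
    rearr′ = solve-∀

  light : Elem n → Bool
  light y = G y ∧ not (heavy y)

  card-light : card light ≤ 2 * t
  card-light = subst₂ _≤_ (*-identityʳ _) (*-comm t 2) (markov light 1 2 (λ y h → proj₁ (∧-split h)) go)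
    where
    go : ∀ y → light y ≡ true → M * 1 ≤ df y * 2
    go y h = +-cancelˡ-≤ (2 * WD y) _ _ (begin
        2 * WD y + M * 1 ≤⟨ +-monoˡ-≤ (M * 1) (<⇒≤ (≰⇒> (⌊⌋-no (M ≤? 2 * WD y) (proj₂ (∧-split {G y} h))))) ⟩
        M + M * 1 ≡⟨ rearr₀ M ⟩
        2 * M ≡⟨ cong (2 *_) (sym (df+WD y (proj₁ (∧-split h)))) ⟩
        2 * (df y + WD y) ≡⟨ rearr (df y) (WD y) ⟩
        2 * WD y + df y * 2 ∎)
      where
      open ≤-Reasoning
      rearr₀ : ∀ m → m + m * 1 ≡ 2 * m
      rearr₀ = solve-∀
      rearr : ∀ a b → 2 * (a + b) ≡ 2 * b + a * 2
      rearr = solve-∀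

  P : Elem n → Elem n → Bool
  P = twin D

  P⁺ : ∀ z y x → D x ≡ true → cov z x ≡ true → cov y x ≡ true → P z y ≡ true
  P⁺ z y x d a b = anyV⁺ (λ x → D x ∧ (cov z x ∧ cov y x)) x (∧-join d (∧-join a b))

  P⁻ : ∀ z y → P z y ≡ true → Σ (Elem n) λ x → D x ≡ true × cov z x ≡ true × cov y x ≡ true
  P⁻ z y h with anyV⁻ (λ x → D x ∧ (cov z x ∧ cov y x)) h
  ... | x , p with ∧-split {D x} p
  ... | d , q = x , d , ∧-split q

  P⇒G : ∀ z y → P z y ≡ true → G y ≡ true
  P⇒G z y h with P⁻ z y h
  ... | x , d , _ , b = D⇒G x y d b

  P-upper : ∀ z → ∑V (λ y → ⟦ P y z ⟧) ≤ n * n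
  P-upper z = begin
    ∑V (λ y → ⟦ P y z ⟧) ≤⟨ ∑V-mono pointwise ⟩
    ∑V (λ y → ∑V (λ x → ⟦ cov y x ⟧ * ⟦ cov z x ⟧)) ≡⟨ ∑V-swap _ ⟩
    ∑V (λ x → ∑V (λ y → ⟦ cov y x ⟧ * ⟦ cov z x ⟧)) ≡⟨ ∑V-cong (λ x → ∑V-*ʳ ⟦ cov z x ⟧ _) ⟩
    ∑V (λ x → ∑V (λ y → ⟦ cov y x ⟧) * ⟦ cov z x ⟧) ≤⟨ ∑V-mono (λ x → *-monoˡ-≤ ⟦ cov z x ⟧ (down-degree≤n x)) ⟩
    ∑V (λ x → n * ⟦ cov z x ⟧) ≡⟨ ∑V-*ˡ n _ ⟩
    n * ∑V (λ x → ⟦ cov z x ⟧) ≤⟨ *-monoʳ-≤ n (up-degree≤n z) ⟩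
    n * n ∎
    where
    open ≤-Reasoning
    pointwise : ∀ y → ⟦ P y z ⟧ ≤ ∑V (λ x → ⟦ cov y x ⟧ * ⟦ cov z x ⟧)
    pointwise y with bool-case (P y z)
    ... | inj₂ e rewrite e = z≤n
    ... | inj₁ e with P⁻ y z e
    ...   | x , _ , a , b = ≤-trans (⟦⟧≤1 (P y z)) (≤-trans
              (≤-reflexive (sym (cong₂ (λ p q → ⟦ p ⟧ * ⟦ q ⟧) a b))) (≤∑V (λ x → ⟦ cov y x ⟧ * ⟦ cov z x ⟧) x))

  card-any : (q : Elem n → Bool) → (∀ x y → q x ≡ true → q y ≡ true → x ≡ y) → card q ≤ ⟦ anyV q ⟧
  card-any q h with bool-case (anyV q)
  ... | inj₁ e = ≤-trans (card-≤1 q h) (≤-reflexive (sym (cong ⟦_⟧ e)))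
  ... | inj₂ e = ≤-trans (≤-reflexive (∑-empty (allElems n) _ λ x _ → cong ⟦_⟧ (¬-not λ qx → true≢false (anyV⁺ q x qx) e))) z≤n

  -- Count paths z - x - y with x in D. Each x has at least n/2 lower covers, and a y other than z
  -- is reached through only one x by `cov-unique`; the extra `ND z` accounts for y = z.
  pairs : ∀ z → ND z * n ≤ 2 * (∑V (λ y → ⟦ P z y ⟧) + ND z)
  pairs z = begin
    ND z * n ≡⟨ sym (∑V-*ʳ n _) ⟩
    ∑V (λ x → ⟦ D x ⟧ * ⟦ cov z x ⟧ * n) ≤⟨ ∑V-mono (λ x → ≤-trans (≤-reflexive (*-assoc ⟦ D x ⟧ ⟦ cov z x ⟧ n))
                                             (≤-trans (⟦⟧-*-mono (D x) λ d → *-monoʳ-≤ ⟦ cov z x ⟧ (deg x (D-rank x d)))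
                                             (≤-reflexive (rearr ⟦ D x ⟧ ⟦ cov z x ⟧ (∑V (λ y → ⟦ cov y x ⟧)))))) ⟩
    ∑V (λ x → 2 * (⟦ D x ⟧ * ⟦ cov z x ⟧ * ∑V (λ y → ⟦ cov y x ⟧))) ≡⟨ ∑V-*ˡ 2 _ ⟩
    2 * ∑V (λ x → ⟦ D x ⟧ * ⟦ cov z x ⟧ * ∑V (λ y → ⟦ cov y x ⟧))
      ≡⟨ cong (2 *_) (∑V-pull (λ x → ⟦ D x ⟧ * ⟦ cov z x ⟧) (λ x y → ⟦ cov y x ⟧)) ⟩
    2 * ∑V (λ y → ∑V (λ x → ⟦ D x ⟧ * ⟦ cov z x ⟧ * ⟦ cov y x ⟧)) ≤⟨ *-monoʳ-≤ 2 (∑V-mono pointwise) ⟩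
    2 * ∑V (λ y → ⟦ P z y ⟧ + ⟦ eqV z y ⟧ * ND z)
      ≡⟨ cong (2 *_) (trans (∑V-+ _ _) (cong (∑V (λ y → ⟦ P z y ⟧) +_) (∑-eqVˡ z (λ _ → ND z)))) ⟩
    2 * (∑V (λ y → ⟦ P z y ⟧) + ND z) ∎
    where
    open ≤-Reasoning
    rearr : ∀ a b d → a * (b * (2 * d)) ≡ 2 * (a * b * d)
    rearr = solve-∀
    pointwise : ∀ y → ∑V (λ x → ⟦ D x ⟧ * ⟦ cov z x ⟧ * ⟦ cov y x ⟧) ≤ ⟦ P z y ⟧ + ⟦ eqV z y ⟧ * ND z
    pointwise y with bool-case (eqV z y)
    ... | inj₁ e = ≤-trans (∑V-mono (λ x → ≤-trans (*-monoʳ-≤ (⟦ D x ⟧ * ⟦ cov z x ⟧) (⟦⟧≤1 (cov y x))) (≤-reflexive (*-identityʳ _))))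
          (≤-trans (≤-reflexive (sym (trans (cong (λ b → ⟦ b ⟧ * ND z) e) (+-identityʳ _)))) (m≤n+m _ ⟦ P z y ⟧))
    ... | inj₂ e = ≤-trans (≤-reflexive (∑V-cong λ x → trans (*-assoc ⟦ D x ⟧ ⟦ cov z x ⟧ ⟦ cov y x ⟧)
            (trans (cong (⟦ D x ⟧ *_) (sym (⟦∧⟧ (cov z x) (cov y x)))) (sym (⟦∧⟧ (D x) (cov z x ∧ cov y x))))))
          (≤-trans (card-any (λ x → D x ∧ (cov z x ∧ cov y x)) unique) (m≤m+n ⟦ P z y ⟧ _))
      where
      unique : ∀ x x′ → D x ∧ (cov z x ∧ cov y x) ≡ true → D x′ ∧ (cov z x′ ∧ cov y x′) ≡ true → x ≡ x′
      unique x x′ p q with x ≟V x′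
      ... | yes r = r
      ... | no r with ∧-split {cov z x} (proj₂ (∧-split {D x} p)) | ∧-split {cov z x′} (proj₂ (∧-split {D x′} q))
      ...   | a , b | a′ , b′ = ⊥-elim (true≢false (subst (λ u → eqV z u ≡ true) (cov-unique r a a′ b b′) (eqV-refl z)) e)

  P-lower : ∀ z → heavy z ≡ true → n * n ≤ 16 * ∑V (λ y → ⟦ P z y ⟧)
  P-lower z hz = begin
    n * n ≤⟨ *-monoʳ-≤ n (heavy-ND z hz) ⟩
    n * (6 * ND z) ≡⟨ rearr₁ n (ND z) ⟩
    2 * (3 * (ND z * n)) ≤⟨ *-monoʳ-≤ 2 (+-cancelʳ-≤ (ND z * n) (3 * (ND z * n)) (8 * p) (begin
      3 * (ND z * n) + ND z * n ≡⟨ rearr₂ (ND z * n) ⟩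
      4 * (ND z * n) ≤⟨ *-monoʳ-≤ 4 (pairs z) ⟩
      4 * (2 * (p + ND z)) ≡⟨ rearr₃ p (ND z) ⟩
      8 * p + ND z * 8 ≤⟨ +-monoʳ-≤ (8 * p) (*-monoʳ-≤ (ND z) n≥8) ⟩
      8 * p + ND z * n ∎)) ⟩
    2 * (8 * p) ≡⟨ sym (*-assoc 2 8 p) ⟩
    16 * p ∎
    where
    open ≤-Reasoning
    p : ℕ
    p = ∑V (λ y → ⟦ P z y ⟧)
    rearr₁ : ∀ n d → n * (6 * d) ≡ 2 * (3 * (d * n))
    rearr₁ = solve-∀
    rearr₂ : ∀ m → 3 * m + m ≡ 4 * m
    rearr₂ = solve-∀
    rearr₃ : ∀ p d → 4 * (2 * (p + d)) ≡ 8 * p + d * 8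
    rearr₃ = solve-∀

  module FirstApprox (m₁ : ℕ) where
    -- The set T will be chosen among the `rich` points, because the upper covers outside D of each
    -- point of T are written into the code, at most m₁ per point. Few points are `poor` by
    -- `miss-df`.
    poor : Elem n → Bool
    poor y = G y ∧ ⌊ m₁ <? miss y ⌋

    rich : Elem n → Bool
    rich y = G y ∧ not ⌊ m₁ <? miss y ⌋

    rich-miss : ∀ y → rich y ≡ true → miss y ≤ m₁
    rich-miss y h = ≮⇒≥ (⌊⌋-no (m₁ <? miss y) (proj₂ (∧-split {G y} h)))

    card-poor : card poor * m₁ ≤ t * (2 * n)
    card-poor = markov poor m₁ (2 * n) (λ y h → proj₁ (∧-split h)) λ y h → ≤-trans
      (*-monoʳ-≤ M (<⇒≤ (⌊⌋⁻ (m₁ <? miss y) (proj₂ (∧-split {G y} h))))) (miss-df y (proj₁ (∧-split h)))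

    richNear poorNear : Elem n → ℕ
    richNear z = ∑V (λ y → ⟦ rich y ⟧ * ⟦ P z y ⟧)
    poorNear z = ∑V (λ y → ⟦ poor y ⟧ * ⟦ P z y ⟧)

    near-split : ∀ z → ∑V (λ y → ⟦ P z y ⟧) ≡ richNear z + poorNear z
    near-split z = trans (∑V-cong pointwise) (∑V-+ _ _)
      where
      go : ∀ b → 1 ≡ ⟦ not b ⟧ * 1 + ⟦ b ⟧ * 1
      go true = refl
      go false = refl
      pointwise : ∀ y → ⟦ P z y ⟧ ≡ ⟦ rich y ⟧ * ⟦ P z y ⟧ + ⟦ poor y ⟧ * ⟦ P z y ⟧
      pointwise y with bool-case (P z y)
      ... | inj₂ e rewrite e | *-zeroʳ ⟦ rich y ⟧ | *-zeroʳ ⟦ poor y ⟧ = refl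
      ... | inj₁ e rewrite e | P⇒G z y e = go ⌊ m₁ <? miss y ⌋

    good bad : Elem n → Bool
    good z = (G z ∧ heavy z) ∧ ⌊ n * n ≤? 32 * richNear z ⌋
    bad z = (G z ∧ heavy z) ∧ not ⌊ n * n ≤? 32 * richNear z ⌋

    bad-poor : ∀ z → bad z ≡ true → n * n ≤ 32 * poorNear z
    bad-poor z h = +-cancelˡ-≤ (32 * richNear z) _ _ (begin
        32 * richNear z + n * n ≤⟨ +-monoˡ-≤ (n * n) (<⇒≤ (≰⇒> (⌊⌋-no (n * n ≤? 32 * richNear z) (proj₂ (∧-split {G z ∧ heavy z} h))))) ⟩
        n * n + n * n ≤⟨ +-mono-≤ pl pl ⟩
        16 * ∑V (λ y → ⟦ P z y ⟧) + 16 * ∑V (λ y → ⟦ P z y ⟧) ≡⟨ rearr (∑V (λ y → ⟦ P z y ⟧)) ⟩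
        32 * ∑V (λ y → ⟦ P z y ⟧) ≡⟨ trans (cong (32 *_) (near-split z)) (*-distribˡ-+ 32 (richNear z) (poorNear z)) ⟩
        32 * richNear z + 32 * poorNear z ∎)
      where
      open ≤-Reasoning
      pl : n * n ≤ 16 * ∑V (λ y → ⟦ P z y ⟧)
      pl = P-lower z (proj₂ (∧-split {G z} (proj₁ (∧-split {G z ∧ heavy z} h))))
      rearr : ∀ p → 16 * p + 16 * p ≡ 32 * p
      rearr = solve-∀

    -- Double counting of twins: a bad point has at least n²/32 poor twins, while a poor point has
    -- at most n² twins altogether.
    card-bad : card bad ≤ 32 * card poor
    card-bad = *-cancelʳ-≤′ (n * n) (*-mono-≤ n>0 n>0) (begin
      card bad * (n * n) ≡⟨ sym (∑V-*ʳ (n * n) _) ⟩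
      ∑V (λ z → ⟦ bad z ⟧ * (n * n)) ≤⟨ ∑V-mono (λ z → ≤-trans (⟦⟧-*-mono (bad z) (bad-poor z)) (⟦⟧*≤ (bad z) _)) ⟩
      ∑V (λ z → 32 * poorNear z) ≡⟨ trans (∑V-*ˡ 32 _) (cong (32 *_) (∑V-swap _)) ⟩
      32 * ∑V (λ y → ∑V (λ z → ⟦ poor y ⟧ * ⟦ P z y ⟧)) ≡⟨ cong (32 *_) (∑V-cong λ y → ∑V-*ˡ ⟦ poor y ⟧ _) ⟩
      32 * ∑V (λ y → ⟦ poor y ⟧ * ∑V (λ z → ⟦ P z y ⟧)) ≤⟨ *-monoʳ-≤ 32 (∑V-mono λ y → *-monoʳ-≤ ⟦ poor y ⟧ (P-upper y)) ⟩
      32 * ∑V (λ y → ⟦ poor y ⟧ * (n * n)) ≡⟨ cong (32 *_) (∑V-*ʳ (n * n) _) ⟩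
      32 * (card poor * (n * n)) ≡⟨ sym (*-assoc 32 (card poor) (n * n)) ⟩
      32 * card poor * (n * n) ∎)
      where open ≤-Reasoning

    -- A good point has at least n²/32 rich twins among at most |G| rich points, so the covering
    -- ratio d/a is n² / (32 |G|).
    module Cvr = Cover rich good P 32 (32 * card G) (n * n)
      (λ z h → ⌊⌋⁻ (n * n ≤? 32 * richNear z) (proj₂ (∧-split {G z ∧ heavy z} h)))
      (*-monoʳ-≤ 32 (card-mono {p = rich} {q = G} λ y h → proj₁ (∧-split h)))

    F₀ : List (Elem n) → Elem n → Bool
    F₀ = twins D

    F₀⇒G : ∀ L y → F₀ L y ≡ true → G y ≡ true
    F₀⇒G L y h with anyV⁻ (λ z → mem L z ∧ P z y) h
    ... | z , q = P⇒G z y (proj₂ (∧-split {mem L z} q))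

    P-sym : ∀ z y → P z y ≡ true → P y z ≡ true
    P-sym z y h with P⁻ z y h
    ... | x , d , a , b = P⁺ y z x d b a

    uncovered : ∀ L → card (λ y → G y ∧ not (F₀ L y)) ≤ card light + (card bad + card (Cvr.left L))
    uncovered L = subst (card (λ y → G y ∧ not (F₀ L y)) ≤_)
      (trans (∑V-+ _ _) (cong (card light +_) (∑V-+ _ _))) (∑V-mono pointwise)
      where
      go : ∀ g h r f c → (f ≡ false → c ≡ false) →
           ⟦ g ∧ not f ⟧ ≤ ⟦ g ∧ not h ⟧ + (⟦ (g ∧ h) ∧ not r ⟧ + ⟦ ((g ∧ h) ∧ r) ∧ not c ⟧)
      go false h r f c k = z≤n
      go true h r true c k = z≤n
      go true false r false c k = s≤s z≤n
      go true true false false c k = s≤s z≤n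
      go true true true false c k rewrite k refl = s≤s z≤n
      pointwise : ∀ y → ⟦ G y ∧ not (F₀ L y) ⟧ ≤ ⟦ light y ⟧ + (⟦ bad y ⟧ + ⟦ Cvr.left L y ⟧)
      pointwise y = go (G y) (heavy y) ⌊ n * n ≤? 32 * richNear y ⌋ (F₀ L y) (anyL (P y) L) λ f → ¬-not λ c →
        let (z , m , p) = anyL⁻ (P y) L c
        in true≢false (anyV⁺ (λ z → mem L z ∧ P z y) z (∧-join (mem⁺ L z m) (P-sym y z p))) f

    missing : List (Elem n) → List (Elem n)
    missing = concatMap λ z → filter (λ x → (cov z x ∧ not (D x)) Data.Bool.≟ true) (allElems n)

    missing⁺ : ∀ L z x → z ∈ L → cov z x ≡ true → D x ≡ false → x ∈ missing L
    missing⁺ L z x m a d = concatMap-∈ _ m (∈-filter⁺ (λ x → (cov z x ∧ not (D x)) Data.Bool.≟ true)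
      (allElems-complete x) (∧-join a (cong not d)))

    missing⁻ : ∀ L x → x ∈ missing L → Σ (Elem n) λ z → z ∈ L × cov z x ≡ true × D x ≡ false
    missing⁻ L x m with concatMap-∈⁻ (λ z → filter (λ x → (cov z x ∧ not (D x)) Data.Bool.≟ true) (allElems n)) L m
    ... | z , mz , q with ∧-split {cov z x} (proj₂ (∈-filter⁻ (λ x → (cov z x ∧ not (D x)) Data.Bool.≟ true) {xs = allElems n} q))
    ...   | a , d = z , mz , a , not-split d

    length-missing : ∀ L → All (λ y → rich y ≡ true) L → length (missing L) ≤ length L * m₁
    length-missing [] [] = z≤n
    length-missing (z ∷ L) (r ∷ rs) = ≤-trans (≤-reflexive (length-++ (filter (λ x → (cov z x ∧ not (D x)) Data.Bool.≟ true) (allElems n))))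
      (+-mono-≤ (≤-trans (≤-reflexive (trans (length-filter≡∑ (λ x → (cov z x ∧ not (D x)) Data.Bool.≟ true) (allElems n))
         (∑V-cong λ x → trans (cong ⟦_⟧ (does-≟true (cov z x ∧ not (D x)))) (⟦∧⟧ (cov z x) (not (D x))))))
         (rich-miss z r)) (length-missing L rs))

    approx : ∀ h ρ → n * n < 32 * card G → 32 * card G ∸ n * n ≤ h * (n * n) → Approx k m₁ h ρ c C t
    approx h ρ large h-ok = from (Cvr.cover-exp h ρ large h-ok)
      where
      from : Σ (List (Elem n)) (λ T → All (λ y → rich y ≡ true) T × length T ≤ h * ρ × card (Cvr.left T) * 2 ^ ρ ≤ card good) →
             Approx k m₁ h ρ c C t
      from (T , T-rich , T-len , T-left) = record
        { T = T ; Ms = missing T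
        ; T⇒G = λ y m → proj₁ (∧-split (All.lookup T-rich m))
        ; F₀⇒G = F₀⇒G T
        ; T-len = T-len
        ; Ms⁺ = missing⁺ T ; Ms⁻ = missing⁻ T ; Ms-len = length-missing T T-rich
        ; po = card poor ; le = card (Cvr.left T)
        ; left≤ = ≤-trans (uncovered T) (+-mono-≤ card-light (+-monoˡ-≤ _ card-bad))
        ; po≤ = card-poor
        ; le≤ = ≤-trans T-left (≤-trans (card-mono {p = good} {q = G} λ z h →
            proj₁ (∧-split {G z} (proj₁ (∧-split {G z ∧ heavy z} h)))) G-gap)
        }

-- Refining the approximation of the shadow and its closure

extendF : ∀ {n} → (Elem n → Bool) → (Elem n → Bool) → Elem n → Bool
extendF F U y = F y ∨ anyV (λ u → U u ∧ cov y u)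

defect : ∀ {n} → (Elem n → Bool) → Elem n → ℕ
defect F x = ∑V (λ y → ⟦ cov y x ⟧ * ⟦ not (F y) ⟧)

upto : ∀ {n} → ℕ → ℕ → (Elem n → Bool) → Elem n → Bool
upto k ψ F x = rk k x ∧ ⌊ defect F x ≤? ψ ⌋

prune : ∀ {n} → (Elem n → Bool) → (Elem n → Bool) → Elem n → Bool
prune S R x = S x ∧ not (anyV (λ y → R y ∧ cov y x))

load : ∀ {n} → (Elem n → Bool) → Elem n → ℕ
load S y = ∑V (λ x → ⟦ S x ⟧ * ⟦ cov y x ⟧)

enlarge : ∀ {n} → ℕ → ℕ → (Elem n → Bool) → (Elem n → Bool) → Elem n → Bool
enlarge k ψ F S y = F y ∨ (⌊ suc (rank y) ≟ k ⌋ ∧ ⌊ ψ <? load S y ⌋)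

closure : ∀ {n} → ℕ → (Elem n → Bool) → (Elem n → Bool) → Elem n → Bool
closure k F X x = rk k x ∧ allV (λ y → cov y x ⇒ᵇ (F y ∨ X y))

-- Sapozhenko's refinement: adding the lower covers of few elements U ⊆ hull k C to F₀, and removing the upper
-- covers of few elements R, makes F₂ ⊆ G and S ⊇ hull k C nearly tight.
record Refined {n} (k ψ : ℕ) (C F₀ : Elem n → Bool) (t : ℕ) : Set where
  field
    U R : List (Elem n)
  F₁ : Elem n → Bool
  F₁ = extendF F₀ (mem U)
  S : Elem n → Bool
  S = prune (upto k ψ F₁) (mem R)
  F₂ : Elem n → Bool
  F₂ = enlarge k ψ F₁ S
  rest : Elem n → Bool
  rest = λ y → shadow C y ∧ not (F₂ y)
  field
    U⊆D : ∀ u → u ∈ U → hull k C u ≡ true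
    D-defect : ∀ x → hull k C x ≡ true → defect F₁ x ≤ ψ
    F₁⇒G : ∀ y → F₁ y ≡ true → shadow C y ≡ true
    R-near : ∀ y → y ∈ R → Σ (Elem n) λ x → rank x ≡ k × defect F₁ x ≤ ψ × cov y x ≡ true
    U-len : length U * suc ψ ≤ card (λ y → shadow C y ∧ not (F₀ y))
    R-len : length R * suc ψ ≤ 2 * t
    D⊆S : ∀ x → hull k C x ≡ true → S x ≡ true
    size : n * card S ≤ n * card F₂ + 12 * (t * ψ)
    card-split : card F₂ + card rest ≡ card (shadow C)
    closure⇔D : ∀ x → closure k F₂ rest x ≡ hull k C x

module Refine {n : ℕ} (k c M : ℕ) (wt : Elem n → Elem n → ℕ) (Wt : Weights k c M wt) (n≥8 : 8 ≤ n)
  (C : Elem n → Bool) (C-rank : ∀ x → C x ≡ true → rank x ≡ k) (ψ : ℕ) (6ψ≤n : 6 * ψ ≤ n)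
  (F₀ : Elem n → Bool) (F₀⇒G : ∀ y → F₀ y ≡ true → shadow C y ≡ true) where

  open Closure k c M wt Wt n≥8 C C-rank
  open Weights Wt
  open Sums n

  F₁ : List (Elem n) → Elem n → Bool
  F₁ U = extendF F₀ (mem U)

  F₁⁺ : ∀ U y u → u ∈ U → cov y u ≡ true → F₁ U y ≡ true
  F₁⁺ U y u m h = ∨-right {F₀ y} (anyV⁺ (λ u → mem U u ∧ cov y u) u (∧-join (mem⁺ U u m) h))

  F₁⁻ : ∀ U y → F₁ U y ≡ true → F₀ y ≡ true ⊎ Σ (Elem n) λ u → u ∈ U × cov y u ≡ true
  F₁⁻ U y h with ∨-split {F₀ y} h
  ... | inj₁ e = inj₁ e
  ... | inj₂ e with anyV⁻ (λ u → mem U u ∧ cov y u) e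
  ...   | u , q with ∧-split {mem U u} q
  ...     | m , p = inj₂ (u , mem⁻ U u m , p)

  F₁-grow : ∀ u U y → F₁ U y ≡ true → F₁ (u ∷ U) y ≡ true
  F₁-grow u U y h with F₁⁻ U y h
  ... | inj₁ e = ∨-left e
  ... | inj₂ (w , m , p) = F₁⁺ (u ∷ U) y w (there m) p

  F₁⇒G : ∀ U → All (λ u → D u ≡ true) U → ∀ y → F₁ U y ≡ true → G y ≡ true
  F₁⇒G U ds y h with F₁⁻ U y h
  ... | inj₁ e = F₀⇒G y e
  ... | inj₂ (u , m , p) = D⇒G u y (All.lookup ds m) p

  gap : List (Elem n) → ℕ
  gap U = card (λ y → G y ∧ not (F₁ U y))

  gap-step : ∀ U u → D u ≡ true → gap (u ∷ U) + defect (F₁ U) u ≤ gap U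
  gap-step U u d = ≤-trans (≤-reflexive (sym (∑V-+ _ _))) (∑V-mono λ y →
    go (G y) (F₁ U y) (F₁ (u ∷ U) y) (cov y u) (D⇒G u y d) (F₁⁺ (u ∷ U) y u (here refl)) (F₁-grow u U y))
    where
    go : ∀ g f f′ e → (e ≡ true → g ≡ true) → (e ≡ true → f′ ≡ true) → (f ≡ true → f′ ≡ true) →
         ⟦ g ∧ not f′ ⟧ + ⟦ e ⟧ * ⟦ not f ⟧ ≤ ⟦ g ∧ not f ⟧
    go g f f′ true a b h rewrite a refl | b refl = ≤-reflexive (+-identityʳ _)
    go false f f′ false a b h = z≤n
    go true true f′ false a b h rewrite h refl = z≤n
    go true false true false a b h = z≤n
    go true false false false a b h = ≤-refl

  DoneU : List (Elem n) → Set
  DoneU U = ∀ x → D x ≡ true → defect (F₁ U) x ≤ ψ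

  -- While some point of D has more than ψ lower covers outside `F₁ U`, adding it to U brings all of
  -- them, which lie in G, into the approximation; the gap shrinks by more than ψ.
  stepU : ∀ U → DoneU U ⊎ Σ (Elem n) λ u → D u ≡ true × gap (u ∷ U) + suc ψ ≤ gap U
  stepU U with bool-case (anyV λ x → D x ∧ ⌊ ψ <? defect (F₁ U) x ⌋)
  ... | inj₁ e with anyV⁻ (λ x → D x ∧ ⌊ ψ <? defect (F₁ U) x ⌋) e
  ...   | u , q with ∧-split {D u} q
  ...     | d , l = inj₂ (u , d , ≤-trans (+-monoʳ-≤ (gap (u ∷ U)) (⌊⌋⁻ (ψ <? defect (F₁ U) u) l)) (gap-step U u d))
  stepU U | inj₂ e = inj₁ λ x d → ≮⇒≥ λ l →
    true≢false (anyV⁺ (λ x → D x ∧ ⌊ ψ <? defect (F₁ U) x ⌋) x (∧-join d (⌊⌋⁺ (ψ <? defect (F₁ U) x) l))) e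

  module Second (U : List (Elem n)) (U⊆D : All (λ u → D u ≡ true) U) (doneU : DoneU U) where
    S₀ : Elem n → Bool
    S₀ = upto k ψ (F₁ U)

    S₀-rank : ∀ x → S₀ x ≡ true → rank x ≡ k
    S₀-rank x h = rk⁻ k x (proj₁ (∧-split h))

    S₀-defect : ∀ x → S₀ x ≡ true → defect (F₁ U) x ≤ ψ
    S₀-defect x h = ⌊⌋⁻ (defect (F₁ U) x ≤? ψ) (proj₂ (∧-split {rk k x} h))

    D⊆S₀ : ∀ x → D x ≡ true → S₀ x ≡ true
    D⊆S₀ x d = ∧-join (rk⁺ k x (D-rank x d)) (⌊⌋⁺ (defect (F₁ U) x ≤? ψ) (doneU x d))

    outside-G : ∀ x → S₀ x ≡ true → ∑V (λ y → ⟦ not (G y) ⟧ * ⟦ cov y x ⟧) ≤ ψ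
    outside-G x s = ≤-trans (∑V-mono λ y → ≤-trans (≤-reflexive (*-comm ⟦ not (G y) ⟧ ⟦ cov y x ⟧))
      (*-monoʳ-≤ ⟦ cov y x ⟧ (⟦⟧-mono λ h → not-join λ f → true≢false (F₁⇒G U U⊆D y f) (not-split h)))) (S₀-defect x s)

    -- At most ψ ≤ n/6 edges of `x` leave G, each of weight at most 3M/n, so at most half of M
    -- escapes.
    S₀-weight : ∀ x → S₀ x ≡ true → M ≤ 2 * ∑V (λ y → ⟦ G y ⟧ * wt y x)
    S₀-weight x s = +-cancelˡ-≤ M _ _ (begin
      M + M ≡⟨ cong (M +_) (sym (+-identityʳ M)) ⟩
      2 * M ≡⟨ cong (2 *_) (sym (w-sum x (S₀-rank x s))) ⟩
      2 * ∑V (λ y → wt y x) ≡⟨ cong (2 *_) (trans (∑V-cong λ y → split (G y) (wt y x)) (∑V-+ _ _)) ⟩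
      2 * (∑V (λ y → ⟦ G y ⟧ * wt y x) + out) ≡⟨ trans (*-distribˡ-+ 2 (∑V (λ y → ⟦ G y ⟧ * wt y x)) out) (+-comm _ (2 * out)) ⟩
      2 * out + 2 * ∑V (λ y → ⟦ G y ⟧ * wt y x) ≤⟨ +-monoˡ-≤ _ out≤ ⟩
      M + 2 * ∑V (λ y → ⟦ G y ⟧ * wt y x) ∎)
      where
      open ≤-Reasoning
      out : ℕ
      out = ∑V (λ y → ⟦ not (G y) ⟧ * wt y x)
      split : ∀ b m → m ≡ ⟦ b ⟧ * m + ⟦ not b ⟧ * m
      split true m = sym (trans (+-identityʳ _) (+-identityʳ m))
      split false m = sym (+-identityʳ m)
      rearr : ∀ n o → n * (2 * o) ≡ 2 * (n * o)
      rearr = solve-∀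
      rearr′ : ∀ m p → 2 * (3 * m * p) ≡ 6 * p * m
      rearr′ = solve-∀
      pointwise : ∀ y → n * (⟦ not (G y) ⟧ * wt y x) ≤ 3 * M * (⟦ not (G y) ⟧ * ⟦ cov y x ⟧)
      pointwise y with bool-case (cov y x)
      ... | inj₂ e rewrite w-off y x e | *-zeroʳ ⟦ not (G y) ⟧ | *-zeroʳ n = z≤n
      ... | inj₁ e rewrite e with not (G y)
      ...   | false rewrite *-zeroʳ n = z≤n
      ...   | true rewrite *-identityʳ (3 * M) | +-identityʳ (wt y x) = w-hi y x (S₀-rank x s)
      out≤ : 2 * out ≤ M
      out≤ = *-cancelˡ-≤′ n n>0 (begin
        n * (2 * out) ≡⟨ rearr n out ⟩
        2 * (n * out) ≤⟨ *-monoʳ-≤ 2 (subst₂ _≤_ (∑V-*ˡ n _) (∑V-*ˡ (3 * M) _) (∑V-mono pointwise)) ⟩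
        2 * (3 * M * ∑V (λ y → ⟦ not (G y) ⟧ * ⟦ cov y x ⟧)) ≤⟨ *-monoʳ-≤ 2 (*-monoʳ-≤ (3 * M) (outside-G x s)) ⟩
        2 * (3 * M * ψ) ≡⟨ rearr′ M ψ ⟩
        6 * ψ * M ≤⟨ *-monoˡ-≤ M 6ψ≤n ⟩
        n * M ∎)

    -- Every such point sends at least M/2 into G. What G receives from outside D fits into the
    -- deficiency, whose total is t M.
    excess : card (λ x → S₀ x ∧ not (D x)) ≤ 2 * t
    excess = *-cancelʳ-≤′ M M>0 (begin
      card q * M ≡⟨ sym (∑V-*ʳ M _) ⟩
      ∑V (λ x → ⟦ q x ⟧ * M) ≤⟨ ∑V-mono (λ x → ⟦⟧-*-mono (q x) λ h → S₀-weight x (proj₁ (∧-split h))) ⟩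
      ∑V (λ x → ⟦ q x ⟧ * (2 * ∑V (λ y → ⟦ G y ⟧ * wt y x)))
        ≡⟨ trans (∑V-cong λ x → rearr ⟦ q x ⟧ (∑V (λ y → ⟦ G y ⟧ * wt y x))) (∑V-*ˡ 2 _) ⟩
      2 * ∑V (λ x → ⟦ q x ⟧ * ∑V (λ y → ⟦ G y ⟧ * wt y x)) ≡⟨ cong (2 *_) (∑V-pull (λ x → ⟦ q x ⟧) (λ x y → ⟦ G y ⟧ * wt y x)) ⟩
      2 * ∑V (λ y → ∑V (λ x → ⟦ q x ⟧ * (⟦ G y ⟧ * wt y x)))
        ≡⟨ cong (2 *_) (∑V-cong λ y → trans (∑V-cong λ x → rearr′ ⟦ q x ⟧ ⟦ G y ⟧ (wt y x)) (∑V-*ˡ ⟦ G y ⟧ _)) ⟩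
      2 * ∑V (λ y → ⟦ G y ⟧ * ∑V (λ x → ⟦ q x ⟧ * wt y x)) ≤⟨ *-monoʳ-≤ 2 (∑V-mono λ y → ⟦⟧-*-mono (G y) (bound y)) ⟩
      2 * ∑V (λ y → ⟦ G y ⟧ * df y) ≡⟨ cong (2 *_) deficiency ⟩
      2 * (t * M) ≡⟨ sym (*-assoc 2 t M) ⟩
      2 * t * M ∎)
      where
      open ≤-Reasoning
      q : Elem n → Bool
      q x = S₀ x ∧ not (D x)
      rearr : ∀ a b → a * (2 * b) ≡ 2 * (a * b)
      rearr = solve-∀
      rearr′ : ∀ a b d → a * (b * d) ≡ b * (a * d)
      rearr′ = solve-∀
      bound : ∀ y → G y ≡ true → ∑V (λ x → ⟦ q x ⟧ * wt y x) ≤ df y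
      bound y g = ≤-trans (∑V-mono λ x → *-monoˡ-≤ (wt y x) (⟦⟧-mono {q x} {not (D x)} λ h → proj₂ (∧-split {S₀ x} h)))
        (+-cancelˡ-≤ (WD y) _ _ (≤-trans (≤-reflexive (WD-split y)) (≤-trans (up-sum≤M y g)
          (≤-reflexive (trans (sym (df+WD y g)) (+-comm (df y) (WD y)))))))

    S₁ : List (Elem n) → Elem n → Bool
    S₁ R = prune S₀ (mem R)

    S₁⇒S₀ : ∀ R x → S₁ R x ≡ true → S₀ x ≡ true
    S₁⇒S₀ R x h = proj₁ (∧-split h)

    S₁-avoids : ∀ R x y → S₁ R x ≡ true → y ∈ R → cov y x ≡ true → ⊥
    S₁-avoids R x y h m e = true≢false (anyV⁺ (λ y → mem R y ∧ cov y x) y (∧-join (mem⁺ R y m) e))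
      (not-split (proj₂ (∧-split {S₀ x} h)))

    S₁⁺ : ∀ R x → S₀ x ≡ true → (∀ y → y ∈ R → cov y x ≡ true → ⊥) → S₁ R x ≡ true
    S₁⁺ R x s h = ∧-join s (not-join λ e →
      let (y , q) = anyV⁻ (λ y → mem R y ∧ cov y x) e
          (m , p) = ∧-split {mem R y} q
      in h y (mem⁻ R y m) p)

    -- The witness `x` is kept because it ties `y` to the neighbourhood of C, as the encoding by a
    -- walk requires.
    GoodR : Elem n → Set
    GoodR y = G y ≡ false × Σ (Elem n) λ x → S₀ x ≡ true × cov y x ≡ true

    surplus : List (Elem n) → ℕ
    surplus R = card (λ x → S₁ R x ∧ not (D x))

    surplus-step : ∀ R y → G y ≡ false → surplus (y ∷ R) + load (S₁ R) y ≤ surplus R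
    surplus-step R y g = ≤-trans (≤-reflexive (sym (∑V-+ _ _))) (∑V-mono λ x →
      go (S₁ R x) (S₁ (y ∷ R) x) (D x) (cov y x)
        (λ h → S₁⁺ R x (S₁⇒S₀ (y ∷ R) x h) λ z m → S₁-avoids (y ∷ R) x z h (there m))
        (λ e → ¬-not λ d → true≢false (D⇒G x y d e) g)
        (λ e → ¬-not λ s → S₁-avoids (y ∷ R) x y s (here refl) e))
      where
      go : ∀ s s′ d e → (s′ ≡ true → s ≡ true) → (e ≡ true → d ≡ false) → (e ≡ true → s′ ≡ false) →
           ⟦ s′ ∧ not d ⟧ + ⟦ s ⟧ * ⟦ e ⟧ ≤ ⟦ s ∧ not d ⟧
      go true s′ d true a b h rewrite b refl | h refl = ≤-refl
      go false s′ d true a b h rewrite h refl = z≤n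
      go s false d false a b h rewrite *-zeroʳ ⟦ s ⟧ = z≤n
      go s true d false a b h rewrite a refl = ≤-reflexive (+-identityʳ _)

    DoneR : List (Elem n) → Set
    DoneR R = ∀ y → suc (rank y) ≡ k → ψ < load (S₁ R) y → G y ≡ true

    stepR : ∀ R → DoneR R ⊎ Σ (Elem n) λ y → GoodR y × surplus (y ∷ R) + suc ψ ≤ surplus R
    stepR R with bool-case (anyV λ y → not (G y) ∧ ⌊ ψ <? load (S₁ R) y ⌋)
    ... | inj₁ e with anyV⁻ (λ y → not (G y) ∧ ⌊ ψ <? load (S₁ R) y ⌋) e
    ...   | y , q with ∧-split {not (G y)} q
    ...     | g , l with ⌊⌋⁻ (ψ <? load (S₁ R) y) l
    ...       | l′ with ∑V-pos (λ x → ⟦ S₁ R x ⟧ * ⟦ cov y x ⟧) (≤-trans (s≤s z≤n) l′)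
    ...         | x , p = inj₂ (y , (not-split g , x , S₁⇒S₀ R x (left (S₁ R x) (cov y x) p) , right (S₁ R x) (cov y x) p) ,
                    ≤-trans (+-monoʳ-≤ (surplus (y ∷ R)) l′) (surplus-step R y (not-split g)))
      where
      left : ∀ a b → 0 < ⟦ a ⟧ * ⟦ b ⟧ → a ≡ true
      left true b h = refl
      right : ∀ a b → 0 < ⟦ a ⟧ * ⟦ b ⟧ → b ≡ true
      right true true h = refl
    stepR R | inj₂ e = inj₁ λ y r l → done y l
      where
      done : ∀ y → ψ < load (S₁ R) y → G y ≡ true
      done y l with bool-case (G y)
      ... | inj₁ g = g
      ... | inj₂ g = ⊥-elim (true≢false (anyV⁺ (λ y → not (G y) ∧ ⌊ ψ <? load (S₁ R) y ⌋) y
              (∧-join (cong not g) (⌊⌋⁺ (ψ <? load (S₁ R) y) l))) e)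

    surplus-start : surplus [] ≤ 2 * t
    surplus-start = ≤-trans (card-mono {p = λ x → S₁ [] x ∧ not (D x)} {q = λ x → S₀ x ∧ not (D x)} λ x h →
      ∧-join (S₁⇒S₀ [] x (proj₁ (∧-split h))) (proj₂ (∧-split {S₁ [] x} h))) excess

    module Third (R : List (Elem n)) (R-good : All GoodR R) (doneR : DoneR R) where
      S : Elem n → Bool
      S = S₁ R

      F₂ : Elem n → Bool
      F₂ = enlarge k ψ (F₁ U) S

      D⊆S : ∀ x → D x ≡ true → S x ≡ true
      D⊆S x d = S₁⁺ R x (D⊆S₀ x d) λ y m e → true≢false (D⇒G x y d e) (proj₁ (All.lookup R-good m))

      S-rank : ∀ x → S x ≡ true → rank x ≡ k
      S-rank x s = S₀-rank x (S₁⇒S₀ R x s)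

      F₂⇒G : ∀ y → F₂ y ≡ true → G y ≡ true
      F₂⇒G y h with ∨-split {F₁ U y} h
      ... | inj₁ e = F₁⇒G U U⊆D y e
      ... | inj₂ e with ∧-split {⌊ suc (rank y) ≟ k ⌋} e
      ...   | r , l = doneR y (⌊⌋⁻ (suc (rank y) ≟ k) r) (⌊⌋⁻ (ψ <? load S y) l)

      rest : Elem n → Bool
      rest y = G y ∧ not (F₂ y)

      rest-load : ∀ y → rest y ≡ true → load S y ≤ ψ
      rest-load y h = ≮⇒≥ λ l → true≢false
        (∨-right {F₁ U y} (∧-join (⌊⌋⁺ (suc (rank y) ≟ k) (G-rank y (proj₁ (∧-split h)))) (⌊⌋⁺ (ψ <? load S y) l)))
        (not-split (proj₂ (∧-split {G y} h)))

      -- A point outside `F₂` has at most ψ ≤ n/6 upper covers in S, hence in D, so it receives at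
      -- most M/2 from D and has deficiency at least M/2.
      card-rest : card rest ≤ 2 * t
      card-rest = subst₂ _≤_ (*-identityʳ _) (*-comm t 2) (markov rest 1 2 (λ y h → proj₁ (∧-split h)) go)
        where
        open ≤-Reasoning
        rearr : ∀ n w → n * (2 * w) ≡ 2 * (n * w)
        rearr = solve-∀
        rearr′ : ∀ m p → 2 * (3 * m * p) ≡ 6 * p * m
        rearr′ = solve-∀
        light-weight : ∀ y → rest y ≡ true → 2 * WD y ≤ M
        light-weight y h = *-cancelˡ-≤′ n n>0 (begin
          n * (2 * WD y) ≡⟨ rearr n (WD y) ⟩
          2 * (n * WD y) ≤⟨ *-monoʳ-≤ 2 (WD-ND D D-rank y) ⟩
          2 * (3 * M * ND y) ≤⟨ *-monoʳ-≤ 2 (*-monoʳ-≤ (3 * M) (≤-trans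
             (∑V-mono λ x → *-monoˡ-≤ ⟦ cov y x ⟧ (⟦⟧-mono (D⊆S x))) (rest-load y h))) ⟩
          2 * (3 * M * ψ) ≡⟨ rearr′ M ψ ⟩
          6 * ψ * M ≤⟨ *-monoˡ-≤ M 6ψ≤n ⟩
          n * M ∎)
        arith : ∀ a b → a + b + (a + b) ≡ 2 * b + a * 2
        arith = solve-∀
        go : ∀ y → rest y ≡ true → M * 1 ≤ df y * 2
        go y h = +-cancelˡ-≤ (2 * WD y) _ _ (begin
          2 * WD y + M * 1 ≤⟨ +-mono-≤ (light-weight y h) (≤-reflexive (*-identityʳ M)) ⟩
          M + M ≡⟨ cong₂ _+_ (sym (df+WD y (proj₁ (∧-split h)))) (sym (df+WD y (proj₁ (∧-split h)))) ⟩
          df y + WD y + (df y + WD y) ≡⟨ arith (df y) (WD y) ⟩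
          2 * WD y + df y * 2 ∎)

      -- Lower covers of D stay in G, so only points of S outside D contribute: at most 2t of them,
      -- with at most ψ edges leaving G each.
      outer-load : ∑V (λ y → ⟦ not (G y) ⟧ * load S y) ≤ 2 * t * ψ
      outer-load = begin
        ∑V (λ y → ⟦ not (G y) ⟧ * load S y) ≡⟨ ∑V-pull (λ y → ⟦ not (G y) ⟧) (λ y x → ⟦ S x ⟧ * ⟦ cov y x ⟧) ⟩
        ∑V (λ x → ∑V (λ y → ⟦ not (G y) ⟧ * (⟦ S x ⟧ * ⟦ cov y x ⟧)))
          ≡⟨ ∑V-cong (λ x → trans (∑V-cong λ y → rearr ⟦ not (G y) ⟧ ⟦ S x ⟧ ⟦ cov y x ⟧) (∑V-*ˡ ⟦ S x ⟧ _)) ⟩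
        ∑V (λ x → ⟦ S x ⟧ * ∑V (λ y → ⟦ not (G y) ⟧ * ⟦ cov y x ⟧)) ≤⟨ ∑V-mono pointwise ⟩
        ∑V (λ x → ⟦ S₀ x ∧ not (D x) ⟧ * ψ) ≡⟨ ∑V-*ʳ ψ _ ⟩
        card (λ x → S₀ x ∧ not (D x)) * ψ ≤⟨ *-monoˡ-≤ ψ excess ⟩
        2 * t * ψ ∎
        where
        open ≤-Reasoning
        rearr : ∀ a b d → a * (b * d) ≡ b * (a * d)
        rearr = solve-∀
        pointwise : ∀ x → ⟦ S x ⟧ * ∑V (λ y → ⟦ not (G y) ⟧ * ⟦ cov y x ⟧) ≤ ⟦ S₀ x ∧ not (D x) ⟧ * ψ
        pointwise x with bool-case (S x)
        ... | inj₂ e = ≤-trans (≤-reflexive (cong (λ b → ⟦ b ⟧ * ∑V (λ y → ⟦ not (G y) ⟧ * ⟦ cov y x ⟧)) e)) z≤n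
        ... | inj₁ e with bool-case (D x)
        ...   | inj₂ d = *-mono-≤ (≤-trans (⟦⟧≤1 (S x)) (≤-reflexive (sym (cong ⟦_⟧ (∧-join (S₁⇒S₀ R x e) (cong not d))))))
                  (outside-G x (S₁⇒S₀ R x e))
        ...   | inj₁ d = ≤-trans (≤-reflexive (trans (cong (⟦ S x ⟧ *_) (∑-empty (allElems n) _ λ y _ → zero-term y)) (*-zeroʳ ⟦ S x ⟧))) z≤n
          where
          zero-term : ∀ y → ⟦ not (G y) ⟧ * ⟦ cov y x ⟧ ≡ 0
          zero-term y with bool-case (cov y x)
          ... | inj₁ q = trans (cong (λ b → ⟦ not b ⟧ * ⟦ cov y x ⟧) (D⇒G x y d q)) refl
          ... | inj₂ q = trans (cong (λ b → ⟦ not (G y) ⟧ * ⟦ b ⟧) q) (*-zeroʳ ⟦ not (G y) ⟧)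

      -- Weigh the edges below S. A point of `F₂` receives at most M. The edges into `rest` and
      -- those leaving G number at most 2tψ each and carry at most 3M/n apiece, which gives 3 · (2 +
      -- 2) = 12.
      size : n * card S ≤ n * card F₂ + 12 * (t * ψ)
      size = *-cancelʳ-≤′ M M>0 (begin
        n * card S * M ≡⟨ trans (*-assoc n (card S) M) (cong (n *_) (sym (∑V-*ʳ M _))) ⟩
        n * ∑V (λ x → ⟦ S x ⟧ * M) ≡⟨ cong (n *_) (∑V-cong λ x → ⟦⟧-*-cong (S x) λ s → sym (w-sum x (S-rank x s))) ⟩
        n * ∑V (λ x → ⟦ S x ⟧ * ∑V (λ y → wt y x)) ≡⟨ cong (n *_) (∑V-pull (λ x → ⟦ S x ⟧) (λ x y → wt y x)) ⟩
        n * ∑V (λ y → ∑V (λ x → ⟦ S x ⟧ * wt y x)) ≡⟨ sym (∑V-*ˡ n _) ⟩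
        ∑V (λ y → n * ∑V (λ x → ⟦ S x ⟧ * wt y x)) ≤⟨ ∑V-mono pointwise ⟩
        ∑V (λ y → n * M * ⟦ F₂ y ⟧ + 3 * M * (⟦ rest y ⟧ * ψ + ⟦ not (G y) ⟧ * load S y))
          ≡⟨ trans (∑V-+ _ _) (cong₂ _+_ (∑V-*ˡ (n * M) _) (trans (∑V-*ˡ (3 * M) _) (cong (3 * M *_) (trans (∑V-+ _ _)
               (cong (_+ ∑V (λ y → ⟦ not (G y) ⟧ * load S y)) (∑V-*ʳ ψ _)))))) ⟩
        n * M * card F₂ + 3 * M * (card rest * ψ + ∑V (λ y → ⟦ not (G y) ⟧ * load S y))
          ≤⟨ +-monoʳ-≤ (n * M * card F₂) (*-monoʳ-≤ (3 * M) (+-mono-≤ (*-monoˡ-≤ ψ card-rest) outer-load)) ⟩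
        n * M * card F₂ + 3 * M * (2 * t * ψ + 2 * t * ψ) ≡⟨ rearr n M (card F₂) t ψ ⟩
        (n * card F₂ + 12 * (t * ψ)) * M ∎)
        where
        open ≤-Reasoning
        rearr : ∀ n m f t p → n * m * f + 3 * m * (2 * t * p + 2 * t * p) ≡ (n * f + 12 * (t * p)) * m
        rearr = solve-∀
        pointwise : ∀ y → n * ∑V (λ x → ⟦ S x ⟧ * wt y x) ≤
                    n * M * ⟦ F₂ y ⟧ + 3 * M * (⟦ rest y ⟧ * ψ + ⟦ not (G y) ⟧ * load S y)
        pointwise y with bool-case (F₂ y)
        ... | inj₁ f = ≤-trans (*-monoʳ-≤ n (≤-trans (∑V-mono λ x → ⟦⟧*≤ (S x) (wt y x)) (up-sum≤M y (F₂⇒G y f))))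
              (≤-trans (≤-reflexive (sym (trans (cong (λ b → n * M * ⟦ b ⟧) f) (*-identityʳ (n * M))))) (m≤m+n _ _))
        ... | inj₂ f = ≤-trans (WD-ND S S-rank y) (≤-trans (*-monoʳ-≤ (3 * M) (by-G (bool-case (G y)))) (m≤n+m _ _))
          where
          by-G : G y ≡ true ⊎ G y ≡ false → load S y ≤ ⟦ rest y ⟧ * ψ + ⟦ not (G y) ⟧ * load S y
          by-G (inj₁ g) = ≤-trans (rest-load y (∧-join g (cong not f)))
            (≤-trans (≤-reflexive (sym (trans (cong (λ b → ⟦ b ⟧ * ψ) (∧-join g (cong not f))) (+-identityʳ ψ)))) (m≤m+n _ _))
          by-G (inj₂ g) = ≤-trans (≤-reflexive (sym (trans (cong (λ b → ⟦ not b ⟧ * load S y) g) (+-identityʳ _)))) (m≤n+m _ _)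

      card-split : card F₂ + card rest ≡ card G
      card-split = trans (sym (∑V-+ _ _)) (∑V-cong λ y → go (F₂ y) (G y) (F₂⇒G y))
        where
        go : ∀ f g → (f ≡ true → g ≡ true) → ⟦ f ⟧ + ⟦ g ∧ not f ⟧ ≡ ⟦ g ⟧
        go true g h rewrite h refl = refl
        go false true h = refl
        go false false h = refl

      closure⊆D : ∀ x → closure k F₂ rest x ≡ true → D x ≡ true
      closure⊆D x h with ∧-split {rk k x} h
      ... | r , a = D⁺ x (rk⁻ k x r) λ y e → go y (∨-split {F₂ y} (⇒ᵇ⁻ (allV⁻ _ a y) e))
        where
        go : ∀ y → F₂ y ≡ true ⊎ rest y ≡ true → G y ≡ true
        go y (inj₁ f) = F₂⇒G y f
        go y (inj₂ r) = proj₁ (∧-split r)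

      D⊆closure : ∀ x → D x ≡ true → closure k F₂ rest x ≡ true
      D⊆closure x d = ∧-join (rk⁺ k x (D-rank x d)) (allV⁺ _ λ y → ⇒ᵇ⁺ {cov y x} λ e → go y (D⇒G x y d e) (bool-case (F₂ y)))
        where
        go : ∀ y → G y ≡ true → F₂ y ≡ true ⊎ F₂ y ≡ false → F₂ y ∨ rest y ≡ true
        go y g (inj₁ f) = ∨-left f
        go y g (inj₂ f) = ∨-right {F₂ y} (∧-join g (cong not f))

      refined : length U * suc ψ ≤ gap [] → length R * suc ψ ≤ surplus [] → Refined k ψ C F₀ t
      refined U-len R-len = record
        { U = U ; R = R
        ; U⊆D = λ u m → All.lookup U⊆D m
        ; D-defect = doneU
        ; F₁⇒G = F₁⇒G U U⊆D
        ; R-near = λ y m → let (_ , x , s , e) = All.lookup R-good m in x , S₀-rank x s , S₀-defect x s , e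
        ; U-len = ≤-trans U-len (card-mono {p = λ y → G y ∧ not (F₁ [] y)} {q = λ y → G y ∧ not (F₀ y)}
            λ y h → ∧-join {G y} (proj₁ (∧-split {G y} h)) (not-join {F₀ y} λ f →
              true≢false {F₁ [] y} (∨-left {F₀ y} f) (not-split {F₁ [] y} (proj₂ (∧-split {G y} h)))))
        ; R-len = ≤-trans R-len surplus-start
        ; D⊆S = D⊆S
        ; size = size
        ; card-split = card-split
        ; closure⇔D = λ x → bool-ext (closure⊆D x) (D⊆closure x)
        }

    refine₂ : length U * suc ψ ≤ gap [] → Refined k ψ C F₀ t
    refine₂ U-len = from (greedy surplus GoodR DoneR (suc ψ) (s≤s z≤n) stepR)
      where
      from : Σ (List (Elem n)) (λ R → All GoodR R × DoneR R × length R * suc ψ ≤ surplus []) → Refined k ψ C F₀ t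
      from (R , R-good , doneR , R-len) = Third.refined R R-good doneR U-len R-len

  refine : Refined k ψ C F₀ t
  refine = from (greedy gap _ DoneU (suc ψ) (s≤s z≤n) stepU)
    where
    from : Σ (List (Elem n)) (λ U → All (λ u → D u ≡ true) U × DoneU U × length U * suc ψ ≤ gap []) → Refined k ψ C F₀ t
    from (U , U⊆D , doneU , U-len) = Second.refine₂ U U⊆D doneU U-len

-- Encoding the container data by marked tokens

anyV-cong : ∀ {n} {p q : Elem n → Bool} → (∀ x → p x ≡ q x) → anyV p ≡ anyV q
anyV-cong {zero} h = h []
anyV-cong {suc n} h = cong₂ _∨_ (anyV-cong {n} λ v → h (0F ∷ v))
  (cong₂ _∨_ (anyV-cong {n} λ v → h (1F ∷ v)) (anyV-cong {n} λ v → h (2F ∷ v)))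

allV-cong : ∀ {n} {p q : Elem n → Bool} → (∀ x → p x ≡ q x) → allV p ≡ allV q
allV-cong {n} h = cong not (anyV-cong {n} λ x → cong not (h x))

extendF-cong : ∀ {n} {F F′ U U′ : Elem n → Bool} → (∀ y → F y ≡ F′ y) → (∀ y → U y ≡ U′ y) →
               ∀ y → extendF F U y ≡ extendF F′ U′ y
extendF-cong {n} f u y = cong₂ _∨_ (f y) (anyV-cong {n} λ z → cong (_∧ cov y z) (u z))

upto-cong : ∀ {n} k ψ {F F′ : Elem n → Bool} → (∀ y → F y ≡ F′ y) → ∀ x → upto k ψ F x ≡ upto k ψ F′ x
upto-cong {n} k ψ f x = cong (λ d → rk k x ∧ ⌊ d ≤? ψ ⌋) (∑-cong (allElems n) λ y → cong (λ b → ⟦ cov y x ⟧ * ⟦ not b ⟧) (f y))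

prune-cong : ∀ {n} {S S′ R R′ : Elem n → Bool} → (∀ y → S y ≡ S′ y) → (∀ y → R y ≡ R′ y) →
             ∀ x → prune S R x ≡ prune S′ R′ x
prune-cong {n} s r x = cong₂ (λ a b → a ∧ not b) (s x) (anyV-cong {n} λ y → cong (_∧ cov y x) (r y))

enlarge-cong : ∀ {n} k ψ {F F′ S S′ : Elem n → Bool} → (∀ y → F y ≡ F′ y) → (∀ y → S y ≡ S′ y) →
               ∀ y → enlarge k ψ F S y ≡ enlarge k ψ F′ S′ y
enlarge-cong {n} k ψ f s y = cong₂ (λ a l → a ∨ (⌊ suc (rank y) ≟ k ⌋ ∧ ⌊ ψ <? l ⌋)) (f y)
  (∑-cong (allElems n) λ x → cong (λ b → ⟦ b ⟧ * ⟦ cov y x ⟧) (s x))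

closure-cong : ∀ {n} k {F F′ X X′ : Elem n → Bool} → (∀ y → F y ≡ F′ y) → (∀ y → X y ≡ X′ y) →
               ∀ x → closure k F X x ≡ closure k F′ X′ x
closure-cong {n} k f e x = cong (rk k x ∧_) (allV-cong {n} λ y → cong₂ (λ a b → cov y x ⇒ᵇ (a ∨ b)) (f y) (e y))

pattern 3F = suc 2F
pattern 4F = suc 3F
pattern 5F = suc 4F

-- The marks 1, 2, 3, 4, 5 carry T₀, the missing neighbours of T₀, U, R and the part of G outside F₂.
module _ {n : ℕ} (k ψ : ℕ) (q : Mark → Elem n → Bool) where
  -- The decoder does not know the hull. For upper covers of points of T, however, belonging to the
  -- hull is the same as not being listed under mark 2, and this suffices to rebuild `twins`, from
  -- which the rest follows.
  decF₀ decF₁ decS decF₂ : Elem n → Bool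
  decF₀ y = anyV λ z → q 1F z ∧ anyV λ x → (rk k x ∧ not (q 2F x)) ∧ (cov z x ∧ cov y x)
  decF₁ = extendF decF₀ (q 3F)
  decS = prune (upto k ψ decF₁) (q 4F)
  decF₂ = enlarge k ψ decF₁ decS

  -- With `false` the container is the approximation S. With `true` the points of ∂C outside `F₂`
  -- are listed too, and the container is the hull itself.
  decode : Bool → Elem n → Bool
  decode false = decS
  decode true = closure k decF₂ (q 5F)

module _ {n : ℕ} (k ψ : ℕ) {q q′ : Mark → Elem n → Bool} (e : ∀ m → m ≢ zero → ∀ y → q m y ≡ q′ m y) where
  decF₀-cong : ∀ y → decF₀ k ψ q y ≡ decF₀ k ψ q′ y
  decF₀-cong y = anyV-cong {n} λ z → cong₂ _∧_ (e 1F (λ ()) z)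
    (anyV-cong {n} λ x → cong (λ b → (rk k x ∧ not b) ∧ (cov z x ∧ cov y x)) (e 2F (λ ()) x))

  decF₁-cong : ∀ y → decF₁ k ψ q y ≡ decF₁ k ψ q′ y
  decF₁-cong = extendF-cong {F = decF₀ k ψ q} decF₀-cong (e 3F (λ ()))

  decS-cong : ∀ x → decS k ψ q x ≡ decS k ψ q′ x
  decS-cong = prune-cong (upto-cong k ψ {decF₁ k ψ q} decF₁-cong) (e 4F (λ ()))

  decode-cong : ∀ b x → decode k ψ q b x ≡ decode k ψ q′ b x
  decode-cong false = decS-cong
  decode-cong true = closure-cong k (enlarge-cong k ψ {decF₁ k ψ q} {S = decS k ψ q} decF₁-cong decS-cong) (e 5F (λ ()))

mark : ∀ {n} → Mark → List (Elem n) → List (Token n)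
mark m = map (_, m)

tokens : ∀ {n} → (T M U R X : List (Elem n)) → List (Token n)
tokens T M U R X = mark 1F T ++ (mark 2F M ++ (mark 3F U ++ (mark 4F R ++ mark 5F X)))

length-tokens : ∀ {n} (T M U R X : List (Elem n)) →
  length (tokens T M U R X) ≡ length T + (length M + (length U + (length R + length X)))
length-tokens T M U R X = trans (length-++ (mark 1F T)) (cong₂ _+_ (length-map _ T)
  (trans (length-++ (mark 2F M)) (cong₂ _+_ (length-map _ M)
  (trans (length-++ (mark 3F U)) (cong₂ _+_ (length-map _ U)
  (trans (length-++ (mark 4F R)) (cong₂ _+_ (length-map _ R) (length-map _ X))))))))

anyL-++ : {A : Set} (p : A → Bool) (xs ys : List A) → anyL p (xs ++ ys) ≡ anyL p xs ∨ anyL p ys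
anyL-++ p [] ys = refl
anyL-++ p (x ∷ xs) ys = trans (cong (p x ∨_) (anyL-++ p xs ys)) (sym (Data.Bool.Properties.∨-assoc (p x) _ _))

marked-mark : ∀ {n} m (L : List (Elem n)) y → marked m (mark m L) y ≡ mem L y
marked-mark m [] y = refl
marked-mark m (z ∷ L) y = cong₂ _∨_
  (trans (cong (eqV z y ∧_) (⌊⌋⁺ (m Data.Fin.≟ m) refl)) (Data.Bool.Properties.∧-identityʳ (eqV z y))) (marked-mark m L y)

marked-other : ∀ {n} m m′ (L : List (Elem n)) y → m′ ≢ m → marked m (mark m′ L) y ≡ false
marked-other m m′ [] y ne = refl
marked-other m m′ (z ∷ L) y ne = cong₂ _∨_
  (trans (cong (eqV z y ∧_) (¬-not λ e → ne (⌊⌋⁻ (m′ Data.Fin.≟ m) e))) (∧-zeroʳ (eqV z y))) (marked-other m m′ L y ne)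

module _ {n : ℕ} (T M U R X : List (Elem n)) (y : Elem n) where
  marked-tokens : ∀ m → marked m (tokens T M U R X) y ≡
    marked m (mark 1F T) y ∨ (marked m (mark 2F M) y ∨ (marked m (mark 3F U) y ∨ (marked m (mark 4F R) y ∨ marked m (mark 5F X) y)))
  marked-tokens m = trans (anyL-++ p (mark 1F T) _) (cong (marked m (mark 1F T) y ∨_)
    (trans (anyL-++ p (mark 2F M) _) (cong (marked m (mark 2F M) y ∨_)
    (trans (anyL-++ p (mark 3F U) _) (cong (marked m (mark 3F U) y ∨_) (anyL-++ p (mark 4F R) _))))))
    where
    p : Token n → Bool
    p t = eqV (proj₁ t) y ∧ ⌊ proj₂ t Data.Fin.≟ m ⌋

  marked₁ : marked 1F (tokens T M U R X) y ≡ mem T y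
  marked₁ rewrite marked-tokens 1F | marked-mark 1F T y | marked-other 1F 2F M y (λ ()) | marked-other 1F 3F U y (λ ())
    | marked-other 1F 4F R y (λ ()) | marked-other 1F 5F X y (λ ()) = Data.Bool.Properties.∨-identityʳ (mem T y)

  marked₂ : marked 2F (tokens T M U R X) y ≡ mem M y
  marked₂ rewrite marked-tokens 2F | marked-mark 2F M y | marked-other 2F 1F T y (λ ()) | marked-other 2F 3F U y (λ ())
    | marked-other 2F 4F R y (λ ()) | marked-other 2F 5F X y (λ ()) = Data.Bool.Properties.∨-identityʳ (mem M y)

  marked₃ : marked 3F (tokens T M U R X) y ≡ mem U y
  marked₃ rewrite marked-tokens 3F | marked-mark 3F U y | marked-other 3F 1F T y (λ ()) | marked-other 3F 2F M y (λ ())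
    | marked-other 3F 4F R y (λ ()) | marked-other 3F 5F X y (λ ()) = Data.Bool.Properties.∨-identityʳ (mem U y)

  marked₄ : marked 4F (tokens T M U R X) y ≡ mem R y
  marked₄ rewrite marked-tokens 4F | marked-mark 4F R y | marked-other 4F 1F T y (λ ()) | marked-other 4F 2F M y (λ ())
    | marked-other 4F 3F U y (λ ()) | marked-other 4F 5F X y (λ ()) = Data.Bool.Properties.∨-identityʳ (mem R y)

  marked₅ : marked 5F (tokens T M U R X) y ≡ mem X y
  marked₅ rewrite marked-tokens 5F | marked-mark 5F X y | marked-other 5F 1F T y (λ ()) | marked-other 5F 2F M y (λ ())
    | marked-other 5F 3F U y (λ ()) | marked-other 5F 4F R y (λ ()) = refl

tokens-∈ : ∀ {n} {T M U R X : List (Elem n)} {ℓ} {P : Elem n → Set ℓ} → (∀ y → y ∈ T → P y) → (∀ y → y ∈ M → P y) →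
  (∀ y → y ∈ U → P y) → (∀ y → y ∈ R → P y) → (∀ y → y ∈ X → P y) → ∀ t → t ∈ tokens T M U R X → P (proj₁ t)
tokens-∈ {T = T} {M} {U} {R} a b c d e t m with ∈-++⁻ (mark 1F T) m
... | inj₁ q with ∈-map⁻ _ q
...   | y , r , refl = a y r
tokens-∈ {T = T} {M} {U} {R} a b c d e t m | inj₂ q with ∈-++⁻ (mark 2F M) q
... | inj₁ q with ∈-map⁻ _ q
...   | y , r , refl = b y r
tokens-∈ {T = T} {M} {U} {R} a b c d e t m | inj₂ _ | inj₂ q with ∈-++⁻ (mark 3F U) q
... | inj₁ q with ∈-map⁻ _ q
...   | y , r , refl = c y r
tokens-∈ {T = T} {M} {U} {R} a b c d e t m | inj₂ _ | inj₂ _ | inj₂ q with ∈-++⁻ (mark 4F R) q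
... | inj₁ q with ∈-map⁻ _ q
...   | y , r , refl = d y r
tokens-∈ {T = T} {M} {U} {R} a b c d e t m | inj₂ _ | inj₂ _ | inj₂ _ | inj₂ q with ∈-map⁻ _ q
... | y , r , refl = e y r

-- `Λ` separates the two outcomes. If at least 2t/Λ points of ∂C escape `F₂`, then S is smaller than
-- ∂C by about that amount. Otherwise listing them adds at most 2t/Λ tokens, and the exact hull is
-- smaller by all of t.
record Encoding {n} (k ψ m₁ h ρ c Λ : ℕ) (C : Elem n → Bool) (g t : ℕ) : Set where
  field
    bit : Bool
    W : List (Token n)
    W-near : ∀ s → s ∈ W → Σ (Elem n) λ x → C x ≡ true × Near 3 x (proj₁ s)
    C-near : ∀ x → C x ≡ true → Σ (Token n) λ s → s ∈ W × Near 3 x (proj₁ s)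
    C⊆ : ∀ x → C x ≡ true → decode k ψ (λ m → marked m W) bit x ≡ true
    τ u w e po le : ℕ
    W-length : length W ≤ τ + τ * m₁ + u + w + e
    τ≤ : τ ≤ h * ρ
    u≤ : u * suc ψ ≤ 2 * t + (32 * po + le)
    po≤ : po * m₁ ≤ t * (2 * n)
    le≤ : le * 2 ^ ρ ≤ t * (c * n)
    w≤ : w * suc ψ ≤ 2 * t
    outcome : (bit ≡ false × e ≡ 0 × n * Λ * card (decode k ψ (λ m → marked m W) bit) + 2 * n * t ≤ n * Λ * g + 12 * Λ * (t * ψ)) ⊎
              (bit ≡ true × Λ * e ≤ 2 * t × card (decode k ψ (λ m → marked m W) bit) + t ≤ g)

module Encode {n : ℕ} (k c ψ m₁ h ρ Λ : ℕ) (n>0 : 0 < n) (6ψ≤n : 6 * ψ ≤ n) (C : Elem n → Bool) (t : ℕ)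
  (C-rank : ∀ x → C x ≡ true → rank x ≡ k)
  (deg : ∀ (x : Elem n) → rank x ≡ k → n ≤ 2 * ∑V (λ y → ⟦ cov y x ⟧))
  (D+t : card (hull k C) + t ≡ card (shadow C))
  (A : Approx k m₁ h ρ c C t)
  (B : Refined k ψ C (twins (hull k C) (Approx.T A)) t) where

  open Sums n
  open Approx A
  open Refined B

  G D : Elem n → Bool
  G = shadow C
  D = hull k C

  D-rank : ∀ x → D x ≡ true → rank x ≡ k
  D-rank x h = rk⁻ k x (proj₁ (∧-split h))

  C⊆D : ∀ x → C x ≡ true → D x ≡ true
  C⊆D x h = ∧-join (rk⁺ k x (C-rank x h)) (allV⁺ _ λ y → ⇒ᵇ⁺ {cov y x} (shadow⁺ C y x h))

  ⟦⟧-pos : ∀ b → 0 < ⟦ b ⟧ → b ≡ true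
  ⟦⟧-pos true _ = refl

  ⟦⟧*-pos : ∀ a b → 0 < ⟦ a ⟧ * ⟦ b ⟧ → a ≡ true × b ≡ true
  ⟦⟧*-pos true true _ = refl , refl

  NearC : ℕ → Elem n → Set
  NearC r y = Σ (Elem n) λ x → C x ≡ true × Near r x y

  relax : ∀ {r s y} → r ≤ s → NearC r y → NearC s y
  relax h (x , p , q) = x , p , near-weaken h q

  C-of-G : ∀ y → G y ≡ true → NearC 1 y
  C-of-G y g = let (x , p , e) = shadow⁻ C y g in x , p , hop y (touch-down x y e) nil

  half-pos : ∀ {m} → 0 < 2 * m → 0 < m
  half-pos {suc m} _ = s≤s z≤n

  C-of-D : ∀ x → D x ≡ true → NearC 2 x
  C-of-D x d =
    let (y , p) = ∑V-pos (λ y → ⟦ cov y x ⟧) (half-pos (≤-trans n>0 (deg x (D-rank x d))))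
        e = ⟦⟧-pos (cov y x) p
        (z , q , nz) = C-of-G y (⇒ᵇ⁻ (allV⁻ _ (proj₂ (∧-split {rk k x} d)) y) e)
    in z , q , near-snoc x nz (touch-up y x e)

  T-near : ∀ y → y ∈ T → NearC 3 y
  T-near y m = relax (s≤s z≤n) (C-of-G y (T⇒G y m))

  M-near : ∀ y → y ∈ Ms → NearC 3 y
  M-near y m =
    let (z , mz , e , _) = Ms⁻ y m
        (x , p , q) = C-of-G z (T⇒G z mz)
    in relax (s≤s (s≤s z≤n)) (x , p , near-snoc y q (touch-up z y e))

  U-near : ∀ y → y ∈ U → NearC 3 y
  U-near y m = relax (s≤s (s≤s z≤n)) (C-of-D y (U⊆D y m))

  -- `x` has at least n/2 lower covers, of which at most ψ ≤ n/6 lie outside `F₁`.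
  touch-F₁ : ∀ x → rank x ≡ k → defect F₁ x ≤ ψ → Σ (Elem n) λ y → cov y x ≡ true × F₁ y ≡ true
  touch-F₁ x r d =
    let (y , p) = ∑V-pos (λ y → ⟦ cov y x ⟧ * ⟦ F₁ y ⟧) (from part ψ n≤ 2ψ≤)
    in y , ⟦⟧*-pos (cov y x) (F₁ y) p
    where
    part : ℕ
    part = ∑V (λ y → ⟦ cov y x ⟧ * ⟦ F₁ y ⟧)
    go : ∀ a f → ⟦ a ⟧ ≡ ⟦ a ⟧ * ⟦ f ⟧ + ⟦ a ⟧ * ⟦ not f ⟧
    go true true = refl
    go true false = refl
    go false f = refl
    split : ∑V (λ y → ⟦ cov y x ⟧) ≡ part + defect F₁ x
    split = trans (∑V-cong λ y → go (cov y x) (F₁ y)) (∑V-+ _ _)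
    n≤ : n ≤ 2 * (part + ψ)
    n≤ = ≤-trans (deg x r) (*-monoʳ-≤ 2 (≤-trans (≤-reflexive split) (+-monoʳ-≤ part d)))
    arith : ∀ p → 2 * (2 * p) + 2 * p ≡ 6 * p
    arith = solve-∀
    2ψ≤ : 2 * ψ ≤ part
    2ψ≤ = *-cancelˡ-≤′ 2 (s≤s z≤n) (+-cancelʳ-≤ (2 * ψ) _ _ (≤-trans (≤-reflexive (arith ψ))
            (≤-trans 6ψ≤n (≤-trans n≤ (≤-reflexive (*-distribˡ-+ 2 part ψ))))))
    from : ∀ p q → n ≤ 2 * (p + q) → 2 * q ≤ p → 0 < p
    from (suc p) q _ _ = s≤s z≤n
    from zero zero a _ = ≤-trans n>0 a

  -- From C down to `y′`, up to `x`, down to `y`: here, as in `via-T`, the full radius 3 of the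
  -- encoding is used.
  R-near′ : ∀ y → y ∈ R → NearC 3 y
  R-near′ y m =
    let (x , r , d , e) = R-near y m
        (y′ , e′ , f) = touch-F₁ x r d
        (z , p , q) = C-of-G y′ (F₁⇒G y′ f)
    in z , p , near-snoc y (near-snoc x q (touch-up y′ x e′)) (touch-down x y e)

  X-near : ∀ y → rest y ≡ true → NearC 3 y
  X-near y h = relax (s≤s z≤n) (C-of-G y (proj₁ (∧-split h)))

  via-T : ∀ X x y → cov y x ≡ true → twins D T y ≡ true → Σ (Token n) λ s → s ∈ tokens T Ms U R X × Near 3 x (proj₁ s)
  via-T X x y e f₀ =
    let (z , q) = anyV⁻ (λ z → mem T z ∧ twin D z y) f₀
        (mz , p) = ∧-split {mem T z} q
        (x′ , w) = anyV⁻ (λ x → D x ∧ (cov z x ∧ cov y x)) p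
        (a , b) = ∧-split {cov z x′} (proj₂ (∧-split {D x′} w))
    in (z , 1F) , ∈-++⁺ˡ (∈-map⁺ _ (mem⁻ T z mz)) ,
       hop y (touch-down x y e) (hop x′ (touch-up y x′ b) (hop z (touch-down x′ z a) nil))

  via-U : ∀ X x y → cov y x ≡ true → anyV (λ u → mem U u ∧ cov y u) ≡ true →
          Σ (Token n) λ s → s ∈ tokens T Ms U R X × Near 3 x (proj₁ s)
  via-U X x y e f =
    let (u , q) = anyV⁻ (λ u → mem U u ∧ cov y u) f
        (m , e′) = ∧-split {mem U u} q
    in (u , 3F) , ∈-++⁺ʳ (mark 1F T) (∈-++⁺ʳ (mark 2F Ms) (∈-++⁺ˡ (∈-map⁺ _ (mem⁻ U u m)))) ,
       near-weaken (s≤s (s≤s z≤n)) (hop y (touch-down x y e) (hop u (touch-up y u e′) nil))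

  C-near : ∀ X x → C x ≡ true → Σ (Token n) λ s → s ∈ tokens T Ms U R X × Near 3 x (proj₁ s)
  C-near X x cx = let (y , e , f) = touch-F₁ x (C-rank x cx) (D-defect x (C⊆D x cx)) in
    Data.Sum.[ via-T X x y e , via-U X x y e ] (∨-split {twins D T y} f)

  inner : List (Elem n) → Elem n → Elem n → Elem n → Bool
  inner X y z x = (rk k x ∧ not (marked 2F (tokens T Ms U R X) x)) ∧ (cov z x ∧ cov y x)

  is-D : ∀ z x → mem T z ≡ true → cov z x ≡ true → mem Ms x ≡ false → D x ≡ true ⊎ D x ≡ false → D x ≡ true
  is-D z x mz e nm (inj₁ d) = d
  is-D z x mz e nm (inj₂ d) = ⊥-elim (true≢false (mem⁺ Ms x (Ms⁺ z x (mem⁻ T z mz) e d)) nm)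

  same-x : ∀ X y z x → mem T z ≡ true → inner X y z x ≡ D x ∧ (cov z x ∧ cov y x)
  same-x X y z x mz = bool-ext
    (λ h → let (h₁ , h₂) = ∧-split {rk k x ∧ not (marked 2F (tokens T Ms U R X) x)} h
               (r , nm) = ∧-split {rk k x} h₁
           in ∧-join (is-D z x mz (proj₁ (∧-split h₂)) (trans (sym (marked₂ T Ms U R X x)) (not-split nm)) (bool-case (D x))) h₂)
    (λ h → let (d , h₂) = ∧-split {D x} h
           in ∧-join (∧-join (rk⁺ k x (D-rank x d)) (not-join λ w →
                true≢false d (proj₂ (proj₂ (proj₂ (Ms⁻ x (mem⁻ Ms x (trans (sym (marked₂ T Ms U R X x)) w)))))))) h₂)

  guarded : ∀ X y z → mem T z ≡ true ⊎ mem T z ≡ false → mem T z ∧ anyV (inner X y z) ≡ mem T z ∧ twin D z y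
  guarded X y z (inj₁ e) = cong (mem T z ∧_) (anyV-cong {n} λ x → same-x X y z x e)
  guarded X y z (inj₂ e) = trans (cong (_∧ anyV (inner X y z)) e) (sym (cong (_∧ twin D z y) e))

  q : List (Elem n) → Mark → Elem n → Bool
  q X m = marked m (tokens T Ms U R X)

  decF₀-correct : ∀ X y → decF₀ k ψ (q X) y ≡ twins D T y
  decF₀-correct X y = anyV-cong {n} λ z →
    trans (cong (_∧ anyV (inner X y z)) (marked₁ T Ms U R X z)) (guarded X y z (bool-case (mem T z)))

  decF₁-correct : ∀ X y → decF₁ k ψ (q X) y ≡ F₁ y
  decF₁-correct X = extendF-cong {F = decF₀ k ψ (q X)} (decF₀-correct X) (marked₃ T Ms U R X)

  decS-correct : ∀ X x → decS k ψ (q X) x ≡ S x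
  decS-correct X = prune-cong (upto-cong k ψ {decF₁ k ψ (q X)} (decF₁-correct X)) (marked₄ T Ms U R X)

  decF₂-correct : ∀ X y → decF₂ k ψ (q X) y ≡ F₂ y
  decF₂-correct X = enlarge-cong k ψ {decF₁ k ψ (q X)} {S = decS k ψ (q X)} (decF₁-correct X) (decS-correct X)

  restList : List (Elem n)
  restList = filter (λ y → rest y Data.Bool.≟ true) (allElems n)

  mem-rest : ∀ y → mem restList y ≡ rest y
  mem-rest y = bool-ext
    (λ h → proj₂ (∈-filter⁻ (λ y → rest y Data.Bool.≟ true) {xs = allElems n} (mem⁻ restList y h)))
    (λ h → mem⁺ restList y (∈-filter⁺ (λ y → rest y Data.Bool.≟ true) (allElems-complete y) h))

  length-rest : length restList ≡ card rest
  length-rest = trans (length-filter≡∑ (λ y → rest y Data.Bool.≟ true) (allElems n))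
    (∑V-cong λ y → cong ⟦_⟧ (does-≟true (rest y)))

  closure-correct : ∀ x → decode k ψ (q restList) true x ≡ D x
  closure-correct x = trans (closure-cong k {decF₂ k ψ (q restList)} (decF₂-correct restList)
      (λ y → trans (marked₅ T Ms U R restList y) (mem-rest y)) x) (closure⇔D x)

  W-bound : ∀ X → length (tokens T Ms U R X) ≤ length T + length T * m₁ + length U + length R + length X
  W-bound X = ≤-trans (≤-reflexive (length-tokens T Ms U R X)) (≤-trans (+-monoʳ-≤ (length T) (+-monoˡ-≤ _ Ms-len))
    (≤-reflexive (arith (length T) (length T * m₁) (length U) (length R) (length X))))
    where
    arith : ∀ a b c d e → a + (b + (c + (d + e))) ≡ a + b + c + d + e
    arith = solve-∀

  encode-by : 2 * t ≤ Λ * card rest ⊎ Λ * card rest ≤ 2 * t → Encoding k ψ m₁ h ρ c Λ C (card G) t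
  encode-by (inj₁ big) = record
    { bit = false ; W = tokens T Ms U R []
    ; W-near = tokens-∈ T-near M-near U-near R-near′ (λ y ())
    ; C-near = C-near []
    ; C⊆ = λ x cx → trans (decS-correct [] x) (D⊆S x (C⊆D x cx))
    ; τ = length T ; u = length U ; w = length R ; e = 0 ; po = po ; le = le
    ; W-length = W-bound []
    ; τ≤ = T-len ; u≤ = ≤-trans U-len left≤ ; po≤ = po≤ ; le≤ = le≤ ; w≤ = R-len
    ; outcome = inj₁ (refl , refl , (begin
        n * Λ * card (decS k ψ (q [])) + 2 * n * t ≡⟨ cong (λ s → n * Λ * s + 2 * n * t) (card-cong (decS-correct [])) ⟩
        n * Λ * card S + 2 * n * t ≡⟨ arith₁ n Λ (card S) t ⟩
        Λ * (n * card S) + n * (2 * t) ≤⟨ +-mono-≤ (*-monoʳ-≤ Λ size) (*-monoʳ-≤ n big) ⟩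
        Λ * (n * card F₂ + 12 * (t * ψ)) + n * (Λ * card rest) ≡⟨ arith₂ n Λ (card F₂) (card rest) (t * ψ) ⟩
        n * Λ * (card F₂ + card rest) + 12 * Λ * (t * ψ) ≡⟨ cong (λ s → n * Λ * s + 12 * Λ * (t * ψ)) card-split ⟩
        n * Λ * card G + 12 * Λ * (t * ψ) ∎))
    }
    where
    open ≤-Reasoning
    arith₁ : ∀ n l s t → n * l * s + 2 * n * t ≡ l * (n * s) + n * (2 * t)
    arith₁ = solve-∀
    arith₂ : ∀ n l f r p → l * (n * f + 12 * p) + n * (l * r) ≡ n * l * (f + r) + 12 * l * p
    arith₂ = solve-∀
  encode-by (inj₂ small) = record
    { bit = true ; W = tokens T Ms U R restList
    ; W-near = tokens-∈ T-near M-near U-near R-near′ λ y m →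
        X-near y (proj₂ (∈-filter⁻ (λ y → rest y Data.Bool.≟ true) {xs = allElems n} m))
    ; C-near = C-near restList
    ; C⊆ = λ x cx → trans (closure-correct x) (C⊆D x cx)
    ; τ = length T ; u = length U ; w = length R ; e = card rest ; po = po ; le = le
    ; W-length = ≤-trans (W-bound restList) (+-monoʳ-≤ (length T + length T * m₁ + length U + length R) (≤-reflexive length-rest))
    ; τ≤ = T-len ; u≤ = ≤-trans U-len left≤ ; po≤ = po≤ ; le≤ = le≤ ; w≤ = R-len
    ; outcome = inj₂ (refl , small , ≤-reflexive (trans (cong (_+ t) (card-cong {decode k ψ (q restList) true} {D} closure-correct)) D+t))
    }

  encode : Encoding k ψ m₁ h ρ c Λ C (card G) t
  encode = encode-by (≤-total (2 * t) (Λ * card rest))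

encoding : ∀ {n} (k c M : ℕ) (wt : Elem n → Elem n → ℕ) → Weights k c M wt → 8 ≤ n →
  (C : Elem n → Bool) → (∀ x → C x ≡ true → rank x ≡ k) → ∀ ψ m₁ h ρ Λ → 6 * ψ ≤ n →
  n * n < 32 * card (shadow C) → 32 * card (shadow C) ∸ n * n ≤ h * (n * n) →
  Encoding k ψ m₁ h ρ c Λ C (card (shadow C)) (card (shadow C) ∸ card (hull k C))
encoding k c M wt Wt n≥8 C C-rank ψ m₁ h ρ Λ 6ψ≤n large h-ok =
  Encode.encode k c ψ m₁ h ρ Λ (≤-trans (s≤s z≤n) n≥8) 6ψ≤n C _ C-rank (Weights.deg Wt)
    (Closure.G≡D+t k c M wt Wt n≥8 C C-rank) A
    (Refine.refine k c M wt Wt n≥8 C C-rank ψ 6ψ≤n (twins (hull k C) (Approx.T A)) (Approx.F₀⇒G A))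
  where
  A : Approx k m₁ h ρ c C (card (shadow C) ∸ card (hull k C))
  A = Closure.FirstApprox.approx k c M wt Wt n≥8 C C-rank m₁ h ρ large h-ok

-- Expansion of components with small shadow

without : ∀ {n} → (Elem n → Bool) → Elem n → Elem n → Bool
without X x y = X y ∧ not (eqV x y)

∑-without : ∀ {n} (X : Elem n → Bool) x → X x ≡ true → (f : Elem n → ℕ) →
  ∑V (λ y → ⟦ without X x y ⟧ * f y) + f x ≡ ∑V (λ y → ⟦ X y ⟧ * f y)
∑-without {n} X x h f = trans (cong (∑V (λ y → ⟦ without X x y ⟧ * f y) +_) (sym (∑-eqVˡ x f)))
  (trans (sym (∑V-+ _ _)) (∑V-cong pointwise))
  where
  open Sums n
  go : ∀ a b m → (b ≡ true → a ≡ true) → ⟦ a ∧ not b ⟧ * m + ⟦ b ⟧ * m ≡ ⟦ a ⟧ * m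
  go a true m h rewrite h refl = refl
  go true false m h = +-identityʳ _
  go false false m h = refl
  pointwise : ∀ y → ⟦ without X x y ⟧ * f y + ⟦ eqV x y ⟧ * f y ≡ ⟦ X y ⟧ * f y
  pointwise y = go (X y) (eqV x y) (f y) λ e → subst (λ u → X u ≡ true) (eqV⁻ x y e) h

card-without : ∀ {n} (X : Elem n → Bool) x → X x ≡ true → suc (card (without X x)) ≡ card X
card-without {n} X x h = trans (+-comm 1 _) (trans (cong (_+ 1) (sym (∑V-cong λ y → *-identityʳ ⟦ without X x y ⟧)))
  (trans (∑-without X x h (λ _ → 1)) (∑V-cong λ y → *-identityʳ ⟦ X y ⟧)))
  where open Sums n

module Peel {n : ℕ} (B : ℕ) where
  open Sums n

  dx : (Elem n → Bool) → Elem n → ℕ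
  dx Y x = ∑V (λ y → ⟦ Y y ⟧ * ⟦ cov y x ⟧)

  edges : (X Y : Elem n → Bool) → ℕ
  edges X Y = ∑V (λ x → ⟦ X x ⟧ * dx Y x)

  edges′ : ∀ X Y → edges X Y ≡ ∑V (λ y → ⟦ Y y ⟧ * load X y)
  edges′ X Y = trans (∑V-pull (λ x → ⟦ X x ⟧) (λ x y → ⟦ Y y ⟧ * ⟦ cov y x ⟧))
    (∑V-cong λ y → trans (∑V-cong λ x → rearr ⟦ X x ⟧ ⟦ Y y ⟧ ⟦ cov y x ⟧) (∑V-*ˡ ⟦ Y y ⟧ _))
    where
    rearr : ∀ a b c → a * (b * c) ≡ b * (a * c)
    rearr = solve-∀

  -- An edge density that survives deletions: removing x with fewer than n/4 edges lowers the left
  -- side by nB and the right side by less, and removing y with fewer than n/(4B) edges lowers them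
  -- by n and by less. Strictness keeps an edge to the end, hence a starting point `x₀`.
  Dense : (X Y : Elem n → Bool) → Set
  Dense X Y = n * B * card X + n * card Y < 4 * B * edges X Y

  record Core (X₀ : Elem n → Bool) : Set where
    field
      X Y : Elem n → Bool
      X⊆ : ∀ x → X x ≡ true → X₀ x ≡ true
      x₀ : Elem n
      x₀∈X : X x₀ ≡ true
      X-deg : ∀ x → X x ≡ true → n ≤ 4 * dx Y x
      Y-deg : ∀ y → Y y ≡ true → n ≤ 4 * B * load X y

  peel : ∀ fuel X₀ X Y → card X + card Y ≤ fuel → (∀ x → X x ≡ true → X₀ x ≡ true) → Dense X Y → Core X₀
  peel fuel X₀ X Y h sub dense =
    branch fuel h (bool-case (anyV λ x → X x ∧ ⌊ 4 * dx Y x <? n ⌋)) (bool-case (anyV λ y → Y y ∧ ⌊ 4 * B * load X y <? n ⌋))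
    where
    open ≤-Reasoning
    branch : ∀ fuel → card X + card Y ≤ fuel →
      anyV (λ x → X x ∧ ⌊ 4 * dx Y x <? n ⌋) ≡ true ⊎ anyV (λ x → X x ∧ ⌊ 4 * dx Y x <? n ⌋) ≡ false →
      anyV (λ y → Y y ∧ ⌊ 4 * B * load X y <? n ⌋) ≡ true ⊎ anyV (λ y → Y y ∧ ⌊ 4 * B * load X y <? n ⌋) ≡ false → Core X₀
    branch fuel h (inj₁ e) _ with anyV⁻ (λ x → X x ∧ ⌊ 4 * dx Y x <? n ⌋) e
    ... | x , q with ∧-split {X x} q
    ... | xx , l with fuel
    ...   | zero = ⊥-elim (<⇒≱ (subst (0 <_) (cong (_+ card Y) (card-without X x xx)) (s≤s z≤n)) h)
    ...   | suc fuel′ = peel fuel′ X₀ (without X x) Y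
        (≤-pred (subst (_≤ suc fuel′) (cong (_+ card Y) (sym (card-without X x xx))) h))
        (λ y p → sub y (proj₁ (∧-split p)))
        (+-cancelʳ-< (n * B) _ _ (begin-strict
          n * B * card (without X x) + n * card Y + n * B ≡⟨ arith (n * B) (card (without X x)) (n * card Y) ⟩
          n * B * suc (card (without X x)) + n * card Y ≡⟨ cong (λ c → n * B * c + n * card Y) (card-without X x xx) ⟩
          n * B * card X + n * card Y <⟨ dense ⟩
          4 * B * edges X Y ≡⟨ cong (4 * B *_) (sym (∑-without X x xx (dx Y))) ⟩
          4 * B * (edges (without X x) Y + dx Y x) ≡⟨ arith′ B (edges (without X x) Y) (dx Y x) ⟩
          4 * B * edges (without X x) Y + 4 * dx Y x * B ≤⟨ +-monoʳ-≤ (4 * B * edges (without X x) Y) (*-monoˡ-≤ B (<⇒≤ (⌊⌋⁻ (4 * dx Y x <? n) l))) ⟩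
          4 * B * edges (without X x) Y + n * B ∎))
      where
      arith : ∀ m c d → m * c + d + m ≡ m * suc c + d
      arith = solve-∀
      arith′ : ∀ b e d → 4 * b * (e + d) ≡ 4 * b * e + 4 * d * b
      arith′ = solve-∀
    branch fuel h (inj₂ _) (inj₁ e) with anyV⁻ (λ y → Y y ∧ ⌊ 4 * B * load X y <? n ⌋) e
    ... | y , q with ∧-split {Y y} q
    ... | yy , l with fuel
    ...   | zero = ⊥-elim (<⇒≱ (subst (0 <_) (trans (sym (+-suc (card X) _)) (cong (card X +_) (card-without Y y yy))) (s≤s z≤n)) h)
    ...   | suc fuel′ = peel fuel′ X₀ X (without Y y)
        (≤-pred (subst (_≤ suc fuel′) (trans (cong (card X +_) (sym (card-without Y y yy))) (+-suc (card X) _)) h))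
        sub
        (+-cancelʳ-< n _ _ (begin-strict
          n * B * card X + n * card (without Y y) + n ≡⟨ arith n (n * B * card X) (card (without Y y)) ⟩
          n * B * card X + n * suc (card (without Y y)) ≡⟨ cong (λ c → n * B * card X + n * c) (card-without Y y yy) ⟩
          n * B * card X + n * card Y <⟨ dense ⟩
          4 * B * edges X Y ≡⟨ cong (4 * B *_) (trans (edges′ X Y) (sym (∑-without Y y yy (load X)))) ⟩
          4 * B * (∑V (λ z → ⟦ without Y y z ⟧ * load X z) + load X y) ≡⟨ *-distribˡ-+ (4 * B) _ (load X y) ⟩
          4 * B * ∑V (λ z → ⟦ without Y y z ⟧ * load X z) + 4 * B * load X y
            ≤⟨ +-mono-≤ (≤-reflexive (cong (4 * B *_) (sym (edges′ X (without Y y))))) (<⇒≤ (⌊⌋⁻ (4 * B * load X y <? n) l)) ⟩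
          4 * B * edges X (without Y y) + n ∎))
      where
      arith : ∀ m c d → c + m * d + m ≡ c + m * suc d
      arith = solve-∀
    branch fuel h (inj₂ noX) (inj₂ noY) = record
      { X = X ; Y = Y ; X⊆ = sub
      ; x₀ = proj₁ seed
      ; x₀∈X = proj₂ seed
      ; X-deg = λ x xx → ≮⇒≥ λ l → true≢false (anyV⁺ (λ x → X x ∧ ⌊ 4 * dx Y x <? n ⌋) x (∧-join xx (⌊⌋⁺ (4 * dx Y x <? n) l))) noX
      ; Y-deg = λ y yy → ≮⇒≥ λ l → true≢false (anyV⁺ (λ y → Y y ∧ ⌊ 4 * B * load X y <? n ⌋) y (∧-join yy (⌊⌋⁺ (4 * B * load X y <? n) l))) noY
      }
      where
      pos-factor : ∀ a b → 0 < a * b → 0 < b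
      pos-factor a zero p = ⊥-elim (<⇒≱ p (≤-reflexive (*-zeroʳ a)))
      pos-factor a (suc b) p = s≤s z≤n
      is-true : ∀ b m → 0 < ⟦ b ⟧ * m → b ≡ true
      is-true true m _ = refl
      seed : Σ (Elem n) λ x → X x ≡ true
      seed = let (x , p) = ∑V-pos (λ x → ⟦ X x ⟧ * dx Y x) (pos-factor (4 * B) _ (≤-<-trans z≤n dense))
              in x , is-true (X x) (dx Y x) p

common-upper : ∀ {n} (y y′ : Elem n) → y ≢ y′ → card (λ x → cov y x ∧ cov y′ x) ≤ 1
common-upper y y′ ne = card-≤1 (λ x → cov y x ∧ cov y′ x) unique
  where
  unique : ∀ x x′ → cov y x ∧ cov y′ x ≡ true → cov y x′ ∧ cov y′ x′ ≡ true → x ≡ x′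
  unique x x′ p q with x ≟V x′
  ... | yes e = e
  ... | no r = ⊥-elim (ne (cov-unique r (proj₁ (∧-split {cov y x} p)) (proj₁ (∧-split {cov y x′} q))
                 (proj₂ (∧-split {cov y x} p)) (proj₂ (∧-split {cov y x′} q))))

eqV-no : ∀ {n} (x y : Elem n) → not (eqV x y) ≡ true → x ≢ y
eqV-no x y h refl = true≢false (eqV-refl x) (not-split h)

⟦⟧*-pos⁻ : ∀ a m → 0 < ⟦ a ⟧ * m → a ≡ true × 0 < m
⟦⟧*-pos⁻ true m h = refl , subst (0 <_) (+-identityʳ m) h

module Paths {n : ℕ} (k : ℕ) (X Y : Elem n → Bool) (X-rank : ∀ x → X x ≡ true → rank x ≡ k) (x₀ : Elem n) (x₀∈X : X x₀ ≡ true)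
  (α β : ℕ) (X-deg : ∀ x → X x ≡ true → α ≤ ∑V (λ y → ⟦ Y y ⟧ * ⟦ cov y x ⟧))
  (Y-deg : ∀ y → Y y ≡ true → β ≤ load X y) where

  open Sums n

  open ≤-Reasoning

  last-step : Elem n → ℕ
  last-step y₂ = ∑V (λ x₂ → ⟦ X x₂ ⟧ * (⟦ cov y₂ x₂ ⟧ * ⟦ not (linked x₂ x₀) ⟧))

  -- Upper covers of y₂ that are linked to x₀ are joins of y₂ with the middle elements of [z , x₀].
  linked-few : ∀ y₁ x₁ y₂ → cov y₁ x₀ ≡ true → cov y₁ x₁ ≡ true → cov y₂ x₁ ≡ true → x₁ ≢ x₀ → y₂ ≢ y₁ →
    ∑V (λ x₂ → ⟦ cov y₂ x₂ ⟧ * ⟦ linked x₂ x₀ ⟧) ≤ 2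
  linked-few y₁ x₁ y₂ a₀ a₁ a₂ x≢ y≢ with cov-meet {x = x₁} a₁ a₂ (λ e → y≢ (sym e))
  ... | z , b₁ , b₂ = begin
    ∑V (λ x₂ → ⟦ cov y₂ x₂ ⟧ * ⟦ linked x₂ x₀ ⟧) ≤⟨ ∑V-mono pointwise ⟩
    ∑V (λ x₂ → ∑V (λ y₃ → ⟦ cov z y₃ ⟧ * ⟦ cov y₃ x₀ ⟧ * ⟦ not (eqV y₂ y₃) ∧ (cov y₂ x₂ ∧ cov y₃ x₂) ⟧)) ≡⟨ ∑V-swap _ ⟩
    ∑V (λ y₃ → ∑V (λ x₂ → ⟦ cov z y₃ ⟧ * ⟦ cov y₃ x₀ ⟧ * ⟦ not (eqV y₂ y₃) ∧ (cov y₂ x₂ ∧ cov y₃ x₂) ⟧))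
      ≡⟨ ∑V-cong (λ y₃ → ∑V-*ˡ (⟦ cov z y₃ ⟧ * ⟦ cov y₃ x₀ ⟧) _) ⟩
    ∑V (λ y₃ → ⟦ cov z y₃ ⟧ * ⟦ cov y₃ x₀ ⟧ * ∑V (λ x₂ → ⟦ not (eqV y₂ y₃) ∧ (cov y₂ x₂ ∧ cov y₃ x₂) ⟧))
      ≤⟨ ∑V-mono (λ y₃ → ≤-trans (*-monoʳ-≤ (⟦ cov z y₃ ⟧ * ⟦ cov y₃ x₀ ⟧) (at-most y₃)) (≤-reflexive (*-identityʳ _))) ⟩
    ∑V (λ y₃ → ⟦ cov z y₃ ⟧ * ⟦ cov y₃ x₀ ⟧) ≤⟨ interval-≤2 z x₀ ⟩
    2 ∎
    where
    at-most : ∀ y₃ → ∑V (λ x₂ → ⟦ not (eqV y₂ y₃) ∧ (cov y₂ x₂ ∧ cov y₃ x₂) ⟧) ≤ 1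
    at-most y₃ = by-eq (bool-case (eqV y₂ y₃))
      where
      by-eq : eqV y₂ y₃ ≡ true ⊎ eqV y₂ y₃ ≡ false → ∑V (λ x₂ → ⟦ not (eqV y₂ y₃) ∧ (cov y₂ x₂ ∧ cov y₃ x₂) ⟧) ≤ 1
      by-eq (inj₁ e) = ≤-trans (≤-reflexive (∑-empty (allElems n) _ λ x _ → cong (λ b → ⟦ not b ∧ (cov y₂ x ∧ cov y₃ x) ⟧) e)) z≤n
      by-eq (inj₂ e) = ≤-trans (card-mono {p = λ x₂ → not (eqV y₂ y₃) ∧ (cov y₂ x₂ ∧ cov y₃ x₂)} {q = λ x₂ → cov y₂ x₂ ∧ cov y₃ x₂}
        λ x h → proj₂ (∧-split {not (eqV y₂ y₃)} h)) (common-upper y₂ y₃ λ { refl → true≢false (eqV-refl y₂) e })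
    y₂≰x₀ : cov y₂ x₀ ≡ true → ⊥
    y₂≰x₀ c = y≢ (cov-unique x≢ a₂ c a₁ a₀)
    pointwise : ∀ x₂ → ⟦ cov y₂ x₂ ⟧ * ⟦ linked x₂ x₀ ⟧ ≤
      ∑V (λ y₃ → ⟦ cov z y₃ ⟧ * ⟦ cov y₃ x₀ ⟧ * ⟦ not (eqV y₂ y₃) ∧ (cov y₂ x₂ ∧ cov y₃ x₂) ⟧)
    pointwise x₂ = by (bool-case (cov y₂ x₂)) (bool-case (linked x₂ x₀))
      where
      by : cov y₂ x₂ ≡ true ⊎ cov y₂ x₂ ≡ false → linked x₂ x₀ ≡ true ⊎ linked x₂ x₀ ≡ false →
        ⟦ cov y₂ x₂ ⟧ * ⟦ linked x₂ x₀ ⟧ ≤ ∑V (λ y₃ → ⟦ cov z y₃ ⟧ * ⟦ cov y₃ x₀ ⟧ * ⟦ not (eqV y₂ y₃) ∧ (cov y₂ x₂ ∧ cov y₃ x₂) ⟧)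
      by (inj₂ e) _ = ≤-trans (≤-reflexive (cong (λ b → ⟦ b ⟧ * ⟦ linked x₂ x₀ ⟧) e)) z≤n
      by (inj₁ _) (inj₂ e) = ≤-trans (≤-reflexive (trans (cong (λ b → ⟦ cov y₂ x₂ ⟧ * ⟦ b ⟧) e) (*-zeroʳ ⟦ cov y₂ x₂ ⟧))) z≤n
      by (inj₁ c) (inj₁ l) with linked⁻ x₂ x₀ l
      ... | y₃ , c₂ , c₀ = ≤-trans (*-mono-≤ (⟦⟧≤1 (cov y₂ x₂)) (⟦⟧≤1 (linked x₂ x₀)))
            (≤-trans (≤-reflexive (sym one)) (≤∑V (λ y₃ → ⟦ cov z y₃ ⟧ * ⟦ cov y₃ x₀ ⟧ * ⟦ not (eqV y₂ y₃) ∧ (cov y₂ x₂ ∧ cov y₃ x₂) ⟧) y₃))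
        where
        r : rank x₂ ≡ rank x₀
        r = trans (cov-rank y₃ x₂ c₂) (sym (cov-rank y₃ x₀ c₀))
        ne : x₂ ≢ x₀
        ne refl = y₂≰x₀ c
        meet-y₃ : y₃ ≡ meet x₂ x₀
        meet-y₃ = ≼-rank-≡ (meet-greatest (cov⇒≼ y₃ x₂ c₂) (cov⇒≼ y₃ x₀ c₀))
          (≤-pred (≤-trans (meet-rank r ne) (≤-reflexive (cov-rank y₃ x₂ c₂))))
        z≼y₃ : z ≼ y₃
        z≼y₃ = subst (z ≼_) (sym meet-y₃) (meet-greatest (≼-trans (cov⇒≼ z y₂ b₂) (cov⇒≼ y₂ x₂ c))
                 (≼-trans (cov⇒≼ z y₁ b₁) (cov⇒≼ y₁ x₀ a₀)))
        zy₃ : cov z y₃ ≡ true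
        zy₃ = ≼⇒cov z≼y₃ (trans (suc-injective (trans (sym (cov-rank y₃ x₀ c₀)) (cov-rank y₁ x₀ a₀))) (cov-rank z y₁ b₁))
        one : ⟦ cov z y₃ ⟧ * ⟦ cov y₃ x₀ ⟧ * ⟦ not (eqV y₂ y₃) ∧ (cov y₂ x₂ ∧ cov y₃ x₂) ⟧ ≡ 1
        one = cong₂ _*_ (cong₂ (λ a b → ⟦ a ⟧ * ⟦ b ⟧) zy₃ c₀)
          (cong ⟦_⟧ (∧-join (not-join λ e → y₂≰x₀ (subst (λ u → cov u x₀ ≡ true) (sym (eqV⁻ y₂ y₃ e)) c₀)) (∧-join c c₂)))

  last-step≥ : ∀ y₁ x₁ y₂ → cov y₁ x₀ ≡ true → cov y₁ x₁ ≡ true → cov y₂ x₁ ≡ true → x₁ ≢ x₀ → y₂ ≢ y₁ →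
    Y y₂ ≡ true → β ∸ 2 ≤ last-step y₂
  last-step≥ y₁ x₁ y₂ a₀ a₁ a₂ x≢ y≢ yy = m≤n+o⇒m∸n≤o β 2 (begin
    β ≤⟨ Y-deg y₂ yy ⟩
    load X y₂ ≤⟨ ∑V-mono (λ x₂ → go (X x₂) (cov y₂ x₂) (linked x₂ x₀)) ⟩
    ∑V (λ x₂ → ⟦ cov y₂ x₂ ⟧ * ⟦ linked x₂ x₀ ⟧ + ⟦ X x₂ ⟧ * (⟦ cov y₂ x₂ ⟧ * ⟦ not (linked x₂ x₀) ⟧)) ≡⟨ ∑V-+ _ _ ⟩
    ∑V (λ x₂ → ⟦ cov y₂ x₂ ⟧ * ⟦ linked x₂ x₀ ⟧) + last-step y₂
      ≤⟨ +-monoˡ-≤ (last-step y₂) (linked-few y₁ x₁ y₂ a₀ a₁ a₂ x≢ y≢) ⟩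
    2 + last-step y₂ ∎)
    where
    go : ∀ a c l → ⟦ a ⟧ * ⟦ c ⟧ ≤ ⟦ c ⟧ * ⟦ l ⟧ + ⟦ a ⟧ * (⟦ c ⟧ * ⟦ not l ⟧)
    go false c l = z≤n
    go true false l = z≤n
    go true true true = s≤s z≤n
    go true true false = s≤s z≤n

  third-step : Elem n → Elem n → ℕ
  third-step y₁ x₁ = ∑V (λ y₂ → ⟦ Y y₂ ⟧ * ⟦ cov y₂ x₁ ⟧ * (⟦ not (eqV y₁ y₂) ⟧ * last-step y₂))

  -- One step of a path: `f` marks the neighbours, and forbidding the vertex `u` just left costs one
  -- from the degree `m`.
  drop-one : (f : Elem n → ℕ) (b : ℕ) (u : Elem n) (m : ℕ) → (∀ y → f y ≤ 1) → m ≤ ∑V f → (g : Elem n → ℕ) →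
    (∀ y → f y ≡ 1 → u ≢ y → b ≤ g y) → (m ∸ 1) * b ≤ ∑V (λ y → f y * (⟦ not (eqV u y) ⟧ * g y))
  drop-one f b u m f≤1 h g lower = begin
    (m ∸ 1) * b ≤⟨ *-monoˡ-≤ b (m≤n+o⇒m∸n≤o m 1 (begin
      m ≤⟨ h ⟩
      ∑V f ≤⟨ ∑V-mono (λ y → split (f y) (eqV u y) (f≤1 y)) ⟩
      ∑V (λ y → ⟦ eqV u y ⟧ + f y * ⟦ not (eqV u y) ⟧) ≡⟨ trans (∑V-+ _ _) (cong (_+ ∑V (λ y → f y * ⟦ not (eqV u y) ⟧)) (∑-eqVˡ₁ u)) ⟩
      1 + ∑V (λ y → f y * ⟦ not (eqV u y) ⟧) ∎)) ⟩
    ∑V (λ y → f y * ⟦ not (eqV u y) ⟧) * b ≡⟨ sym (∑V-*ʳ b _) ⟩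
    ∑V (λ y → f y * ⟦ not (eqV u y) ⟧ * b) ≤⟨ ∑V-mono pointwise ⟩
    ∑V (λ y → f y * (⟦ not (eqV u y) ⟧ * g y)) ∎
    where
    split : ∀ m e → m ≤ 1 → m ≤ ⟦ e ⟧ + m * ⟦ not e ⟧
    split m true h = ≤-trans h (s≤s z≤n)
    split m false h = ≤-reflexive (sym (*-identityʳ m))
    pointwise : ∀ y → f y * ⟦ not (eqV u y) ⟧ * b ≤ f y * (⟦ not (eqV u y) ⟧ * g y)
    pointwise y = by (f y) refl (bool-case (eqV u y))
      where
      by : ∀ m → f y ≡ m → eqV u y ≡ true ⊎ eqV u y ≡ false → m * ⟦ not (eqV u y) ⟧ * b ≤ m * (⟦ not (eqV u y) ⟧ * g y)
      by zero e _ = z≤n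
      by (suc m) e (inj₁ q) = ≤-trans (≤-reflexive (trans (cong (λ c → suc m * ⟦ not c ⟧ * b) q) (cong (_* b) (*-zeroʳ (suc m))))) z≤n
      by (suc m) e (inj₂ q) = ≤-trans (≤-reflexive (*-assoc (suc m) ⟦ not (eqV u y) ⟧ b))
        (*-monoʳ-≤ (suc m) (*-monoʳ-≤ ⟦ not (eqV u y) ⟧
          (lower y (≤-antisym (f≤1 y) (subst (1 ≤_) (sym e) (s≤s z≤n))) λ { refl → true≢false (eqV-refl u) q })))

  ⟦⟧*⟦⟧≤1 : ∀ a b → ⟦ a ⟧ * ⟦ b ⟧ ≤ 1
  ⟦⟧*⟦⟧≤1 a b = *-mono-≤ (⟦⟧≤1 a) (⟦⟧≤1 b)

  ⟦⟧*⟦⟧≡1 : ∀ a b → ⟦ a ⟧ * ⟦ b ⟧ ≡ 1 → a ≡ true × b ≡ true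
  ⟦⟧*⟦⟧≡1 true true _ = refl , refl

  third-step≥ : ∀ y₁ x₁ → cov y₁ x₀ ≡ true → cov y₁ x₁ ≡ true → x₁ ≢ x₀ → X x₁ ≡ true → (α ∸ 1) * (β ∸ 2) ≤ third-step y₁ x₁
  third-step≥ y₁ x₁ a₀ a₁ x≢ xx = drop-one (λ y₂ → ⟦ Y y₂ ⟧ * ⟦ cov y₂ x₁ ⟧) (β ∸ 2) y₁ α
    (λ y → ⟦⟧*⟦⟧≤1 (Y y) (cov y x₁)) (X-deg x₁ xx) last-step
    λ y₂ e ne → let (yy , c) = ⟦⟧*⟦⟧≡1 (Y y₂) (cov y₂ x₁) e in last-step≥ y₁ x₁ y₂ a₀ a₁ c x≢ (λ q → ne (sym q)) yy

  second-step : Elem n → ℕ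
  second-step y₁ = ∑V (λ x₁ → ⟦ X x₁ ⟧ * ⟦ cov y₁ x₁ ⟧ * (⟦ not (eqV x₀ x₁) ⟧ * third-step y₁ x₁))

  second-step≥ : ∀ y₁ → cov y₁ x₀ ≡ true → Y y₁ ≡ true → (β ∸ 1) * ((α ∸ 1) * (β ∸ 2)) ≤ second-step y₁
  second-step≥ y₁ a₀ yy = drop-one (λ x₁ → ⟦ X x₁ ⟧ * ⟦ cov y₁ x₁ ⟧) ((α ∸ 1) * (β ∸ 2)) x₀ β
    (λ x → ⟦⟧*⟦⟧≤1 (X x) (cov y₁ x)) (Y-deg y₁ yy) (third-step y₁)
    λ x₁ e ne → let (xx , c) = ⟦⟧*⟦⟧≡1 (X x₁) (cov y₁ x₁) e in third-step≥ y₁ x₁ a₀ c (λ q → ne (sym q)) xx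

  paths : ℕ
  paths = ∑V (λ y₁ → ⟦ Y y₁ ⟧ * ⟦ cov y₁ x₀ ⟧ * second-step y₁)

  paths≥ : α * ((β ∸ 1) * ((α ∸ 1) * (β ∸ 2))) ≤ paths
  paths≥ = begin
    α * b ≤⟨ *-monoˡ-≤ b (X-deg x₀ x₀∈X) ⟩
    ∑V (λ y → ⟦ Y y ⟧ * ⟦ cov y x₀ ⟧) * b ≡⟨ sym (∑V-*ʳ b _) ⟩
    ∑V (λ y → ⟦ Y y ⟧ * ⟦ cov y x₀ ⟧ * b) ≤⟨ ∑V-mono (λ y → subst₂ _≤_ (sym (*-assoc ⟦ Y y ⟧ ⟦ cov y x₀ ⟧ b))
      (sym (*-assoc ⟦ Y y ⟧ ⟦ cov y x₀ ⟧ (second-step y)))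
      (⟦⟧-*-mono (Y y) λ yy → ⟦⟧-*-mono (cov y x₀) λ c → second-step≥ y c yy)) ⟩
    paths ∎
    where
    b : ℕ
    b = (β ∸ 1) * ((α ∸ 1) * (β ∸ 2))

  joins : Elem n → Elem n → Elem n → ℕ
  joins x₂ y₁ y₂ = ∑V (λ x₁ → ⟦ not (eqV y₁ y₂) ∧ (cov y₁ x₁ ∧ cov y₂ x₁) ⟧)

  joins≤1 : ∀ x₂ y₁ y₂ → joins x₂ y₁ y₂ ≤ 1
  joins≤1 x₂ y₁ y₂ = by-eq (bool-case (eqV y₁ y₂))
    where
    by-eq : eqV y₁ y₂ ≡ true ⊎ eqV y₁ y₂ ≡ false → joins x₂ y₁ y₂ ≤ 1
    by-eq (inj₁ e) = ≤-trans (≤-reflexive (∑-empty (allElems n) _ λ x _ → cong (λ b → ⟦ not b ∧ (cov y₁ x ∧ cov y₂ x) ⟧) e)) z≤n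
    by-eq (inj₂ e) = ≤-trans (card-mono {p = λ x → not (eqV y₁ y₂) ∧ (cov y₁ x ∧ cov y₂ x)} {q = λ x → cov y₁ x ∧ cov y₂ x}
      λ x h → proj₂ (∧-split {not (eqV y₁ y₂)} h)) (common-upper y₁ y₂ λ { refl → true≢false (eqV-refl y₁) e })

  weightOf : Elem n → Elem n → Elem n → Elem n → ℕ
  weightOf x₂ y₁ x₁ y₂ = ⟦ Y y₁ ⟧ * ⟦ cov y₁ x₀ ⟧ * (⟦ X x₁ ⟧ * ⟦ cov y₁ x₁ ⟧ * (⟦ not (eqV x₀ x₁) ⟧ *
    (⟦ Y y₂ ⟧ * ⟦ cov y₂ x₁ ⟧ * (⟦ not (eqV y₁ y₂) ⟧ * (⟦ X x₂ ⟧ * (⟦ cov y₂ x₂ ⟧ * ⟦ not (linked x₂ x₀) ⟧))))))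

  into : ∀ (a : ℕ) (f : Elem n → ℕ) → a * ∑V f ≡ ∑V (λ x → a * f x)
  into a f = sym (∑V-*ˡ a f)

  into₂ : ∀ (a : ℕ) (f : Elem n → Elem n → ℕ) → a * ∑V (λ y → ∑V (f y)) ≡ ∑V (λ y → ∑V (λ x → a * f y x))
  into₂ a f = trans (into a _) (∑V-cong λ y → into a (f y))

  into₃ : ∀ (a : ℕ) (f : Elem n → Elem n → Elem n → ℕ) →
    a * ∑V (λ z → ∑V (λ y → ∑V (f z y))) ≡ ∑V (λ z → ∑V (λ y → ∑V (λ x → a * f z y x)))
  into₃ a f = trans (into a _) (∑V-cong λ z → into₂ a (f z))

  paths-expand : paths ≡ ∑V (λ x₂ → ∑V (λ y₁ → ∑V (λ y₂ → ∑V (λ x₁ → weightOf x₂ y₁ x₁ y₂))))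
  paths-expand = trans (∑V-cong λ y₁ → trans (cong (p₁ y₁ *_) (second y₁)) (into₃ (p₁ y₁) _)) reorder
    where
    p₁ : Elem n → ℕ
    p₁ y₁ = ⟦ Y y₁ ⟧ * ⟦ cov y₁ x₀ ⟧
    p₂ : Elem n → Elem n → ℕ
    p₂ y₁ x₁ = ⟦ X x₁ ⟧ * ⟦ cov y₁ x₁ ⟧
    p₃ : Elem n → ℕ
    p₃ x₁ = ⟦ not (eqV x₀ x₁) ⟧
    p₄ : Elem n → Elem n → ℕ
    p₄ x₁ y₂ = ⟦ Y y₂ ⟧ * ⟦ cov y₂ x₁ ⟧
    p₅ : Elem n → Elem n → ℕ
    p₅ y₁ y₂ = ⟦ not (eqV y₁ y₂) ⟧
    p₆ : Elem n → Elem n → ℕ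
    p₆ y₂ x₂ = ⟦ X x₂ ⟧ * (⟦ cov y₂ x₂ ⟧ * ⟦ not (linked x₂ x₀) ⟧)
    third : ∀ y₁ x₁ → third-step y₁ x₁ ≡ ∑V (λ y₂ → ∑V (λ x₂ → p₄ x₁ y₂ * (p₅ y₁ y₂ * p₆ y₂ x₂)))
    third y₁ x₁ = ∑V-cong λ y₂ → trans (cong (p₄ x₁ y₂ *_) (into (p₅ y₁ y₂) (p₆ y₂))) (into (p₄ x₁ y₂) _)
    second : ∀ y₁ → second-step y₁ ≡
      ∑V (λ x₁ → ∑V (λ y₂ → ∑V (λ x₂ → p₂ y₁ x₁ * (p₃ x₁ * (p₄ x₁ y₂ * (p₅ y₁ y₂ * p₆ y₂ x₂))))))
    second y₁ = ∑V-cong λ x₁ → trans (cong (λ m → p₂ y₁ x₁ * (p₃ x₁ * m)) (third y₁ x₁))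
      (trans (cong (p₂ y₁ x₁ *_) (into₂ (p₃ x₁) _)) (into₂ (p₂ y₁ x₁) _))
    reorder : ∑V (λ y₁ → ∑V (λ x₁ → ∑V (λ y₂ → ∑V (λ x₂ → weightOf x₂ y₁ x₁ y₂)))) ≡
              ∑V (λ x₂ → ∑V (λ y₁ → ∑V (λ y₂ → ∑V (λ x₁ → weightOf x₂ y₁ x₁ y₂))))
    reorder = trans (∑V-cong λ y₁ → trans (∑V-cong λ x₁ → ∑V-swap _) (trans (∑V-swap _) (∑V-cong λ x₂ → ∑V-swap _))) (∑V-swap _)

  -- A path x₀ – y₁ – x₁ – y₂ – x₂ with x₂ not linked to x₀ has y₁ and y₂ above meet x₀ x₂.
  weight-bound : ∀ x₂ y₁ y₂ x₁ → weightOf x₂ y₁ x₁ y₂ ≤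
    ⟦ X x₂ ⟧ * (⟦ cov (meet x₀ x₂) y₁ ⟧ * ⟦ cov y₁ x₀ ⟧ * (⟦ cov (meet x₀ x₂) y₂ ⟧ * ⟦ cov y₂ x₂ ⟧ * ⟦ not (eqV y₁ y₂) ∧ (cov y₁ x₁ ∧ cov y₂ x₁) ⟧))
  weight-bound x₂ y₁ y₂ x₁ = from (weightOf x₂ y₁ x₁ y₂) refl
    where
    rhs : ℕ
    rhs = ⟦ X x₂ ⟧ * (⟦ cov (meet x₀ x₂) y₁ ⟧ * ⟦ cov y₁ x₀ ⟧ * (⟦ cov (meet x₀ x₂) y₂ ⟧ * ⟦ cov y₂ x₂ ⟧ * ⟦ not (eqV y₁ y₂) ∧ (cov y₁ x₁ ∧ cov y₂ x₁) ⟧))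
    le1 : weightOf x₂ y₁ x₁ y₂ ≤ 1
    le1 = *-mono-≤ (⟦⟧*⟦⟧≤1 (Y y₁) (cov y₁ x₀)) (*-mono-≤ (⟦⟧*⟦⟧≤1 (X x₁) (cov y₁ x₁)) (*-mono-≤ (⟦⟧≤1 (not (eqV x₀ x₁)))
      (*-mono-≤ (⟦⟧*⟦⟧≤1 (Y y₂) (cov y₂ x₁)) (*-mono-≤ (⟦⟧≤1 (not (eqV y₁ y₂))) (*-mono-≤ (⟦⟧≤1 (X x₂)) (⟦⟧*⟦⟧≤1 (cov y₂ x₂) (not (linked x₂ x₀))))))))
    from : ∀ m → weightOf x₂ y₁ x₁ y₂ ≡ m → m ≤ rhs
    from zero e = z≤n
    from (suc m) e with ⟦⟧*-pos⁻ (Y y₁) (⟦ cov y₁ x₀ ⟧ * _) (subst (0 <_) (trans (sym e) (*-assoc ⟦ Y y₁ ⟧ ⟦ cov y₁ x₀ ⟧ _)) (s≤s z≤n))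
    ... | _ , h₁ with ⟦⟧*-pos⁻ (cov y₁ x₀) _ h₁
    ... | a₀ , h₂ with ⟦⟧*-pos⁻ (X x₁) _ (subst (0 <_) (*-assoc ⟦ X x₁ ⟧ ⟦ cov y₁ x₁ ⟧ _) h₂)
    ... | _ , h₃ with ⟦⟧*-pos⁻ (cov y₁ x₁) _ h₃
    ... | a₁ , h₄ with ⟦⟧*-pos⁻ (not (eqV x₀ x₁)) _ h₄
    ... | _ , h₅ with ⟦⟧*-pos⁻ (Y y₂) _ (subst (0 <_) (*-assoc ⟦ Y y₂ ⟧ ⟦ cov y₂ x₁ ⟧ _) h₅)
    ... | _ , h₆ with ⟦⟧*-pos⁻ (cov y₂ x₁) _ h₆
    ... | a₂ , h₇ with ⟦⟧*-pos⁻ (not (eqV y₁ y₂)) _ h₇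
    ... | ne , h₈ with ⟦⟧*-pos⁻ (X x₂) _ h₈
    ... | xx₂ , h₉ with ⟦⟧*-pos⁻ (cov y₂ x₂) _ h₉
    ... | a₃ , h₁₀ with ⟦⟧*-pos⁻ (not (linked x₂ x₀)) 1 (subst (0 <_) (sym (*-identityʳ _)) h₁₀)
    ... | nl , _ with cov-meet {x = x₁} a₁ a₂ (eqV-no y₁ y₂ ne)
    ... | z , b₁ , b₂ = ≤-trans (subst (_≤ 1) e le1) (≤-reflexive (sym one))
      where
      r₀ : rank x₀ ≡ suc (suc (rank z))
      r₀ = trans (cov-rank y₁ x₀ a₀) (cong suc (cov-rank z y₁ b₁))
      r₂ : rank x₂ ≡ suc (suc (rank z))
      r₂ = trans (cov-rank y₂ x₂ a₃) (cong suc (cov-rank z y₂ b₂))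
      unlinked : linked x₂ x₀ ≡ true → ⊥
      unlinked l = true≢false l (not-split nl)
      x₀≢x₂ : x₀ ≢ x₂
      x₀≢x₂ refl = unlinked (linked⁺ y₂ x₂ x₀ a₃ a₃)
      z≼meet : z ≼ meet x₀ x₂
      z≼meet = meet-greatest (≼-trans (cov⇒≼ z y₁ b₁) (cov⇒≼ y₁ x₀ a₀)) (≼-trans (cov⇒≼ z y₂ b₂) (cov⇒≼ y₂ x₂ a₃))
      low-meet : rank (meet x₀ x₂) ≤ rank z
      low-meet = ≮⇒≥ λ l →
        let s = ≤-antisym (≤-pred (≤-trans (meet-rank (trans r₀ (sym r₂)) x₀≢x₂) (≤-reflexive r₀))) l
        in unlinked (linked⁺ (meet x₀ x₂) x₂ x₀ (≼⇒cov (meet-≼ʳ x₀ x₂) (trans r₂ (cong suc (sym s))))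
             (≼⇒cov (meet-≼ˡ x₀ x₂) (trans r₀ (cong suc (sym s)))))
      z≡ : z ≡ meet x₀ x₂
      z≡ = ≼-rank-≡ z≼meet low-meet
      one : rhs ≡ 1
      one = cong₂ (λ a b → ⟦ a ⟧ * b) xx₂ (cong₂ _*_
        (cong₂ (λ a b → ⟦ a ⟧ * ⟦ b ⟧) (subst (λ u → cov u y₁ ≡ true) z≡ b₁) a₀)
        (cong₂ _*_ (cong₂ (λ a b → ⟦ a ⟧ * ⟦ b ⟧) (subst (λ u → cov u y₂ ≡ true) z≡ b₂) a₃)
          (cong ⟦_⟧ (∧-join ne (∧-join a₁ a₂)))))

  -- For a fixed end x₂ there are at most two choices of y₁ between `meet x₀ x₂` and x₀, two of y₂
  -- between it and x₂, and one of x₁ as a common upper cover of y₁ ≠ y₂.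
  paths≤ : paths ≤ 4 * card X
  paths≤ = begin
    paths ≡⟨ paths-expand ⟩
    ∑V (λ x₂ → ∑V (λ y₁ → ∑V (λ y₂ → ∑V (λ x₁ → weightOf x₂ y₁ x₁ y₂))))
      ≤⟨ ∑V-mono (λ x₂ → ∑V-mono λ y₁ → ∑V-mono λ y₂ → ∑V-mono λ x₁ → weight-bound x₂ y₁ y₂ x₁) ⟩
    ∑V (λ x₂ → ∑V (λ y₁ → ∑V (λ y₂ → ∑V (λ x₁ → ⟦ X x₂ ⟧ * (A x₂ y₁ * (B x₂ y₂ * J y₁ y₂ x₁))))))
      ≡⟨ ∑V-cong (λ x₂ → trans (∑V-cong λ y₁ → trans (∑V-cong λ y₂ → trans (∑V-*ˡ ⟦ X x₂ ⟧ _) (cong (⟦ X x₂ ⟧ *_)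
           (trans (∑V-*ˡ (A x₂ y₁) _) (cong (A x₂ y₁ *_) (∑V-*ˡ (B x₂ y₂) _))))) (∑V-*ˡ ⟦ X x₂ ⟧ _)) (∑V-*ˡ ⟦ X x₂ ⟧ _)) ⟩
    ∑V (λ x₂ → ⟦ X x₂ ⟧ * ∑V (λ y₁ → ∑V (λ y₂ → A x₂ y₁ * (B x₂ y₂ * joins x₂ y₁ y₂))))
      ≤⟨ ∑V-mono (λ x₂ → *-monoʳ-≤ ⟦ X x₂ ⟧ (four x₂)) ⟩
    ∑V (λ x₂ → ⟦ X x₂ ⟧ * 4) ≡⟨ trans (∑V-*ʳ 4 _) (*-comm (card X) 4) ⟩
    4 * card X ∎
    where
    A B : Elem n → Elem n → ℕ
    A x₂ y₁ = ⟦ cov (meet x₀ x₂) y₁ ⟧ * ⟦ cov y₁ x₀ ⟧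
    B x₂ y₂ = ⟦ cov (meet x₀ x₂) y₂ ⟧ * ⟦ cov y₂ x₂ ⟧
    J : Elem n → Elem n → Elem n → ℕ
    J y₁ y₂ x₁ = ⟦ not (eqV y₁ y₂) ∧ (cov y₁ x₁ ∧ cov y₂ x₁) ⟧
    four : ∀ x₂ → ∑V (λ y₁ → ∑V (λ y₂ → A x₂ y₁ * (B x₂ y₂ * joins x₂ y₁ y₂))) ≤ 4
    four x₂ = begin
      ∑V (λ y₁ → ∑V (λ y₂ → A x₂ y₁ * (B x₂ y₂ * joins x₂ y₁ y₂)))
        ≤⟨ ∑V-mono (λ y₁ → ∑V-mono λ y₂ → *-monoʳ-≤ (A x₂ y₁) (≤-trans (*-monoʳ-≤ (B x₂ y₂) (joins≤1 x₂ y₁ y₂)) (≤-reflexive (*-identityʳ _)))) ⟩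
      ∑V (λ y₁ → ∑V (λ y₂ → A x₂ y₁ * B x₂ y₂)) ≡⟨ ∑V-cong (λ y₁ → ∑V-*ˡ (A x₂ y₁) _) ⟩
      ∑V (λ y₁ → A x₂ y₁ * ∑V (B x₂)) ≤⟨ ∑V-mono (λ y₁ → *-monoʳ-≤ (A x₂ y₁) (interval-≤2 (meet x₀ x₂) x₂)) ⟩
      ∑V (λ y₁ → A x₂ y₁ * 2) ≡⟨ ∑V-*ʳ 2 _ ⟩
      ∑V (A x₂) * 2 ≤⟨ *-monoˡ-≤ 2 (interval-≤2 (meet x₀ x₂) x₀) ⟩
      4 ∎

-- C has at least n|C|/2 edges to its shadow, so |∂C| < B|C| makes the pair dense. In the core left
-- by peeling, degrees are at least n/4 and n/(4B), and the ends of the paths of length four are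
-- already numerous.
poor-expansion-large : ∀ {n} (k B α β : ℕ) (C : Elem n → Bool) → (∀ x → C x ≡ true → rank x ≡ k) →
  (∀ (x : Elem n) → rank x ≡ k → n ≤ 2 * ∑V (λ y → ⟦ cov y x ⟧)) → 0 < n → 0 < B →
  4 * α ≤ n → 4 * B * β ≤ n → card (shadow C) < B * card C →
  α * ((β ∸ 1) * ((α ∸ 1) * (β ∸ 2))) ≤ 4 * card C
poor-expansion-large {n} k B α β C C-rank deg n>0 B>0 hα hβ few =
  ≤-trans (Paths.paths≥ k X Y X-rank x₀ x₀∈X α β degX degY)
    (≤-trans (Paths.paths≤ k X Y X-rank x₀ x₀∈X α β degX degY) (*-monoʳ-≤ 4 (card-mono X⊆)))
  where
  open Sums n
  open Peel {n} B
  open ≤-Reasoning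
  full-degree : ∀ x → C x ≡ true → dx (shadow C) x ≡ ∑V (λ y → ⟦ cov y x ⟧)
  full-degree x c = ∑V-cong λ y → by y (bool-case (cov y x))
    where
    by : ∀ y → cov y x ≡ true ⊎ cov y x ≡ false → ⟦ shadow C y ⟧ * ⟦ cov y x ⟧ ≡ ⟦ cov y x ⟧
    by y (inj₁ e) = trans (cong (λ b → ⟦ b ⟧ * ⟦ cov y x ⟧) (shadow⁺ C y x c e)) (+-identityʳ _)
    by y (inj₂ e) = trans (cong (λ b → ⟦ shadow C y ⟧ * ⟦ b ⟧) e) (trans (*-zeroʳ ⟦ shadow C y ⟧) (sym (cong ⟦_⟧ e)))
  edge-count : card C * n ≤ 2 * edges C (shadow C)
  edge-count = begin
    card C * n ≡⟨ sym (∑V-*ʳ n _) ⟩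
    ∑V (λ x → ⟦ C x ⟧ * n) ≤⟨ ∑V-mono (λ x → ⟦⟧-*-mono (C x) λ c → ≤-trans (deg x (C-rank x c)) (≤-reflexive (cong (2 *_) (sym (full-degree x c))))) ⟩
    ∑V (λ x → ⟦ C x ⟧ * (2 * dx (shadow C) x)) ≡⟨ trans (∑V-cong λ x → rearr ⟦ C x ⟧ (dx (shadow C) x)) (∑V-*ˡ 2 _) ⟩
    2 * edges C (shadow C) ∎
    where
    rearr : ∀ a b → a * (2 * b) ≡ 2 * (a * b)
    rearr = solve-∀
  dense : Dense C (shadow C)
  dense = begin-strict
    n * B * card C + n * card (shadow C) <⟨ +-monoʳ-< (n * B * card C) (*-monoʳ-<′ n>0 few) ⟩
    n * B * card C + n * (B * card C) ≡⟨ rearr n B (card C) ⟩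
    2 * B * (card C * n) ≤⟨ *-monoʳ-≤ (2 * B) edge-count ⟩
    2 * B * (2 * edges C (shadow C)) ≡⟨ rearr′ B (edges C (shadow C)) ⟩
    4 * B * edges C (shadow C) ∎
    where
    rearr : ∀ n b c → n * b * c + n * (b * c) ≡ 2 * b * (c * n)
    rearr = solve-∀
    rearr′ : ∀ b e → 2 * b * (2 * e) ≡ 4 * b * e
    rearr′ = solve-∀
    *-monoʳ-<′ : ∀ {m a b} → 0 < m → a < b → m * a < m * b
    *-monoʳ-<′ {suc m} _ l = *-monoʳ-< (suc m) l
  core : Core C
  core = peel _ C C (shadow C) ≤-refl (λ _ h → h) dense
  open Core core
  X-rank : ∀ x → X x ≡ true → rank x ≡ k
  X-rank x h = C-rank x (X⊆ x h)
  degX : ∀ x → X x ≡ true → α ≤ dx Y x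
  degX x h = *-cancelˡ-≤′ 4 (s≤s z≤n) (≤-trans hα (X-deg x h))
  degY : ∀ y → Y y ≡ true → β ≤ load X y
  degY y h = *-cancelˡ-≤′ (4 * B) (*-mono-≤ {1} {4} (s≤s z≤n) B>0) (≤-trans hβ (Y-deg y h))

-- Edge weights

quo : ℕ → ℕ → ℕ
quo m N with m ∣? N
... | yes d = quotient d
... | no _ = 0

quo-* : ∀ m N → m ∣ N → quo m N * m ≡ N
quo-* m N d with m ∣? N
... | yes (divides q e) = sym e
... | no h = ⊥-elim (h d)

∣-factorial : ∀ m N → 0 < m → m ≤ N → m ∣ N !
∣-factorial (suc m) N _ h = ∣-trans (m∣m*n (m !)) (m≤n⇒m!∣n! h)

-- Edge weights by the type (a, b, c) of the upper end: when b > 2a, edges lowering a 2 get slightly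
-- less than the uniform weight and edges lowering a 1 slightly more; M clears all denominators.
module EdgeWeights (n : ℕ) where
  K M : ℕ
  K = (4 * n + 1) !
  M = K * n !

  M>0 : 0 < M
  M>0 = *-mono-≤ {1} {K} (n!>0 (4 * n + 1)) (n!>0 n)
    where
    n!>0 : ∀ m → 0 < m !
    n!>0 m = >-nonZero⁻¹ (m !) {{m !≢0}}

  highW lowW : ℕ → ℕ → ℕ → ℕ
  highW a b c with 2 * a <? b
  ... | yes _ = 4 * quo (4 * (b + c) + 1) K * n !
  ... | no _ = K * quo (b + c) (n !)
  lowW a b c with 2 * a <? b
  ... | yes _ = (4 * b + 1) * (quo (4 * (b + c) + 1) K * quo b (n !))
  ... | no _ = K * quo (b + c) (n !)

  quoK : ∀ D → D ≤ n → quo (4 * D + 1) K * (4 * D + 1) ≡ K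
  quoK D h = quo-* (4 * D + 1) K (∣-factorial (4 * D + 1) (4 * n + 1) (m≤n+m 1 (4 * D)) (+-monoˡ-≤ 1 (*-monoʳ-≤ 4 h)))

  quon : ∀ D → 0 < D → D ≤ n → quo D (n !) * D ≡ n !
  quon D p h = quo-* D (n !) (∣-factorial D n p h)

  high-boost : ∀ a b c → 2 * a < b → b + c ≤ n → highW a b c * (4 * (b + c) + 1) ≡ 4 * M
  high-boost a b c h d with 2 * a <? b
  ... | no q = ⊥-elim (q h)
  ... | yes _ = trans (rearr (quo (4 * (b + c) + 1) K) (n !) (4 * (b + c) + 1)) (cong (λ m → 4 * (m * n !)) (quoK (b + c) d))
    where
    rearr : ∀ q f D → 4 * q * f * D ≡ 4 * (q * D * f)
    rearr = solve-∀

  low-boost : ∀ a b c → 2 * a < b → b + c ≤ n → lowW a b c * (b * (4 * (b + c) + 1)) ≡ (4 * b + 1) * M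
  low-boost a b c h d with 2 * a <? b
  ... | no q = ⊥-elim (q h)
  ... | yes _ = trans (rearr (4 * b + 1) (quo (4 * (b + c) + 1) K) (quo b (n !)) b (4 * (b + c) + 1))
      (cong₂ (λ m l → (4 * b + 1) * (m * l)) (quoK (b + c) d) (quon b (≤-<-trans z≤n h) (m+n≤o⇒m≤o b d)))
    where
    rearr : ∀ e q s b D → e * (q * s) * (b * D) ≡ e * (q * D * (s * b))
    rearr = solve-∀

  flat : ∀ D → 0 < D → D ≤ n → K * quo D (n !) * D ≡ M
  flat D p h = trans (*-assoc K _ D) (cong (K *_) (quon D p h))

  high-flat : ∀ a b c → b ≤ 2 * a → 0 < b + c → b + c ≤ n → highW a b c * (b + c) ≡ M
  high-flat a b c h p d with 2 * a <? b
  ... | yes q = ⊥-elim (<⇒≱ q h)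
  ... | no _ = flat (b + c) p d

  low-flat : ∀ a b c → b ≤ 2 * a → 0 < b + c → b + c ≤ n → lowW a b c * (b + c) ≡ M
  low-flat a b c h p d with 2 * a <? b
  ... | yes q = ⊥-elim (<⇒≱ q h)
  ... | no _ = flat (b + c) p d

  split-type : ∀ a b → 2 * a < b ⊎ b ≤ 2 * a
  split-type a b with 2 * a <? b
  ... | yes q = inj₁ q
  ... | no q = inj₂ (≮⇒≥ q)

  open ≤-Reasoning

  -- With D = b + c, in the boosted case the c edges lowering a 2 take 4/(4D + 1) of M each, and the
  -- remaining (4b + 1)/(4D + 1) is shared by the b others.
  type-sum : ∀ a b c → 0 < b + c → b + c ≤ n → b * lowW a b c + c * highW a b c ≡ M
  type-sum a b c p d with split-type a b
  ... | inj₂ h = trans (cong₂ (λ l m → b * l + c * m) equalW (refl {x = highW a b c}))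
        (trans (sym (*-distribʳ-+ (highW a b c) b c)) (trans (*-comm (b + c) _) (high-flat a b c h p d)))
    where
    equalW : lowW a b c ≡ highW a b c
    equalW = *-cancelʳ-≡ (lowW a b c) (highW a b c) (b + c) {{>-nonZero p}} (trans (low-flat a b c h p d) (sym (high-flat a b c h p d)))
  ... | inj₁ h = *-cancelʳ-≡ _ M (4 * (b + c) + 1) {{>-nonZero (m≤n+m 1 (4 * (b + c)))}}
      (trans (rearr b (lowW a b c) c (highW a b c) (4 * (b + c) + 1))
      (trans (cong₂ (λ l m → l + c * m) (low-boost a b c h d) (high-boost a b c h d)) (rearr′ b c M)))
    where
    rearr : ∀ b l c m D → (b * l + c * m) * D ≡ l * (b * D) + c * (m * D)
    rearr = solve-∀
    rearr′ : ∀ b c M → (4 * b + 1) * M + c * (4 * M) ≡ M * (4 * (b + c) + 1)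
    rearr′ = solve-∀

  4D+1≤8n : ∀ D → 0 < D → D ≤ n → 4 * D + 1 ≤ 4 * (2 * n)
  4D+1≤8n D p h = ≤-trans (+-mono-≤ (*-monoʳ-≤ 4 h) (≤-trans (s≤s z≤n) (*-monoʳ-≤ 4 (≤-trans p h)))) (≤-reflexive (rearr n))
    where
    rearr : ∀ n → 4 * n + 4 * n ≡ 4 * (2 * n)
    rearr = solve-∀

  high-lo : ∀ a b c → 0 < b + c → b + c ≤ n → M ≤ 2 * n * highW a b c
  high-lo a b c p d with split-type a b
  ... | inj₂ h = begin
      M ≡⟨ sym (high-flat a b c h p d) ⟩
      highW a b c * (b + c) ≤⟨ *-monoʳ-≤ (highW a b c) (≤-trans d (m≤n*m n 2)) ⟩
      highW a b c * (2 * n) ≡⟨ *-comm (highW a b c) (2 * n) ⟩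
      2 * n * highW a b c ∎
  ... | inj₁ h = *-cancelˡ-≤ 4 (begin
      4 * M ≡⟨ sym (high-boost a b c h d) ⟩
      highW a b c * (4 * (b + c) + 1) ≤⟨ *-monoʳ-≤ (highW a b c) (4D+1≤8n (b + c) p d) ⟩
      highW a b c * (4 * (2 * n)) ≡⟨ rearr (highW a b c) (2 * n) ⟩
      4 * (2 * n * highW a b c) ∎)
    where
    rearr : ∀ w m → w * (4 * m) ≡ 4 * (m * w)
    rearr = solve-∀

  low-lo : ∀ a b c → 0 < b → b + c ≤ n → M ≤ 2 * n * lowW a b c
  low-lo a b c p d with split-type a b
  ... | inj₂ h = begin
      M ≡⟨ sym (low-flat a b c h (≤-trans p (m≤m+n b c)) d) ⟩
      lowW a b c * (b + c) ≤⟨ *-monoʳ-≤ (lowW a b c) (≤-trans d (m≤n*m n 2)) ⟩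
      lowW a b c * (2 * n) ≡⟨ *-comm (lowW a b c) (2 * n) ⟩
      2 * n * lowW a b c ∎
  ... | inj₁ h = *-cancelˡ-≤′ (4 * b) (*-mono-≤ {1} {4} (s≤s z≤n) p) (begin
      4 * b * M ≤⟨ *-monoˡ-≤ M (m≤m+n (4 * b) 1) ⟩
      (4 * b + 1) * M ≡⟨ sym (low-boost a b c h d) ⟩
      lowW a b c * (b * (4 * (b + c) + 1)) ≤⟨ *-monoʳ-≤ (lowW a b c) (*-monoʳ-≤ b (4D+1≤8n (b + c) (≤-trans p (m≤m+n b c)) d)) ⟩
      lowW a b c * (b * (4 * (2 * n))) ≡⟨ rearr (lowW a b c) b (2 * n) ⟩
      4 * b * (2 * n * lowW a b c) ∎)
    where
    rearr : ∀ w b m → w * (b * (4 * m)) ≡ 4 * b * (m * w)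
    rearr = solve-∀

  high-hi : ∀ a b c → 0 < b + c → b + c ≤ n → n ≤ 2 * (b + c) → n * highW a b c ≤ 3 * M
  high-hi a b c p d half with split-type a b
  ... | inj₂ h = begin
      n * highW a b c ≤⟨ *-monoˡ-≤ (highW a b c) half ⟩
      2 * (b + c) * highW a b c ≡⟨ rearr (b + c) (highW a b c) ⟩
      2 * (highW a b c * (b + c)) ≡⟨ cong (2 *_) (high-flat a b c h p d) ⟩
      2 * M ≤⟨ *-monoˡ-≤ M (≤-by {2} 1 refl) ⟩
      3 * M ∎
    where
    rearr : ∀ D w → 2 * D * w ≡ 2 * (w * D)
    rearr = solve-∀
  ... | inj₁ h = *-cancelˡ-≤ 2 (begin
      2 * (n * highW a b c) ≤⟨ *-monoʳ-≤ 2 (*-monoˡ-≤ (highW a b c) half) ⟩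
      2 * (2 * (b + c) * highW a b c) ≡⟨ rearr (b + c) (highW a b c) ⟩
      highW a b c * (4 * (b + c)) ≤⟨ *-monoʳ-≤ (highW a b c) (m≤m+n (4 * (b + c)) 1) ⟩
      highW a b c * (4 * (b + c) + 1) ≡⟨ high-boost a b c h d ⟩
      4 * M ≤⟨ *-monoˡ-≤ M (≤-by {4} 2 refl) ⟩
      6 * M ≡⟨ *-assoc 2 3 M ⟩
      2 * (3 * M) ∎)
    where
    rearr : ∀ D w → 2 * (2 * D * w) ≡ w * (4 * D)
    rearr = solve-∀

  low-hi : ∀ a b c → 0 < b → b + c ≤ n → n ≤ 2 * (b + c) → n * lowW a b c ≤ 3 * M
  low-hi a b c p d half with split-type a b
  ... | inj₂ h = begin
      n * lowW a b c ≤⟨ *-monoˡ-≤ (lowW a b c) half ⟩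
      2 * (b + c) * lowW a b c ≡⟨ rearr (b + c) (lowW a b c) ⟩
      2 * (lowW a b c * (b + c)) ≡⟨ cong (2 *_) (low-flat a b c h (≤-trans p (m≤m+n b c)) d) ⟩
      2 * M ≤⟨ *-monoˡ-≤ M (≤-by {2} 1 refl) ⟩
      3 * M ∎
    where
    rearr : ∀ D w → 2 * D * w ≡ 2 * (w * D)
    rearr = solve-∀
  ... | inj₁ h = *-cancelˡ-≤′ (2 * b) (*-mono-≤ {1} {2} (s≤s z≤n) p) (begin
      2 * b * (n * lowW a b c) ≤⟨ *-monoʳ-≤ (2 * b) (*-monoˡ-≤ (lowW a b c) half) ⟩
      2 * b * (2 * (b + c) * lowW a b c) ≡⟨ rearr b (b + c) (lowW a b c) ⟩
      lowW a b c * (b * (4 * (b + c))) ≤⟨ *-monoʳ-≤ (lowW a b c) (*-monoʳ-≤ b (m≤m+n (4 * (b + c)) 1)) ⟩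
      lowW a b c * (b * (4 * (b + c) + 1)) ≡⟨ low-boost a b c h d ⟩
      (4 * b + 1) * M ≤⟨ *-monoˡ-≤ M (≤-trans (+-monoʳ-≤ (4 * b) (≤-trans p (m≤n*m b 2))) (≤-reflexive (rearr″ b))) ⟩
      2 * b * 3 * M ≡⟨ *-assoc (2 * b) 3 M ⟩
      2 * b * (3 * M) ∎)
    where
    rearr : ∀ b D w → 2 * b * (2 * D * w) ≡ w * (b * (4 * D))
    rearr = solve-∀
    rearr″ : ∀ b → 4 * b + 2 * b ≡ 2 * b * 3
    rearr″ = solve-∀

  scale-gap : ∀ p p′ T → 0 < p → p ≤ p′ → p * T + M ≤ p * M → p′ * T + M ≤ p′ * M
  scale-gap p p′ T p>0 h g = begin
    p′ * T + M ≡⟨ cong (λ m → m * T + M) (sym (m∸n+n≡m h)) ⟩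
    (p′ ∸ p + p) * T + M ≡⟨ rearr (p′ ∸ p) p T M ⟩
    (p′ ∸ p) * T + (p * T + M) ≤⟨ +-mono-≤ (*-monoʳ-≤ (p′ ∸ p) (*-cancelˡ-≤′ p p>0 (m+n≤o⇒m≤o (p * T) g))) g ⟩
    (p′ ∸ p) * M + p * M ≡⟨ trans (sym (*-distribʳ-+ M (p′ ∸ p) p)) (cong (_* M) (m∸n+n≡m h)) ⟩
    p′ * M ∎
    where
    rearr : ∀ d p T M → (d + p) * T + M ≡ d * T + (p * T + M)
    rearr = solve-∀

  -- m₀ H + m₁ F is the total weight of the edges above an element of type (m₀, m₁, m₂); s = m₂ - m₀.
  gap-boosted : ∀ m₀ m₁ s F H → 2 * m₀ ≤ m₁ + 1 → m₁ * (F * (4 * (m₀ + m₁ + s) + 1)) ≡ m₁ * (4 * M) →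
    m₀ * (H * ((m₁ + 1) * (4 * (m₀ + m₁ + s) + 5))) ≡ m₀ * ((4 * (m₁ + 1) + 1) * M) →
    2 * (4 * (m₀ + m₁ + s) + 1) * (m₀ * H + m₁ * F) + M ≤ 2 * (4 * (m₀ + m₁ + s) + 1) * M
  gap-boosted m₀ m₁ s F H h eF eH = begin
    2 * (4 * δ + 1) * (m₀ * H + m₁ * F) + M ≡⟨ rearr₁ δ m₀ H m₁ F M ⟩
    2 * (m₀ * (H * (4 * δ + 1))) + 2 * (m₁ * (F * (4 * δ + 1))) + M
      ≤⟨ +-monoˡ-≤ M (+-mono-≤ (≤-trans (*-monoʳ-≤ 2 (*-monoʳ-≤ m₀ (*-monoʳ-≤ H (+-monoʳ-≤ (4 * δ) (s≤s z≤n))))) lowPart)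
           (≤-reflexive (cong (2 *_) eF))) ⟩
    (8 * m₀ + 1) * M + 2 * (m₁ * (4 * M)) + M ≤⟨ ≤-by (8 * s * M) (rearr₂ m₀ m₁ s M) ⟩
    2 * (4 * δ + 1) * M ∎
    where
    δ : ℕ
    δ = m₀ + m₁ + s
    rearr₁ : ∀ d a H b F M → 2 * (4 * d + 1) * (a * H + b * F) + M ≡ 2 * (a * (H * (4 * d + 1))) + 2 * (b * (F * (4 * d + 1))) + M
    rearr₁ = solve-∀
    rearr₂ : ∀ a b s M → 2 * (4 * (a + b + s) + 1) * M ≡ (8 * a + 1) * M + 2 * (b * (4 * M)) + M + 8 * s * M
    rearr₂ = solve-∀
    lowPart : 2 * (m₀ * (H * (4 * δ + 5))) ≤ (8 * m₀ + 1) * M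
    lowPart = *-cancelˡ-≤′ (m₁ + 1) (m≤n+m 1 m₁) (begin
      (m₁ + 1) * (2 * (m₀ * (H * (4 * δ + 5)))) ≡⟨ rearr₃ (m₁ + 1) m₀ H (4 * δ + 5) ⟩
      2 * (m₀ * (H * ((m₁ + 1) * (4 * δ + 5)))) ≡⟨ cong (2 *_) eH ⟩
      2 * (m₀ * ((4 * (m₁ + 1) + 1) * M)) ≡⟨ rearr₄ m₀ (m₁ + 1) M ⟩
      (m₁ + 1) * (8 * m₀ * M) + 2 * m₀ * M ≤⟨ +-monoʳ-≤ ((m₁ + 1) * (8 * m₀ * M)) (*-monoˡ-≤ M h) ⟩
      (m₁ + 1) * (8 * m₀ * M) + (m₁ + 1) * M ≡⟨ rearr₅ (m₁ + 1) m₀ M ⟩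
      (m₁ + 1) * ((8 * m₀ + 1) * M) ∎)
      where
      rearr₃ : ∀ P a H D → P * (2 * (a * (H * D))) ≡ 2 * (a * (H * (P * D)))
      rearr₃ = solve-∀
      rearr₄ : ∀ a P M → 2 * (a * ((4 * P + 1) * M)) ≡ P * (8 * a * M) + 2 * a * M
      rearr₄ = solve-∀
      rearr₅ : ∀ P a M → P * (8 * a * M) + P * M ≡ P * ((8 * a + 1) * M)
      rearr₅ = solve-∀

  -- The type crosses the threshold: upper covers obtained by raising a 0 are boosted, those
  -- obtained by raising a 1 are not. Here m₀ is at least m₁/3, and the slack left by uniform
  -- weights outweighs the extra weight of the boosted edges.
  gap-mixed : ∀ m₀′ m₁ s F H → 2 * m₀′ ≤ m₁ + 1 → m₁ ≤ 3 * suc m₀′ →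
    m₁ * (F * (suc m₀′ + m₁ + s)) ≡ m₁ * M →
    H * ((m₁ + 1) * (4 * (suc m₀′ + m₁ + s) + 5)) ≡ (4 * (m₁ + 1) + 1) * M →
    4 * (4 * (suc m₀′ + m₁ + s) + 5) * (suc m₀′ * H + m₁ * F) + M ≤ 4 * (4 * (suc m₀′ + m₁ + s) + 5) * M
  gap-mixed m₀′ m₁ s F H h h₁ eF eH = *-cancelˡ-≤′ δ (s≤s z≤n) (begin
    δ * (4 * (4 * δ + 5) * (m₀ * H + m₁ * F) + M) ≡⟨ rearr₁ δ m₀ H m₁ F M ⟩
    2 * (2 * (δ * m₀ * (H * (4 * δ + 5)))) + 4 * (4 * δ + 5) * (m₁ * (F * δ)) + δ * M
      ≤⟨ +-monoˡ-≤ (δ * M) (+-mono-≤ (*-monoʳ-≤ 2 lowPart) (≤-reflexive (cong (4 * (4 * δ + 5) *_) eF))) ⟩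
    2 * ((8 * δ * m₀ + 3 * m₀ + 2 * s) * M) + 4 * (4 * δ + 5) * (m₁ * M) + δ * M
      ≡⟨ rearr₂ δ m₀ m₁ s M ⟩
    (16 * δ * m₀ + 6 * m₀ + 4 * s + 16 * δ * m₁ + 20 * m₁ + δ) * M ≤⟨ *-monoˡ-≤ M (begin
      16 * δ * m₀ + 6 * m₀ + 4 * s + 16 * δ * m₁ + 20 * m₁ + δ ≡⟨ rearr₃ δ m₀ m₁ s ⟩
      16 * δ * (m₀ + m₁) + 7 * m₀ + 5 * s + 20 * m₁ + m₁ ≤⟨ +-monoʳ-≤ _ h₁ ⟩
      16 * δ * (m₀ + m₁) + 7 * m₀ + 5 * s + 20 * m₁ + 3 * m₀ ≤⟨ ≤-by (16 * δ * s + 15 * s + 10 * m₀) (rearr₄ δ m₀ m₁ s) ⟩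
      16 * δ * (m₀ + m₁ + s) + 20 * (m₀ + m₁ + s) ≡⟨ rearr₅ δ ⟩
      δ * (4 * (4 * δ + 5)) ∎) ⟩
    δ * (4 * (4 * δ + 5)) * M ≡⟨ *-assoc δ (4 * (4 * δ + 5)) M ⟩
    δ * (4 * (4 * δ + 5) * M) ∎)
    where
    m₀ δ P : ℕ
    m₀ = suc m₀′
    δ = m₀ + m₁ + s
    P = m₁ + 1
    rearr₁ : ∀ d a H b F M → d * (4 * (4 * d + 5) * (a * H + b * F) + M) ≡
      2 * (2 * (d * a * (H * (4 * d + 5)))) + 4 * (4 * d + 5) * (b * (F * d)) + d * M
    rearr₁ = solve-∀
    rearr₂ : ∀ d a b s M → 2 * ((8 * d * a + 3 * a + 2 * s) * M) + 4 * (4 * d + 5) * (b * M) + d * M ≡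
      (16 * d * a + 6 * a + 4 * s + 16 * d * b + 20 * b + d) * M
    rearr₂ = solve-∀
    rearr₃ : ∀ d a b s → 16 * d * a + 6 * a + 4 * s + 16 * d * b + 20 * b + (a + b + s) ≡
      16 * d * (a + b) + 7 * a + 5 * s + 20 * b + b
    rearr₃ = solve-∀
    rearr₄ : ∀ d a b s → 16 * d * (a + b + s) + 20 * (a + b + s) ≡
      16 * d * (a + b) + 7 * a + 5 * s + 20 * b + 3 * a + (16 * d * s + 15 * s + 10 * a)
    rearr₄ = solve-∀
    rearr₅ : ∀ d → 16 * d * d + 20 * d ≡ d * (4 * (4 * d + 5))
    rearr₅ = solve-∀
    m₀≤P : m₀ ≤ P
    m₀≤P = from m₀′ m₁ h
      where
      from : ∀ a b → 2 * a ≤ b + 1 → suc a ≤ b + 1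
      from zero b q = m≤n+m 1 b
      from (suc a) b q = ≤-trans (≤-by a (arith a)) q
        where
        arith : ∀ a → 2 * suc a ≡ suc (suc a) + a
        arith = solve-∀
    middle : 2 * (m₀ * δ) ≤ (3 * m₀ + 2 * s) * P
    middle = begin
      2 * (m₀ * δ) ≡⟨ arith₁ m₀′ m₁ s ⟩
      2 * (m₀ * P) + m₀ * (2 * m₀′) + 2 * s * m₀
        ≤⟨ +-mono-≤ (+-monoʳ-≤ (2 * (m₀ * P)) (*-monoʳ-≤ m₀ h)) (*-monoʳ-≤ (2 * s) m₀≤P) ⟩
      2 * (m₀ * P) + m₀ * P + 2 * s * P ≡⟨ arith₂ m₀ P s ⟩
      (3 * m₀ + 2 * s) * P ∎
      where
      arith₁ : ∀ a b s → 2 * (suc a * (suc a + b + s)) ≡ 2 * (suc a * (b + 1)) + suc a * (2 * a) + 2 * s * suc a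
      arith₁ = solve-∀
      arith₂ : ∀ a P s → 2 * (a * P) + a * P + 2 * s * P ≡ (3 * a + 2 * s) * P
      arith₂ = solve-∀
    lowPart : 2 * (δ * m₀ * (H * (4 * δ + 5))) ≤ (8 * δ * m₀ + 3 * m₀ + 2 * s) * M
    lowPart = *-cancelˡ-≤′ P (m≤n+m 1 m₁) (begin
      P * (2 * (δ * m₀ * (H * (4 * δ + 5)))) ≡⟨ rearr₆ P (δ * m₀) H (4 * δ + 5) ⟩
      2 * (δ * m₀ * (H * (P * (4 * δ + 5)))) ≡⟨ cong (λ m → 2 * (δ * m₀ * m)) eH ⟩
      2 * (δ * m₀ * ((4 * P + 1) * M)) ≡⟨ rearr₇ δ m₀ P M ⟩
      P * (8 * δ * m₀ * M) + 2 * (m₀ * δ) * M ≤⟨ +-monoʳ-≤ (P * (8 * δ * m₀ * M)) (*-monoˡ-≤ M middle) ⟩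
      P * (8 * δ * m₀ * M) + (3 * m₀ + 2 * s) * P * M ≡⟨ rearr₈ P δ m₀ s M ⟩
      P * ((8 * δ * m₀ + 3 * m₀ + 2 * s) * M) ∎)
      where
      rearr₆ : ∀ P a H D → P * (2 * (a * (H * D))) ≡ 2 * (a * (H * (P * D)))
      rearr₆ = solve-∀
      rearr₇ : ∀ d a P M → 2 * (d * a * ((4 * P + 1) * M)) ≡ P * (8 * d * a * M) + 2 * (a * d) * M
      rearr₇ = solve-∀
      rearr₈ : ∀ P d a s M → P * (8 * d * a * M) + (3 * a + 2 * s) * P * M ≡ P * ((8 * d * a + 3 * a + 2 * s) * M)
      rearr₈ = solve-∀

  -- With δ = m₀ + m₁ + s, uniform weights fall short of M by the proportion (m₀ + s + δs) / (δ(δ +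
  -- 1)), which is at least 1 / (4(δ + 1)) because m₁ ≤ 3 m₀.
  gap-flat : ∀ m₀ m₁ s F H → 0 < m₀ → m₁ ≤ 3 * m₀ → m₁ * (F * (m₀ + m₁ + s)) ≡ m₁ * M → H * (m₀ + m₁ + s + 1) ≡ M →
    4 * (m₀ + m₁ + s + 1) * (m₀ * H + m₁ * F) + M ≤ 4 * (m₀ + m₁ + s + 1) * M
  gap-flat m₀ m₁ s F H m₀>0 h₁ eF eH = *-cancelˡ-≤′ δ (≤-trans m₀>0 (≤-trans (m≤m+n m₀ m₁) (m≤m+n _ s))) (begin
    δ * (4 * (δ + 1) * (m₀ * H + m₁ * F) + M) ≡⟨ rearr₁ δ m₀ H m₁ F M ⟩
    4 * (δ * m₀ * (H * (δ + 1))) + 4 * (δ + 1) * (m₁ * (F * δ)) + δ * M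
      ≡⟨ cong₂ (λ p q → 4 * (δ * m₀ * p) + 4 * (δ + 1) * q + δ * M) eH eF ⟩
    4 * (δ * m₀ * M) + 4 * (δ + 1) * (m₁ * M) + δ * M ≡⟨ rearr₂ m₀ m₁ s M ⟩
    (4 * δ * (m₀ + m₁) + 4 * m₁ + m₀ + s) * M + m₁ * M ≤⟨ +-monoʳ-≤ ((4 * δ * (m₀ + m₁) + 4 * m₁ + m₀ + s) * M) (*-monoˡ-≤ M h₁) ⟩
    (4 * δ * (m₀ + m₁) + 4 * m₁ + m₀ + s) * M + 3 * m₀ * M ≤⟨ ≤-by ((4 * δ * s + 3 * s) * M) (rearr₃ m₀ m₁ s M) ⟩
    δ * (4 * (δ + 1) * M) ∎)
    where
    δ : ℕ
    δ = m₀ + m₁ + s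
    rearr₁ : ∀ d a H b F M → d * (4 * (d + 1) * (a * H + b * F) + M) ≡
      4 * (d * a * (H * (d + 1))) + 4 * (d + 1) * (b * (F * d)) + d * M
    rearr₁ = solve-∀
    rearr₂ : ∀ a b s M → 4 * ((a + b + s) * a * M) + 4 * (a + b + s + 1) * (b * M) + (a + b + s) * M ≡
      (4 * (a + b + s) * (a + b) + 4 * b + a + s) * M + b * M
    rearr₂ = solve-∀
    rearr₃ : ∀ a b s M → (a + b + s) * (4 * (a + b + s + 1) * M) ≡
      (4 * (a + b + s) * (a + b) + 4 * b + a + s) * M + 3 * a * M + (4 * (a + b + s) * s + 3 * s) * M
    rearr₃ = solve-∀

low-counts : ∀ {n} (y x : Elem n) → covₛ low y x ≡ true →
  cnt₀ y ≡ suc (cnt₀ x) × cnt₁ x ≡ suc (cnt₁ y) × cnt₂ x ≡ cnt₂ y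
low-counts [] [] ()
low-counts (0F ∷ y) (0F ∷ x) h = let (a , b , c) = low-counts y x h in cong suc a , b , c
low-counts (1F ∷ y) (1F ∷ x) h = let (a , b , c) = low-counts y x h in a , cong suc b , c
low-counts (2F ∷ y) (2F ∷ x) h = let (a , b , c) = low-counts y x h in a , b , cong suc c
low-counts (0F ∷ y) (1F ∷ x) h with refl ← eqV⁻ y x h = refl , refl , refl

high-counts : ∀ {n} (y x : Elem n) → covₛ high y x ≡ true →
  cnt₀ x ≡ cnt₀ y × cnt₁ y ≡ suc (cnt₁ x) × cnt₂ x ≡ suc (cnt₂ y)
high-counts [] [] ()
high-counts (0F ∷ y) (0F ∷ x) h = let (a , b , c) = high-counts y x h in cong suc a , b , c
high-counts (1F ∷ y) (1F ∷ x) h = let (a , b , c) = high-counts y x h in a , cong suc b , c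
high-counts (2F ∷ y) (2F ∷ x) h = let (a , b , c) = high-counts y x h in a , b , cong suc c
high-counts (1F ∷ y) (2F ∷ x) h with refl ← eqV⁻ y x h = refl , refl , refl

module RankWeights (n : ℕ) (n≥2 : 2 ≤ n) where
  open EdgeWeights n
  open ≤-Reasoning

  n>0 : 0 < n
  n>0 = ≤-trans (s≤s z≤n) n≥2

  boosted≤ : ∀ δ → δ ≤ n → 4 * (4 * δ + 5) ≤ 40 * n
  boosted≤ δ h = begin
    4 * (4 * δ + 5) ≤⟨ *-monoʳ-≤ 4 (+-mono-≤ (*-monoʳ-≤ 4 h) (*-monoʳ-≤ 5 n>0)) ⟩
    4 * (4 * n + 5 * n) ≤⟨ ≤-by (4 * n) (arith n) ⟩
    40 * n ∎
    where
    arith : ∀ n → 40 * n ≡ 4 * (4 * n + 5 * n) + 4 * n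
    arith = solve-∀

  -- Without 0s, an unboosted point has at most one 1; its single upper edge carries at most M/2
  -- because the upper end has at least two lower covers.
  gap-zero : ∀ m₁ s F → m₁ ≤ 1 → 2 ≤ m₁ + s → m₁ * (F * (m₁ + s)) ≡ m₁ * M → 2 * (0 + m₁ * F) + M ≤ 2 * M
  gap-zero zero s F h d e = ≤-by M refl₂
    where
    refl₂ : 2 * M ≡ M + M
    refl₂ = cong (M +_) (+-identityʳ M)
  gap-zero (suc zero) s F h d e = begin
    2 * (1 * F) + M ≡⟨ cong (_+ M) (arith F) ⟩
    F * 2 + M ≤⟨ +-monoˡ-≤ M (*-monoʳ-≤ F d) ⟩
    F * (1 + s) + M ≡⟨ cong (_+ M) (*-cancelˡ-≡ _ _ 1 e) ⟩
    M + M ≡⟨ cong (M +_) (sym (+-identityʳ M)) ⟩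
    2 * M ∎
    where
    arith : ∀ F → 2 * (1 * F) ≡ F * 2
    arith = solve-∀
  gap-zero (suc (suc m₁)) s F (s≤s ())

  -- Truncated subtraction is harmless: the type of an upper cover that does not exist is multiplied
  -- by 0. If raising a 1 leads to a boosted type, then so does raising a 0, which leaves the three
  -- cases above and m₀ = 0.
  gap : ∀ m₀ m₁ s → m₀ + (m₁ + (m₀ + s)) ≡ n →
    40 * n * (m₀ * lowW (m₀ ∸ 1) (suc m₁) (m₀ + s) + m₁ * highW m₀ (m₁ ∸ 1) (suc (m₀ + s))) + M ≤ 40 * n * M
  gap m₀ m₁ s total = by m₀ m₁ total (split-type m₀ (m₁ ∸ 1))
    where
    high-δ : ∀ a b → (b ∸ 1) + suc (a + s) ≡ a + b + s ⊎ b ≡ 0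
    high-δ a zero = inj₂ refl
    high-δ a (suc b) = inj₁ (arith a b s)
      where
      arith : ∀ a b s → b + suc (a + s) ≡ a + suc b + s
      arith = solve-∀
    low-δ : ∀ a b → suc b + (a + s) ≡ a + b + s + 1
    low-δ a b = arith a b s
      where
      arith : ∀ a b s → suc b + (a + s) ≡ a + b + s + 1
      arith = solve-∀
    δ≤ : ∀ a b → a + (b + (a + s)) ≡ n → a + b + s ≤ n
    δ≤ a b e = ≤-by a (trans (sym e) (arith a b s))
      where
      arith : ∀ a b s → a + (b + (a + s)) ≡ a + b + s + a
      arith = solve-∀
    lowδ≤ : ∀ a b → suc a + (b + (suc a + s)) ≡ n → suc b + (suc a + s) ≤ n
    lowδ≤ a b e = ≤-by a (trans (sym e) (arith a b s))
      where
      arith : ∀ a b s → suc a + (b + (suc a + s)) ≡ suc b + (suc a + s) + a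
      arith = solve-∀
    four-five : ∀ d → 4 * (d + 1) + 1 ≡ 4 * d + 5
    four-five = solve-∀
    high-boost′ : ∀ a b → a + (b + (a + s)) ≡ n → 2 * a < b ∸ 1 →
      b * (highW a (b ∸ 1) (suc (a + s)) * (4 * (a + b + s) + 1)) ≡ b * (4 * M)
    high-boost′ a b e h with high-δ a b
    ... | inj₂ refl = refl
    ... | inj₁ q = cong (b *_) (trans (cong (λ d → highW a (b ∸ 1) (suc (a + s)) * (4 * d + 1)) (sym q))
          (high-boost a (b ∸ 1) (suc (a + s)) h (subst (_≤ n) (sym q) (δ≤ a b e))))
    high-flat′ : ∀ a b → a + (b + (a + s)) ≡ n → b ∸ 1 ≤ 2 * a →
      b * (highW a (b ∸ 1) (suc (a + s)) * (a + b + s)) ≡ b * M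
    high-flat′ a b e h with high-δ a b
    ... | inj₂ refl = refl
    ... | inj₁ q = cong (b *_) (trans (cong (highW a (b ∸ 1) (suc (a + s)) *_) (sym q))
          (high-flat a (b ∸ 1) (suc (a + s)) h (subst (0 <_) (sym (+-suc (b ∸ 1) (a + s))) (s≤s z≤n)) (subst (_≤ n) (sym q) (δ≤ a b e))))
    low-boost′ : ∀ a b → suc a + (b + (suc a + s)) ≡ n → 2 * a < suc b →
      lowW a (suc b) (suc a + s) * ((b + 1) * (4 * (suc a + b + s) + 5)) ≡ (4 * (b + 1) + 1) * M
    low-boost′ a b e h = trans (cong (lowW a (suc b) (suc a + s) *_) (cong₂ _*_ (+-comm b 1)
        (trans (sym (four-five (suc a + b + s))) (cong (λ d → 4 * d + 1) (sym (low-δ (suc a) b))))))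
      (trans (low-boost a (suc b) (suc a + s) h (lowδ≤ a b e)) (cong (λ d → (4 * d + 1) * M) (+-comm 1 b)))
    by : ∀ m₀ m₁ → m₀ + (m₁ + (m₀ + s)) ≡ n → 2 * m₀ < m₁ ∸ 1 ⊎ m₁ ∸ 1 ≤ 2 * m₀ →
      40 * n * (m₀ * lowW (m₀ ∸ 1) (suc m₁) (m₀ + s) + m₁ * highW m₀ (m₁ ∸ 1) (suc (m₀ + s))) + M ≤ 40 * n * M
    by m₀ m₁ e (inj₁ h) = scale-gap (2 * (4 * (m₀ + m₁ + s) + 1)) (40 * n) _ (*-mono-≤ {1} {2} (s≤s z≤n) (m≤n+m 1 (4 * (m₀ + m₁ + s))))
      (≤-trans (≤-by (8 * (m₀ + m₁ + s) + 18) (arith (m₀ + m₁ + s))) (boosted≤ (m₀ + m₁ + s) (δ≤ m₀ m₁ e)))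
      (gap-boosted m₀ m₁ s _ _ (≤-trans (<⇒≤ h) (≤-trans (m∸n≤m m₁ 1) (m≤m+n m₁ 1))) (high-boost′ m₀ m₁ e h) (low-eq m₀ m₁ e h))
      where
      arith : ∀ d → 4 * (4 * d + 5) ≡ 2 * (4 * d + 1) + (8 * d + 18)
      arith = solve-∀
      low-eq : ∀ m₀ m₁ → m₀ + (m₁ + (m₀ + s)) ≡ n → 2 * m₀ < m₁ ∸ 1 →
        m₀ * (lowW (m₀ ∸ 1) (suc m₁) (m₀ + s) * ((m₁ + 1) * (4 * (m₀ + m₁ + s) + 5))) ≡ m₀ * ((4 * (m₁ + 1) + 1) * M)
      low-eq zero m₁ e h = refl
      low-eq (suc m₀) m₁ e h = cong (suc m₀ *_) (low-boost′ m₀ m₁ e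
        (≤-trans (s≤s (*-monoʳ-≤ 2 (n≤1+n m₀))) (≤-trans h (≤-trans (m∸n≤m m₁ 1) (n≤1+n m₁)))))
    by zero m₁ e (inj₂ h) = scale-gap 2 (40 * n) _ (s≤s z≤n) (≤-trans (*-mono-≤ {1} {40} (s≤s z≤n) n≥2) ≤-refl)
      (gap-zero m₁ s _ (small m₁ h) (subst (2 ≤_) (sym e) n≥2) (high-flat′ 0 m₁ e h))
      where
      small : ∀ m → m ∸ 1 ≤ 0 → m ≤ 1
      small zero _ = z≤n
      small (suc zero) _ = ≤-refl
    by (suc m₀) m₁ e (inj₂ h) = inner (split-type m₀ (suc m₁))
      where
      m₁≤ : m₁ ≤ 3 * suc m₀
      m₁≤ = ≤-trans (m≤n+m∸n m₁ 1) (≤-trans (+-monoʳ-≤ 1 h) (≤-by m₀ (arith m₀)))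
        where
        arith : ∀ a → 3 * suc a ≡ 1 + 2 * suc a + a
        arith = solve-∀
      inner : 2 * m₀ < suc m₁ ⊎ suc m₁ ≤ 2 * m₀ →
        40 * n * (suc m₀ * lowW m₀ (suc m₁) (suc m₀ + s) + m₁ * highW (suc m₀) (m₁ ∸ 1) (suc (suc m₀ + s))) + M ≤ 40 * n * M
      inner (inj₁ q) = scale-gap (4 * (4 * (suc m₀ + m₁ + s) + 5)) (40 * n) _ (*-mono-≤ {1} {4} (s≤s z≤n) (≤-trans (s≤s z≤n) (m≤n+m 5 (4 * (suc m₀ + m₁ + s)))))
        (boosted≤ (suc m₀ + m₁ + s) (δ≤ (suc m₀) m₁ e))
        (gap-mixed m₀ m₁ s _ _ (≤-trans (<⇒≤ q) (≤-reflexive (+-comm 1 m₁))) m₁≤ (high-flat′ (suc m₀) m₁ e h) (low-boost′ m₀ m₁ e q))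
      inner (inj₂ q) = scale-gap (4 * (suc m₀ + m₁ + s + 1)) (40 * n) _ (*-mono-≤ {1} {4} (s≤s z≤n) (m≤n+m 1 (suc m₀ + m₁ + s)))
        (≤-trans (*-monoʳ-≤ 4 (+-mono-≤ (m≤n*m (suc m₀ + m₁ + s) 4) (s≤s z≤n))) (boosted≤ (suc m₀ + m₁ + s) (δ≤ (suc m₀) m₁ e)))
        (gap-flat (suc m₀) m₁ s _ _ (s≤s z≤n) m₁≤ (high-flat′ (suc m₀) m₁ e h)
          (trans (cong (lowW m₀ (suc m₁) (suc m₀ + s) *_) (sym (low-δ (suc m₀) m₁)))
            (low-flat m₀ (suc m₁) (suc m₀ + s) q (s≤s z≤n) (lowδ≤ m₀ m₁ e))))

  highOf lowOf : Elem n → ℕ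
  highOf x = highW (cnt₀ x) (cnt₁ x) (cnt₂ x)
  lowOf x = lowW (cnt₀ x) (cnt₁ x) (cnt₂ x)

  wt : Elem n → Elem n → ℕ
  wt y x = ⟦ covₛ low y x ⟧ * lowOf x + ⟦ covₛ high y x ⟧ * highOf x

  data EdgeKind (y x : Elem n) : Set where
    none : covₛ low y x ≡ false → covₛ high y x ≡ false → cov y x ≡ false → EdgeKind y x
    lower-edge : covₛ low y x ≡ true → covₛ high y x ≡ false → cov y x ≡ true → EdgeKind y x
    upper-edge : covₛ low y x ≡ false → covₛ high y x ≡ true → cov y x ≡ true → EdgeKind y x

  edgeKind : ∀ y x → EdgeKind y x
  edgeKind y x = by (bool-case (covₛ low y x)) (bool-case (covₛ high y x)) (bool-case (cov y x))
    where
    sum : ∀ {a b c} → cov y x ≡ a → covₛ low y x ≡ b → covₛ high y x ≡ c → ⟦ a ⟧ ≡ ⟦ b ⟧ + ⟦ c ⟧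
    sum p q r = trans (sym (cong ⟦_⟧ p)) (trans (cov-split y x) (cong₂ (λ b c → ⟦ b ⟧ + ⟦ c ⟧) q r))
    by : covₛ low y x ≡ true ⊎ covₛ low y x ≡ false → covₛ high y x ≡ true ⊎ covₛ high y x ≡ false →
         cov y x ≡ true ⊎ cov y x ≡ false → EdgeKind y x
    by (inj₂ p) (inj₂ q) (inj₂ r) = none p q r
    by (inj₁ p) (inj₂ q) (inj₁ r) = lower-edge p q r
    by (inj₂ p) (inj₁ q) (inj₁ r) = upper-edge p q r
    by (inj₁ p) (inj₁ q) (inj₁ r) with sum r p q
    ... | ()
    by (inj₁ p) (inj₁ q) (inj₂ r) with sum r p q
    ... | ()
    by (inj₂ p) (inj₂ q) (inj₁ r) with sum r p q
    ... | ()
    by (inj₁ p) (inj₂ q) (inj₂ r) with sum r p q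
    ... | ()
    by (inj₂ p) (inj₁ q) (inj₂ r) with sum r p q
    ... | ()

  wt-lower : ∀ y x → covₛ low y x ≡ true → covₛ high y x ≡ false → wt y x ≡ lowOf x
  wt-lower y x p q = trans (cong₂ (λ a b → ⟦ a ⟧ * lowOf x + ⟦ b ⟧ * highOf x) p q) (trans (+-identityʳ _) (+-identityʳ _))

  wt-upper : ∀ y x → covₛ low y x ≡ false → covₛ high y x ≡ true → wt y x ≡ highOf x
  wt-upper y x p q = trans (cong₂ (λ a b → ⟦ a ⟧ * lowOf x + ⟦ b ⟧ * highOf x) p q) (+-identityʳ _)

  wt-none : ∀ y x → covₛ low y x ≡ false → covₛ high y x ≡ false → wt y x ≡ 0
  wt-none y x p q = cong₂ (λ a b → ⟦ a ⟧ * lowOf x + ⟦ b ⟧ * highOf x) p q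

  module _ (k : ℕ) (n<k : n < k) where
    open Sums n

    D≤n : ∀ (x : Elem n) → cnt₁ x + cnt₂ x ≤ n
    D≤n x = subst (cnt₁ x + cnt₂ x ≤_) (cnt-total x) (m≤n+m _ (cnt₀ x))

    n≤2D : ∀ (x : Elem n) → rank x ≡ k → n ≤ 2 * (cnt₁ x + cnt₂ x)
    n≤2D x r = ≤-trans (<⇒≤ n<k) (≤-trans (≤-reflexive (trans (sym r) (sym (cnt-rank x)))) (≤-by (cnt₁ x) (arith (cnt₁ x) (cnt₂ x))))
      where
      arith : ∀ b c → 2 * (b + c) ≡ b + (c + c) + b
      arith = solve-∀

    D>0 : ∀ (x : Elem n) → rank x ≡ k → 0 < cnt₁ x + cnt₂ x
    D>0 x r = from (cnt₁ x + cnt₂ x) (n≤2D x r)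
      where
      from : ∀ d → n ≤ 2 * d → 0 < d
      from zero h = ≤-trans n>0 h
      from (suc d) _ = s≤s z≤n

    up-weight : ∀ y → suc (rank y) ≡ k → 40 * n * ∑V (λ x → wt y x) + M ≤ 40 * n * M
    up-weight y r = subst (λ T → 40 * n * T + M ≤ 40 * n * M) (sym total-weight)
      (subst (λ m₂ → 40 * n * (m₀ * lowW (m₀ ∸ 1) (suc m₁) m₂ + m₁ * highW m₀ (m₁ ∸ 1) (suc m₂)) + M ≤ 40 * n * M)
        (m+[n∸m]≡n m₀≤m₂) (gap m₀ m₁ (m₂ ∸ m₀) (trans (cong (λ m → m₀ + (m₁ + m)) (m+[n∸m]≡n m₀≤m₂)) (cnt-total y))))
      where
      m₀ m₁ m₂ : ℕ
      m₀ = cnt₀ y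
      m₁ = cnt₁ y
      m₂ = cnt₂ y
      m₀≤m₂ : m₀ ≤ m₂
      m₀≤m₂ = +-cancelʳ-≤ (m₁ + m₂) m₀ m₂ (begin
        m₀ + (m₁ + m₂) ≡⟨ cnt-total y ⟩
        n ≤⟨ ≤-pred (subst (n <_) (sym r) n<k) ⟩
        rank y ≡⟨ sym (cnt-rank y) ⟩
        m₁ + (m₂ + m₂) ≡⟨ arith m₁ m₂ ⟩
        m₂ + (m₁ + m₂) ∎)
        where
        arith : ∀ b c → b + (c + c) ≡ c + (b + c)
        arith = solve-∀
      low-term : ∀ x → ⟦ covₛ low y x ⟧ * lowOf x ≡ ⟦ covₛ low y x ⟧ * lowW (m₀ ∸ 1) (suc m₁) m₂
      low-term x = ⟦⟧-*-cong (covₛ low y x) λ e → let (a , b , c) = low-counts y x e in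
        trans (cong₂ (λ p q → lowW p q (cnt₂ x)) (sym (cong (_∸ 1) a)) b) (cong (lowW (m₀ ∸ 1) (suc m₁)) c)
      high-term : ∀ x → ⟦ covₛ high y x ⟧ * highOf x ≡ ⟦ covₛ high y x ⟧ * highW m₀ (m₁ ∸ 1) (suc m₂)
      high-term x = ⟦⟧-*-cong (covₛ high y x) λ e → let (a , b , c) = high-counts y x e in
        trans (cong₂ (λ p q → highW p q (cnt₂ x)) a (sym (cong (_∸ 1) b))) (cong (highW m₀ (m₁ ∸ 1)) c)
      total-weight : ∑V (λ x → wt y x) ≡ m₀ * lowW (m₀ ∸ 1) (suc m₁) m₂ + m₁ * highW m₀ (m₁ ∸ 1) (suc m₂)
      total-weight = trans (∑V-+ _ _) (cong₂ _+_
        (trans (∑V-cong low-term) (trans (∑V-*ʳ (lowW (m₀ ∸ 1) (suc m₁) m₂) _) (cong (_* lowW (m₀ ∸ 1) (suc m₁) m₂) (low-up y))))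
        (trans (∑V-cong high-term) (trans (∑V-*ʳ (highW m₀ (m₁ ∸ 1) (suc m₂)) _) (cong (_* highW m₀ (m₁ ∸ 1) (suc m₂)) (high-up y)))))

    weights : Weights k 40 M wt
    weights = record
      { M>0 = M>0
      ; w-off = λ y x e → off y x e (edgeKind y x)
      ; w-sum = λ x r → trans (∑V-+ _ _) (trans (cong₂ _+_
          (trans (∑V-*ʳ (lowOf x) _) (cong (_* lowOf x) (low-down x)))
          (trans (∑V-*ʳ (highOf x) _) (cong (_* highOf x) (high-down x))))
          (type-sum (cnt₀ x) (cnt₁ x) (cnt₂ x) (D>0 x r) (D≤n x)))
      ; w-up = up-weight
      ; w-lo = λ y x e r → lo y x e r (edgeKind y x)
      ; w-hi = λ y x r → hi y x r (edgeKind y x)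
      ; deg = λ x r → ≤-trans (n≤2D x r) (≤-reflexive (cong (2 *_) (sym (down-degree x))))
      }
      where
      off : ∀ y x → cov y x ≡ false → EdgeKind y x → wt y x ≡ 0
      off y x e (none p q _) = wt-none y x p q
      off y x e (lower-edge _ _ r) = ⊥-elim (true≢false r e)
      off y x e (upper-edge _ _ r) = ⊥-elim (true≢false r e)
      has-one : ∀ y x → covₛ low y x ≡ true → 0 < cnt₁ x
      has-one y x p = let (_ , b , _) = low-counts y x p in subst (0 <_) (sym b) (s≤s z≤n)
      lo : ∀ y x → cov y x ≡ true → rank x ≡ k → EdgeKind y x → M ≤ 2 * n * wt y x
      lo y x e r (none _ _ q) = ⊥-elim (true≢false e q)
      lo y x e r (lower-edge p q _) = subst (λ w → M ≤ 2 * n * w) (sym (wt-lower y x p q)) (low-lo (cnt₀ x) (cnt₁ x) (cnt₂ x) (has-one y x p) (D≤n x))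
      lo y x e r (upper-edge p q _) = subst (λ w → M ≤ 2 * n * w) (sym (wt-upper y x p q)) (high-lo (cnt₀ x) (cnt₁ x) (cnt₂ x) (D>0 x r) (D≤n x))
      hi : ∀ y x → rank x ≡ k → EdgeKind y x → n * wt y x ≤ 3 * M
      hi y x r (none p q _) = ≤-trans (≤-reflexive (trans (cong (n *_) (wt-none y x p q)) (*-zeroʳ n))) z≤n
      hi y x r (lower-edge p q _) = subst (λ w → n * w ≤ 3 * M) (sym (wt-lower y x p q)) (low-hi (cnt₀ x) (cnt₁ x) (cnt₂ x) (has-one y x p) (D≤n x) (n≤2D x r))
      hi y x r (upper-edge p q _) = subst (λ w → n * w ≤ 3 * M) (sym (wt-upper y x p q)) (high-hi (cnt₀ x) (cnt₁ x) (cnt₂ x) (D>0 x r) (D≤n x) (n≤2D x r))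

-- Choice of parameters

abstract
  tokenCount : ℕ → ℕ
  tokenCount n = (1 + (n + n)) ^ 8 * 6

  length-walks′ : ∀ {n} ℓ (x : Elem n) → length (walks ℓ x) ≤ tokenCount n ^ ℓ
  length-walks′ = length-walks

  tokenCount-≥ : ∀ n → n ^ 8 ≤ tokenCount n
  tokenCount-≥ n = ≤-trans (^-monoˡ-≤ 8 (≤-trans (m≤m+n n n) (n≤1+n (n + n)))) (m≤m*n ((1 + (n + n)) ^ 8) 6)

  tokenCount-≤ : ∀ n → 0 < n → tokenCount n ≤ (3 * n) ^ 8 * 6
  tokenCount-≤ n h = *-monoˡ-≤ 6 (^-monoˡ-≤ 8 (+-mono-≤ h (≤-reflexive (cong (n +_) (sym (+-identityʳ n))))))

-- `r` is logarithmic in n: two walk tokens cost at most r bits, yet n is at least r¹⁰. Of this, r⁸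
-- is for powers of r, and r² ≥ 4096² = 16777216 is the reserve that absorbs numerical constants in
-- `below-n`.
record Scale (n r : ℕ) : Set where
  field
    r-big : 4096 ≤ r
    n-big : (r * r) * (r * r) * ((r * r) * (r * r)) * (r * r) ≤ n
    code-small : tokenCount n ^ 2 ≤ 2 ^ r

  r>0 : 0 < r
  r>0 = ≤-trans (s≤s z≤n) r-big

  r2 r4 r8 r5 : ℕ
  r2 = r * r
  r4 = r2 * r2
  r8 = r4 * r4
  r5 = r4 * r

  r2>0 : 0 < r2
  r2>0 = *-mono-≤ r>0 r>0
  r4>0 : 0 < r4
  r4>0 = *-mono-≤ r2>0 r2>0
  r8>0 : 0 < r8
  r8>0 = *-mono-≤ r4>0 r4>0

  r2-big : 16777216 ≤ r2
  r2-big = *-mono-≤ r-big r-big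

  below-n : ∀ c d → c ≤ 16777216 → d ≤ r8 → c * d ≤ n
  below-n c d hc hd = ≤-trans (*-mono-≤ (≤-trans hc r2-big) hd) (≤-trans (≤-reflexive (*-comm r2 r8)) n-big)

  n>0 : 0 < n
  n>0 = ≤-trans (*-mono-≤ r8>0 r2>0) n-big

  r≤r2 : r ≤ r2
  r≤r2 = ≤-trans (≤-reflexive (sym (*-identityʳ r))) (*-monoʳ-≤ r r>0)
  r2≤r4 : r2 ≤ r4
  r2≤r4 = ≤-trans (≤-reflexive (sym (*-identityʳ r2))) (*-monoʳ-≤ r2 r2>0)
  r4≤r8 : r4 ≤ r8
  r4≤r8 = ≤-trans (≤-reflexive (sym (*-identityʳ r4))) (*-monoʳ-≤ r4 r4>0)
  r5≤r8 : r5 ≤ r8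
  r5≤r8 = *-monoʳ-≤ r4 (≤-trans r≤r2 r2≤r4)

  nn>0 : 0 < n * n
  nn>0 = *-mono-≤ n>0 n>0

  n≤token : n * n * (n * n) * (n * n) * (n * n) ≤ tokenCount n
  n≤token = ≤-trans (≤-reflexive (arith n)) (tokenCount-≥ n)
    where
    arith : ∀ n → n * n * (n * n) * (n * n) * (n * n) ≡ n * (n * (n * (n * (n * (n * (n * (n * 1)))))))
    arith = solve-∀

  token≤ : tokenCount n ≤ 2 ^ r
  token≤ = ≤-trans (≤-trans (≤-reflexive (sym (*-identityʳ (tokenCount n))))
    (*-monoʳ-≤ (tokenCount n) (≤-trans token>0 (≤-reflexive (sym (*-identityʳ (tokenCount n))))))) code-small
    where
    token>0 : 0 < tokenCount n
    token>0 = ≤-trans (*-mono-≤ (*-mono-≤ (*-mono-≤ nn>0 nn>0) nn>0) nn>0) n≤token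

  n⁸≤2^r : n * n * (n * n) * (n * n) * (n * n) ≤ 2 ^ r
  n⁸≤2^r = ≤-trans n≤token token≤

  grow : ∀ m → m ≤ m * (n * n)
  grow m = ≤-trans (≤-reflexive (sym (*-identityʳ m))) (*-monoʳ-≤ m (*-mono-≤ n>0 n>0))

  n²≤2^r : n * n ≤ 2 ^ r
  n²≤2^r = ≤-trans (grow (n * n)) (≤-trans (grow (n * n * (n * n))) (≤-trans (grow (n * n * (n * n) * (n * n))) n⁸≤2^r))

cancel-const : ∀ c r2 x t → 0 < c → c * 256 ≤ r2 → x * (r2 * r2) ≤ c * t → 256 * (r2 * x) ≤ t
cancel-const c r2 x t c>0 h b = *-cancelˡ-≤′ c c>0 (begin
  c * (256 * (r2 * x)) ≡⟨ sym (*-assoc c 256 (r2 * x)) ⟩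
  c * 256 * (r2 * x) ≤⟨ *-monoˡ-≤ (r2 * x) h ⟩
  r2 * (r2 * x) ≡⟨ arith′ r2 x ⟩
  x * (r2 * r2) ≤⟨ b ⟩
  c * t ∎)
  where
  open ≤-Reasoning
  arith′ : ∀ r x → r * (r * x) ≡ x * (r * r)
  arith′ = solve-∀

module _ {n r : ℕ} (Sc : Scale n r) where
  open Scale Sc
  open ≤-Reasoning

  -- The hypotheses give τ ≤ a b r t / n. Of the factor r⁸, bounded by n, one r is this one, r⁵ is
  -- the number of listed neighbours per point of T, and r² is the reserve demanded of every budget.
  star-budget : ∀ a b d → 0 < a → 0 < b → ∀ τ h g t → τ ≤ h * r → h * (n * n) ≤ a * g → g ≤ t * (b * n) →
    2 * (a * b) * d * r8 ≤ n → d * (r2 * (τ + τ * r5)) ≤ t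
  star-budget a b d a>0 b>0 τ h g t hτ hh hg hn = *-cancelˡ-≤′ (a * b * r) (*-mono-≤ (*-mono-≤ a>0 b>0) r>0) (begin
    a * b * r * (d * (r2 * (τ + τ * r5))) ≤⟨ *-monoʳ-≤ (a * b * r) (*-monoʳ-≤ d (*-monoʳ-≤ r2 (+-monoˡ-≤ (τ * r5)
        (≤-trans (≤-reflexive (sym (*-identityʳ τ))) (*-monoʳ-≤ τ (*-mono-≤ r4>0 r>0)))))) ⟩
    a * b * r * (d * (r2 * (τ * r5 + τ * r5))) ≡⟨ arith₁ (a * b) d r r2 r4 τ ⟩
    2 * (a * b) * d * (r * r2 * (r4 * r)) * τ ≡⟨ cong (λ m → 2 * (a * b) * d * m * τ) (arith₅ r) ⟩
    2 * (a * b) * d * r8 * τ ≤⟨ *-monoˡ-≤ τ hn ⟩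
    n * τ ≤⟨ *-cancelˡ-≤′ n n>0 (begin
      n * (n * τ) ≡⟨ arith₂ n τ ⟩
      τ * (n * n) ≤⟨ *-monoˡ-≤ (n * n) hτ ⟩
      h * r * (n * n) ≡⟨ arith₃ h r (n * n) ⟩
      r * (h * (n * n)) ≤⟨ *-monoʳ-≤ r (≤-trans hh (*-monoʳ-≤ a hg)) ⟩
      r * (a * (t * (b * n))) ≡⟨ arith₄ a b r t n ⟩
      n * (a * b * r * t) ∎) ⟩
    a * b * r * t ∎)
    where
    arith₁ : ∀ c d r p q τ → c * r * (d * (p * (τ * (q * r) + τ * (q * r)))) ≡ 2 * c * d * (r * p * (q * r)) * τ
    arith₁ = solve-∀
    arith₅ : ∀ r → r * (r * r) * ((r * r) * (r * r) * r) ≡ (r * r) * (r * r) * ((r * r) * (r * r))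
    arith₅ = solve-∀
    arith₂ : ∀ n τ → n * (n * τ) ≡ τ * (n * n)
    arith₂ = solve-∀
    arith₃ : ∀ h r m → h * r * m ≡ r * (h * m)
    arith₃ = solve-∀
    arith₄ : ∀ c d r t n → r * (c * (t * (d * n))) ≡ n * (c * d * r * t)
    arith₄ = solve-∀

module Budget {n r : ℕ} (Sc : Scale n r) where
  open Scale Sc
  open ≤-Reasoning

  -- Dividing po ≤ 2nt/r⁵ by ψ, which is of order n/r, leaves a constant times t/r⁴. Two of these
  -- powers of r give the factor r² of the conclusion and the others swallow the constants; this is
  -- why m₁ is taken as r⁵.
  u-budget : ∀ u ψ t po le → n ≤ 96 * r * suc ψ → u * suc ψ ≤ 2 * t + (32 * po + le) → po * r5 ≤ t * (2 * n) →
    le * n ≤ 40 * t → 256 * (r2 * u) ≤ t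
  u-budget u ψ t po le hψ hu hpo hle = cancel-const (96 * (2 + 2 * 32 + 40)) r2 u t (s≤s z≤n) (≤-trans (≤-by {2605056} 14172160 refl) r2-big)
    (*-cancelˡ-≤′ r r>0 (*-cancelˡ-≤′ n n>0 (begin
      n * (r * (u * r4)) ≡⟨ arith₁ n r u r4 ⟩
      n * u * r5 ≤⟨ *-monoˡ-≤ r5 (*-monoˡ-≤ u hψ) ⟩
      96 * r * suc ψ * u * r5 ≡⟨ arith₂ 96 r (suc ψ) u r5 ⟩
      96 * r * (u * suc ψ * r5) ≤⟨ *-monoʳ-≤ (96 * r) (*-monoˡ-≤ r5 hu) ⟩
      96 * r * ((2 * t + (32 * po + le)) * r5) ≡⟨ arith₃ 96 32 r t po le r5 ⟩
      96 * r * (2 * t * r5 + 32 * (po * r5) + le * r5)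
        ≤⟨ *-monoʳ-≤ (96 * r) (+-mono-≤ (+-mono-≤ (*-monoʳ-≤ (2 * t) r5≤n) (*-monoʳ-≤ 32 hpo))
             (≤-trans (*-monoʳ-≤ le r5≤n) (≤-trans hle (≤-trans (≤-reflexive (sym (*-identityʳ (40 * t)))) (*-monoʳ-≤ (40 * t) n>0))))) ⟩
      96 * r * (2 * t * n + 32 * (t * (2 * n)) + 40 * t * n) ≡⟨ arith₄ 96 32 40 r t n ⟩
      n * (r * (96 * (2 + 2 * 32 + 40) * t)) ∎)))
    where
    r5≤n : r5 ≤ n
    r5≤n = ≤-trans (≤-reflexive (sym (+-identityʳ r5))) (below-n 1 r5 (s≤s z≤n) r5≤r8)
    arith₁ : ∀ n r u q → n * (r * (u * q)) ≡ n * u * (q * r)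
    arith₁ = solve-∀
    arith₂ : ∀ c r p u q → c * r * p * u * q ≡ c * r * (u * p * q)
    arith₂ = solve-∀
    arith₃ : ∀ c d r t po le q → c * r * ((2 * t + (d * po + le)) * q) ≡ c * r * (2 * t * q + d * (po * q) + le * q)
    arith₃ = solve-∀
    arith₄ : ∀ c d e r t n → c * r * (2 * t * n + d * (t * (2 * n)) + e * t * n) ≡ n * (r * (c * (2 + 2 * d + e) * t))
    arith₄ = solve-∀

  w-budget : ∀ w ψ t → n ≤ 96 * r * suc ψ → w * suc ψ ≤ 2 * t → 256 * (r2 * w) ≤ t
  w-budget w ψ t hψ hw = *-cancelˡ-≤′ (2 * 96 * r) (*-mono-≤ {1} {2 * 96} (s≤s z≤n) r>0) (begin
    2 * 96 * r * (256 * (r2 * w)) ≡⟨ arith₁ (2 * 96) 256 r r2 w ⟩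
    2 * 96 * 256 * (r * r2) * w ≤⟨ *-monoˡ-≤ w (below-n (2 * 96 * 256) (r * r2) (≤-by {49152} 16728064 refl)
       (≤-trans (*-monoˡ-≤ r2 r≤r2) r4≤r8)) ⟩
    n * w ≤⟨ *-monoˡ-≤ w hψ ⟩
    96 * r * suc ψ * w ≡⟨ arith₂ 96 r (suc ψ) w ⟩
    96 * r * (w * suc ψ) ≤⟨ *-monoʳ-≤ (96 * r) hw ⟩
    96 * r * (2 * t) ≡⟨ arith₃ 96 r t ⟩
    2 * 96 * r * t ∎)
    where
    arith₁ : ∀ c d r q w → c * r * (d * (q * w)) ≡ c * d * (r * q) * w
    arith₁ = solve-∀
    arith₂ : ∀ c r p u → c * r * p * u ≡ c * r * (u * p)
    arith₂ = solve-∀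
    arith₃ : ∀ c r t → c * r * (2 * t) ≡ 2 * c * r * t
    arith₃ = solve-∀

  τ-budget : ∀ τ h g t → τ ≤ h * r → h * (n * n) ≤ 32 * g → g ≤ t * (40 * n) → 256 * (r2 * (τ + τ * r5)) ≤ t
  τ-budget τ h g t hτ hh hg = star-budget Sc 32 40 256 (s≤s z≤n) (s≤s z≤n) τ h g t hτ hh hg
    (below-n (2 * (32 * 40) * 256) r8 (≤-by {655360} 16121856 refl) ≤-refl)

  base-budget : ∀ τ u w t → 256 * (r2 * (τ + τ * r5)) ≤ t → 256 * (r2 * u) ≤ t → 256 * (r2 * w) ≤ t →
    64 * (r2 * (τ + τ * r5 + u + w)) ≤ t
  base-budget τ u w t a b c = *-cancelˡ-≤′ 4 (s≤s z≤n) (begin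
    4 * (64 * (r2 * (τ + τ * r5 + u + w))) ≡⟨ arith 64 r2 (τ + τ * r5) u w ⟩
    4 * 64 * (r2 * (τ + τ * r5)) + 4 * 64 * (r2 * u) + 4 * 64 * (r2 * w) ≤⟨ +-mono-≤ (+-mono-≤ a b) c ⟩
    t + t + t ≤⟨ ≤-by t (arith′ t) ⟩
    4 * t ∎)
    where
    arith : ∀ d q a b c → 4 * (d * (q * (a + b + c))) ≡ 4 * d * (q * a) + 4 * d * (q * b) + 4 * d * (q * c)
    arith = solve-∀
    arith′ : ∀ t → 4 * t ≡ t + t + t + t
    arith′ = solve-∀

floorDiv : ∀ m d → 0 < d → Σ ℕ λ q → q * d ≤ m × m < suc q * d
floorDiv m (suc d) _ = m / suc d , m/n*n≤m m (suc d) ,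
  subst (_< suc (m / suc d) * suc d) (sym (m≡m%n+[m/n]*n m (suc d))) (+-monoˡ-< (m / suc d * suc d) (m%n<n m (suc d)))

floor : ∀ m d → 0 < d → ℕ
floor m d h = proj₁ (floorDiv m d h)

floor-≤ : ∀ m d h → floor m d h * d ≤ m
floor-≤ m d h = proj₁ (proj₂ (floorDiv m d h))

floor-< : ∀ m d h → m < suc (floor m d h) * d
floor-< m d h = proj₂ (proj₂ (floorDiv m d h))

floor-max : ∀ m d h q → q * d ≤ m → q ≤ floor m d h
floor-max m d h q l = ≮⇒≥ λ s → <⇒≱ (floor-< m d h) (≤-trans (*-monoˡ-≤ d s) l)

four-powers : ∀ n p q x y z w → n ≤ p * x → n ≤ q * y → n ≤ p * z → n ≤ q * w →
  n * n * n * n ≤ p * p * (q * q) * (x * (y * (z * w)))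
four-powers n p q x y z w a b c d = ≤-trans (*-mono-≤ (*-mono-≤ (*-mono-≤ a b) c) d) (≤-reflexive (arith p q x y z w))
  where
  arith : ∀ p q x y z w → p * x * (q * y) * (p * z) * (q * w) ≡ p * p * (q * q) * (x * (y * (z * w)))
  arith = solve-∀

path-count-bound : ∀ p c d n r x y z w → 0 < p → 0 < c → 0 < r → n ≤ p * x → n ≤ c * r * y → n ≤ p * z → n ≤ c * r * w →
  p * p * (c * c) * d * (r * (r * r) * (r * r)) ≤ n → d * (n * n * n * (r * (r * r))) ≤ x * (y * (z * w))
path-count-bound p c d n r x y z w p>0 c>0 r>0 h₁ h₂ h₃ h₄ hn =
  *-cancelˡ-≤′ (p * p * (c * r * (c * r))) (*-mono-≤ (*-mono-≤ p>0 p>0) (*-mono-≤ (*-mono-≤ c>0 r>0) (*-mono-≤ c>0 r>0))) (begin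
    p * p * (c * r * (c * r)) * (d * (n * n * n * (r * (r * r)))) ≡⟨ arith p c d n r ⟩
    p * p * (c * c) * d * (r * (r * r) * (r * r)) * (n * n * n) ≤⟨ *-monoˡ-≤ (n * n * n) hn ⟩
    n * (n * n * n) ≡⟨ *-comm n (n * n * n) ⟩
    n * n * n * n ≤⟨ four-powers n p (c * r) x y z w h₁ h₂ h₃ h₄ ⟩
    p * p * (c * r * (c * r)) * (x * (y * (z * w))) ∎)
  where
  open ≤-Reasoning
  arith : ∀ p c d n r → p * p * (c * r * (c * r)) * (d * (n * n * n * (r * (r * r)))) ≡
    p * p * (c * c) * d * (r * (r * r) * (r * r)) * (n * n * n)
  arith = solve-∀

floor-sub : ∀ n c β j → n < suc β * c → c + c + 2 * j * c ≤ n → n ≤ 2 * c * (β ∸ j)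
floor-sub n c β j h small = +-cancelʳ-≤ (2 * c * j) _ _ (begin
  n + 2 * c * j ≤⟨ +-cancelʳ-≤ (c + c) _ _ (begin
    n + 2 * c * j + (c + c) ≡⟨ arith₁ n c j ⟩
    n + (c + c + 2 * j * c) ≤⟨ +-monoʳ-≤ n small ⟩
    n + n ≤⟨ +-mono-≤ (<⇒≤ h) (<⇒≤ h) ⟩
    suc β * c + suc β * c ≡⟨ arith₂ β c ⟩
    2 * c * β + (c + c) ∎) ⟩
  2 * c * β ≤⟨ *-monoʳ-≤ (2 * c) (m≤n+m∸n β j) ⟩
  2 * c * (j + (β ∸ j)) ≡⟨ arith₃ c j (β ∸ j) ⟩
  2 * c * (β ∸ j) + 2 * c * j ∎)
  where
  open ≤-Reasoning
  arith₁ : ∀ n c j → n + 2 * c * j + (c + c) ≡ n + (c + c + 2 * j * c)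
  arith₁ = solve-∀
  arith₂ : ∀ b c → suc b * c + suc b * c ≡ 2 * c * b + (c + c)
  arith₂ = solve-∀
  arith₃ : ∀ c j m → 2 * c * (j + m) ≡ 2 * c * m + 2 * c * j
  arith₃ = solve-∀

cancel-2^ : ∀ c a b m → c * 2 ^ (a + b) ≤ 2 ^ b * m → c * 2 ^ a ≤ m
cancel-2^ c a b m h = *-cancelˡ-≤′ (2 ^ b) (pow-pos 2 b (s≤s z≤n))
  (≤-trans (≤-reflexive (trans (arith c (2 ^ a) (2 ^ b)) (cong (c *_) (sym (^-distribˡ-+-* 2 a b))))) h)
  where
  arith : ∀ c x y → y * (c * x) ≡ c * (x * y)
  arith = solve-∀

-- Counting downsets through a fixed point

LayerBound : (n r k : ℕ) → Set
LayerBound n r k = ∀ (S : Elem n → Bool) j → n * card S ≤ j * 2 ^ (r + r) → countS (ens {n} k (atMost k S)) ≤ 2 ^ (card S + j)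

module Key {n r : ℕ} (Sc : Scale n r) (k : ℕ) (n<k : n < k) (Zb : LayerBound n r k)
  (b : ℕ) (v : Elem n) (b<k : b < k) (rv : rank v ≡ k) (T : Elem n → Bool)
  (g₀ e : ℕ) (4e≤g₀ : 4 * e ≤ g₀) (4r≤g₀ : 4 * (r + 1) ≤ g₀) (e≤n² : e ≤ n * n) where

  open Scale Sc
  open Budget Sc
  open ≤-Reasoning

  n≥8 : 8 ≤ n
  n≥8 = below-n 8 1 (≤-by {8} 16777208 refl) r8>0

  n≥2 : 2 ≤ n
  n≥2 = ≤-trans (s≤s (s≤s z≤n)) n≥8

  module RW = RankWeights n n≥2

  M : ℕ
  M = EdgeWeights.M n

  Wt : Weights k 40 M RW.wt
  Wt = RW.weights k n<k

  border : Sub n → ℕ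
  border I = card (shadow (cmp k v I))

  Q : Sub n → Bool
  Q I = ens b T I ∧ ((I ∋ v) ∧ ⌊ g₀ ≤? border I ⌋)

  -- The threshold n³r³ is below the order n⁴/r² supplied by the path count, and above it t is at
  -- least of order n²r³, so that t/(64r) exceeds e ≤ n² together with the cost of the union bound.
  g₁ : ℕ
  g₁ = n * n * n * (r * r2)

  Qₛ Qₗ : Sub n → Bool
  Qₛ I = Q I ∧ ⌊ border I <? g₁ ⌋
  Qₗ I = Q I ∧ not ⌊ border I <? g₁ ⌋

  Q-ens : ∀ I → Q I ≡ true → Ens b T I
  Q-ens I q = ens⁻ (proj₁ (∧-split q))

  Q-v : ∀ I → Q I ≡ true → (I ∋ v) ≡ true
  Q-v I q = proj₁ (∧-split (proj₂ (∧-split {ens b T I} q)))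

  Q-g : ∀ I → Q I ≡ true → g₀ ≤ border I
  Q-g I q = ⌊⌋⁻ (g₀ ≤? border I) (proj₂ (∧-split {I ∋ v} (proj₂ (∧-split {ens b T I} q))))

  others : ℕ
  others = countS (λ I → ens b T I ∧ not (I ∋ v))

  -- The raw list may contain useless containers. Keeping only those that satisfy both size
  -- conditions makes every listed one admissible and loses none that covers an actual component.
  unionFiltered : (P : Sub n → Bool) → (∀ I → P I ≡ true → Q I ≡ true) →
    {A : Set} (K : List A) (raw : A → List (Elem n → Bool)) (g j ℓ : A → ℕ) (e′ : ℕ) →
    (∀ a → length (raw a) ≤ 2 ^ ℓ a) →
    (∀ I → P I ≡ true → Σ A λ a → a ∈ K × Σ (Elem n → Bool) λ S → S ∈ raw a × g a ≤ border I ×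
       (∀ x → cmp k v I x ≡ true → S x ≡ true) × n * card S ≤ j a * 2 ^ (r + r) × card S + j a + (ℓ a + e′) ≤ g a) →
    countS P * 2 ^ e′ ≤ length K * others
  unionFiltered P P⇒Q {A} K raw g j ℓ e′ len cover =
    Union.union k b v b<k rv T P (λ I p → Q-ens I (P⇒Q I p)) (λ I p → Q-v I (P⇒Q I p)) K
      (λ a → filter (ok? a) (raw a)) g j ℓ e′
      (λ a → ≤-trans (Data.List.Properties.length-filter (ok? a) (raw a)) (len a))
      (λ a S m → let (p , q) = proj₂ (∈-filter⁻ (ok? a) {xs = raw a} m) in Zb S (j a) p , q)
      λ I p → let (a , aK , S , Sm , gb , sub , c₁ , c₂) = cover I p in a , aK , S , ∈-filter⁺ (ok? a) Sm (c₁ , c₂) , gb , sub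
    where
    ok? : ∀ a S → Dec (n * card S ≤ j a * 2 ^ (r + r) × card S + j a + (ℓ a + e′) ≤ g a)
    ok? a S = (n * card S ≤? j a * 2 ^ (r + r)) Relation.Nullary.×-dec (card S + j a + (ℓ a + e′) ≤? g a)

  walks-length : ∀ m → length (walks (2 * m) v) ≤ 2 ^ (r * m)
  walks-length m = begin
    length (walks (2 * m) v) ≤⟨ length-walks′ (2 * m) v ⟩
    tokenCount n ^ (2 * m) ≡⟨ sym (^-*-assoc (tokenCount n) 2 m) ⟩
    (tokenCount n ^ 2) ^ m ≤⟨ ^-monoˡ-≤ m code-small ⟩
    (2 ^ r) ^ m ≡⟨ ^-*-assoc 2 r m ⟩
    2 ^ (r * m) ∎

  module Component (I : Sub n) (q : Q I ≡ true) where
    C : Elem n → Bool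
    C = cmp k v I

    U : Elem n → Bool
    U = lay k I

    C-rank : ∀ x → C x ≡ true → rank x ≡ k
    C-rank x h = rk⁻ k x (proj₂ (∧-split {I ∋ x} (comp-⊆ U v (∧-join (Q-v I q) (rk⁺ k v rv)) x h)))

    ind : ∀ (P : Elem n → Bool) → P v ≡ true →
      (∀ x x′ → P x ≡ true → C x′ ≡ true → linked x x′ ≡ true → P x′ ≡ true) → ∀ x → C x ≡ true → P x ≡ true
    ind P base next x h = proj₁ (∧-split (comp-ind U v (λ y → P y ∧ C y) (∧-join base (comp-root U v))
      (λ y y′ p u l → let (py , cy) = ∧-split {P y} p
                          cy′ = comp-closed U v y y′ cy u l
                      in ∧-join (next y y′ py cy′ l) cy′) x h))

    s : ℕ
    s = card C

    s≤g : s ≤ border I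
    s≤g = ≤-trans (card-mono {p = C} {q = hull k C} (Closure.C⊆D k 40 M RW.wt Wt n≥8 C C-rank))
            (Closure.D≤G k 40 M RW.wt Wt n≥8 C C-rank)

    -- Otherwise the path count would give |C| ≥ g₁, whereas |C| ≤ |∂C| < g₁.
    expansion : border I < g₁ → 4 * r * s ≤ border I
    expansion small = ≮⇒≥ λ few → <⇒≱ (*-monoʳ-< 4 (≤-<-trans s≤g small)) (≤-trans big (poor-expansion-large k (4 * r) a₀ b₀ C C-rank
        (Weights.deg Wt) n>0 (*-mono-≤ {1} {4} (s≤s z≤n) r>0)
        (≤-trans (≤-reflexive (*-comm 4 a₀)) (floor-≤ n 4 (s≤s z≤n)))
        (≤-trans (≤-reflexive (*-comm (4 * (4 * r)) b₀)) (floor-≤ n (4 * (4 * r)) 16r>0)) few))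
      where
      16r>0 : 0 < 4 * (4 * r)
      16r>0 = *-mono-≤ {1} {4} (s≤s z≤n) (*-mono-≤ {1} {4} (s≤s z≤n) r>0)
      a₀ b₀ : ℕ
      a₀ = floor n 4 (s≤s z≤n)
      b₀ = floor n (4 * (4 * r)) 16r>0
      r≤r8 : r ≤ r8
      r≤r8 = ≤-trans r≤r2 (≤-trans r2≤r4 r4≤r8)
      a-sub : ∀ j → j ≤ 1 → n ≤ 2 * 4 * (a₀ ∸ j)
      a-sub j h = floor-sub n 4 a₀ j (floor-< n 4 (s≤s z≤n)) (≤-trans (+-monoʳ-≤ 8 (*-monoˡ-≤ 4 (*-monoʳ-≤ 2 h)))
        (below-n 16 1 (≤-by {16} 16777200 refl) r8>0))
      b-sub : ∀ j → j ≤ 2 → n ≤ 2 * (4 * (4 * r)) * (b₀ ∸ j)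
      b-sub j h = floor-sub n (4 * (4 * r)) b₀ j (floor-< n (4 * (4 * r)) 16r>0)
        (≤-trans (+-monoʳ-≤ (4 * (4 * r) + 4 * (4 * r)) (*-monoˡ-≤ (4 * (4 * r)) (*-monoʳ-≤ 2 h)))
          (≤-trans (≤-reflexive (arith 4 r)) (below-n (4 * (6 * 4)) r (≤-by {96} 16777120 refl) r≤r8)))
        where
        arith : ∀ c r → c * (c * r) + c * (c * r) + 4 * (c * (c * r)) ≡ c * (6 * c) * r
        arith = solve-∀
      big : 4 * g₁ ≤ a₀ * ((b₀ ∸ 1) * ((a₀ ∸ 1) * (b₀ ∸ 2)))
      big = path-count-bound (2 * 4) (2 * (4 * 4)) 4 n r a₀ (b₀ ∸ 1) (a₀ ∸ 1) (b₀ ∸ 2) (s≤s z≤n) (s≤s z≤n) r>0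
        (a-sub 0 z≤n) (q-form (b₀ ∸ 1) (b-sub 1 (s≤s z≤n))) (a-sub 1 ≤-refl) (q-form (b₀ ∸ 2) (b-sub 2 ≤-refl))
        (below-n (2 * 4 * (2 * 4) * (2 * (4 * 4) * (2 * (4 * 4))) * 4) (r * (r * r) * (r * r)) (≤-by {262144} 16515072 refl)
          (≤-trans (*-monoˡ-≤ r2 (*-monoˡ-≤ r2 r≤r2)) (*-monoʳ-≤ r4 r2≤r4)))
        where
        q-form : ∀ m → n ≤ 2 * (4 * (4 * r)) * m → n ≤ 2 * (4 * 4) * r * m
        q-form m h = ≤-trans h (≤-reflexive (cong (_* m) (arith₀ 4 r)))
          where
          arith₀ : ∀ c r → 2 * (c * (c * r)) ≡ 2 * (c * c) * r
          arith₀ = solve-∀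

  -- The classes are the pairs (|C|, |∂C|), at most g₁² ≤ n⁸ ≤ 2^r. With s = |C|, the container, its
  -- error and its code cost s + s + rs, at most |∂C|/2 by `expansion`; the other half pays for e
  -- and r + 1.
  smallPart : countS Qₛ * 2 ^ (e + 1) ≤ others
  smallPart = cancel-2^ (countS Qₛ) (e + 1) r others (≤-trans
    (unionFiltered Qₛ (λ I p → proj₁ (∧-split p)) K raw (λ a → proj₂ a) (λ a → proj₁ a) (λ a → r * proj₁ a) (e + 1 + r) raw-length cover)
    (*-monoˡ-≤ others K-length))
    where
    K : List (ℕ × ℕ)
    K = cartesianProduct (upTo g₁) (upTo g₁)
    K-length : length K ≤ 2 ^ r
    K-length = begin
      length K ≡⟨ trans (length-cartesianProduct (upTo g₁) (upTo g₁)) (cong₂ _*_ (length-upTo g₁) (length-upTo g₁)) ⟩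
      g₁ * g₁ ≤⟨ *-mono-≤ g₁≤ g₁≤ ⟩
      n * n * n * n * (n * n * n * n) ≡⟨ arith n ⟩
      n * n * (n * n) * (n * n) * (n * n) ≤⟨ n⁸≤2^r ⟩
      2 ^ r ∎
      where
      g₁≤ : g₁ ≤ n * n * n * n
      g₁≤ = *-monoʳ-≤ (n * n * n) (≤-trans (≤-reflexive (sym (+-identityʳ (r * r2)))) (below-n 1 (r * r2) (s≤s z≤n) (≤-trans (*-monoˡ-≤ r2 r≤r2) r4≤r8)))
      arith : ∀ n → n * n * n * n * (n * n * n * n) ≡ n * n * (n * n) * (n * n) * (n * n)
      arith = solve-∀
    raw : ℕ × ℕ → List (Elem n → Bool)
    raw (s , _) = map (λ p → marked 1F p) (walks (2 * s) v)
    raw-length : ∀ a → length (raw a) ≤ 2 ^ (r * proj₁ a)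
    raw-length (s , _) = ≤-trans (≤-reflexive (length-map (λ p → marked 1F p) (walks (2 * s) v))) (walks-length s)
    cover : ∀ I → Qₛ I ≡ true → Σ (ℕ × ℕ) λ a → a ∈ K × Σ (Elem n → Bool) λ S → S ∈ raw a × proj₂ a ≤ border I ×
       (∀ x → cmp k v I x ≡ true → S x ≡ true) × n * card S ≤ proj₁ a * 2 ^ (r + r) × card S + proj₁ a + (r * proj₁ a + (e + 1 + r)) ≤ proj₂ a
    cover I h = (s , border I) , ∈-cartesianProduct⁺ (∈-upTo⁺ (≤-<-trans s≤g small)) (∈-upTo⁺ small) ,
        marked 1F p , ∈-map⁺ (λ p → marked 1F p) p∈ , ≤-refl , (λ x c → trans (p≡C x) c) ,
        ≤-trans (≤-reflexive (cong (n *_) cardS)) (≤-trans (≤-reflexive (*-comm n s)) (*-monoʳ-≤ s n≤H)) ,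
        subst (λ c → c + s + (r * s + (e + 1 + r)) ≤ border I) (sym cardS) fits
      where
      qI : Q I ≡ true
      qI = proj₁ (∧-split h)
      open Component I qI
      open Sums n
      small : border I < g₁
      small = ⌊⌋⁻ (border I <? g₁) (proj₂ (∧-split {Q I} h))
      L : List (Elem n)
      L = filter (λ x → C x Data.Bool.≟ true) (allElems n)
      C-of-L : ∀ x → x ∈ L → C x ≡ true
      C-of-L x m = proj₂ (∈-filter⁻ (λ x → C x Data.Bool.≟ true) {xs = allElems n} m)
      L-of-C : ∀ x → C x ≡ true → x ∈ L
      L-of-C x c = ∈-filter⁺ (λ x → C x Data.Bool.≟ true) (allElems-complete x) c
      W : List (Token n)
      W = mark 1F L
      W-length : length W ≡ s
      W-length = trans (length-map _ L) (trans (length-filter≡∑ (λ x → C x Data.Bool.≟ true) (allElems n))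
        (∑V-cong λ x → cong ⟦_⟧ (does-≟true (C x))))
      W-near : ∀ t → t ∈ W → Σ (Elem n) λ c → C c ≡ true × Near 3 c (proj₁ t)
      W-near t m with ∈-map⁻ _ m
      ... | x , mx , refl = x , C-of-L x mx , near-stay 3 x
      code : Σ (List (Token n)) λ p → p ∈ walks (2 * s) v × (∀ m → m ≢ zero → ∀ y → marked m p y ≡ marked m W y)
      code = code-of v C ind W W-near (λ c h → (c , 1F) , ∈-map⁺ _ (L-of-C c h) , near-stay 3 c) (2 * s)
        (≤-reflexive (cong (2 *_) W-length))
      p : List (Token n)
      p = proj₁ code
      p∈ : p ∈ walks (2 * s) v
      p∈ = proj₁ (proj₂ code)
      p≡C : ∀ x → marked 1F p x ≡ C x
      p≡C x = trans (proj₂ (proj₂ code) 1F (λ ()) x) (trans (marked-mark 1F L x)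
        (bool-ext (λ m → C-of-L x (mem⁻ L x m)) (λ c → mem⁺ L x (L-of-C x c))))
      cardS : card (marked 1F p) ≡ s
      cardS = card-cong p≡C
      n≤H : n ≤ 2 ^ (r + r)
      n≤H = ≤-trans (≤-trans (≤-reflexive (sym (*-identityʳ n))) (*-monoʳ-≤ n n>0)) (≤-trans n²≤2^r (pow-mono 1 (m≤m+n r r)))
      fits : s + s + (r * s + (e + 1 + r)) ≤ border I
      fits = *-cancelˡ-≤ 4 (begin
        4 * (s + s + (r * s + (e + 1 + r))) ≡⟨ arith s r e ⟩
        4 * (2 + r) * s + (4 * e + 4 * (r + 1)) ≤⟨ +-mono-≤ (*-monoˡ-≤ s (*-monoʳ-≤ 4 (+-monoˡ-≤ r (≤-trans (≤-by {2} 4094 refl) r-big))))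
             (+-mono-≤ (≤-trans 4e≤g₀ (Q-g I qI)) (≤-trans 4r≤g₀ (Q-g I qI))) ⟩
        4 * (r + r) * s + (border I + border I) ≡⟨ cong (_+ (border I + border I)) (arith′ r s) ⟩
        4 * r * s + 4 * r * s + (border I + border I) ≤⟨ +-monoˡ-≤ (border I + border I) (+-mono-≤ (expansion small) (expansion small)) ⟩
        border I + border I + (border I + border I) ≡⟨ arith″ (border I) ⟩
        4 * border I ∎)
        where
        arith : ∀ s r e → 4 * (s + s + (r * s + (e + 1 + r))) ≡ 4 * (2 + r) * s + (4 * e + 4 * (r + 1))
        arith = solve-∀
        arith′ : ∀ r s → 4 * (r + r) * s ≡ 4 * r * s + 4 * r * s
        arith′ = solve-∀
        arith″ : ∀ g → g + g + (g + g) ≡ 4 * g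
        arith″ = solve-∀

  t-of : Sub n → ℕ
  t-of I = border I ∸ card (hull k (cmp k v I))

  64r>0 : 0 < 64 * r
  64r>0 = *-mono-≤ {1} {64} (s≤s z≤n) r>0

  u-of third-of tokensFor : ℕ → ℕ
  u-of t = floor t (64 * r) 64r>0
  third-of t = floor t 3 (s≤s z≤n)
  tokensFor m = floor m r r>0

  -- A walk of 2 m tokens costs r m bits, so the allowances amount to u = t/(64r) bits for the
  -- approximate container and t/3 for the exact one. The respective gains over |∂C| are 8u and t.
  budget : ℕ × Bool → ℕ
  budget (t , false) = tokensFor (u-of t)
  budget (t , true) = tokensFor (third-of t)

  -- The last summand pays for the classes (|∂C|, t, bit), at most 2^(4n+1) in number.
  e′ : ℕ
  e′ = e + 1 + (2 * n + 2 * n + 1)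

  largePart : countS Qₗ * 2 ^ (e + 1) ≤ others
  largePart = cancel-2^ (countS Qₗ) (e + 1) (2 * n + 2 * n + 1) others (≤-trans
    (unionFiltered Qₗ (λ I p → proj₁ (∧-split p)) K raw proj₁ (λ a → u-of (proj₁ (proj₂ a))) (λ a → r * budget (proj₂ a)) e′ raw-length cover)
    (*-monoˡ-≤ others K-length))
    where
    N : ℕ
    N = suc (3 ^ n)
    K : List (ℕ × (ℕ × Bool))
    K = cartesianProduct (upTo N) (cartesianProduct (upTo N) (false ∷ true ∷ []))
    N≤ : N ≤ 2 ^ (2 * n)
    N≤ = ≤-trans (3^n<4^n n n>0) (≤-reflexive (^-*-assoc 2 2 n))
      where
      3^n<4^n : ∀ m → 0 < m → 3 ^ m < 4 ^ m
      3^n<4^n (suc m) _ = ≤-trans (+-monoˡ-≤ (3 * 3 ^ m) (m^n>0 3 m)) (≤-trans (≤-reflexive (arith (3 ^ m))) (*-monoʳ-≤ 4 (^-monoˡ-≤ m (n≤1+n 3))))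
        where
        arith : ∀ c → c + 3 * c ≡ 4 * c
        arith = solve-∀
    K-length : length K ≤ 2 ^ (2 * n + 2 * n + 1)
    K-length = begin
      length K ≡⟨ trans (length-cartesianProduct (upTo N) (cartesianProduct (upTo N) (false ∷ true ∷ []))) (cong₂ _*_ (length-upTo N)
           (trans (length-cartesianProduct (upTo N) (false ∷ true ∷ [])) (cong (_* 2) (length-upTo N)))) ⟩
      N * (N * 2) ≤⟨ *-mono-≤ N≤ (*-monoˡ-≤ 2 N≤) ⟩
      2 ^ (2 * n) * (2 ^ (2 * n) * 2) ≡⟨ sym (trans (^-distribˡ-+-* 2 (2 * n + 2 * n) 1) (trans (cong (_* 2) (^-distribˡ-+-* 2 (2 * n) (2 * n)))
           (*-assoc (2 ^ (2 * n)) (2 ^ (2 * n)) 2))) ⟩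
      2 ^ (2 * n + 2 * n + 1) ∎
    96r>0 : 0 < 96 * r
    96r>0 = *-mono-≤ {1} {96} (s≤s z≤n) r>0
    -- 96 is 12 · 8: with Λ = 8r the error 12 Λ t ψ in `outcome` is at most n t, half of the gain 2
    -- n t.
    ψ Λ : ℕ
    ψ = floor n (96 * r) 96r>0
    Λ = 8 * r
    raw : ℕ × (ℕ × Bool) → List (Elem n → Bool)
    raw (_ , t , bit) = map (λ p → decode k ψ (λ m → marked m p) bit) (walks (2 * budget (t , bit)) v)
    raw-length : ∀ a → length (raw a) ≤ 2 ^ (r * budget (proj₂ a))
    raw-length (_ , t , bit) = ≤-trans (≤-reflexive (length-map (λ p → decode k ψ (λ m → marked m p) bit) (walks (2 * budget (t , bit)) v)))
      (walks-length (budget (t , bit)))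
    n≤ψ : n ≤ 96 * r * suc ψ
    n≤ψ = ≤-trans (<⇒≤ (floor-< n (96 * r) 96r>0)) (≤-reflexive (*-comm (suc ψ) (96 * r)))
    ψ≤n : 96 * r * ψ ≤ n
    ψ≤n = ≤-trans (≤-reflexive (*-comm (96 * r) ψ)) (floor-≤ n (96 * r) 96r>0)
    6ψ≤n : 6 * ψ ≤ n
    6ψ≤n = ≤-trans (*-monoˡ-≤ ψ (≤-trans (≤-by {6} 90 refl) (≤-trans (≤-reflexive (sym (*-identityʳ 96))) (*-monoʳ-≤ 96 r>0)))) ψ≤n
    cover : ∀ I → Qₗ I ≡ true → Σ (ℕ × (ℕ × Bool)) λ a → a ∈ K × Σ (Elem n → Bool) λ S → S ∈ raw a × proj₁ a ≤ border I ×
       (∀ x → cmp k v I x ≡ true → S x ≡ true) × n * card S ≤ u-of (proj₁ (proj₂ a)) * 2 ^ (r + r) ×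
       card S + u-of (proj₁ (proj₂ a)) + (r * budget (proj₂ a) + e′) ≤ proj₁ a
    cover I h = (g , t , En.bit) ,
        ∈-cartesianProduct⁺ (∈-upTo⁺ (s≤s (card≤3^ (shadow C)))) (∈-cartesianProduct⁺ (∈-upTo⁺ (s≤s (≤-trans (m∸n≤m g (card (hull k C))) (card≤3^ (shadow C))))) (bit∈ En.bit)) ,
        S , ∈-map⁺ (λ p → decode k ψ (λ m → marked m p) En.bit) p∈ , ≤-refl ,
        (λ x c → trans (S≡ x) (En.C⊆ x c)) , fitsH , subst (λ c → c + u + (r * budget (t , En.bit) + e′) ≤ g) (sym cardS) fits
      where
      qI : Q I ≡ true
      qI = proj₁ (∧-split h)
      open Component I qI
      open Sums n
      g t u : ℕ
      g = border I
      t = t-of I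
      u = u-of t
      bit∈ : ∀ c → c ∈ (false ∷ true ∷ [])
      bit∈ false = here refl
      bit∈ true = there (here refl)
      large : g₁ ≤ g
      large = ≮⇒≥ (⌊⌋-no (border I <? g₁) (proj₂ (∧-split {Q I} h)))
      gap : g ≤ t * (40 * n)
      gap = Closure.G-gap k 40 M RW.wt Wt n≥8 C C-rank
      hh : ℕ
      hh = floor (32 * g) (n * n) nn>0
      n²<g : n * n < 32 * g
      n²<g = begin-strict
        n * n <⟨ ≤-trans (≤-reflexive (sym (*-identityʳ (suc (n * n))))) (≤-trans (*-mono-≤ {suc (n * n)} {n * n * n} {1} {r * r2} more (*-mono-≤ r>0 r2>0)) large) ⟩
        g ≤⟨ m≤n*m g 32 ⟩
        32 * g ∎
        where
        more : suc (n * n) ≤ n * n * n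
        more = ≤-trans (+-monoˡ-≤ (n * n) nn>0) (≤-trans (≤-reflexive (arith (n * n))) (*-monoʳ-≤ (n * n) n≥2))
          where
          arith : ∀ m → m + m ≡ m * 2
          arith = solve-∀
      -- Taking ρ = r halvings shrinks the uncovered remainder `le` to at most 40t/n, because 2^r ≥
      -- n².
      En : Encoding k ψ r5 hh r 40 Λ C g t
      En = encoding k 40 M RW.wt Wt n≥8 C C-rank ψ r5 hh r Λ 6ψ≤n n²<g
        (m≤n+o⇒m∸n≤o (32 * g) (n * n) (≤-trans (<⇒≤ (floor-< (32 * g) (n * n) nn>0)) ≤-refl))
      module En = Encoding En
      base : ℕ
      base = En.τ + En.τ * r5 + En.u + En.w
      le-n : En.le * n ≤ 40 * t
      le-n = *-cancelʳ-≤′ n n>0 (begin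
        En.le * n * n ≡⟨ *-assoc En.le n n ⟩
        En.le * (n * n) ≤⟨ *-monoʳ-≤ En.le n²≤2^r ⟩
        En.le * 2 ^ r ≤⟨ En.le≤ ⟩
        t * (40 * n) ≡⟨ arith 40 t n ⟩
        40 * t * n ∎)
        where
        arith : ∀ c t n → t * (c * n) ≡ c * t * n
        arith = solve-∀
      base-small : 64 * (r2 * base) ≤ t
      base-small = base-budget En.τ En.u En.w t
        (τ-budget En.τ hh g t En.τ≤ (floor-≤ (32 * g) (n * n) nn>0) gap)
        (u-budget En.u ψ t En.po En.le n≤ψ En.u≤ En.po≤ le-n)
        (w-budget En.w ψ t n≤ψ En.w≤)
      t-big : n * n * (64 * r * 8) ≤ t
      t-big = *-cancelˡ-≤′ (40 * n) (*-mono-≤ {1} {40} (s≤s z≤n) n>0) (begin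
        40 * n * (n * n * (64 * r * 8)) ≡⟨ arith 40 64 8 n r ⟩
        40 * 64 * 8 * (n * n * n * r) ≤⟨ *-monoˡ-≤ (n * n * n * r) (≤-trans (≤-by {40 * 64 * 8} 16756736 refl) r2-big) ⟩
        r2 * (n * n * n * r) ≡⟨ arith′ r2 n r ⟩
        n * n * n * (r * r2) ≤⟨ large ⟩
        g ≤⟨ gap ⟩
        t * (40 * n) ≡⟨ *-comm t (40 * n) ⟩
        40 * n * t ∎)
        where
        arith : ∀ c d f n r → c * n * (n * n * (d * r * f)) ≡ c * d * f * (n * n * n * r)
        arith = solve-∀
        arith′ : ∀ q n r → q * (n * n * n * r) ≡ n * n * n * (r * q)
        arith′ = solve-∀
      u-big : 8 * (n * n) ≤ u
      u-big = floor-max t (64 * r) 64r>0 (8 * (n * n)) (≤-trans (≤-reflexive (arith 8 (n * n) (64 * r))) t-big)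
        where
        arith : ∀ c m d → c * m * d ≡ m * (d * c)
        arith = solve-∀
      u≤t : u * (64 * r) ≤ t
      u≤t = floor-≤ t (64 * r) 64r>0
      e′≤u : e′ ≤ u
      e′≤u = ≤-trans (+-mono-≤ (+-mono-≤ e≤n² nn>0) (+-mono-≤ (+-mono-≤ (*-monoʳ-≤ 2 n≤n²) (*-monoʳ-≤ 2 n≤n²)) nn>0))
        (≤-trans (≤-by (n * n) (arith (n * n))) u-big)
        where
        n≤n² : n ≤ n * n
        n≤n² = ≤-trans (≤-reflexive (sym (*-identityʳ n))) (*-monoʳ-≤ n n>0)
        arith : ∀ m → 8 * m ≡ m + m + (2 * m + 2 * m + m) + m
        arith = solve-∀
      base-u : base * r ≤ u
      base-u = floor-max t (64 * r) 64r>0 (base * r) (≤-trans (≤-reflexive (arith 64 base r)) base-small)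
        where
        arith : ∀ c b r → b * r * (c * r) ≡ c * (r * r * b)
        arith = solve-∀
      dec : Bool → Elem n → Bool
      dec bit = decode k ψ (λ m → marked m En.W) bit
      Good : Bool → Set
      Good bit = length En.W ≤ budget (t , bit) × card (dec bit) + u + (r * budget (t , bit) + e′) ≤ g
      tokens≤ : ∀ m → r * tokensFor m ≤ m
      tokens≤ m = ≤-trans (≤-reflexive (*-comm r (tokensFor m))) (floor-≤ m r r>0)
      sizeA : n * Λ * card (dec false) + 2 * n * t ≤ n * Λ * g + 12 * Λ * (t * ψ) → card (dec false) + 8 * u ≤ g
      sizeA o = *-cancelˡ-≤′ Λ (*-mono-≤ {1} {8} (s≤s z≤n) r>0) (*-cancelˡ-≤′ n n>0 (+-cancelʳ-≤ (n * t) _ _ (begin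
        n * (Λ * (c + 8 * u)) + n * t ≡⟨ arith₁ n 8 r c u t ⟩
        n * Λ * c + n * (u * (8 * 8 * r)) + n * t ≤⟨ +-monoˡ-≤ (n * t) (+-monoʳ-≤ (n * Λ * c) (*-monoʳ-≤ n u≤t)) ⟩
        n * Λ * c + n * t + n * t ≡⟨ arith₂ (n * Λ * c) n t ⟩
        n * Λ * c + 2 * n * t ≤⟨ o ⟩
        n * Λ * g + 12 * Λ * (t * ψ) ≡⟨ cong (n * Λ * g +_) (arith₃ 12 8 r t ψ) ⟩
        n * Λ * g + t * (12 * 8 * r * ψ) ≤⟨ +-monoʳ-≤ (n * Λ * g) (*-monoʳ-≤ t ψ≤n) ⟩
        n * Λ * g + t * n ≡⟨ cong₂ _+_ (*-assoc n Λ g) (*-comm t n) ⟩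
        n * (Λ * g) + n * t ∎)))
        where
        c : ℕ
        c = card (dec false)
        arith₁ : ∀ n d r c u t → n * (d * r * (c + d * u)) + n * t ≡ n * (d * r) * c + n * (u * (d * d * r)) + n * t
        arith₁ = solve-∀
        arith₂ : ∀ a n t → a + n * t + n * t ≡ a + 2 * n * t
        arith₂ = solve-∀
        arith₃ : ∀ a d r t p → a * (d * r) * (t * p) ≡ t * (a * d * r * p)
        arith₃ = solve-∀
      -- With Λ = 8r the hypothesis says r e ≤ t/4, and r `base` ≤ u is at most t/64, so the sum
      -- stays below t/3.
      W-budgetB : Λ * En.e ≤ 2 * t → length En.W ≤ budget (t , true)
      W-budgetB o = floor-max (third-of t) r r>0 (length En.W) (floor-max t 3 (s≤s z≤n) (length En.W * r) (*-cancelˡ-≤′ 8 (s≤s z≤n) (begin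
        8 * (length En.W * r * 3) ≤⟨ *-monoʳ-≤ 8 (*-monoˡ-≤ 3 (*-monoˡ-≤ r En.W-length)) ⟩
        8 * ((base + En.e) * r * 3) ≡⟨ arith₁ 8 3 r base En.e ⟩
        8 * 3 * (base * r) + 3 * (Λ * En.e) ≤⟨ +-mono-≤ (*-monoʳ-≤ (8 * 3) base-u) (*-monoʳ-≤ 3 o) ⟩
        8 * 3 * u + 3 * (2 * t) ≤⟨ +-monoˡ-≤ (3 * (2 * t)) (≤-trans (*-monoˡ-≤ u (≤-trans (≤-by {8 * 3} 40 refl) (≤-trans (≤-reflexive (sym (*-identityʳ 64))) (*-monoʳ-≤ 64 r>0))))
             (≤-trans (≤-reflexive (*-comm (64 * r) u)) u≤t)) ⟩
        t + 3 * (2 * t) ≤⟨ ≤-by t (arith₂ t) ⟩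
        8 * t ∎)))
        where
        arith₁ : ∀ a c r b e → a * ((b + e) * r * c) ≡ a * c * (b * r) + c * (a * r * e)
        arith₁ = solve-∀
        arith₂ : ∀ t → 8 * t ≡ t + 3 * (2 * t) + t
        arith₂ = solve-∀
      fitsB : card (dec true) + t ≤ g → card (dec true) + u + (r * budget (t , true) + e′) ≤ g
      fitsB o = ≤-trans (≤-trans (≤-reflexive (+-assoc (card (dec true)) u _)) (+-monoʳ-≤ (card (dec true)) inner)) o
        where
        arith : ∀ u c → 3 * (u + (c + u)) ≡ 6 * u + c * 3
        arith = solve-∀
        arith′ : ∀ t → 3 * t ≡ t + t + t
        arith′ = solve-∀
        inner : u + (r * budget (t , true) + e′) ≤ t
        inner = *-cancelˡ-≤′ 3 (s≤s z≤n) (begin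
          3 * (u + (r * budget (t , true) + e′)) ≤⟨ *-monoʳ-≤ 3 (+-monoʳ-≤ u (+-mono-≤ (tokens≤ (third-of t)) e′≤u)) ⟩
          3 * (u + (third-of t + u)) ≡⟨ arith u (third-of t) ⟩
          6 * u + third-of t * 3 ≤⟨ +-mono-≤ (≤-trans (*-monoˡ-≤ u (≤-trans (≤-by {6} 58 refl) (≤-trans (≤-reflexive (sym (*-identityʳ 64))) (*-monoʳ-≤ 64 r>0))))
             (≤-trans (≤-reflexive (*-comm (64 * r) u)) u≤t)) (floor-≤ t 3 (s≤s z≤n)) ⟩
          t + t ≤⟨ ≤-by t (arith′ t) ⟩
          3 * t ∎)
      goodFor : (En.bit ≡ false × En.e ≡ 0 × n * Λ * card (dec En.bit) + 2 * n * t ≤ n * Λ * g + 12 * Λ * (t * ψ)) ⊎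
                (En.bit ≡ true × Λ * En.e ≤ 2 * t × card (dec En.bit) + t ≤ g) → Good En.bit
      goodFor (inj₁ (b≡ , e≡ , o)) = subst Good (sym b≡)
        (floor-max u r r>0 (length En.W) (≤-trans (*-monoˡ-≤ r (≤-trans En.W-length (≤-reflexive (trans (cong (base +_) e≡) (+-identityʳ base))))) base-u) ,
         ≤-trans (≤-trans (≤-reflexive (+-assoc (card (dec false)) u _)) (+-monoʳ-≤ (card (dec false)) (≤-trans (+-monoʳ-≤ u (+-mono-≤ (tokens≤ u) e′≤u)) (≤-by (5 * u) (arith u)))))
           (sizeA (subst (λ b → n * Λ * card (dec b) + 2 * n * t ≤ n * Λ * g + 12 * Λ * (t * ψ)) b≡ o)))
        where
        arith : ∀ u → 8 * u ≡ u + (u + u) + 5 * u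
        arith = solve-∀
      goodFor (inj₂ (b≡ , o₁ , o₂)) = subst Good (sym b≡)
        (W-budgetB o₁ , fitsB (subst (λ b → card (dec b) + t ≤ g) b≡ o₂))
      good : Good En.bit
      good = goodFor En.outcome
      code : Σ (List (Token n)) λ p → p ∈ walks (2 * budget (t , En.bit)) v × (∀ m → m ≢ zero → ∀ y → marked m p y ≡ marked m En.W y)
      code = code-of v C ind En.W En.W-near En.C-near (2 * budget (t , En.bit)) (*-monoʳ-≤ 2 (proj₁ good))
      p : List (Token n)
      p = proj₁ code
      p∈ : p ∈ walks (2 * budget (t , En.bit)) v
      p∈ = proj₁ (proj₂ code)
      S : Elem n → Bool
      S = decode k ψ (λ m → marked m p) En.bit
      S≡ : ∀ x → S x ≡ dec En.bit x
      S≡ = decode-cong k ψ (proj₂ (proj₂ code)) En.bit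
      cardS : card S ≡ card (dec En.bit)
      cardS = card-cong S≡
      fits : card (dec En.bit) + u + (r * budget (t , En.bit) + e′) ≤ g
      fits = proj₂ good
      u>0 : 0 < u
      u>0 = ≤-trans (*-mono-≤ {1} {8} (s≤s z≤n) nn>0) u-big
      -- |S| ≤ |∂C| ≤ 40 n t, and t is at most 128 r u, so n |S| exceeds u only by a polynomial
      -- factor, which 2^(2r) dominates.
      fitsH : n * card S ≤ u * 2 ^ (r + r)
      fitsH = begin
        n * card S ≤⟨ *-monoʳ-≤ n (≤-trans (≤-reflexive cardS) (≤-trans (≤-trans (m≤m+n _ u) (m≤m+n _ _)) fits)) ⟩
        n * g ≤⟨ *-monoʳ-≤ n (≤-trans gap (*-monoˡ-≤ (40 * n) (≤-trans (<⇒≤ (floor-< t (64 * r) 64r>0)) (*-monoˡ-≤ (64 * r) (+-monoˡ-≤ u u>0))))) ⟩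
        n * ((u + u) * (64 * r) * (40 * n)) ≡⟨ arith n u 64 40 r ⟩
        u * (2 * 64 * 40 * r * (n * n)) ≤⟨ *-monoʳ-≤ u (*-mono-≤ (≤-trans (below-n (2 * 64 * 40) r (≤-by {2 * 64 * 40} 16772096 refl) (≤-trans r≤r2 (≤-trans r2≤r4 r4≤r8)))
             (≤-trans (≤-trans (≤-reflexive (sym (*-identityʳ n))) (*-monoʳ-≤ n n>0)) n²≤2^r)) n²≤2^r) ⟩
        u * (2 ^ r * 2 ^ r) ≡⟨ cong (u *_) (sym (^-distribˡ-+-* 2 r r)) ⟩
        u * 2 ^ (r + r) ∎
        where
        arith : ∀ n u c d r → n * ((u + u) * (c * r) * (d * n)) ≡ u * (2 * c * d * r * (n * n))
        arith = solve-∀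

  key : countS Q * 2 ^ e ≤ others
  key = *-cancelˡ-≤ 2 (begin
    2 * (countS Q * 2 ^ e) ≡⟨ arith (countS Q) (2 ^ e) ⟩
    countS Q * (2 ^ e * 2) ≡⟨ cong (countS Q *_) (sym (^-distribˡ-+-* 2 e 1)) ⟩
    countS Q * 2 ^ (e + 1) ≤⟨ *-monoˡ-≤ (2 ^ (e + 1)) split ⟩
    (countS Qₛ + countS Qₗ) * 2 ^ (e + 1) ≡⟨ *-distribʳ-+ (2 ^ (e + 1)) (countS Qₛ) (countS Qₗ) ⟩
    countS Qₛ * 2 ^ (e + 1) + countS Qₗ * 2 ^ (e + 1) ≤⟨ +-mono-≤ smallPart largePart ⟩
    others + others ≡⟨ cong (others +_) (sym (+-identityʳ others)) ⟩
    2 * others ∎)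
    where
    arith : ∀ q p → 2 * (q * p) ≡ q * (p * 2)
    arith = solve-∀
    go : ∀ q s → ⟦ q ⟧ ≤ ⟦ q ∧ s ⟧ + ⟦ q ∧ not s ⟧
    go false s = z≤n
    go true true = s≤s z≤n
    go true false = s≤s z≤n
    split : countS Q ≤ countS Qₛ + countS Qₗ
    split = ≤-trans (∑-mono (allSubs n) λ I → go (Q I) ⌊ border I <? g₁ ⌋) (≤-reflexive (∑-+ (allSubs n) _ _))

-- Layer-by-layer induction

-- This is (1 + 1/A)^m ≤ A / (A - m) with d = A - m. The induction step is (A + 1) d ≤ A (d + 1),
-- valid since d ≤ A.
power-loss : ∀ A m d → m + d ≡ A → (A + 1) ^ m * d ≤ A ^ m * A
power-loss A zero d e = ≤-reflexive (cong (1 *_) e)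
power-loss A (suc m) d e = begin
  (A + 1) * (A + 1) ^ m * d ≡⟨ arith A ((A + 1) ^ m) d ⟩
  (A + 1) ^ m * (A * d + d) ≤⟨ *-monoʳ-≤ ((A + 1) ^ m) (+-monoʳ-≤ (A * d) (≤-trans (m≤n+m d (suc m)) (≤-reflexive e))) ⟩
  (A + 1) ^ m * (A * d + A) ≡⟨ arith′ A ((A + 1) ^ m) d ⟩
  A * ((A + 1) ^ m * suc d) ≤⟨ *-monoʳ-≤ A (power-loss A m (suc d) (trans (+-suc m d) e)) ⟩
  A * (A ^ m * A) ≡⟨ sym (*-assoc A (A ^ m) A) ⟩
  A * A ^ m * A ∎
  where
  open ≤-Reasoning
  arith : ∀ A p d → (A + 1) * p * d ≡ p * (A * d + d)
  arith = solve-∀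
  arith′ : ∀ A p d → p * (A * d + A) ≡ A * (p * suc d)
  arith′ = solve-∀

doubling : ∀ H → 0 < H → (2 * H + 1) ^ H ≤ 2 * (2 * H) ^ H
doubling H H>0 = *-cancelʳ-≤′ H H>0 (≤-trans (power-loss (2 * H) H H (cong (H +_) (sym (+-identityʳ H))))
  (≤-reflexive (arith ((2 * H) ^ H) H)))
  where
  arith : ∀ p H → p * (2 * H) ≡ 2 * p * H
  arith = solve-∀

rank≤2n : ∀ {n} (v : Elem n) → rank v ≤ 2 * n
rank≤2n {n} v = begin
  rank v ≡⟨ sym (cnt-rank v) ⟩
  cnt₁ v + (cnt₂ v + cnt₂ v) ≤⟨ ≤-by (cnt₁ v + 2 * cnt₀ v) (arith (cnt₀ v) (cnt₁ v) (cnt₂ v)) ⟩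
  2 * (cnt₀ v + (cnt₁ v + cnt₂ v)) ≡⟨ cong (2 *_) (cnt-total v) ⟩
  2 * n ∎
  where
  open ≤-Reasoning
  arith : ∀ a b c → 2 * (a + (b + c)) ≡ b + (c + c) + (b + 2 * a)
  arith = solve-∀

lower-cover : ∀ {n} (v : Elem n) → 0 < rank v → Σ (Elem n) λ y → cov y v ≡ true
lower-cover {n} v h with ≼-pred (bottom-≼ v) (subst (_< rank v) (sym (rank-bottom n)) h)
... | y , _ , c = y , c

module LayerStep {n r : ℕ} (Sc : Scale n r) (k : ℕ) (n<k : n < k)
  (next : ∀ (v : Elem n) → rank v ≡ suc k → LayerBound n r (suc k)) (S : Elem n → Bool) where

  open Scale Sc
  open ≤-Reasoning
  open Sums n

  -- Only these points can occur in layer k + 1 of a downset whose layer k lies in S. Adding them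
  -- one at a time turns the count into a product of factors close to 1.
  supported : Elem n → Bool
  supported v = rk (suc k) v ∧ allV (λ y → cov y v ⇒ᵇ S y)

  L : List (Elem n)
  L = filter (λ v → supported v Data.Bool.≟ true) (allElems n)

  length-L : length L ≤ n * card S
  length-L = begin
    length L ≡⟨ trans (length-filter≡∑ (λ v → supported v Data.Bool.≟ true) (allElems n)) (∑V-cong λ v → cong ⟦_⟧ (does-≟true (supported v))) ⟩
    card supported ≤⟨ ∑V-mono one ⟩
    ∑V (λ v → ∑V (λ y → ⟦ S y ⟧ * ⟦ cov y v ⟧)) ≡⟨ trans (∑V-swap _) (∑V-cong λ y → ∑V-*ˡ ⟦ S y ⟧ _) ⟩
    ∑V (λ y → ⟦ S y ⟧ * ∑V (λ v → ⟦ cov y v ⟧)) ≤⟨ ∑V-mono (λ y → *-monoʳ-≤ ⟦ S y ⟧ (up-degree≤n y)) ⟩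
    ∑V (λ y → ⟦ S y ⟧ * n) ≡⟨ trans (∑V-*ʳ n _) (*-comm (card S) n) ⟩
    n * card S ∎
    where
    one : ∀ v → ⟦ supported v ⟧ ≤ ∑V (λ y → ⟦ S y ⟧ * ⟦ cov y v ⟧)
    one v = by (bool-case (supported v))
      where
      by : supported v ≡ true ⊎ supported v ≡ false → ⟦ supported v ⟧ ≤ ∑V (λ y → ⟦ S y ⟧ * ⟦ cov y v ⟧)
      by (inj₂ e) = ≤-trans (≤-reflexive (cong ⟦_⟧ e)) z≤n
      by (inj₁ e) = let (rv , a) = ∧-split {rk (suc k) v} e
                        (y , c) = lower-cover v (subst (0 <_) (sym (rk⁻ (suc k) v rv)) (s≤s z≤n))
                    in ≤-trans (⟦⟧≤1 (supported v)) (≤-trans (≤-reflexive (sym (cong₂ (λ p q → ⟦ p ⟧ * ⟦ q ⟧) (⇒ᵇ⁻ (allV⁻ _ a y) c) c)))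
                         (≤∑V (λ y → ⟦ S y ⟧ * ⟦ cov y v ⟧) y))

  allowed : List (Elem n) → Elem n → Bool
  allowed L′ x = atMost k S x ∧ (rk (suc k) x ⇒ᵇ mem L′ x)

  N : List (Elem n) → ℕ
  N L′ = countS (ens {n} k (allowed L′))

  allowed-all : countS (ens {n} k (atMost k S)) ≤ N L
  allowed-all = countS-mono λ I h → let module E = Ens (ens⁻ {b = k} {atMost k S} {I} h) in
    ens⁺ (mkEns E.down E.base λ x i → ∧-join (E.within x i) (⇒ᵇ⁺ {rk (suc k) x} λ rx → mem⁺ L x
      (∈-filter⁺ (λ v → supported v Data.Bool.≟ true) (allElems-complete x) (∧-join rx (allV⁺ _ λ y → ⇒ᵇ⁺ {cov y x} λ c →
        ⇒ᵇ⁻ (E.within y (E.down x y c i)) (rk⁺ k y (suc-injective (trans (sym (cov-rank y x c)) (rk⁻ (suc k) x rx)))))))))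

  -- Without points of rank k + 1 there are none above either, and everything below rank k is filled
  -- in, so the downset is determined by its layer k.
  allowed-none : N [] ≤ 2 ^ card S
  allowed-none = subst₂ _≤_ (length-fam (ens k (allowed []))) (length-subsets S)
    (injection-length (fam-unique (ens k (allowed []))) (subsets S) (λ I → tab (lay k I)) into-S
      λ I J m m′ e → Sub-ext λ x → bool-ext (transfer I J (∈-fam⁻ _ m) (∈-fam⁻ _ m′) e x) (transfer J I (∈-fam⁻ _ m′) (∈-fam⁻ _ m) (sym e) x))
    where
    into-S : ∀ I → I ∈ fam (ens k (allowed [])) → tab (lay k I) ∈ subsets S
    into-S I m = let module E = Ens (ens⁻ {b = k} {allowed []} {I} (∈-fam⁻ _ m)) in
      ∈-subsets⁺ S _ λ x h → let (i , rx) = ∧-split {I ∋ x} (trans (sym (∋-tab (lay k I) x)) h)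
                             in ⇒ᵇ⁻ (proj₁ (∧-split (E.within x i))) rx
    transfer : ∀ I J → ens k (allowed []) I ≡ true → ens k (allowed []) J ≡ true → tab (lay k I) ≡ tab (lay k J) →
      ∀ x → (I ∋ x) ≡ true → (J ∋ x) ≡ true
    transfer I J hI hJ e x i = by (<-cmp (rank x) k)
      where
      module EI = Ens (ens⁻ {b = k} {allowed []} {I} hI)
      module EJ = Ens (ens⁻ {b = k} {allowed []} {J} hJ)
      by : Tri (rank x < k) (rank x ≡ k) (k < rank x) → (J ∋ x) ≡ true
      by (tri< a _ _) = EJ.base x a
      by (tri≈ _ a _) = proj₁ (∧-split {J ∋ x} (trans (sym (∋-tab (lay k J) x)) (trans (cong (_∋ x) (sym e))
        (trans (∋-tab (lay k I) x) (∧-join i (rk⁺ k x a))))))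
      by (tri> _ _ a) = let (y , yx , ry) = ≼-of-rank (suc k) x a
                        in ⊥-elim (false≢true (⇒ᵇ⁻ (proj₂ (∧-split {atMost k S y} (EI.within y (EI.down-≼ y x yx i)))) (rk⁺ (suc k) y ry)))
        where
        false≢true : false ≡ true → ⊥
        false≢true ()

  H A : ℕ
  H = 2 ^ (r + r)
  A = 2 * H

  H>0 : 0 < H
  H>0 = pow-pos 2 (r + r) (s≤s z≤n)

  -- A downset containing v has all lower covers of v in the shadow of its component, at least n/2 ≥
  -- g₀ points. Hence `key` in layer k + 1 with e = 2r + 1 bounds these downsets by a 1/A part of
  -- those avoiding v, where A = 2^(2r+1).
  add-one : ∀ v L′ → rank v ≡ suc k → N (v ∷ L′) * A ≤ (A + 1) * N L′
  add-one v L′ rv = begin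
    N (v ∷ L′) * A ≤⟨ *-monoˡ-≤ A split ⟩
    (others + countS Ky.Q) * A ≡⟨ *-distribʳ-+ A others (countS Ky.Q) ⟩
    others * A + countS Ky.Q * A ≤⟨ +-monoʳ-≤ (others * A) Ky.key ⟩
    others * A + others ≡⟨ arith others A ⟩
    (A + 1) * others ≤⟨ *-monoʳ-≤ (A + 1) others≤ ⟩
    (A + 1) * N L′ ∎
    where
    arith : ∀ o A → o * A + o ≡ (A + 1) * o
    arith = solve-∀
    arith′ : ∀ r → r + (r + r) ≡ 3 * r
    arith′ = solve-∀
    g₀ : ℕ
    g₀ = 4 * (1 + (r + r))
    module Ky = Key Sc (suc k) (m≤n⇒m≤1+n n<k) (next v rv) k v ≤-refl rv (allowed (v ∷ L′)) g₀ (1 + (r + r)) ≤-refl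
      (*-monoʳ-≤ 4 (≤-trans (≤-reflexive (+-comm r 1)) (+-monoʳ-≤ 1 (m≤m+n r r))))
      (≤-trans (≤-trans (+-monoˡ-≤ (r + r) r>0) (≤-trans (≤-reflexive (arith′ r)) (below-n 3 r (≤-by {3} 16777213 refl) (≤-trans r≤r2 (≤-trans r2≤r4 r4≤r8)))))
        (≤-trans (≤-reflexive (sym (*-identityʳ n))) (*-monoʳ-≤ n n>0)))
    others : ℕ
    others = countS (λ I → ens k (allowed (v ∷ L′)) I ∧ not (I ∋ v))
    border-large : ∀ I → (I ∋ v) ≡ true → g₀ ≤ card (shadow (cmp (suc k) v I))
    border-large I i = *-cancelˡ-≤ 2 (begin
      2 * g₀ ≡⟨ sym (*-assoc 2 4 (1 + (r + r))) ⟩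
      2 * 4 * (1 + (r + r)) ≤⟨ *-monoʳ-≤ (2 * 4) (+-monoˡ-≤ (r + r) r>0) ⟩
      2 * 4 * (r + (r + r)) ≡⟨ arith″ (2 * 4) r ⟩
      2 * 4 * 3 * r ≤⟨ below-n (2 * 4 * 3) r (≤-by {24} 16777192 refl) (≤-trans r≤r2 (≤-trans r2≤r4 r4≤r8)) ⟩
      n ≤⟨ Weights.deg Ky.Wt v rv ⟩
      2 * ∑V (λ y → ⟦ cov y v ⟧) ≤⟨ *-monoʳ-≤ 2 (card-mono {p = λ y → cov y v} {q = shadow (cmp (suc k) v I)}
           λ y c → shadow⁺ (cmp (suc k) v I) y v (comp-root (lay (suc k) I) v) c) ⟩
      2 * card (shadow (cmp (suc k) v I)) ∎)
      where
      arith″ : ∀ c r → c * (r + (r + r)) ≡ c * 3 * r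
      arith″ = solve-∀
    split : N (v ∷ L′) ≤ others + countS Ky.Q
    split = ≤-trans (∑-mono (allSubs n) λ I → go (ens k (allowed (v ∷ L′)) I) (I ∋ v) ⌊ g₀ ≤? card (shadow (cmp (suc k) v I)) ⌋
        λ i → ⌊⌋⁺ (g₀ ≤? card (shadow (cmp (suc k) v I))) (border-large I i))
      (≤-reflexive (∑-+ (allSubs n) _ _))
      where
      go : ∀ a i g → (i ≡ true → g ≡ true) → ⟦ a ⟧ ≤ ⟦ a ∧ not i ⟧ + ⟦ a ∧ (i ∧ g) ⟧
      go false i g h = z≤n
      go true false g h = s≤s z≤n
      go true true g h rewrite h refl = s≤s z≤n
    others≤ : others ≤ N L′
    others≤ = countS-mono λ I h → let (a , nv) = ∧-split {ens k (allowed (v ∷ L′)) I} h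
                                      module E = Ens (ens⁻ {b = k} {allowed (v ∷ L′)} {I} a)
      in ens⁺ (mkEns E.down E.base λ x i → let (p , q) = ∧-split {atMost k S x} (E.within x i) in
           ∧-join p (⇒ᵇ⁺ {rk (suc k) x} λ rx → drop-head I x i nv (⇒ᵇ⁻ q rx)))
      where
      drop-head : ∀ I x → (I ∋ x) ≡ true → not (I ∋ v) ≡ true → mem (v ∷ L′) x ≡ true → mem L′ x ≡ true
      drop-head I x i nv h with ∨-split {eqV v x} h
      ... | inj₂ m = m
      ... | inj₁ e = ⊥-elim (true≢false (subst (λ u → (I ∋ u) ≡ true) (sym (eqV⁻ v x e)) i) (not-split nv))

  add-all : ∀ L′ → (∀ v → v ∈ L′ → rank v ≡ suc k) → N L′ * A ^ length L′ ≤ (A + 1) ^ length L′ * N []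
  add-all [] h = ≤-reflexive (*-comm (N []) 1)
  add-all (v ∷ L′) h = begin
    N (v ∷ L′) * (A * A ^ length L′) ≡⟨ sym (*-assoc (N (v ∷ L′)) A _) ⟩
    N (v ∷ L′) * A * A ^ length L′ ≤⟨ *-monoˡ-≤ (A ^ length L′) (add-one v L′ (h v (here refl))) ⟩
    (A + 1) * N L′ * A ^ length L′ ≡⟨ *-assoc (A + 1) (N L′) _ ⟩
    (A + 1) * (N L′ * A ^ length L′) ≤⟨ *-monoʳ-≤ (A + 1) (add-all L′ λ u m → h u (there m)) ⟩
    (A + 1) * ((A + 1) ^ length L′ * N []) ≡⟨ sym (*-assoc (A + 1) ((A + 1) ^ length L′) (N [])) ⟩
    (A + 1) * (A + 1) ^ length L′ * N [] ∎

  -- At most n|S| ≤ Hj points are added, each costing a factor 1 + 1/(2H), and H such factors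
  -- together cost at most 2 by `doubling`.
  bound : ∀ j → n * card S ≤ j * 2 ^ (r + r) → countS (ens {n} k (atMost k S)) ≤ 2 ^ (card S + j)
  bound j h = ≤-trans allowed-all (*-cancelʳ-≤′ (A ^ (H * j)) (pow-pos A (H * j) (*-mono-≤ {1} {2} (s≤s z≤n) H>0)) (begin
    N L * A ^ (H * j) ≡⟨ cong (λ m → N L * A ^ m) (sym (m+[n∸m]≡n len≤)) ⟩
    N L * A ^ (ℓ + d) ≡⟨ cong (N L *_) (^-distribˡ-+-* A ℓ d) ⟩
    N L * (A ^ ℓ * A ^ d) ≡⟨ sym (*-assoc (N L) (A ^ ℓ) (A ^ d)) ⟩
    N L * A ^ ℓ * A ^ d ≤⟨ *-mono-≤ (add-all L L-rank) (^-monoˡ-≤ d (m≤m+n A 1)) ⟩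
    (A + 1) ^ ℓ * N [] * (A + 1) ^ d ≡⟨ arith ((A + 1) ^ ℓ) (N []) ((A + 1) ^ d) ⟩
    N [] * ((A + 1) ^ ℓ * (A + 1) ^ d) ≡⟨ cong (N [] *_) (trans (sym (^-distribˡ-+-* (A + 1) ℓ d)) (cong ((A + 1) ^_) (m+[n∸m]≡n len≤))) ⟩
    N [] * (A + 1) ^ (H * j) ≡⟨ cong (N [] *_) (sym (^-*-assoc (A + 1) H j)) ⟩
    N [] * ((A + 1) ^ H) ^ j ≤⟨ *-mono-≤ allowed-none (^-monoˡ-≤ j (doubling H H>0)) ⟩
    2 ^ card S * (2 * A ^ H) ^ j ≡⟨ cong (2 ^ card S *_) (*-pow 2 (A ^ H) j) ⟩
    2 ^ card S * (2 ^ j * (A ^ H) ^ j) ≡⟨ sym (*-assoc (2 ^ card S) (2 ^ j) ((A ^ H) ^ j)) ⟩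
    2 ^ card S * 2 ^ j * (A ^ H) ^ j ≡⟨ cong₂ _*_ (sym (^-distribˡ-+-* 2 (card S) j)) (^-*-assoc A H j) ⟩
    2 ^ (card S + j) * A ^ (H * j) ∎))
    where
    ℓ d : ℕ
    ℓ = length L
    d = H * j ∸ ℓ
    len≤ : ℓ ≤ H * j
    len≤ = ≤-trans length-L (≤-trans h (≤-reflexive (*-comm j H)))
    arith : ∀ a b c → a * b * c ≡ b * (a * c)
    arith = solve-∀
    L-rank : ∀ v → v ∈ L → rank v ≡ suc k
    L-rank v m = rk⁻ (suc k) v (proj₁ (∧-split (proj₂ (∈-filter⁻ (λ v → supported v Data.Bool.≟ true) {xs = allElems n} m))))

-- The fuel measures the distance to the top rank 2n. When it runs out, no point of rank k + 1
-- exists and the hypothesis of `LayerStep` about the next layer holds vacuously.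
layerBound : ∀ {n r} → Scale n r → ∀ fuel k → n < k → 2 * n ≤ k + fuel → LayerBound n r k
layerBound Sc zero k n<k h = LayerStep.bound Sc k n<k λ v rv →
  ⊥-elim (<⇒≱ (≤-reflexive (sym rv)) (≤-trans (rank≤2n v) (≤-trans h (≤-reflexive (+-identityʳ k)))))
layerBound Sc (suc fuel) k n<k h = LayerStep.bound Sc k n<k λ v rv →
  layerBound Sc fuel (suc k) (m≤n⇒m≤1+n n<k) (≤-trans h (≤-reflexive (+-suc k fuel)))

-- Antichains and downsets

∈-sublists⇒∈ : {A : Set} (xs : List A) {S : List A} → S ∈ sublists xs → ∀ {a} → a ∈ S → a ∈ xs
∈-sublists⇒∈ [] (here refl) ()
∈-sublists⇒∈ (x ∷ xs) m a∈S with ∈-++⁻ (sublists xs) m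
... | inj₁ l = there (∈-sublists⇒∈ xs l a∈S)
... | inj₂ l with ∈-map⁻ (x ∷_) l
∈-sublists⇒∈ (x ∷ xs) m (here refl) | inj₂ l | S′ , l′ , refl = here refl
∈-sublists⇒∈ (x ∷ xs) m (there a∈S) | inj₂ l | S′ , l′ , refl = there (∈-sublists⇒∈ xs l′ a∈S)

sublists-unique : {A : Set} {xs : List A} → Unique xs → Unique (sublists xs)
sublists-unique [] = [] ∷ []
sublists-unique {xs = x ∷ xs} (px ∷ u) = Uniq.++⁺ (sublists-unique u) (Uniq.map⁺ (λ { refl → refl }) (sublists-unique u)) disj
  where
  disj : ∀ {S} → ¬ (S ∈ sublists xs × S ∈ map (x ∷_) (sublists xs))
  disj (a , b) with ∈-map⁻ (x ∷_) b
  ... | S′ , _ , refl = All.lookup px (∈-sublists⇒∈ xs a (here refl)) refl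

sublists-ext : {A : Set} {xs : List A} → Unique xs → ∀ {S S′} → S ∈ sublists xs → S′ ∈ sublists xs →
  (∀ a → a ∈ S → a ∈ S′) → (∀ a → a ∈ S′ → a ∈ S) → S ≡ S′
sublists-ext [] (here refl) (here refl) f g = refl
sublists-ext {xs = x ∷ xs} (px ∷ u) m m′ f g with ∈-++⁻ (sublists xs) m | ∈-++⁻ (sublists xs) m′
... | inj₁ l | inj₁ l′ = sublists-ext u l l′ f g
... | inj₁ l | inj₂ l′ with ∈-map⁻ (x ∷_) l′
...   | T , _ , refl = ⊥-elim (All.lookup px (∈-sublists⇒∈ xs l (g x (here refl))) refl)
sublists-ext {xs = x ∷ xs} (px ∷ u) m m′ f g | inj₂ l | inj₁ l′ with ∈-map⁻ (x ∷_) l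
... | T , _ , refl = ⊥-elim (All.lookup px (∈-sublists⇒∈ xs l′ (f x (here refl))) refl)
sublists-ext {xs = x ∷ xs} (px ∷ u) m m′ f g | inj₂ l | inj₂ l′ with ∈-map⁻ (x ∷_) l | ∈-map⁻ (x ∷_) l′
... | T , t , refl | T′ , t′ , refl = cong (x ∷_) (sublists-ext u t t′
      (λ a h → strip a (∈-sublists⇒∈ xs t h) (f a (there h))) (λ a h → strip a (∈-sublists⇒∈ xs t′ h) (g a (there h))))
  where
  strip : ∀ {T} a → a ∈ xs → a ∈ (x ∷ T) → a ∈ T
  strip a ax (here refl) = ⊥-elim (All.lookup px ax refl)
  strip a ax (there h) = h

module _ {A : Set} {P : A → Set} (P? : ∀ x → Dec (P x)) where
  filter-sublist : ∀ xs → filter P? xs ∈ sublists xs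
  filter-sublist [] = here refl
  filter-sublist (x ∷ xs) with P? x
  ... | yes _ = ∈-++⁺ʳ (sublists xs) (∈-map⁺ (x ∷_) (filter-sublist xs))
  ... | no _ = ∈-++⁺ˡ (filter-sublist xs)

  sublists-filter⁺ : ∀ xs {S} → S ∈ sublists xs → (∀ a → a ∈ S → P a) → S ∈ sublists (filter P? xs)
  sublists-filter⁺ [] m h = m
  sublists-filter⁺ (x ∷ xs) m h with ∈-++⁻ (sublists xs) m
  sublists-filter⁺ (x ∷ xs) m h | inj₁ l with P? x
  ... | yes _ = ∈-++⁺ˡ (sublists-filter⁺ xs l h)
  ... | no _ = sublists-filter⁺ xs l h
  sublists-filter⁺ (x ∷ xs) m h | inj₂ l with ∈-map⁻ (x ∷_) l
  ... | T , t , refl with P? x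
  ...   | yes _ = ∈-++⁺ʳ (sublists (filter P? xs)) (∈-map⁺ (x ∷_) (sublists-filter⁺ xs t λ a q → h a (there q)))
  ...   | no np = ⊥-elim (np (h x (here refl)))

  sublists-filter⁻ : ∀ xs {S} → S ∈ sublists (filter P? xs) → S ∈ sublists xs
  sublists-filter⁻ [] m = m
  sublists-filter⁻ (x ∷ xs) m with P? x
  ... | no _ = ∈-++⁺ˡ (sublists-filter⁻ xs m)
  ... | yes _ with ∈-++⁻ (sublists (filter P? xs)) m
  ...   | inj₁ l = ∈-++⁺ˡ (sublists-filter⁻ xs l)
  ...   | inj₂ l with ∈-map⁻ (x ∷_) l
  ...     | T , t , refl = ∈-++⁺ʳ (sublists xs) (∈-map⁺ (x ∷_) (sublists-filter⁻ xs t))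

antichain-≼ : ∀ {n} {S : List (Elem n)} → IsAntichain S → ∀ {a b} → a ∈ S → b ∈ S → a ≼ b → a ≡ b
antichain-≼ (h ∷ hs) (here refl) (here refl) l = refl
antichain-≼ (h ∷ hs) (here refl) (there b) l = ⊥-elim (proj₁ (All.lookup h b) l)
antichain-≼ (h ∷ hs) (there a) (here refl) l = ⊥-elim (proj₂ (All.lookup h a) l)
antichain-≼ (h ∷ hs) (there a) (there b) l = antichain-≼ hs a b l

≼-antisym : ∀ {n} {x y : Elem n} → x ≼ y → y ≼ x → x ≡ y
≼-antisym p q = ≼-rank-≡ p (≼-rank q)

pairwise : {A : Set} {R : A → A → Set} {xs : List A} → Unique xs → (∀ a b → a ∈ xs → b ∈ xs → a ≢ b → R a b) → AllPairs R xs
pairwise [] h = []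
pairwise {xs = x ∷ xs} (px ∷ u) h = All.tabulate (λ {b} m → h x b (here refl) (there m) (All.lookup px m)) ∷
  pairwise u λ a b p q → h a b (there p) (there q)

antichains : ∀ n → List (List (Elem n))
antichains n = filter isAntichain? (sublists (allElems n))

antichains-unique : ∀ n → Unique (antichains n)
antichains-unique n = Uniq.filter⁺ isAntichain? (sublists-unique (allElems-unique n))

downset : ∀ {n} → Sub n → Bool
downset = ens 0 full

∈-antichains⁻ : ∀ {n} {S : List (Elem n)} → S ∈ antichains n → S ∈ sublists (allElems n) × IsAntichain S
∈-antichains⁻ {n} m = ∈-filter⁻ isAntichain? {xs = sublists (allElems n)} m

-- φ is instantiated by the identity and by the order-reversing involution.
module Generate {n : ℕ} (φ : Elem n → Elem n) (φ-inj : ∀ x y → φ x ≡ φ y → x ≡ y)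
  (φ-order : ∀ x y → φ x ≼ φ y → x ≼ y ⊎ y ≼ x) where

  below : List (Elem n) → Elem n → Bool
  below S x = anyL (λ a → x ≼ᵇ φ a) S

  below⁺ : ∀ S x a → a ∈ S → x ≼ φ a → below S x ≡ true
  below⁺ S x a m l = anyL⁺ (λ a → x ≼ᵇ φ a) m (⌊⌋⁺ (x ≼? φ a) l)

  below⁻ : ∀ S x → below S x ≡ true → Σ (Elem n) λ a → a ∈ S × x ≼ φ a
  below⁻ S x h with anyL⁻ (λ a → x ≼ᵇ φ a) S h
  ... | a , m , q = a , m , ⌊⌋⁻ (x ≼? φ a) q

  down : List (Elem n) → Sub n
  down S = tab (below S)

  down-Ens : ∀ S → downset (down S) ≡ true
  down-Ens S = ens⁺ (mkEns
    (λ x y c h → let (a , m , l) = below⁻ S x (trans (sym (∋-tab (below S) x)) h) in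
      trans (∋-tab (below S) y) (below⁺ S y a m (≼-trans (cov⇒≼ y x c) l)))
    (λ x ()) (λ _ _ → refl))

  φ-antichain : ∀ {S} → IsAntichain S → ∀ {a b} → a ∈ S → b ∈ S → φ a ≼ φ b → a ≡ b
  φ-antichain h {a} {b} p q l with φ-order a b l
  ... | inj₁ r = antichain-≼ h p q r
  ... | inj₂ r = sym (antichain-≼ h q p r)

  -- Passing from S to S′ and back gives φ a ≼ φ b ≼ φ c with a and c in the antichain S; so a = c
  -- and all three images coincide.
  down-⊆ : ∀ {S S′} → IsAntichain S → down S ≡ down S′ → ∀ a → a ∈ S → a ∈ S′
  down-⊆ {S} {S′} h e a m =
    let (b , mb , l) = below⁻ S′ (φ a) (trans (sym (∋-tab (below S′) (φ a))) (trans (cong (_∋ φ a) (sym e))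
                         (trans (∋-tab (below S) (φ a)) (below⁺ S (φ a) a m (≼-refl (φ a))))))
        (c , mc , l′) = below⁻ S (φ b) (trans (sym (∋-tab (below S) (φ b))) (trans (cong (_∋ φ b) e)
                         (trans (∋-tab (below S′) (φ b)) (below⁺ S′ (φ b) b mb (≼-refl (φ b))))))
        a≡c = φ-antichain h m mc (≼-trans l l′)
    in subst (_∈ S′) (φ-inj b a (≼-antisym (subst (λ u → φ b ≼ φ u) (sym a≡c) l′) l)) mb

  down-injective : ∀ S S′ → S ∈ antichains n → S′ ∈ antichains n → down S ≡ down S′ → S ≡ S′
  down-injective S S′ m m′ e = sublists-ext (allElems-unique n) (proj₁ (∈-antichains⁻ m)) (proj₁ (∈-antichains⁻ m′))
    (down-⊆ (proj₂ (∈-antichains⁻ m)) e) (down-⊆ (proj₂ (∈-antichains⁻ m′)) (sym e))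

module Maximal {n : ℕ} where
  maximal : Sub n → Elem n → Bool
  maximal I x = (I ∋ x) ∧ allV (λ z → cov x z ⇒ᵇ not (I ∋ z))

  maxList : Sub n → List (Elem n)
  maxList I = filter (λ x → maximal I x Data.Bool.≟ true) (allElems n)

  maxList⁻ : ∀ I x → x ∈ maxList I → maximal I x ≡ true
  maxList⁻ I x m = proj₂ (∈-filter⁻ (λ x → maximal I x Data.Bool.≟ true) {xs = allElems n} m)

  climb : ∀ I fuel x → 2 * n ≤ rank x + fuel → (I ∋ x) ≡ true → Σ (Elem n) λ z → x ≼ z × maximal I z ≡ true
  climb I fuel x h i with bool-case (anyV (λ z → not (cov x z ⇒ᵇ not (I ∋ z))))
  ... | inj₂ e = x , ≼-refl x , ∧-join i (cong not e)
  ... | inj₁ e with anyV⁻ (λ z → not (cov x z ⇒ᵇ not (I ∋ z))) e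
  ...   | z , q with both (cov x z) (I ∋ z) q
    where
    both : ∀ a b → not (a ⇒ᵇ not b) ≡ true → a ≡ true × b ≡ true
    both true true _ = refl , refl
  climb I zero x h i | inj₁ e | z , q | c , iz = ⊥-elim (<⇒≱ (≤-reflexive (sym (cov-rank x z c)))
    (≤-trans (rank≤2n z) (≤-trans h (≤-reflexive (+-identityʳ _)))))
  climb I (suc fuel) x h i | inj₁ e | z , q | c , iz with climb I fuel z (≤-trans h (≤-reflexive
      (trans (+-suc (rank x) fuel) (cong (_+ fuel) (sym (cov-rank x z c)))))) iz
  ... | w , zw , mw = w , ≼-trans (cov⇒≼ x z c) zw , mw

  incomparable : ∀ I → Ens 0 full I → ∀ x y → x ∈ maxList I → y ∈ maxList I → x ≢ y → ¬ (x ≼ y)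
  incomparable I E x y mx my ne l =
    let open Ens E
        (ix , ax) = ∧-split {I ∋ x} (maxList⁻ I x mx)
        (iy , _) = ∧-split {I ∋ y} (maxList⁻ I y my)
        x<y : rank x < rank y
        x<y = ≰⇒> λ q → ne (≼-rank-≡ l q)
        (z , xz , zy , rz) = ≼-interpolate (suc (rank x)) l (n≤1+n _) x<y
    in true≢false (down-≼ z y zy iy) (not-split (⇒ᵇ⁻ (allV⁻ _ ax z) (≼⇒cov xz rz)))

  maxList-antichain : ∀ I → downset I ≡ true → maxList I ∈ antichains n
  maxList-antichain I h = ∈-filter⁺ isAntichain? (filter-sublist (λ x → maximal I x Data.Bool.≟ true) (allElems n))
    (pairwise (Uniq.filter⁺ (λ x → maximal I x Data.Bool.≟ true) (allElems-unique n)) λ a b ma mb ne →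
      incomparable I (ens⁻ h) a b ma mb ne , incomparable I (ens⁻ h) b a mb ma λ e → ne (sym e))

  maxList-⊆ : ∀ I J → downset J ≡ true → maxList I ≡ maxList J → ∀ x → (I ∋ x) ≡ true → (J ∋ x) ≡ true
  maxList-⊆ I J hJ e x i =
    let (z , xz , mz) = climb I (2 * n) x (m≤n+m (2 * n) (rank x)) i
        z∈J = maxList⁻ J z (subst (z ∈_) e (∈-filter⁺ (λ x → maximal I x Data.Bool.≟ true) (allElems-complete z) mz))
    in Ens.down-≼ (ens⁻ {b = 0} {full} {J} hJ) x z xz (proj₁ (∧-split z∈J))

  -- Every element of a finite downset lies below a maximal one, so the antichain of its maximal
  -- elements recovers the downset.
  downsets≤α : countS (downset {n}) ≤ α n
  downsets≤α = subst (_≤ α n) (length-fam {n} downset) (injection-length (fam-unique downset) (antichains n) maxList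
    (λ I m → maxList-antichain I (∈-fam⁻ downset m))
    λ I J mI mJ e → Sub-ext λ x → bool-ext (maxList-⊆ I J (∈-fam⁻ downset mJ) e x) (maxList-⊆ J I (∈-fam⁻ downset mI) (sym e) x))

-- Order reversal and the split into high, low and middle antichains

flip : Fin 3 → Fin 3
flip 0F = 2F
flip 1F = 1F
flip 2F = 0F

rev : ∀ {n} → Elem n → Elem n
rev [] = []
rev (a ∷ x) = flip a ∷ rev x

flip-sum : ∀ a → toℕ (flip a) + toℕ a ≡ 2
flip-sum 0F = refl
flip-sum 1F = refl
flip-sum 2F = refl

rev-rank : ∀ {n} (x : Elem n) → rank (rev x) + rank x ≡ 2 * n
rev-rank [] = refl
rev-rank {suc n} (a ∷ x) = trans (+-interchange (toℕ (flip a)) (rank (rev x)) (toℕ a) (rank x))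
  (trans (cong₂ _+_ (flip-sum a) (rev-rank x)) (arith n))
  where
  arith : ∀ n → 2 + 2 * n ≡ 2 * suc n
  arith = solve-∀

rev-inj : ∀ {n} (x y : Elem n) → rev x ≡ rev y → x ≡ y
rev-inj x y e = trans (sym (rev-rev x)) (trans (cong rev e) (rev-rev y))
  where
  flip-flip : ∀ a → flip (flip a) ≡ a
  flip-flip 0F = refl
  flip-flip 1F = refl
  flip-flip 2F = refl
  rev-rev : ∀ {n} (x : Elem n) → rev (rev x) ≡ x
  rev-rev [] = refl
  rev-rev (a ∷ x) = cong₂ _∷_ (flip-flip a) (rev-rev x)

rev-order : ∀ {n} (x y : Elem n) → rev x ≼ rev y → y ≼ x
rev-order [] [] Pointwise.[] = Pointwise.[]
rev-order (a ∷ x) (b ∷ y) (p Pointwise.∷ ps) = anti a b p Pointwise.∷ rev-order x y ps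
  where
  anti : ∀ a b → toℕ (flip a) ≤ toℕ (flip b) → toℕ b ≤ toℕ a
  anti a b h = +-cancelˡ-≤ (toℕ (flip a)) _ _ (≤-trans (+-monoˡ-≤ (toℕ b) h)
    (≤-reflexive (trans (flip-sum b) (sym (flip-sum a)))))

reachesRank : ∀ {n} → ℕ → Sub n → Bool
reachesRank m I = downset I ∧ anyV (λ x → (I ∋ x) ∧ rk m x)

module Classify (n : ℕ) where
  isHigh isLow : List (Elem n) → Bool
  isHigh S = anyL (λ a → ⌊ 2 + n ≤? rank a ⌋) S
  isLow S = anyL (λ a → ⌊ 2 + rank a ≤? n ⌋) S

  count : (List (Elem n) → Bool) → ℕ
  count p = length (filter (λ S → p S Data.Bool.≟ true) (antichains n))

  -- Only the images under φ have to reach rank n + 2, so the same injection counts high antichains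
  -- directly and low ones through `rev`.
  module Into (φ : Elem n → Elem n) (φ-inj : ∀ x y → φ x ≡ φ y → x ≡ y)
    (φ-order : ∀ x y → φ x ≼ φ y → x ≼ y ⊎ y ≼ x) (p : List (Elem n) → Bool)
    (p-high : ∀ S → p S ≡ true → Σ (Elem n) λ a → a ∈ S × 2 + n ≤ rank (φ a)) where
    open Generate φ φ-inj φ-order

    count≤ : count p ≤ countS (reachesRank {n} (2 + n))
    count≤ = subst (count p ≤_) (length-fam {n} (reachesRank (2 + n))) (injection-length
      (Uniq.filter⁺ (λ S → p S Data.Bool.≟ true) (antichains-unique n)) (fam (reachesRank (2 + n))) down
      (λ S m → ∈-fam⁺ (reachesRank (2 + n)) (∧-join (down-Ens S) (reach S (proj₂ (member m)))))
      λ S S′ m m′ e → down-injective S S′ (proj₁ (member m)) (proj₁ (member m′)) e)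
      where
      member : ∀ {S} → S ∈ filter (λ S → p S Data.Bool.≟ true) (antichains n) → S ∈ antichains n × p S ≡ true
      member m = ∈-filter⁻ (λ S → p S Data.Bool.≟ true) {xs = antichains n} m
      reach : ∀ S → p S ≡ true → anyV (λ x → (down S ∋ x) ∧ rk (2 + n) x) ≡ true
      reach S h = let (a , m , l) = p-high S h
                      (y , ya , ry) = ≼-of-rank (2 + n) (φ a) l
                  in anyV⁺ (λ x → (down S ∋ x) ∧ rk (2 + n) x) y
                       (∧-join (trans (∋-tab (below S) y) (below⁺ S y a m ya)) (rk⁺ (2 + n) y ry))

  high≤ : count isHigh ≤ countS (reachesRank {n} (2 + n))
  high≤ = Into.count≤ (λ x → x) (λ x y e → e) (λ x y l → inj₁ l) isHigh λ S h →
    let (a , m , q) = anyL⁻ (λ a → ⌊ 2 + n ≤? rank a ⌋) S h in a , m , ⌊⌋⁻ (2 + n ≤? rank a) q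

  low≤ : count isLow ≤ countS (reachesRank {n} (2 + n))
  low≤ = Into.count≤ rev rev-inj (λ x y l → inj₂ (rev-order x y l)) isLow λ S h →
    let (a , m , q) = anyL⁻ (λ a → ⌊ 2 + rank a ≤? n ⌋) S h in a , m , flipped a (⌊⌋⁻ (2 + rank a ≤? n) q)
    where
    flipped : ∀ a → 2 + rank a ≤ n → 2 + n ≤ rank (rev a)
    flipped a l = +-cancelʳ-≤ (rank a) _ _ (≤-trans (≤-reflexive (arith n (rank a)))
      (≤-trans (+-monoʳ-≤ n l) (≤-reflexive (trans (cong (n +_) (sym (+-identityʳ n))) (sym (rev-rank a))))))
      where
      arith : ∀ n r → 2 + n + r ≡ n + (2 + r)
      arith = solve-∀

  middle : List (List (Elem n))
  middle = filter isAntichain? (sublists (filter inMiddle? (allElems n)))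

  mid≤α : αMid n ≤ α n
  mid≤α = injection-length (Uniq.filter⁺ isAntichain? (sublists-unique (Uniq.filter⁺ inMiddle? (allElems-unique n)))) (antichains n) (λ S → S)
    (λ S m → let (a , b) = ∈-filter⁻ isAntichain? {xs = sublists (filter inMiddle? (allElems n))} m in
      ∈-filter⁺ isAntichain? (sublists-filter⁻ inMiddle? (allElems n) a) b)
    λ S S′ _ _ e → e

  neither : List (Elem n) → Bool
  neither S = not (isHigh S ∨ isLow S)

  neither≤ : count neither ≤ αMid n
  neither≤ = injection-length (Uniq.filter⁺ (λ S → neither S Data.Bool.≟ true) (antichains-unique n)) middle (λ S → S) into λ S S′ _ _ e → e
    where
    into : ∀ S → S ∈ filter (λ S → neither S Data.Bool.≟ true) (antichains n) → S ∈ middle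
    into S m =
      let (ma , q) = ∈-filter⁻ (λ S → neither S Data.Bool.≟ true) {xs = antichains n} m
          (ms , anti) = ∈-antichains⁻ ma
      in ∈-filter⁺ isAntichain? (sublists-filter⁺ inMiddle? (allElems n) ms λ a a∈S →
           ≮⇒≥ (λ l → true≢false (∨-right {isHigh S} (anyL⁺ (λ a → ⌊ 2 + rank a ≤? n ⌋) a∈S (⌊⌋⁺ (2 + rank a ≤? n) l))) (not-split q)) ,
           ≮⇒≥ (λ l → true≢false (∨-left {b = isLow S} (anyL⁺ (λ a → ⌊ 2 + n ≤? rank a ⌋) a∈S (⌊⌋⁺ (2 + n ≤? rank a) l))) (not-split q))) anti

  α≤ : α n ≤ αMid n + 2 * countS (reachesRank {n} (2 + n))
  α≤ = begin
    length (antichains n) ≡⟨ trans (sym (*-identityʳ _)) (sym (∑-const (antichains n) 1)) ⟩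
    ∑ (antichains n) (λ _ → 1) ≤⟨ ∑-mono (antichains n) (λ S → go (isHigh S) (isLow S)) ⟩
    ∑ (antichains n) (λ S → ⟦ neither S ⟧ + (⟦ isHigh S ⟧ + ⟦ isLow S ⟧))
      ≡⟨ trans (∑-+ (antichains n) _ _) (cong (∑ (antichains n) (λ S → ⟦ neither S ⟧) +_) (∑-+ (antichains n) _ _)) ⟩
    ∑ (antichains n) (λ S → ⟦ neither S ⟧) + (∑ (antichains n) (λ S → ⟦ isHigh S ⟧) + ∑ (antichains n) (λ S → ⟦ isLow S ⟧))
      ≡⟨ cong₂ _+_ (as-count neither) (cong₂ _+_ (as-count isHigh) (as-count isLow)) ⟩
    count neither + (count isHigh + count isLow) ≤⟨ +-mono-≤ neither≤ (+-mono-≤ high≤ (≤-trans low≤ (≤-reflexive (sym (+-identityʳ _))))) ⟩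
    αMid n + 2 * countS (reachesRank {n} (2 + n)) ∎
    where
    open ≤-Reasoning
    go : ∀ h l → 1 ≤ ⟦ not (h ∨ l) ⟧ + (⟦ h ⟧ + ⟦ l ⟧)
    go true l = s≤s z≤n
    go false true = s≤s z≤n
    go false false = s≤s z≤n
    as-count : ∀ p → ∑ (antichains n) (λ S → ⟦ p S ⟧) ≡ count p
    as-count p = sym (trans (length-filter≡∑ (λ S → p S Data.Bool.≟ true) (antichains n))
      (∑-cong (antichains n) λ S → cong ⟦_⟧ (does-≟true (p S))))

-- Downsets reaching rank n + 2

half-degree : ∀ {n} (x : Elem n) → n ≤ rank x → n ≤ 2 * ∑V (λ y → ⟦ cov y x ⟧)
half-degree {n} x h = ≤-trans h (≤-trans (≤-reflexive (sym (cnt-rank x)))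
  (≤-trans (≤-by (cnt₁ x) (arith (cnt₁ x) (cnt₂ x))) (≤-reflexive (cong (2 *_) (sym (down-degree x))))))
  where
  arith : ∀ b c → 2 * (b + c) ≡ b + (c + c) + b
  arith = solve-∀

module Reach {n r : ℕ} (Sc : Scale n r) where
  open Scale Sc
  open Sums n
  open ≤-Reasoning

  -- `Key` needs 4e ≤ |∂C|, and |∂C| is at least n²/8 here.
  e : ℕ
  e = floor (n * n) 32 (s≤s z≤n)

  scaled≤n² : ∀ c m → c ≤ 16777216 → m ≤ n → c * m ≤ n * n
  scaled≤n² c m hc hm = *-mono-≤ (≤-trans (≤-reflexive (sym (*-identityʳ c))) (below-n c 1 hc r8>0)) hm

  r≤n : r ≤ n
  r≤n = ≤-trans (≤-reflexive (sym (+-identityʳ r))) (below-n 1 r (s≤s z≤n) (≤-trans r≤r2 (≤-trans r2≤r4 r4≤r8)))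

  r+1≤e : r + 1 ≤ e
  r+1≤e = floor-max (n * n) 32 (s≤s z≤n) (r + 1) (begin
    (r + 1) * 32 ≤⟨ *-monoˡ-≤ 32 (+-monoʳ-≤ r r>0) ⟩
    (r + r) * 32 ≡⟨ arith r 32 ⟩
    2 * 32 * r ≤⟨ scaled≤n² (2 * 32) r (≤-by {64} 16777152 refl) r≤n ⟩
    n * n ∎)
    where
    arith : ∀ r c → (r + r) * c ≡ 2 * c * r
    arith = solve-∀

  e≤n² : e ≤ n * n
  e≤n² = ≤-trans (m≤m*n e 32) (floor-≤ (n * n) 32 (s≤s z≤n))

  shadow₂ : Elem n → Elem n → Bool
  shadow₂ v y = anyV λ x → cov x v ∧ cov y x

  -- The factor 8 is 2 · 2 · 2: a point of rank at least n has at least n/2 lower covers, which is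
  -- used at two levels, and a point two ranks below v is reached through at most two intermediate
  -- ones.
  shadow₂-large : ∀ v → rank v ≡ 2 + n → n * n ≤ 8 * card (shadow₂ v)
  shadow₂-large v rv = begin
    n * n ≤⟨ *-monoˡ-≤ n (half-degree v (≤-trans (m≤n+m n 2) (≤-reflexive (sym rv)))) ⟩
    2 * ∑V (λ x → ⟦ cov x v ⟧) * n ≡⟨ trans (*-assoc 2 (∑V (λ x → ⟦ cov x v ⟧)) n) (cong (2 *_) (sym (∑V-*ʳ n _))) ⟩
    2 * ∑V (λ x → ⟦ cov x v ⟧ * n) ≤⟨ *-monoʳ-≤ 2 (∑V-mono λ x → ⟦⟧-*-mono (cov x v) λ c →
         half-degree x (≤-trans (n≤1+n n) (≤-reflexive (suc-injective (trans (sym rv) (cov-rank x v c)))))) ⟩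
    2 * ∑V (λ x → ⟦ cov x v ⟧ * (2 * ∑V (λ y → ⟦ cov y x ⟧)))
      ≡⟨ cong (2 *_) (trans (∑V-cong λ x → arith ⟦ cov x v ⟧ (∑V (λ y → ⟦ cov y x ⟧))) (∑V-*ˡ 2 _)) ⟩
    2 * (2 * ∑V (λ x → ⟦ cov x v ⟧ * ∑V (λ y → ⟦ cov y x ⟧))) ≡⟨ cong (λ m → 2 * (2 * m)) (∑V-pull (λ x → ⟦ cov x v ⟧) (λ x y → ⟦ cov y x ⟧)) ⟩
    2 * (2 * ∑V (λ y → ∑V (λ x → ⟦ cov x v ⟧ * ⟦ cov y x ⟧))) ≤⟨ *-monoʳ-≤ 2 (*-monoʳ-≤ 2 (∑V-mono λ y → inner y (bool-case (shadow₂ v y)))) ⟩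
    2 * (2 * ∑V (λ y → 2 * ⟦ shadow₂ v y ⟧)) ≡⟨ cong (λ m → 2 * (2 * m)) (∑V-*ˡ 2 _) ⟩
    2 * (2 * (2 * card (shadow₂ v))) ≡⟨ arith′ (card (shadow₂ v)) ⟩
    8 * card (shadow₂ v) ∎
    where
    arith : ∀ a b → a * (2 * b) ≡ 2 * (a * b)
    arith = solve-∀
    arith′ : ∀ m → 2 * (2 * (2 * m)) ≡ 8 * m
    arith′ = solve-∀
    inner : ∀ y → shadow₂ v y ≡ true ⊎ shadow₂ v y ≡ false → ∑V (λ x → ⟦ cov x v ⟧ * ⟦ cov y x ⟧) ≤ 2 * ⟦ shadow₂ v y ⟧
    inner y (inj₁ s) = ≤-trans (≤-trans (≤-reflexive (∑V-cong λ x → *-comm ⟦ cov x v ⟧ ⟦ cov y x ⟧)) (interval-≤2 y v))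
      (≤-reflexive (cong (λ c → 2 * ⟦ c ⟧) (sym s)))
    inner y (inj₂ s) = ≤-trans (≤-reflexive (∑-empty (allElems n) _ λ x _ → trans (sym (⟦∧⟧ (cov x v) (cov y x)))
      (cong ⟦_⟧ (¬-not λ h → true≢false (anyV⁺ (λ x → cov x v ∧ cov y x) x h) s)))) z≤n

  through : Elem n → Sub n → Bool
  through v I = downset I ∧ ((I ∋ v) ∧ rk (2 + n) v)

  -- The component is taken at one chosen lower cover w of v, in layer n + 1; any other lower cover
  -- shares a lower cover with w by `cov-meet` and so belongs to the same component.
  through-bound : ∀ v → rank v ≡ 2 + n → countS (through v) * 2 ^ e ≤ countS (downset {n})
  through-bound v rv = ≤-trans (*-monoˡ-≤ (2 ^ e) (countS-mono {P = through v} {Q = Ky.Q} through⇒Q))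
    (≤-trans Ky.key (countS-mono {P = λ I → downset I ∧ not (I ∋ w)} {Q = downset} λ I h → proj₁ (∧-split h)))
    where
    cover : Σ (Elem n) λ w → cov w v ≡ true
    cover = lower-cover v (subst (0 <_) (sym rv) (s≤s z≤n))
    w : Elem n
    w = proj₁ cover
    below-rank : ∀ x → cov x v ≡ true → rank x ≡ 1 + n
    below-rank x c = suc-injective (trans (sym (cov-rank x v c)) rv)
    module Ky = Key Sc (1 + n) ≤-refl (layerBound Sc (2 * n) (1 + n) ≤-refl (m≤n+m (2 * n) (1 + n)))
      0 w (s≤s z≤n) (below-rank w (proj₂ cover)) full (4 * e) e ≤-refl (*-monoʳ-≤ 4 r+1≤e) e≤n²
    through⇒Q : ∀ I → through v I ≡ true → Ky.Q I ≡ true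
    through⇒Q I h = ∧-join hI (∧-join (down v w (proj₂ cover) iv) (⌊⌋⁺ (4 * e ≤? card (shadow C)) (*-cancelˡ-≤′ 8 (s≤s z≤n) (begin
      8 * (4 * e) ≡⟨ trans (sym (*-assoc 8 4 e)) (*-comm 32 e) ⟩
      e * 32 ≤⟨ floor-≤ (n * n) 32 (s≤s z≤n) ⟩
      n * n ≤⟨ shadow₂-large v rv ⟩
      8 * card (shadow₂ v) ≤⟨ *-monoʳ-≤ 8 (card-mono {p = shadow₂ v} {q = shadow C} λ y s →
           let (x , q) = anyV⁻ (λ x → cov x v ∧ cov y x) s
               (a , c) = ∧-split {cov x v} q
           in shadow⁺ C y x (in-C x a) c) ⟩
      8 * card (shadow C) ∎))))
      where
      hI : downset I ≡ true
      hI = proj₁ (∧-split h)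
      iv : (I ∋ v) ≡ true
      iv = proj₁ (∧-split (proj₂ (∧-split {downset I} h)))
      open Ens (ens⁻ {b = 0} {full} {I} hI)
      C : Elem n → Bool
      C = cmp (1 + n) w I
      in-C : ∀ x → cov x v ≡ true → C x ≡ true
      in-C x c with w ≟V x
      ... | yes refl = comp-root (lay (1 + n) I) w
      ... | no ne with cov-meet {x = v} (proj₂ cover) c ne
      ...   | z , zw , zx = comp-closed (lay (1 + n) I) w w x (comp-root (lay (1 + n) I) w)
              (∧-join (down v x c iv) (rk⁺ (1 + n) x (below-rank x c))) (linked⁺ z w x zw zx)

  reach-bound : countS (reachesRank {n} (2 + n)) * 2 ^ e ≤ 3 ^ n * countS (downset {n})
  reach-bound = begin
    countS (reachesRank {n} (2 + n)) * 2 ^ e ≤⟨ *-monoˡ-≤ (2 ^ e) (≤-trans (∑-mono (allSubs n) pointwise) (≤-reflexive (∑-swap (allSubs n) (allElems n) _))) ⟩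
    ∑V {n} (λ v → countS (through v)) * 2 ^ e ≡⟨ sym (∑V-*ʳ (2 ^ e) _) ⟩
    ∑V {n} (λ v → countS (through v) * 2 ^ e) ≤⟨ ∑V-mono each ⟩
    ∑V {n} (λ v → countS (downset {n})) ≡⟨ trans (∑-const (allElems n) (countS (downset {n}))) (cong (_* countS (downset {n})) (length-allElems n)) ⟩
    3 ^ n * countS (downset {n}) ∎
    where
    pointwise : ∀ I → ⟦ reachesRank {n} (2 + n) I ⟧ ≤ ∑V (λ v → ⟦ through v I ⟧)
    pointwise I = by (bool-case (reachesRank {n} (2 + n) I))
      where
      by : reachesRank {n} (2 + n) I ≡ true ⊎ reachesRank {n} (2 + n) I ≡ false → ⟦ reachesRank {n} (2 + n) I ⟧ ≤ ∑V (λ v → ⟦ through v I ⟧)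
      by (inj₂ q) = ≤-trans (≤-reflexive (cong ⟦_⟧ q)) z≤n
      by (inj₁ q) = let (d , a) = ∧-split {downset I} q
                        (v , h) = anyV⁻ (λ x → (I ∋ x) ∧ rk (2 + n) x) a
                    in ≤-trans (⟦⟧≤1 (reachesRank {n} (2 + n) I)) (≤-trans (≤-reflexive (sym (cong ⟦_⟧ (∧-join d h)))) (≤∑V (λ v → ⟦ through v I ⟧) v))
    each : ∀ v → countS (through v) * 2 ^ e ≤ countS (downset {n})
    each v = by (bool-case (rk (2 + n) v))
      where
      by : rk (2 + n) v ≡ true ⊎ rk (2 + n) v ≡ false → countS (through v) * 2 ^ e ≤ countS (downset {n})
      by (inj₁ q) = through-bound v (rk⁻ (2 + n) v q)
      by (inj₂ q) = ≤-trans (≤-reflexive (cong (_* 2 ^ e) (∑-empty (allSubs n) _ λ I _ → cong ⟦_⟧ (¬-not λ h →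
        true≢false (proj₂ (∧-split {I ∋ v} (proj₂ (∧-split {downset I} h)))) q)))) z≤n

  -- 2n bits pay for the 3^n ≤ 4^n choices of v; the other two are used up in `difference`.
  f : ℕ
  f = e ∸ (2 * n + 2)

  e-large : 2 * n + 2 ≤ e
  e-large = floor-max (n * n) 32 (s≤s z≤n) (2 * n + 2) (begin
    (2 * n + 2) * 32 ≤⟨ *-monoˡ-≤ 32 (+-monoʳ-≤ (2 * n) (*-monoʳ-≤ 2 n>0)) ⟩
    (2 * n + 2 * n) * 32 ≡⟨ arith n 32 ⟩
    4 * 32 * n ≤⟨ scaled≤n² (4 * 32) n (≤-by {128} 16777088 refl) ≤-refl ⟩
    n * n ∎)
    where
    arith : ∀ n c → (2 * n + 2 * n) * c ≡ 4 * c * n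
    arith = solve-∀

  e≡ : e ≡ f + (2 * n + 2)
  e≡ = sym (m∸n+n≡m {e} {2 * n + 2} e-large)

  f-large : n * n ≤ 128 * f
  f-large = +-cancelʳ-≤ (3 * (n * n)) _ _ (begin
    n * n + 3 * (n * n) ≡⟨ arith₁ (n * n) ⟩
    4 * (n * n) ≤⟨ *-monoʳ-≤ 4 (<⇒≤ (floor-< (n * n) 32 (s≤s z≤n))) ⟩
    4 * (suc e * 32) ≡⟨ cong (λ m → 4 * (suc m * 32)) {e} {f + (2 * n + 2)} e≡ ⟩
    4 * (suc (f + (2 * n + 2)) * 32) ≡⟨ arith₂ 4 32 f n ⟩
    4 * 32 * f + 4 * 32 * (2 * n + 3) ≤⟨ +-monoʳ-≤ (4 * 32 * f) (*-monoʳ-≤ (4 * 32) (+-monoʳ-≤ (2 * n) (*-monoʳ-≤ 3 n>0))) ⟩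
    4 * 32 * f + 4 * 32 * (2 * n + 3 * n) ≡⟨ cong (4 * 32 * f +_) (arith₃ (4 * 32) n) ⟩
    4 * 32 * f + 4 * 32 * 5 * n ≤⟨ +-monoʳ-≤ (4 * 32 * f) (≤-trans (scaled≤n² (4 * 32 * 5) n (≤-by {640} 16776576 refl) ≤-refl) (m≤n*m (n * n) 3)) ⟩
    128 * f + 3 * (n * n) ∎)
    where
    arith₁ : ∀ m → m + 3 * m ≡ 4 * m
    arith₁ = solve-∀
    arith₂ : ∀ c d f n → c * (suc (f + (2 * n + 2)) * d) ≡ c * d * f + c * d * (2 * n + 3)
    arith₂ = solve-∀
    arith₃ : ∀ c n → c * (2 * n + 3 * n) ≡ c * 5 * n
    arith₃ = solve-∀

  -- `reach-bound` compares X with the number of all downsets, hence with α n ≤ αMid n + 2X, which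
  -- involves X again. The two spare bits give 4X · 2^f on the left, half of which absorbs the 2X on
  -- the right.
  difference : ∣ α n - αMid n ∣ * 2 ^ f ≤ αMid n
  difference = ≤-trans (*-monoˡ-≤ (2 ^ f) diff≤) (+-cancelʳ-≤ (2 * X * 2 ^ f) _ _ (begin
    2 * X * 2 ^ f + 2 * X * 2 ^ f ≡⟨ arith₁ X (2 ^ f) ⟩
    X * (2 ^ f * 2 ^ 2) ≡⟨ cong (X *_) (sym (^-distribˡ-+-* 2 f 2)) ⟩
    X * 2 ^ (f + 2) ≤⟨ cancel-2^ X (f + 2) (2 * n) (αMid n + 2 * X) (begin
      X * 2 ^ (f + 2 + 2 * n) ≡⟨ cong (λ m → X * 2 ^ m) (trans (arith₂ f n) (sym e≡)) ⟩
      X * 2 ^ e ≤⟨ reach-bound ⟩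
      3 ^ n * countS (downset {n}) ≤⟨ *-mono-≤ (≤-trans (^-monoˡ-≤ n (n≤1+n 3)) (≤-reflexive (^-*-assoc 2 2 n))) (≤-trans (Maximal.downsets≤α {n}) (Classify.α≤ n)) ⟩
      2 ^ (2 * n) * (αMid n + 2 * X) ∎) ⟩
    αMid n + 2 * X ≤⟨ +-monoʳ-≤ (αMid n) (≤-trans (≤-reflexive (sym (*-identityʳ (2 * X)))) (*-monoʳ-≤ (2 * X) (pow-pos 2 f (s≤s z≤n)))) ⟩
    αMid n + 2 * X * 2 ^ f ∎))
    where
    X : ℕ
    X = countS (reachesRank {n} (2 + n))
    arith₁ : ∀ x p → 2 * x * p + 2 * x * p ≡ x * (p * 4)
    arith₁ = solve-∀
    arith₂ : ∀ f n → f + 2 + 2 * n ≡ f + (2 * n + 2)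
    arith₂ = solve-∀
    diff≤ : ∣ α n - αMid n ∣ ≤ 2 * X
    diff≤ = ≤-trans (≤-reflexive (m≤n⇒∣n-m∣≡n∸m (Classify.mid≤α n))) (m≤n+o⇒m∸n≤o (α n) (αMid n) (Classify.α≤ n))

-- The bound B / m ≤ 2^(-s/K) has a fractional exponent; raising to the power K keeps it in the
-- natural numbers. With K = 128 and s = n² this is the error e^(-Ω(n²)).
power-form : ∀ K B m f s → B * 2 ^ f ≤ m → s ≤ K * f → B ^ K * 2 ^ s ≤ m ^ K
power-form K B m f s h l = begin
  B ^ K * 2 ^ s ≤⟨ *-monoʳ-≤ (B ^ K) (pow-mono 1 l) ⟩
  B ^ K * 2 ^ (K * f) ≡⟨ cong (λ e → B ^ K * 2 ^ e) (*-comm K f) ⟩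
  B ^ K * 2 ^ (f * K) ≡⟨ cong (B ^ K *_) (sym (^-*-assoc 2 f K)) ⟩
  B ^ K * (2 ^ f) ^ K ≡⟨ sym (*-pow B (2 ^ f) K) ⟩
  (B * 2 ^ f) ^ K ≤⟨ ^-monoˡ-≤ K h ⟩
  m ^ K ∎
  where open ≤-Reasoning

-- A logarithmic scale for all large n

dyadic : ∀ n → 0 < n → Σ ℕ λ L → 2 ^ L ≤ n × n < 2 ^ suc L
dyadic (suc zero) _ = 0 , ≤-refl , ≤-refl
dyadic (suc (suc n)) _ with dyadic (suc n) (s≤s z≤n)
... | L , a , b with suc (suc n) <? 2 ^ suc L
... | yes c = L , m≤n⇒m≤1+n a , c
... | no c = suc L , ≮⇒≥ c , ≤-<-trans b (^-monoʳ-< 2 ≤-refl (n<1+n (suc L)))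

module Threshold (n : ℕ) (large : 2 ^ (20 * 400) ≤ n) where
  open ≤-Reasoning

  n>0 : 0 < n
  n>0 = ≤-trans (pow-pos 2 (20 * 400) (s≤s z≤n)) large

  L : ℕ
  L = proj₁ (dyadic n n>0)

  L≤ : 2 ^ L ≤ n
  L≤ = proj₁ (proj₂ (dyadic n n>0))

  <L : n < 2 ^ suc L
  <L = proj₂ (proj₂ (dyadic n n>0))

  L-large : 20 * 400 ≤ L
  L-large = ≮⇒≥ λ l → <⇒≱ <L (≤-trans (pow-mono 1 l) large)

  -- With 2^L ≤ n < 2^(L+1) one has 3n ≤ 2^(L+3) and 6 ≤ 2³, so two tokens cost at most 2(8(L + 3) +
  -- 3) = 16L + 54 bits. For r¹⁰ ≤ n it is enough that r ≤ m² and m ≤ 2^q with 20 q ≤ L. The bound q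
  -- ≥ 400 is there because r ≤ 16 · 20 m + m = 321 m.
  r q m : ℕ
  r = 16 * L + 54
  q = floor L 20 (s≤s z≤n)
  m = suc q

  q-large : 400 ≤ q
  q-large = floor-max L 20 (s≤s z≤n) 400 (≤-trans (≤-reflexive (*-comm 400 20)) L-large)

  r≤m² : r ≤ m * m
  r≤m² = begin
    16 * L + 54 ≤⟨ +-mono-≤ (*-monoʳ-≤ 16 (<⇒≤ (floor-< L 20 (s≤s z≤n)))) (≤-trans (≤-trans (≤-by {54} 346 refl) q-large) (n≤1+n q)) ⟩
    16 * (m * 20) + m ≡⟨ arith 16 m 20 ⟩
    (16 * 20 + 1) * m ≤⟨ *-monoˡ-≤ m (≤-trans (≤-by {321} 79 refl) (≤-trans q-large (n≤1+n q))) ⟩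
    m * m ∎
    where
    arith : ∀ c m d → c * (m * d) + m ≡ (c * d + 1) * m
    arith = solve-∀

  m≤2^q : m ≤ 2 ^ q
  m≤2^q = below q
    where
    below : ∀ q → suc q ≤ 2 ^ q
    below zero = ≤-refl
    below (suc q) = ≤-trans (+-mono-≤ (≤-trans (s≤s z≤n) (below q)) (below q)) (≤-reflexive (cong (2 ^ q +_) (sym (+-identityʳ (2 ^ q)))))

  tenth-power : ∀ x → (x * x) * (x * x) * ((x * x) * (x * x)) * (x * x) ≡ x * (x * (x * (x * (x * (x * (x * (x * (x * (x * 1)))))))))
  tenth-power = solve-∀

  scale : Scale n r
  scale = record
    { r-big = ≤-trans (≤-trans (≤-by {4096} 123904 refl) (*-monoʳ-≤ 16 L-large)) (m≤m+n (16 * L) 54)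
    ; n-big = begin
        (r * r) * (r * r) * ((r * r) * (r * r)) * (r * r) ≡⟨ tenth-power r ⟩
        r ^ 10 ≤⟨ ^-monoˡ-≤ 10 (≤-trans r≤m² (*-mono-≤ m≤2^q m≤2^q)) ⟩
        (2 ^ q * 2 ^ q) ^ 10 ≡⟨ cong (_^ 10) (sym (^-distribˡ-+-* 2 q q)) ⟩
        (2 ^ (q + q)) ^ 10 ≡⟨ ^-*-assoc 2 (q + q) 10 ⟩
        2 ^ ((q + q) * 10) ≡⟨ cong (2 ^_) (arith₂ q) ⟩
        2 ^ (q * 20) ≤⟨ pow-mono 1 (floor-≤ L 20 (s≤s z≤n)) ⟩
        2 ^ L ≤⟨ L≤ ⟩
        n ∎
    ; code-small = begin
        tokenCount n ^ 2 ≤⟨ ^-monoˡ-≤ 2 (tokenCount-≤ n n>0) ⟩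
        ((3 * n) ^ 8 * 6) ^ 2 ≤⟨ ^-monoˡ-≤ 2 (*-mono-≤ (^-monoˡ-≤ 8 3n≤) (≤-by {6} 2 refl)) ⟩
        ((2 ^ (L + 3)) ^ 8 * 2 ^ 3) ^ 2 ≡⟨ cong (_^ 2) (trans (cong (_* 2 ^ 3) (^-*-assoc 2 (L + 3) 8)) (sym (^-distribˡ-+-* 2 ((L + 3) * 8) 3))) ⟩
        (2 ^ ((L + 3) * 8 + 3)) ^ 2 ≡⟨ ^-*-assoc 2 ((L + 3) * 8 + 3) 2 ⟩
        2 ^ (((L + 3) * 8 + 3) * 2) ≡⟨ cong (2 ^_) (arith L) ⟩
        2 ^ (16 * L + 54) ∎
    }
    where
    arith : ∀ L → ((L + 3) * 8 + 3) * 2 ≡ 16 * L + 54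
    arith = solve-∀
    arith₂ : ∀ q → (q + q) * 10 ≡ q * 20
    arith₂ = solve-∀
    3n≤ : 3 * n ≤ 2 ^ (L + 3)
    3n≤ = begin
      3 * n ≤⟨ *-mono-≤ (n≤1+n 3) (<⇒≤ <L) ⟩
      2 ^ 2 * 2 ^ suc L ≡⟨ sym (^-distribˡ-+-* 2 2 (suc L)) ⟩
      2 ^ (2 + suc L) ≡⟨ cong (2 ^_) (+-comm 3 L) ⟩
      2 ^ (L + 3) ∎

theorem1p3 : Σ ℕ λ k → Σ ℕ λ N → (n : ℕ) → N ≤ n →
    ∣ α n - αMid n ∣ ^ suc k * 2 ^ (n * n) ≤ αMid n ^ suc k
theorem1p3 = 127 , 2 ^ (20 * 400) , λ n h →
  power-form 128 (∣ α n - αMid n ∣) (αMid n) (Reach.f (Threshold.scale n h)) (n * n)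
    (Reach.difference (Threshold.scale n h)) (Reach.f-large (Threshold.scale n h))
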